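{- Every oriented tree with $n$ nodes ($n\ge 2$) and $k$ leaves is $(n+144k^2-280k+124)$-unavoidable.
   Context: A tournament is an orientation of a complete graph. A digraph $D$ is $m$-unavoidable if every tournament of order $m$ contains $D$ as a subdigraph. An oriented tree is an orientation of a tree; its vertices are called nodes. A leaf of an oriented tree is a vertex adjacent to at most one vertex. -}

module Defs where

open import Data.Nat using (ℕ; zero; suc; _+_; _*_; _∸_; _≤_; _<_)
open import Data.Fin using (Fin; toℕ)
open import Data.Fin.Properties using (_≟_)
open import Data.Bool using (Bool; true; false; not; _∨_)
open import Data.List using (List; []; _∷_; length; filterᵇ; allFin; concatMap; map)
open import Data.Product using (Σ; _×_; _,_)
open import Relation.Binary.PropositionalEquality using (_≡_; _≢_)
open import Relation.Nullary using (¬_)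
open import Relation.Nullary.Decidable using (does)
open import Function.Definitions using (Injective)

Digraph : ℕ → Set
Digraph n = Fin n → Fin n → Bool

record Tournament (m : ℕ) : Set where
  field
    arc      : Digraph m
    loopless : ∀ i → arc i i ≡ false
    complete : ∀ i j → i ≢ j → arc i j ≡ not (arc j i)

adj : ∀ {n} → Digraph n → Fin n → Fin n → Bool
adj D u v = D u v ∨ D v u

data Walk {n : ℕ} (D : Digraph n) : Fin n → Fin n → Set where
  here : ∀ {u} → Walk D u u
  step : ∀ {u w v} → adj D u w ≡ true → Walk D w v → Walk D u v

degree : ∀ {n} → Digraph n → Fin n → ℕ
degree D u = length (filterᵇ (λ v → adj D u v) (allFin _))

edgeCount : ∀ {n} → Digraph n → ℕ
edgeCount {n} D =
  length (filterᵇ (λ p → adj D (Data.Product.proj₁ p) (Data.Product.proj₂ p))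
                 (filterᵇ (λ p → does (toℕ (Data.Product.proj₁ p) Data.Nat.<? toℕ (Data.Product.proj₂ p)))
                         (concatMap (λ u → map (λ v → (u , v)) (allFin n)) (allFin n))))
  where import Data.Nat
        import Data.Product

record OrientedTree (n : ℕ) : Set where
  field
    arc        : Digraph n
    loopless   : ∀ u → arc u u ≡ false
    oriented   : ∀ u v → arc u v ≡ true → arc v u ≡ false
    connected  : ∀ u v → Walk arc u v
    edges      : edgeCount arc ≡ n ∸ 1

leafCount : ∀ {n} → Digraph n → ℕ
leafCount {n} D = length (filterᵇ (λ u → does (degree D u Data.Nat.≤? 1)) (allFin n))
  where import Data.Nat

_⊆ᵀ_ : ∀ {n m} → Digraph n → Tournament m → Set
_⊆ᵀ_ {n} {m} D T =
  Σ (Fin n → Fin m) λ f → Injective _≡_ _≡_ f ×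
    (∀ u v → D u v ≡ true → Tournament.arc T (f u) (f v) ≡ true)

Unavoidable : ∀ {n} → ℕ → Digraph n → Set
Unavoidable m D = (T : Tournament m) → D ⊆ᵀ T

-- The tree is rooted at a leaf and embedded into a locally median order of the tournament: there every vertex
-- dominates at least half of any interval just after it, and is dominated by at least half of any interval just
-- before it.  Branch nodes joined by short directed paths are placed greedily and form clusters of bounded density.
-- A long directed path leads to a cluster outside everything embedded so far: its first three arcs jump over the
-- occupied zone, and each further arc skips at most as many free vertices as occupied ones.  A path with turns
-- is filled in last: some of its ends are kept free by reserving neighbours of the nodes already placed, and the
-- theorem of Havet and Thomassé (of two vertices one is the origin of a prescribed oriented path) embeds the part
-- after the first turn without waste.  Each of the O(k) paths wastes O(k) vertices, whence the quadratic term.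

module Submission where

open import Data.Nat
open import Data.Nat.Properties
open import Data.Empty using (⊥; ⊥-elim)
open import Relation.Binary.PropositionalEquality hiding ([_]; J)
open import Data.Nat.Tactic.RingSolver using (solve-∀)
open import Data.Bool using (Bool; true; false; not; _∧_; T?; _∨_) renaming (T to IsTrue)
open import Data.List using (List; []; _∷_; _++_; length; map; replicate; allFin; filterᵇ; concatMap)
open import Data.Product using (_×_; _,_; proj₁; proj₂; ∃)
open import Data.Sum using (_⊎_; inj₁; inj₂)
open import Relation.Nullary using (¬_; yes; no; Dec)
open import Relation.Nullary.Decidable using (does; dec-true; dec-false)
open import Function using (_∘_; id; case_of_)
open import Data.List.Properties using (length-++; ++-assoc; map-++; ++-identityʳ; length-replicate; length-map)
open import Data.Unit using (⊤; tt)
open import Data.List.Relation.Unary.All using (All; []; _∷_; lookup; tabulate)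
open import Data.List.Relation.Unary.All.Properties using () renaming (++⁺ to All-++)
open import Data.List.Membership.Propositional using (_∈_)
open import Data.List.Relation.Unary.Any using (here; there)
open import Defs
open import Data.Fin using (Fin; toℕ; fromℕ<)
open import Data.Fin.Properties using (toℕ-injective; toℕ<n; toℕ-fromℕ<; fromℕ<-injective; fromℕ<-cong)
open import Data.List.Relation.Unary.AllPairs using ([]; _∷_)
import Data.List.Relation.Unary.Unique.Propositional as UP
import Data.Product.Properties
import Data.Fin.Properties
import Data.List.Membership.DecPropositional
open import Data.List.Relation.Unary.Unique.Propositional.Properties using (allFin⁺) renaming (filter⁺ to Unique-filter)
open import Data.List.Membership.Propositional.Properties using (∈-∃++; ∈-filter⁺; ∈-filter⁻; ∈-allFin; ∈-map⁺; ∈-concat⁺′; ∈-++⁻; ∈-++⁺ˡ; ∈-++⁺ʳ)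

-- Where the constants come from. `jump` crosses an interval once its length is six times the number
-- of occupied vertices in it, up to a constant; this is why clusters have density one sixth,
-- measured from either of their ends. The obstacle is that the two inner vertices of a jump land
-- anywhere, possibly in the stretch kept for another path. A directed path before which `J` others
-- have been filled in must tolerate `2 * J` such vertices: `12 * J` extra positions for its jump
-- and `4 * J` for its greedy part. Summing `16 * j` over `j < J` gives `8 * J * (J - 1)`. With `k`
-- leaves at most `3 * k - 4` paths jump, so the quadratic part stays below `72 * k * k`, and with
-- the linear waste added the total is below the stated polynomial for every `k` from 2 on. The
-- widths of all zones are read off a plan of the tree before any vertex is chosen. A path with
-- turns between two nodes is a second obstacle, since both ends are placed before its middle: seven
-- neighbours are reserved at one end, and the path is embedded from the other.

-- The lemmas arith-n below are consequences of linear inequalities: l ≤ r is a combination of the hypotheses with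
-- coefficients in ℕ (Farkas), and only a semiring identity remains.
lin : ∀ {l r L R} e → l ≤ r → L + r + e ≡ R + l → L ≤ R
lin {l} {r} {L} {R} e p q =
  +-cancelʳ-≤ l L R (≤-trans (+-monoʳ-≤ L p) (≤-trans (m≤m+n (L + r) e) (≤-reflexive q)))

-- Integer rounding: the hypotheses give `suc g * (L - R) ≤ g`, and an integer below a proper
-- fraction is at most 0.
linG : ∀ {l r L R} g e → l ≤ r → suc g * L + r + e ≡ suc g * R + l + g → L ≤ R
linG {l} {r} {L} {R} g e p q = ≮⇒≥ λ R<L → <-irrefl refl (+-cancelʳ-≤ l _ _ (begin
  suc (suc g * R + g) + l ≡⟨ lhs g R l ⟩
  suc g * suc R + l       ≤⟨ +-mono-≤ (*-monoʳ-≤ (suc g) R<L) p ⟩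
  suc g * L + r           ≤⟨ m≤m+n _ e ⟩
  suc g * L + r + e       ≡⟨ q ⟩
  suc g * R + l + g       ≡⟨ rhs g R l ⟩
  suc g * R + g + l       ∎))
  where
  open ≤-Reasoning
  lhs : ∀ g R l → suc (suc g * R + g) + l ≡ suc g * suc R + l
  lhs = solve-∀
  rhs : ∀ g R l → suc g * R + l + g ≡ suc g * R + g + l
  rhs = solve-∀

linE : ∀ {l r L R} → l ≡ r → L + r ≡ R + l → L ≡ R
linE {l} {L = L} {R} refl q = +-cancelʳ-≡ l L R q

infixr 5 _⊕_
infix 6 _⊛_
_⊕_ : ∀ {a b c d} → a ≤ b → c ≤ d → a + c ≤ b + d
_⊕_ = +-mono-≤

_⊛_ : ∀ {a b} k → a ≤ b → k * a ≤ k * b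
k ⊛ p = *-monoʳ-≤ k p

infixr 5 _⊕≡_
infix 6 _⊛≡_
_⊕≡_ : ∀ {a b c d} → a ≡ b → c ≡ d → a + c ≡ b + d
_⊕≡_ = cong₂ _+_

_⊛≡_ : ∀ {a b} k → a ≡ b → k * a ≡ k * b
k ⊛≡ p = cong (k *_) p

1≰0 : 1 ≤ 0 → ⊥
1≰0 ()

arith-1 : ∀ a b c d e → e ≡ c + d → a + b + e ≡ a + c + (b + d)
arith-1 a b c d e refl = eq a b c d
  where
  eq : ∀ a b c d → a + b + (c + d) ≡ a + c + (b + d)
  eq = solve-∀

arith-2 : ∀ a b c d e → b ≡ c + e → c ≡ d + a → a ≤ b
arith-2 a b c d e refl refl = lin (d + e) (z≤n {0}) (eq a d e)
  where
  eq : ∀ a d e → a + 0 + (d + e) ≡ (d + a) + e + 0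
  eq = solve-∀

arith-3 : ∀ a b c d → a ≡ b → b ≤ 2 * c → 2 * d < b → c ≤ d → ⊥
arith-3 a b c d refl h1 h2 h3 = 1≰0 (lin 0 (h1 ⊕ (h2 ⊕ (2 ⊛ h3))) (eq b c d))
  where
  eq : ∀ b c d → 1 + ((2 * c) + (b + 2 * d)) + 0 ≡ 0 + (b + ((1 + (2 * d)) + 2 * c))
  eq = solve-∀

arith-4 : ∀ a b c d → a + (1 + b + c) ≤ d → 1 + a + b + c ≤ d
arith-4 a b c d h0 = lin 0 h0 (eq a b c d)
  where
  eq : ∀ a b c d → 1 + a + b + c + d + 0 ≡ d + (a + (1 + b + c))
  eq = solve-∀

arith-5 : ∀ a b c d e f g h i → 1 + a + 2 * f ≤ 1 + b + c → f ≡ g + e → g ≡ d + h → h ≡ 0 → b ≤ 2 * i → i ≡ d → a + 2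
    * e ≤ c
arith-5 a b c d e f g h i h0 refl refl refl h4 refl = lin 0 (h0 ⊕ h4) (eq a b c d e)
  where
  eq : ∀ a b c d e → a + 2 * e + ((1 + b + c) + (2 * d)) + 0 ≡ c + ((1 + a + 2 * ((d + 0) + e)) + b)
  eq = solve-∀

arith-6 : ∀ a b c d → a ≤ 1 + b + c + d → a ≤ b + (1 + (c + d))
arith-6 a b c d h0 = lin 0 h0 (eq a b c d)
  where
  eq : ∀ a b c d → a + (1 + b + c + d) + 0 ≡ b + (1 + (c + d)) + a
  eq = solve-∀

arith-7 : ∀ a b c d e f g → a + b + c ≡ 1 → d + e + f ≡ g → a + d + (b + e) + (c + f) ≡ 1 + g
arith-7 a b c d e f g h0 refl = linE h0 (eq a b c d e f)
  where
  eq : ∀ a b c d e f → a + d + (b + e) + (c + f) + 1 ≡ 1 + (d + e + f) + (a + b + c)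
  eq = solve-∀

arith-8 : ∀ a b c d e → a + b + c ≡ e → a ≡ 0 → e ≤ 2 * d → d ≤ c → b ≤ c
arith-8 a b c d e refl refl h2 h3 = lin 0 (h2 ⊕ (2 ⊛ h3)) (eq b c d)
  where
  eq : ∀ b c d → b + ((2 * d) + 2 * c) + 0 ≡ c + ((0 + b + c) + 2 * d)
  eq = solve-∀

arith-9 : ∀ a b c d → b + c ≤ d → a + b + c < 1 + a + d
arith-9 a b c d h0 = lin 0 h0 (eq a b c d)
  where
  eq : ∀ a b c d → 1 + (a + b + c) + d + 0 ≡ 1 + a + d + (b + c)
  eq = solve-∀

arith-10 : ∀ a b c d e f g h i j k → 6 * e + 5 ≤ k → a + b + c ≡ k → d ≤ 1 → b ≤ c → k ≤ 2 * f → k ≤ 2 * g → f ≤ h → h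
    ≡ a + e → g ≤ j → j ≡ i + e → i ≡ b + d → ⊥
arith-10 a b c d e f g h i j k h0 refl h2 h3 h4 h5 h6 refl h8 refl refl = 1≰0
    (lin 0 (h0 ⊕ ((4 ⊛ h2) ⊕ ((2 ⊛ h3) ⊕ (h4 ⊕ ((2 ⊛ h5) ⊕ ((2 ⊛ h6) ⊕ (4 ⊛ h8))))))) (eq a b c d e f g))
  where
  eq : ∀ a b c d e f g → 1 + ((a + b + c) +
      (4 * 1 + (2 * c + ((2 * f) + (2 * (2 * g) + (2 * (a + e) + 4 * (((b + d) + e)))))))) + 0 ≡ 0 + ((6 * e + 5) +
      (4 * d + (2 * b + ((a + b + c) + (2 * (a + b + c) + (2 * f + 4 * g))))))
  eq = solve-∀

arith-11 : ∀ a b → 6 + a ≤ b → a ≤ 6 + b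
arith-11 a b h0 = lin 12 h0 (eq a b)
  where
  eq : ∀ a b → a + b + 12 ≡ 6 + b + (6 + a)
  eq = solve-∀

arith-12 : ∀ a b c d → b ≡ c + d → c ≤ 1 → d ≡ 0 → 6 * b ≤ a + 6
arith-12 a b c d refl h1 refl = lin a (6 ⊛ h1) (eq a c)
  where
  eq : ∀ a c → 6 * (c + 0) + 6 * 1 + a ≡ a + 6 + 6 * c
  eq = solve-∀

arith-13 : ∀ a b c d e f g → b ≡ c + d → c ≤ 1 → d ≡ e + f → f ≡ g → e ≡ 0 → 6 * g ≤ a + 6 → 6 * b ≤ 6 + a + 6
arith-13 a b c d e f g refl h1 refl refl refl h5 = lin 0 ((6 ⊛ h1) ⊕ h5) (eq a c g)
  where
  eq : ∀ a c g → 6 * (c + (0 + g)) + (6 * 1 + (a + 6)) + 0 ≡ 6 + a + 6 + (6 * c + (6 * g))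
  eq = solve-∀

arith-14 : ∀ a b c d → b ≤ a → c ≤ 6 → b + c ≡ 6 + d → d ≤ a
arith-14 a b c d h0 h1 h2 = lin 0 (h0 ⊕ (h1 ⊕ (≤-reflexive (sym h2)))) (eq a b c d)
  where
  eq : ∀ a b c d → d + (a + (6 + (b + c))) + 0 ≡ a + (b + (c + (6 + d)))
  eq = solve-∀

arith-15 : ∀ a b c d e f g → b ≡ c + d → c ≤ 1 → g ≡ f + e → d ≡ g → e ≡ 0 → 6 * f ≤ a + 6 → 6 * b ≤ 6 + a + 6
arith-15 a b c d e f g refl h1 refl refl refl h5 = lin 0 ((6 ⊛ h1) ⊕ h5) (eq a c f)
  where
  eq : ∀ a c f → 6 * (c + (f + 0)) + (6 * 1 + (a + 6)) + 0 ≡ 6 + a + 6 + (6 * c + (6 * f))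
  eq = solve-∀

arith-16 : ∀ a b c → a + (6 + b) ≡ 6 + c → a + b ≡ c
arith-16 a b c h0 = linE h0 (eq a b c)
  where
  eq : ∀ a b c → a + b + (6 + c) ≡ c + (a + (6 + b))
  eq = solve-∀

arith-17 : ∀ a b → b ≤ 1 → 6 * b ≤ a + 6
arith-17 a b h0 = lin a (6 ⊛ h0) (eq a b)
  where
  eq : ∀ a b → 6 * b + 6 * 1 + a ≡ a + 6 + 6 * b
  eq = solve-∀

arith-18 : ∀ a b c d → a ≤ b → c ≤ d → b + 6 ≤ c → a ≤ d
arith-18 a b c d h0 h1 h2 = lin 6 (h0 ⊕ (h1 ⊕ h2)) (eq a b c d)
  where
  eq : ∀ a b c d → a + (b + (d + c)) + 6 ≡ d + (a + (c + (b + 6)))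
  eq = solve-∀

arith-19 : ∀ a b c d → a < b → b ≤ c → c + 6 ≤ d → a < d
arith-19 a b c d h0 h1 h2 = lin 6 (h0 ⊕ (h1 ⊕ h2)) (eq a b c d)
  where
  eq : ∀ a b c d → 1 + a + (b + (c + d)) + 6 ≡ d + ((1 + a) + (b + (c + 6)))
  eq = solve-∀

arith-20 : ∀ a b c d → c ≤ a → d ≤ c → b + 6 ≤ d → b ≤ a
arith-20 a b c d h0 h1 h2 = lin 6 (h0 ⊕ (h1 ⊕ h2)) (eq a b c d)
  where
  eq : ∀ a b c d → b + (a + (c + d)) + 6 ≡ a + (c + (d + (b + 6)))
  eq = solve-∀

arith-21 : ∀ a b c d → b ≡ c + d → d ≡ 0 → 6 * c ≤ a + 6 → 6 * b ≤ a + 6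
arith-21 a b c d refl refl h2 = lin 0 h2 (eq a c)
  where
  eq : ∀ a c → 6 * (c + 0) + (a + 6) + 0 ≡ a + 6 + (6 * c)
  eq = solve-∀

arith-22 : ∀ a b c d → a + b + 6 + c ≤ a + d → b + 6 + c ≤ d
arith-22 a b c d h0 = lin 0 h0 (eq a b c d)
  where
  eq : ∀ a b c d → b + 6 + c + (a + d) + 0 ≡ d + (a + b + 6 + c)
  eq = solve-∀

arith-23 : ∀ a b c → a + 6 + b + c ≡ a + (6 + b + c)
arith-23 = solve-∀

arith-24 : ∀ a b c → a + (b + 6 + c) ≡ a + b + 6 + c
arith-24 = solve-∀

arith-25 : ∀ a b c d → b ≡ c + d → c ≡ 0 → 6 * d ≤ a + 6 → 6 * b ≤ a + 6
arith-25 a b c d refl refl h2 = lin 0 h2 (eq a d)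
  where
  eq : ∀ a d → 6 * (0 + d) + (a + 6) + 0 ≡ a + 6 + (6 * d)
  eq = solve-∀

arith-26 : ∀ a b c d e → a + b + 6 + c ≤ e → a + d ≡ e → b + 6 + c ≤ d
arith-26 a b c d e h0 refl = lin 0 h0 (eq a b c d)
  where
  eq : ∀ a b c d → b + 6 + c + (a + d) + 0 ≡ d + (a + b + 6 + c)
  eq = solve-∀

arith-27 : ∀ a b c d → a + b + 6 + c + d ≡ a + (b + 6 + c + d)
arith-27 = solve-∀

arith-28 : ∀ a b c d → a + (b + c) ≤ a + b + d → c ≤ d
arith-28 a b c d h0 = lin 0 h0 (eq a b c d)
  where
  eq : ∀ a b c d → c + (a + b + d) + 0 ≡ d + (a + (b + c))
  eq = solve-∀

arith-29 : ∀ a b c d e → a ≤ b → 6 * b ≤ e + 6 → c + e ≤ c + d → 6 * a ≤ d + 6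
arith-29 a b c d e h0 h1 h2 = lin 0 ((6 ⊛ h0) ⊕ (h1 ⊕ h2)) (eq a b c d e)
  where
  eq : ∀ a b c d e → 6 * a + (6 * b + ((e + 6) + (c + d))) + 0 ≡ d + 6 + (6 * a + ((6 * b) + (c + e)))
  eq = solve-∀

arith-30 : ∀ a b c d e f → a ≡ b + c → c ≡ 0 → 6 * b ≤ f + 6 → d + f ≤ d + e → 6 * a ≤ e + 6
arith-30 a b c d e f refl refl h2 h3 = lin 0 (h2 ⊕ h3) (eq b d e f)
  where
  eq : ∀ b d e f → 6 * (b + 0) + ((f + 6) + (d + e)) + 0 ≡ e + 6 + ((6 * b) + (d + f))
  eq = solve-∀

arith-31 : ∀ a b c d → c ≡ b + d → a + c ≡ b + (a + d)
arith-31 a b c d refl = eq a b d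
  where
  eq : ∀ a b d → a + (b + d) ≡ b + (a + d)
  eq = solve-∀

arith-32 : ∀ a b c → a + (b + c) ≡ b + (a + c)
arith-32 = solve-∀

arith-33 : ∀ a b c d e → a ≡ b + d → d ≡ c + e → a ≡ b + c + e
arith-33 a b c d e refl refl = eq b c e
  where
  eq : ∀ b c e → b + (c + e) ≡ b + c + e
  eq = solve-∀

arith-34 : ∀ a b c d e → a ≤ b → b ≡ c + d + e → c ≡ 0 → a ≤ d + e
arith-34 a b c d e h0 refl refl = lin 0 h0 (eq a d e)
  where
  eq : ∀ a d e → a + (0 + d + e) + 0 ≡ d + e + a
  eq = solve-∀

arith-35 : ∀ a b c d e → a ≤ b + c → d ≡ c + e → 1 + a ≤ 1 + b + d
arith-35 a b c d e h0 refl = lin e h0 (eq a b c e)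
  where
  eq : ∀ a b c e → 1 + a + (b + c) + e ≡ 1 + b + (c + e) + a
  eq = solve-∀

arith-36 : ∀ a b c d e → a ≤ b + c → d ≡ c + e → 1 ≤ e → 1 + a ≤ b + d
arith-36 a b c d e h0 refl h2 = lin 0 (h0 ⊕ h2) (eq a b c e)
  where
  eq : ∀ a b c e → 1 + a + ((b + c) + e) + 0 ≡ b + (c + e) + (a + 1)
  eq = solve-∀

arith-37 : ∀ a b c d e → a + b + 8 * c ≡ e + 8 * (c * c) → a + (d + 16 * c + b) + 8 * (1 + c) ≡ d + e + 8 *
    ((1 + c) * (1 + c))
arith-37 a b c d e h0 = linE h0 (eq a b c d e)
  where
  eq : ∀ a b c d e → a + (d + 16 * c + b) + 8 * (1 + c) + (e + 8 * (c * c)) ≡ d + e + 8 * ((1 + c) * (1 + c)) +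
      (a + b + 8 * c)
  eq = solve-∀

arith-38 : ∀ a b c d e → a + b + 8 * c ≡ e + 8 * (c * c) → d + 16 * c + a + b + 8 * (1 + c) ≡ d + e + 8 *
    ((1 + c) * (1 + c))
arith-38 a b c d e h0 = linE h0 (eq a b c d e)
  where
  eq : ∀ a b c d e → d + 16 * c + a + b + 8 * (1 + c) + (e + 8 * (c * c)) ≡ d + e + 8 * ((1 + c) * (1 + c)) +
      (a + b + 8 * c)
  eq = solve-∀

arith-39 : ∀ a b c d e → a + b + 8 * c ≡ e + 8 * (c * c) → a + (d + b) + 8 * c ≡ d + e + 8 * (c * c)
arith-39 a b c d e h0 = linE h0 (eq a b c d e)
  where
  eq : ∀ a b c d e → a + (d + b) + 8 * c + (e + 8 * (c * c)) ≡ d + e + 8 * (c * c) + (a + b + 8 * c)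
  eq = solve-∀

arith-40 : ∀ a b → 12 * (1 + a) + b ≤ 1 + 11 + (12 * a + b)
arith-40 a b  = lin 0 (z≤n {0}) (eq a b)
  where
  eq : ∀ a b → 12 * (1 + a) + b + 0 + 0 ≡ 1 + 11 + (12 * a + b) + 0
  eq = solve-∀

arith-41 : ∀ a b c d e f g → f ≤ a + b + e → g ≤ c + d + f → g ≤ c + a + (d + b) + e
arith-41 a b c d e f g h0 h1 = lin 0 (h0 ⊕ h1) (eq a b c d e f g)
  where
  eq : ∀ a b c d e f g → g + ((a + b + e) + (c + d + f)) + 0 ≡ c + a + (d + b) + e + (f + g)
  eq = solve-∀

arith-42 : ∀ a b → 12 * (1 + a) + b ≤ 1 + 22 + (12 * a + b)
arith-42 a b  = lin 11 (z≤n {0}) (eq a b)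
  where
  eq : ∀ a b → 12 * (1 + a) + b + 0 + 11 ≡ 1 + 22 + (12 * a + b) + 0
  eq = solve-∀

arith-43 : ∀ a b → 12 * (2 + a) + b ≤ 2 + 22 + (12 * a + b)
arith-43 a b  = lin 0 (z≤n {0}) (eq a b)
  where
  eq : ∀ a b → 12 * (2 + a) + b + 0 + 0 ≡ 2 + 22 + (12 * a + b) + 0
  eq = solve-∀

arith-44 : ∀ a b c → 12 * 0 + (a + 12 * b + 20 + c) ≤ 3 + a + 22 + (12 * b + c)
arith-44 a b c  = lin 5 (z≤n {0}) (eq a b c)
  where
  eq : ∀ a b c → 12 * 0 + (a + 12 * b + 20 + c) + 0 + 5 ≡ 3 + a + 22 + (12 * b + c) + 0
  eq = solve-∀

arith-45 : ∀ a b c d → d ≤ a + b + c → d ≤ a + (33 + b) + c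
arith-45 a b c d h0 = lin 33 h0 (eq a b c d)
  where
  eq : ∀ a b c d → d + (a + b + c) + 33 ≡ a + (33 + b) + c + d
  eq = solve-∀

arith-46 : ∀ a → a + 54 + 0 ≤ a + 55 + 0
arith-46 a  = lin 1 (z≤n {0}) (eq a)
  where
  eq : ∀ a → a + 54 + 0 + 0 + 1 ≡ a + 55 + 0 + 0
  eq = solve-∀

arith-47 : ∀ a → 12 * 2 + 0 ≤ 3 + a + 21 + 0
arith-47 a  = lin a (z≤n {0}) (eq a)
  where
  eq : ∀ a → 12 * 2 + 0 + 0 + a ≡ 3 + a + 21 + 0 + 0
  eq = solve-∀

arith-48 : ∀ a b c d → c ≡ d + (2 + b) → d ≡ a → a + (3 + b) ≡ 1 + c
arith-48 a b c d refl refl = eq a b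
  where
  eq : ∀ a b → a + (3 + b) ≡ 1 + (a + (2 + b))
  eq = solve-∀

arith-49 : ∀ a b c d e → c ≡ d → d ≡ e + (2 + b) → e ≡ a → a + (3 + b) ≡ 1 + c
arith-49 a b c d e refl refl refl = eq a b
  where
  eq : ∀ a b → a + (3 + b) ≡ 1 + (a + (2 + b))
  eq = solve-∀

arith-50 : ∀ a → 1 + 11 + a ≤ 1 + 183 + a
arith-50 a  = lin 172 (z≤n {0}) (eq a)
  where
  eq : ∀ a → 1 + 11 + a + 0 + 172 ≡ 1 + 183 + a + 0
  eq = solve-∀

arith-51 : ∀ a b → 1 + a + 1 + 44 + b ≤ 1 + a + 1 + 183 + b
arith-51 a b  = lin 139 (z≤n {0}) (eq a b)
  where
  eq : ∀ a b → 1 + a + 1 + 44 + b + 0 + 139 ≡ 1 + a + 1 + 183 + b + 0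
  eq = solve-∀

arith-52 : ∀ a b c → a ≡ 1 + c + 0 → 1 + a + b ≡ 2 + c + b
arith-52 a b c refl = eq b c
  where
  eq : ∀ b c → 1 + (1 + c + 0) + b ≡ 2 + c + b
  eq = solve-∀

arith-53 : ∀ a b c d e f → e ≡ c + d → 12 * a + c ≤ 1 + f + 54 + 0 → 12 * 7 + (12 * (a + b) + 7 + e) ≤ 2 + f + 150 +
    (12 * b + d)
arith-53 a b c d e f refl h1 = lin 6 h1 (eq a b c d f)
  where
  eq : ∀ a b c d f → 12 * 7 + (12 * (a + b) + 7 + (c + d)) + (1 + f + 54 + 0) + 6 ≡ 2 + f + 150 + (12 * b + d) +
      (12 * a + c)
  eq = solve-∀

arith-54 : ∀ a b → a ≤ 2 + 0 → 7 + a + b ≤ 9 + b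
arith-54 a b h0 = lin 0 h0 (eq a b)
  where
  eq : ∀ a b → 7 + a + b + (2 + 0) + 0 ≡ 9 + b + a
  eq = solve-∀

arith-55 : ∀ a b c d e f g → b ≡ d + 2 → d ≡ c → e ≡ f + 1 → f ≡ g + (2 + c) → g ≡ a → a + (2 + b) ≡ 1 + e
arith-55 a b c d e f g refl refl refl refl refl = eq a c
  where
  eq : ∀ a c → a + (2 + (c + 2)) ≡ 1 + ((a + (2 + c)) + 1)
  eq = solve-∀

arith-56 : ∀ a b c d e f g h i j k → e ≡ c + d → 12 * a + c ≤ f + 55 * g + 183 * h → 12 * b + d ≤ i + 55 * j + 183 * k
    → 12 * (a + b) + e ≤ f + i + 55 * (g + j) + 183 * (h + k)
arith-56 a b c d e f g h i j k refl h1 h2 = lin 0 (h1 ⊕ h2) (eq a b c d f g h i j k)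
  where
  eq : ∀ a b c d f g h i j k → 12 * (a + b) + (c + d) + ((f + 55 * g + 183 * h) + (i + 55 * j + 183 * k)) + 0 ≡ f + i
      + 55 * (g + j) + 183 * (h + k) + ((12 * a + c) + (12 * b + d))
  eq = solve-∀

arith-57 : ∀ a b c d e f g → c ≡ a + b → a ≤ d + 2 * e → b ≤ f + 2 * g → c ≤ d + f + 2 * (e + g)
arith-57 a b c d e f g refl h1 h2 = lin 0 (h1 ⊕ h2) (eq a b d e f g)
  where
  eq : ∀ a b d e f g → a + b + ((d + 2 * e) + (f + 2 * g)) + 0 ≡ d + f + 2 * (e + g) + (a + b)
  eq = solve-∀

arith-58 : ∀ a b c d e f → a ≤ 2 * c + 9 * d → b ≤ 2 * e + 9 * f → a + b ≤ 2 * (c + e) + 9 * (d + f)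
arith-58 a b c d e f h0 h1 = lin 0 (h0 ⊕ h1) (eq a b c d e f)
  where
  eq : ∀ a b c d e f → a + b + ((2 * c + 9 * d) + (2 * e + 9 * f)) + 0 ≡ 2 * (c + e) + 9 * (d + f) + (a + b)
  eq = solve-∀

arith-59 : ∀ a b c d e f → b ≤ c + 183 + a → a ≤ d + 55 * e + 183 * f → b ≤ c + d + 55 * e + 183 * (1 + f)
arith-59 a b c d e f h0 h1 = lin 0 (h0 ⊕ h1) (eq a b c d e f)
  where
  eq : ∀ a b c d e f → b + ((c + 183 + a) + (d + 55 * e + 183 * f)) + 0 ≡ c + d + 55 * e + 183 * (1 + f) + (b + a)
  eq = solve-∀

arith-60 : ∀ a b c d → b ≤ 2 + a → a ≤ c + 2 * d → b ≤ c + 2 * (1 + d)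
arith-60 a b c d h0 h1 = lin 0 (h0 ⊕ h1) (eq a b c d)
  where
  eq : ∀ a b c d → b + ((2 + a) + (c + 2 * d)) + 0 ≡ c + 2 * (1 + d) + (b + a)
  eq = solve-∀

arith-61 : ∀ a b c d → b ≤ 9 + a → a ≤ 2 * c + 9 * d → b ≤ 2 * c + 9 * (1 + d)
arith-61 a b c d h0 h1 = lin 0 (h0 ⊕ h1) (eq a b c d)
  where
  eq : ∀ a b c d → b + ((9 + a) + (2 * c + 9 * d)) + 0 ≡ 2 * c + 9 * (1 + d) + (b + a)
  eq = solve-∀

arith-62 : ∀ a → a + 55 + 0 ≤ a + 55 * 1 + 183 * 0
arith-62 a  = lin 0 (z≤n {0}) (eq a)
  where
  eq : ∀ a → a + 55 + 0 + 0 + 0 ≡ a + 55 * 1 + 183 * 0 + 0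
  eq = solve-∀

arith-63 : ∀ a b c → b ≡ a + 1 → 1 + b + c ≡ 1 + a + (1 + c + 0)
arith-63 a b c refl = eq a c
  where
  eq : ∀ a c → 1 + (a + 1) + c ≡ 1 + a + (1 + c + 0)
  eq = solve-∀

arith-64 : ∀ a b → 1 + a ≤ b → 1 + (a + 0) ≤ b + 0
arith-64 a b h0 = lin 0 h0 (eq a b)
  where
  eq : ∀ a b → 1 + (a + 0) + b + 0 ≡ b + 0 + (1 + a)
  eq = solve-∀

arith-65 : ∀ a b c d e f → 1 + a ≤ b → 1 + c ≤ d → e ≤ f → 1 + (1 + (a + (c + e))) ≤ b + (d + f)
arith-65 a b c d e f h0 h1 h2 = lin 0 (h0 ⊕ (h1 ⊕ h2)) (eq a b c d e f)
  where
  eq : ∀ a b c d e f → 1 + (1 + (a + (c + e))) + (b + (d + f)) + 0 ≡ b + (d + f) + ((1 + a) + ((1 + c) + e))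
  eq = solve-∀

arith-66 : ∀ a b c d e f g → a ≡ b + c → d ≡ e + f + g → a + d ≡ b + e + (c + f) + g
arith-66 a b c d e f g refl refl = eq b c e f g
  where
  eq : ∀ b c e f g → (b + c) + (e + f + g) ≡ b + e + (c + f) + g
  eq = solve-∀

arith-67 : ∀ a b c d e → d ≡ b + c → e ≡ b + (a + c) → a + d ≡ e
arith-67 a b c d e refl refl = eq a b c
  where
  eq : ∀ a b c → a + (b + c) ≡ b + (a + c)
  eq = solve-∀

arith-68 : ∀ a b c d e f g h i j k l m n o → a ≡ c + d + (f + g) → b ≡ c + e + h → d ≡ e → f ≡ m + n → g ≡ i + j + l →
    h ≡ i + k + (n + l) → k ≡ o + j → a + o ≡ b + m
arith-68 a b c d e f g h i j k l m n o refl refl refl refl refl refl refl = eq c e i j l m n o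
  where
  eq : ∀ c e i j l m n o → (c + e + ((m + n) + (i + j + l))) + o ≡ (c + e + (i + (o + j) + (n + l))) + m
  eq = solve-∀

arith-69 : ∀ a b c → a ≤ c → b ≤ c * c → a + b ≤ (1 + c) * (1 + c)
arith-69 a b c h0 h1 = lin (1 + c) (h0 ⊕ h1) (eq a b c)
  where
  eq : ∀ a b c → a + b + (c + (c * c)) + (1 + c) ≡ (1 + c) * (1 + c) + (a + b)
  eq = solve-∀

arith-70 : ∀ a b c d e f g → a ≡ c + d → b ≡ c + (1 + e) → d ≡ f + (1 + g) → e ≡ f + g → a ≡ b
arith-70 a b c d e f g refl refl refl refl = eq c f g
  where
  eq : ∀ c f g → c + (f + (1 + g)) ≡ c + (1 + (f + g))
  eq = solve-∀

arith-71 : ∀ a b c d e f g h → a ≡ c + d → b ≡ c + (h + e) → d ≡ f + (h + g) → e ≡ f + g → a ≡ b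
arith-71 a b c d e f g h refl refl refl refl = eq c f g h
  where
  eq : ∀ c f g h → c + (f + (h + g)) ≡ c + (h + (f + g))
  eq = solve-∀

arith-72 : ∀ a b c d e → a ≤ 0 + b → e < d → b + d ≡ c + e → c ≤ a → ⊥
arith-72 a b c d e h0 h1 h2 h3 = 1≰0 (lin 0 (h0 ⊕ (h1 ⊕ ((≤-reflexive h2) ⊕ h3))) (eq a b c d e))
  where
  eq : ∀ a b c d e → 1 + ((0 + b) + (d + ((c + e) + a))) + 0 ≡ 0 + (a + ((1 + e) + ((b + d) + c)))
  eq = solve-∀

arith-73 : ∀ a b c d e f → a ≤ 1 + f + b → e < d → b + d ≡ c + e → a ≤ f + c
arith-73 a b c d e f h0 h1 h2 = lin 0 (h0 ⊕ (h1 ⊕ (≤-reflexive h2))) (eq a b c d e f)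
  where
  eq : ∀ a b c d e f → a + ((1 + f + b) + (d + (c + e))) + 0 ≡ f + c + (a + ((1 + e) + (b + d)))
  eq = solve-∀

arith-74 : ∀ a b c d e → a ≤ 0 + b → d < e → c + d ≡ b + e → c ≤ a → ⊥
arith-74 a b c d e h0 h1 h2 h3 = 1≰0 (lin 0 (h0 ⊕ (h1 ⊕ ((≤-reflexive (sym h2)) ⊕ h3))) (eq a b c d e))
  where
  eq : ∀ a b c d e → 1 + ((0 + b) + (e + ((c + d) + a))) + 0 ≡ 0 + (a + ((1 + d) + ((b + e) + c)))
  eq = solve-∀

arith-75 : ∀ a b c d e f → a ≤ 1 + f + b → d < e → c + d ≡ b + e → a ≤ f + c
arith-75 a b c d e f h0 h1 h2 = lin 0 (h0 ⊕ (h1 ⊕ (≤-reflexive (sym h2)))) (eq a b c d e f)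
  where
  eq : ∀ a b c d e f → a + ((1 + f + b) + (e + (c + d))) + 0 ≡ f + c + (a + ((1 + d) + (b + e)))
  eq = solve-∀

arith-76 : ∀ a b c d e → a + b ≡ 1 → c + d ≡ e → a + c + (b + d) ≡ 1 + e
arith-76 a b c d e h0 refl = linE h0 (eq a b c d)
  where
  eq : ∀ a b c d → a + c + (b + d) + 1 ≡ 1 + (c + d) + (a + b)
  eq = solve-∀

arith-77 : ∀ a b → b ≡ a → a ≤ 2 * b
arith-77 a b refl = lin a (z≤n {0}) (eq a)
  where
  eq : ∀ a → a + 0 + a ≡ 2 * a + 0
  eq = solve-∀

arith-78 : ∀ a b c d e f → d ≡ b + c → e ≡ b + (a + c) → a + d ≤ f + e
arith-78 a b c d e f refl refl = lin f (z≤n {0}) (eq a b c f)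
  where
  eq : ∀ a b c f → a + (b + c) + 0 + f ≡ f + (b + (a + c)) + 0
  eq = solve-∀

arith-79 : ∀ a b c d e → b ≡ c → c + d ≡ e → e ≡ a → d ≤ c → a ≤ 2 * b
arith-79 a b c d e refl refl refl h3 = lin 0 h3 (eq c d)
  where
  eq : ∀ c d → c + d + c + 0 ≡ 2 * c + d
  eq = solve-∀

arith-80 : ∀ a b c d e f g → a + b < c → f ≡ c → f ≡ g → g ≡ e + d → e ≡ a → b + 1 ≤ d
arith-80 a b c d e f g h0 refl refl refl refl = lin 0 h0 (eq a b d)
  where
  eq : ∀ a b d → b + 1 + (a + d) + 0 ≡ d + (1 + (a + b))
  eq = solve-∀

arith-81 : ∀ a b c → a + 1 ≤ b → b ≡ c + 0 → c ≡ a → ⊥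
arith-81 a b c h0 refl refl = 1≰0 (lin 0 h0 (eq a))
  where
  eq : ∀ a → 1 + (a + 0) + 0 ≡ 0 + (a + 1)
  eq = solve-∀

arith-82 : ∀ a b c d e → b ≡ d → c + d ≡ e → e ≡ a → c ≤ d → a ≤ 2 * b
arith-82 a b c d e refl refl refl h3 = lin 0 h3 (eq c d)
  where
  eq : ∀ c d → c + d + d + 0 ≡ 2 * d + c
  eq = solve-∀

arith-83 : ∀ a b c d e → c ≡ d + e → a ≤ 2 * d → e ≡ b → a + b ≤ 2 * c
arith-83 a b c d e refl h1 refl = lin b h1 (eq a b d)
  where
  eq : ∀ a b d → a + b + (2 * d) + b ≡ 2 * (d + b) + a
  eq = solve-∀

arith-84 : ∀ a b c d e → a ≤ c → b ≡ d + (1 + e) → c ≡ d + e → 1 + a ≤ b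
arith-84 a b c d e h0 refl refl = lin 0 h0 (eq a d e)
  where
  eq : ∀ a d e → 1 + a + (d + e) + 0 ≡ d + (1 + e) + a
  eq = solve-∀

arith-85 : ∀ a b c d e f g h i j k → c ≡ f + j → d ≡ g + k → e ≡ c + d → h ≡ f + g → i ≡ b + j + k → a + (b + e) ≡ a +
    h + i
arith-85 a b c d e f g h i j k refl refl refl refl refl = eq a b f g j k
  where
  eq : ∀ a b f g j k → a + (b + ((f + j) + (g + k))) ≡ a + (f + g) + (b + j + k)
  eq = solve-∀

arith-86 : ∀ a b c → (1 + (a + b)) * c ≡ c + a * c + b * c
arith-86 = solve-∀

arith-87 : ∀ a b c d e f g h i j → b ≡ e + i → c ≡ f + j → d ≡ b + c → g ≡ e + f → h ≡ i + j → a + d ≡ a + g + h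
arith-87 a b c d e f g h i j refl refl refl refl refl = eq a e f i j
  where
  eq : ∀ a e f i j → a + ((e + i) + (f + j)) ≡ a + (e + f) + (i + j)
  eq = solve-∀

arith-88 : ∀ a b c → (a + b) * c ≡ a * c + b * c
arith-88 = solve-∀

arith-89 : ∀ a b c d → b ≡ c + d → a + c ≡ 0 → d ≡ 1 → a + b ≡ 1
arith-89 a b c d refl h1 refl = linE h1 (eq a c)
  where
  eq : ∀ a c → a + (c + 1) + 0 ≡ 1 + (a + c)
  eq = solve-∀

arith-90 : ∀ a b c d → b ≡ c + d → d ≡ 0 → a + c ≤ 1 → a + b ≤ 1
arith-90 a b c d refl refl h2 = lin 0 h2 (eq a c)
  where
  eq : ∀ a c → a + (c + 0) + 1 + 0 ≡ 1 + (a + c)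
  eq = solve-∀

arith-91 : ∀ a b c d e f g h → a ≡ c + e → b ≡ d + f → g ≡ e + f → h ≡ 1 → 1 + (1 + 0 + a) + b ≡ 1 + c + d + (h + g)
arith-91 a b c d e f g h refl refl refl refl = eq c d e f
  where
  eq : ∀ c d e f → 1 + (1 + 0 + (c + e)) + (d + f) ≡ 1 + c + d + (1 + (e + f))
  eq = solve-∀

arith-92 : ∀ a b c d e f g h → a ≡ c + e → b ≡ d + f → g ≡ e + f → h ≡ 0 → 1 + a + b ≡ 1 + c + d + (h + g)
arith-92 a b c d e f g h refl refl refl refl = eq c d e f
  where
  eq : ∀ c d e f → 1 + (c + e) + (d + f) ≡ 1 + c + d + (0 + (e + f))
  eq = solve-∀

arith-93 : ∀ a b c d → a ≤ 1 + b + (1 + c) → d ≡ 1 + c → a ≤ b + (1 + d)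
arith-93 a b c d h0 refl = lin 0 h0 (eq a b c)
  where
  eq : ∀ a b c → a + (1 + b + (1 + c)) + 0 ≡ b + (1 + (1 + c)) + a
  eq = solve-∀

arith-94 : ∀ a b c d e → e ≡ c + d → b + c ≤ a + (b + e)
arith-94 a b c d e refl = lin (a + d) (z≤n {0}) (eq a b c d)
  where
  eq : ∀ a b c d → b + c + 0 + (a + d) ≡ a + (b + (c + d)) + 0
  eq = solve-∀

arith-95 : ∀ a b c d e → e ≡ c + d → a + d ≤ a + (b + e)
arith-95 a b c d e refl = lin (b + c) (z≤n {0}) (eq a b c d)
  where
  eq : ∀ a b c d → a + d + 0 + (b + c) ≡ a + (b + (c + d)) + 0
  eq = solve-∀

arith-96 : ∀ a b c d e → e ≡ c + d → a + (b + e) ≤ 1 → 1 ≤ b + c → 1 ≤ a + d → ⊥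
arith-96 a b c d e refl h1 h2 h3 = 1≰0 (lin 0 (h1 ⊕ (h2 ⊕ h3)) (eq a b c d))
  where
  eq : ∀ a b c d → 1 + (1 + ((b + c) + (a + d))) + 0 ≡ 0 + ((a + (b + (c + d))) + (1 + 1))
  eq = solve-∀

arith-97 : ∀ a b c d e f g h → a ≡ b → b ≡ c + d → h ≡ f + g → c ≤ e + f → d ≤ g → a ≤ e + h
arith-97 a b c d e f g h refl refl refl h3 h4 = lin 0 (h3 ⊕ h4) (eq c d e f g)
  where
  eq : ∀ c d e f g → c + d + ((e + f) + g) + 0 ≡ e + (f + g) + (c + d)
  eq = solve-∀

arith-98 : ∀ a b c → c ≡ a + b → 1 ≤ c → a < 1 → 1 ≤ b
arith-98 a b c refl h1 h2 = lin 0 (h1 ⊕ h2) (eq a b)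
  where
  eq : ∀ a b → 1 + ((a + b) + 1) + 0 ≡ b + (1 + (1 + a))
  eq = solve-∀

arith-99 : ∀ a b c d e → 1 + a ≤ b → b ≡ e → a ≡ c → 1 + c ≡ d → 1 + e ≡ d → ⊥
arith-99 a b c d e h0 refl refl refl h4 = 1≰0 (lin 0 (h0 ⊕ (≤-reflexive h4)) (eq c e))
  where
  eq : ∀ c e → 1 + (e + (1 + c)) + 0 ≡ 0 + ((1 + c) + (1 + e))
  eq = solve-∀

arith-100 : ∀ a b c d e → 1 + d ≤ c → 1 + a ≤ b → d ≡ e → e ≡ b + 0 → a + 0 + 2 ≤ c
arith-100 a b c d e h0 h1 refl refl = lin 0 (h0 ⊕ h1) (eq a b c)
  where
  eq : ∀ a b c → a + 0 + 2 + (c + b) + 0 ≡ c + ((1 + (b + 0)) + (1 + a))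
  eq = solve-∀

arith-101 : ∀ a b c d e f g h → 1 + a ≤ b → 1 + c ≤ d → e ≤ f → h ≤ g → h ≡ b + (d + f) → a + (c + e) + 2 ≤ g
arith-101 a b c d e f g h h0 h1 h2 h3 refl = lin 0 (h0 ⊕ (h1 ⊕ (h2 ⊕ h3))) (eq a b c d e f g)
  where
  eq : ∀ a b c d e f g → a + (c + e) + 2 + (b + (d + (f + g))) + 0 ≡ g + ((1 + a) + ((1 + c) + (e + ((b + (d + f))))))
  eq = solve-∀

arith-102 : ∀ a b → b ≤ b * b → a * a + (a + b) ≤ (a + b) * (a + b) + a
arith-102 a b h0 = lin (2 * a * b) h0 (eq a b)
  where
  eq : ∀ a b → a * a + (a + b) + (b * b) + (2 * a * b) ≡ (a + b) * (a + b) + a + b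
  eq = solve-∀

arith-103 : ∀ a b c d → a ≤ b + 2 * c → b ≤ 2 + d → c + 2 ≤ 2 + d → a ≤ 3 * d + 2
arith-103 a b c d h0 h1 h2 = lin 0 (h0 ⊕ (h1 ⊕ (2 ⊛ h2))) (eq a b c d)
  where
  eq : ∀ a b c d → a + ((b + 2 * c) + ((2 + d) + 2 * (2 + d))) + 0 ≡ 3 * d + 2 + (a + (b + 2 * (c + 2)))
  eq = solve-∀

arith-104 : ∀ a b c d e f g → a ≡ c → b ≤ 2 * d + 9 * e → d ≤ 2 + f → e + 2 ≤ 2 + f → 1 + c + 144 *
    ((2 + f) * (2 + f)) + 124 ≤ g + 280 * (2 + f) → a + b + 11 ≤ g
arith-104 a b c d e f g refl h1 h2 h3 h4 = lin (126 + 285 * f + 144 * f * f) (h1 ⊕ ((2 ⊛ h2) ⊕ ((9 ⊛ h3) ⊕ h4)))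
    (eq b c d e f g)
  where
  eq : ∀ b c d e f g → c + b + 11 + ((2 * d + 9 * e) + (2 * (2 + f) + (9 * (2 + f) + (g + 280 * (2 + f))))) +
      (126 + 285 * f + 144 * f * f) ≡ g + (b + (2 * d + (9 * (e + 2) + (1 + c + 144 * ((2 + f) * (2 + f)) + 124))))
  eq = solve-∀

arith-105 : ∀ a b c d e → e ≡ a + (b + (c + d)) → e ≡ b + a + (c + d)
arith-105 a b c d e refl = eq a b c d
  where
  eq : ∀ a b c d → a + (b + (c + d)) ≡ b + a + (c + d)
  eq = solve-∀

arith-106 : ∀ a b c d e → e ≡ c + (d + 0) → a + (b + e) ≡ a + b + c + d
arith-106 a b c d e refl = eq a b c d
  where
  eq : ∀ a b c d → a + (b + (c + (d + 0))) ≡ a + b + c + d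
  eq = solve-∀

arith-107 : ∀ a b c d e f → f ≡ c + (d + 0) → d ≡ e → b + (a + f) ≡ a + b + c + e
arith-107 a b c d e f refl refl = eq a b c e
  where
  eq : ∀ a b c e → b + (a + (c + (e + 0))) ≡ a + b + c + e
  eq = solve-∀

arith-108 : ∀ a b c d e → b ≡ c → c ≡ d + e → e ≡ 0 → 6 * d ≤ a + 6 → 2 * b < a + 3
arith-108 a b c d e refl refl refl h3 = linG 2 (2 + 2 * a) h3 (eq a d)
  where
  eq : ∀ a d → 3 * (1 + (2 * (d + 0))) + (a + 6) + (2 + 2 * a) ≡ 3 * (a + 3) + (6 * d) + 2
  eq = solve-∀

arith-109 : ∀ a b c → 6 + a ≤ b → a ≤ 1 + b + c
arith-109 a b c h0 = lin (7 + c) h0 (eq a b c)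
  where
  eq : ∀ a b c → a + b + (7 + c) ≡ 1 + b + c + (6 + a)
  eq = solve-∀

arith-110 : ∀ a b c → b < c + 3 → 1 + a + b < 6 + (1 + a + c)
arith-110 a b c h0 = lin 3 h0 (eq a b c)
  where
  eq : ∀ a b c → 1 + (1 + a + b) + (c + 3) + 3 ≡ 6 + (1 + a + c) + (1 + b)
  eq = solve-∀

arith-111 : ∀ a b c → 6 + c + b ≡ a → 3 + b ≤ a
arith-111 a b c refl = lin (3 + c) (z≤n {0}) (eq b c)
  where
  eq : ∀ b c → 3 + b + 0 + (3 + c) ≡ 6 + c + b + 0
  eq = solve-∀

arith-112 : ∀ a b c → 6 + c + b ≡ a → a ≡ 3 + c + (3 + b)
arith-112 a b c refl = eq b c
  where
  eq : ∀ b c → 6 + c + b ≡ 3 + c + (3 + b)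
  eq = solve-∀

arith-113 : ∀ a → 3 + a + 3 ≡ 6 + a
arith-113 = solve-∀

arith-114 : ∀ a b c d → b < 3 + c → 6 + a + c ≡ d → a + (1 + b) ≤ d
arith-114 a b c d h0 refl = lin 3 h0 (eq a b c)
  where
  eq : ∀ a b c → a + (1 + b) + (3 + c) + 3 ≡ 6 + a + c + (1 + b)
  eq = solve-∀

arith-115 : ∀ a b → 6 * (1 + a) + b ≡ 6 + (6 * a + b)
arith-115 = solve-∀

arith-116 : ∀ a b → 6 * a + (6 + b) ≡ 6 * (1 + a) + b
arith-116 = solve-∀

arith-117 : ∀ a b c d → d ≡ c + (a + b) → d ≡ a + c + b
arith-117 a b c d refl = eq a b c
  where
  eq : ∀ a b c → c + (a + b) ≡ a + c + b
  eq = solve-∀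

arith-118 : ∀ a b c d e f g → a + b + c + (e + d) ≤ f + g → e + a + b + c + d ≤ f + g
arith-118 a b c d e f g h0 = lin 0 h0 (eq a b c d e f g)
  where
  eq : ∀ a b c d e f g → e + a + b + c + d + (f + g) + 0 ≡ f + g + (a + b + c + (e + d))
  eq = solve-∀

arith-119 : ∀ a b c d e → c ≡ b + d + e → a + c ≡ a + b + d + e
arith-119 a b c d e refl = eq a b d e
  where
  eq : ∀ a b d e → a + (b + d + e) ≡ a + b + d + e
  eq = solve-∀

arith-120 : ∀ a b c → 6 * b + (6 * a + c) ≡ 6 * (a + b) + c
arith-120 = solve-∀

arith-121 : ∀ a b c d e f g h i j k l m → c ≡ a + b → f ≡ d + e → i ≡ g + h → a + d + g + j ≤ m + k → b + e + h + k ≤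
    0 + l → c + f + i + j ≤ m + l
arith-121 a b c d e f g h i j k l m refl refl refl h3 h4 = lin 0 (h3 ⊕ h4) (eq a b d e g h j k l m)
  where
  eq : ∀ a b d e g h j k l m → (a + b) + (d + e) + (g + h) + j + ((m + k) + (0 + l)) + 0 ≡ m + l + ((a + d + g + j) +
      (b + e + h + k))
  eq = solve-∀

arith-122 : ∀ a b c d e f g h i j k → c ≡ a + b → f ≡ d + e → i ≡ g + h → a + d + g ≡ j → b + e + h ≡ k → c + f + i ≡
    j + k
arith-122 a b c d e f g h i j k refl refl refl refl refl = eq a b d e g h
  where
  eq : ∀ a b d e g h → (a + b) + (d + e) + (g + h) ≡ (a + d + g) + (b + e + h)
  eq = solve-∀

arith-123 : ∀ a b c d e f g h i → c ≡ a + b → f ≡ d + e → a + d ≤ i + g → b + e ≤ 0 + h → c + f ≤ i + (g + h)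
arith-123 a b c d e f g h i refl refl h2 h3 = lin 0 (h2 ⊕ h3) (eq a b d e g h i)
  where
  eq : ∀ a b d e g h i → (a + b) + (d + e) + ((i + g) + (0 + h)) + 0 ≡ i + (g + h) + ((a + d) + (b + e))
  eq = solve-∀

arith-124 : ∀ a b c d e f g h i j k l → a ≡ b + c → b ≡ j + f + h → c ≡ k + g + i → d ≡ f + g → e ≡ h + i → l ≡ j + k
    → a ≡ l + d + e
arith-124 a b c d e f g h i j k l refl refl refl refl refl refl = eq f g h i j k
  where
  eq : ∀ f g h i j k → (j + f + h) + (k + g + i) ≡ (j + k) + (f + g) + (h + i)
  eq = solve-∀

arith-125 : ∀ a b c d → c ≡ d + b → 0 + 0 + (d + 0) + b ≤ a + c
arith-125 a b c d refl = lin a (z≤n {0}) (eq a b d)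
  where
  eq : ∀ a b d → 0 + 0 + (d + 0) + b + 0 + a ≡ a + (d + b) + 0
  eq = solve-∀

arith-126 : ∀ a → 0 + 0 + (3 + a + 0) ≡ 3 + a
arith-126 = solve-∀

arith-127 : ∀ a b → b ≡ 2 → 0 + (b + 0) ≤ a + 2
arith-127 a b refl = lin a (z≤n {0}) (eq a)
  where
  eq : ∀ a → 0 + (2 + 0) + 0 + a ≡ a + 2 + 0
  eq = solve-∀

arith-128 : ∀ a b → b ≡ a + 0 → a ≡ 0 + 0 + b
arith-128 a b refl = eq a
  where
  eq : ∀ a → a ≡ 0 + 0 + (a + 0)
  eq = solve-∀

arith-129 : ∀ a b c d e → c ≡ d + b → e ≡ d + a → 0 + 0 + (e + 0) + b ≤ a + c
arith-129 a b c d e refl refl = lin 0 (z≤n {0}) (eq a b d)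
  where
  eq : ∀ a b d → 0 + 0 + ((d + a) + 0) + b + 0 + 0 ≡ a + (d + b) + 0
  eq = solve-∀

arith-130 : ∀ a b c → b ≡ 2 → c ≡ b + a → 0 + (c + 0) ≤ a + 2
arith-130 a b c refl refl = lin 0 (z≤n {0}) (eq a)
  where
  eq : ∀ a → 0 + ((2 + a) + 0) + 0 + 0 ≡ a + 2 + 0
  eq = solve-∀

arith-131 : ∀ a b c d → c ≡ d + b → 0 + (d + 0) + 0 + b ≤ a + c
arith-131 a b c d refl = lin a (z≤n {0}) (eq a b d)
  where
  eq : ∀ a b d → 0 + (d + 0) + 0 + b + 0 + a ≡ a + (d + b) + 0
  eq = solve-∀

arith-132 : ∀ a → 0 + (a + 0) + 0 ≡ a
arith-132 = solve-∀

arith-133 : ∀ a b c d → b ≡ 7 → b + (c + d) + 0 + 0 ≤ a + (7 + c + d)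
arith-133 a b c d refl = lin a (z≤n {0}) (eq a c d)
  where
  eq : ∀ a c d → 7 + (c + d) + 0 + 0 + 0 + a ≡ a + (7 + c + d) + 0
  eq = solve-∀

arith-134 : ∀ a b → b ≡ a + 0 → a ≡ 0 + b + 0
arith-134 a b refl = eq a
  where
  eq : ∀ a → a ≡ 0 + (a + 0) + 0
  eq = solve-∀

arith-135 : ∀ a b c → 6 * (a + b) + c ≡ 6 * a + (6 * b + c)
arith-135 = solve-∀

arith-136 : ∀ a b → 0 + (a + 0) + 0 + b ≤ a + b
arith-136 a b  = lin 0 (z≤n {0}) (eq a b)
  where
  eq : ∀ a b → 0 + (a + 0) + 0 + b + 0 + 0 ≡ a + b + 0
  eq = solve-∀

arith-137 : ∀ a b → 0 + (3 + a + b + 0) + 0 ≡ 3 + a + b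
arith-137 = solve-∀

arith-138 : ∀ a b → a + b + 0 + 0 ≤ a + b
arith-138 a b  = lin 0 (z≤n {0}) (eq a b)
  where
  eq : ∀ a b → a + b + 0 + 0 + 0 + 0 ≡ a + b + 0
  eq = solve-∀

arith-139 : ∀ a b c d e → b ≡ a + c → b ≤ d → a ≤ d + e
arith-139 a b c d e refl h1 = lin (c + e) h1 (eq a c d e)
  where
  eq : ∀ a c d e → a + d + (c + e) ≡ d + e + (a + c)
  eq = solve-∀

arith-140 : ∀ a b c d e f g h i j k l → a ≡ j + k + l + i + g + h → b ≡ c + d → h + d + (g + c + i + e) ≤ f → a + b +
    e ≤ f + (j + k + l)
arith-140 a b c d e f g h i j k l refl refl h2 = lin 0 h2 (eq c d e f g h i j k l)
  where
  eq : ∀ c d e f g h i j k l → (j + k + l + i + g + h) + (c + d) + e + f + 0 ≡ f + (j + k + l) +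
      (h + d + (g + c + i + e))
  eq = solve-∀

arith-141 : ∀ a b c d e f g h i j k → a ≡ 3 + b + c + d → g ≡ e + f → j ≡ h + i → c + h + e ≡ k → d + f ≡ j → a + g ≡
    3 + b + k + i
arith-141 a b c d e f g h i j k refl refl refl refl h4 = linE h4 (eq b c d e f h i)
  where
  eq : ∀ b c d e f h i → (3 + b + c + d) + (e + f) + (h + i) ≡ 3 + b + (c + h + e) + i + (d + f)
  eq = solve-∀

arith-142 : ∀ a b c d e f g h → c ≡ a + b → f ≡ d + e → d + a ≤ g + h → b ≤ f → c ≤ g + h + e
arith-142 a b c d e f g h refl refl h2 h3 = lin 0 (h2 ⊕ h3) (eq a b d e g h)
  where
  eq : ∀ a b d e g h → a + b + ((g + h) + (d + e)) + 0 ≡ g + h + e + ((d + a) + b)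
  eq = solve-∀

arith-143 : ∀ a b c d e f → a ≡ b + (1 + c) → c ≡ d + e → b ≡ f → 2 + a ≡ 3 + f + d + e
arith-143 a b c d e f refl refl refl = eq d e f
  where
  eq : ∀ d e f → 2 + (f + (1 + (d + e))) ≡ 3 + f + d + e
  eq = solve-∀

arith-144 : ∀ a b c d e f g h → g ≡ c + (d + h) → h ≡ e + f → a + (b + g) ≡ a + b + c + d + e + f
arith-144 a b c d e f g h refl refl = eq a b c d e f
  where
  eq : ∀ a b c d e f → a + (b + (c + (d + (e + f)))) ≡ a + b + c + d + e + f
  eq = solve-∀

arith-145 : ∀ a b c d e f g h i j k l → a ≡ b + c → b ≤ d + 2 * l → d ≡ e → e ≡ f + g → g ≡ 0 → c ≡ h + k → h ≡ i + j
    → i ≤ 1 → j ≤ 1 → k ≡ 0 → a ≤ f + 2 * (1 + l)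
arith-145 a b c d e f g h i j k l refl h1 refl refl refl refl refl h7 h8 refl = lin 0 (h1 ⊕ (h7 ⊕ h8)) (eq b f i j l)
  where
  eq : ∀ b f i j l → b + ((i + j) + 0) + (((f + 0) + 2 * l) + (1 + 1)) + 0 ≡ f + 2 * (1 + l) + (b + (i + j))
  eq = solve-∀

arith-146 : ∀ a b c d e f g h i j k l m n o p q → a ≡ b + g → b ≡ c + d → c ≡ o + p + q + n → d ≡ l + f + i → e ≡ m +
    j → e ≡ f + g → h ≡ i + j → k ≡ o + p + q + n + l + m → a ≡ k + h
arith-146 a b c d e f g h i j k l m n o p q refl refl refl refl refl h5 refl refl = linE (sym h5) (eq f g i j l m n o
    p q)
  where
  eq : ∀ f g i j l m n o p q → ((o + p + q + n) + (l + f + i)) + g + (m + j) ≡ (o + p + q + n + l + m) + (i + j) +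
      (f + g)
  eq = solve-∀

arith-147 : ∀ a b c d e f g h i j k → a ≡ b + c → d + b + e + f ≤ h + k → h + c + g ≤ j → i ≡ j + k → a +
    (d + e + f + g) ≤ i
arith-147 a b c d e f g h i j k refl h1 h2 refl = lin 0 (h1 ⊕ h2) (eq b c d e f g h j k)
  where
  eq : ∀ b c d e f g h j k → (b + c) + (d + e + f + g) + ((h + k) + j) + 0 ≡ j + k + ((d + b + e + f) + (h + c + g))
  eq = solve-∀

arith-148 : ∀ a b c d e f g → 1 + a + b ≡ f → g ≡ f + (12 * c + 17) + (d + 4 * c + 2) → 1 + a + (b + (12 * c + 17)) +
    (d + 4 * c + 2 + 6 * e) ≡ 6 * e + g
arith-148 a b c d e f g refl refl = eq a b c d e
  where
  eq : ∀ a b c d e → 1 + a + (b + (12 * c + 17)) + (d + 4 * c + 2 + 6 * e) ≡ 6 * e + ((1 + a + b) + (12 * c + 17) +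
      (d + 4 * c + 2))
  eq = solve-∀

arith-149 : ∀ a b c d → a ≡ 6 * b + c → d ≡ 6 * b + (1 + (6 * b + c)) → a ≤ d
arith-149 a b c d refl refl = lin (1 + 6 * b) (z≤n {0}) (eq b c)
  where
  eq : ∀ b c → 6 * b + c + 0 + (1 + 6 * b) ≡ 6 * b + (1 + (6 * b + c)) + 0
  eq = solve-∀

arith-150 : ∀ a b c → a ≤ b → a ≤ 1 + b + c
arith-150 a b c h0 = lin (1 + c) h0 (eq a b c)
  where
  eq : ∀ a b c → a + b + (1 + c) ≡ 1 + b + c + a
  eq = solve-∀

arith-151 : ∀ a b c d → 1 + b + c ≡ a → a ≤ 1 + b + (c + (12 * d + 17))
arith-151 a b c d refl = lin (17 + 12 * d) (z≤n {0}) (eq b c d)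
  where
  eq : ∀ b c d → 1 + b + c + 0 + (17 + 12 * d) ≡ 1 + b + (c + (12 * d + 17)) + 0
  eq = solve-∀

arith-152 : ∀ a b c d e → c ≤ d → 1 + a + b + d ≤ e → 1 + a + (b + c) ≤ e
arith-152 a b c d e h0 h1 = lin 0 (h0 ⊕ h1) (eq a b c d e)
  where
  eq : ∀ a b c d e → 1 + a + (b + c) + (d + e) + 0 ≡ e + (c + (1 + a + b + d))
  eq = solve-∀

arith-153 : ∀ a b c d e f g → 1 + a + b ≡ e → g ≡ e + (12 * c + 17) + (f + 4 * c + 2) → 1 + a + (b + (12 * c + 17) +
    d) ≤ g + d
arith-153 a b c d e f g refl refl = lin (2 + 4 * c + f) (z≤n {0}) (eq a b c d f)
  where
  eq : ∀ a b c d f → 1 + a + (b + (12 * c + 17) + d) + 0 + (2 + 4 * c + f) ≡ ((1 + a + b) + (12 * c + 17) +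
      (f + 4 * c + 2)) + d + 0
  eq = solve-∀

arith-154 : ∀ a b c d e f g → b + f ≡ g → b ≡ e + 12 * c + 20 + 16 * d + a → 1 + (6 * c + a) +
    (6 * c + (e + 4 * d + 2)) + (12 * d + 17 + f) ≡ g
arith-154 a b c d e f g refl refl = eq a c d e f
  where
  eq : ∀ a c d e f → 1 + (6 * c + a) + (6 * c + (e + 4 * d + 2)) + (12 * d + 17 + f) ≡ (e + 12 * c + 20 + 16 * d + a)
      + f
  eq = solve-∀

arith-155 : ∀ a b c d e → b ≡ e + 12 * c + 20 + 16 * d + a → 1 + (6 * c + a) + (6 * c + (e + 4 * d + 2)) ≤ b
arith-155 a b c d e refl = lin (17 + 12 * d) (z≤n {0}) (eq a c d e)
  where
  eq : ∀ a c d e → 1 + (6 * c + a) + (6 * c + (e + 4 * d + 2)) + 0 + (17 + 12 * d) ≡ e + 12 * c + 20 + 16 * d + a + 0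
  eq = solve-∀

arith-156 : ∀ a b → b ≤ 1 + (6 * a + b)
arith-156 a b  = lin (1 + 6 * a) (z≤n {0}) (eq a b)
  where
  eq : ∀ a b → b + 0 + (1 + 6 * a) ≡ 1 + (6 * a + b) + 0
  eq = solve-∀

arith-157 : ∀ a b c d e → a ≤ b → b + d ≡ c → c < e → a ≤ e
arith-157 a b c d e h0 refl h2 = lin (1 + d) (h0 ⊕ h2) (eq a b d e)
  where
  eq : ∀ a b d e → a + (b + e) + (1 + d) ≡ e + (a + (1 + (b + d)))
  eq = solve-∀

arith-158 : ∀ a b c → b ≤ 1 + (6 * a + b) + c
arith-158 a b c  = lin (1 + 6 * a + c) (z≤n {0}) (eq a b c)
  where
  eq : ∀ a b c → b + 0 + (1 + 6 * a + c) ≡ 1 + (6 * a + b) + c + 0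
  eq = solve-∀

arith-159 : ∀ a b c d e f → a ≡ 6 * c + (1 + b) → d + e ≡ 6 * c + f → a ≤ 1 + b + d + e
arith-159 a b c d e f refl h1 = lin f (≤-reflexive (sym h1)) (eq b c d e f)
  where
  eq : ∀ b c d e f → 6 * c + (1 + b) + (d + e) + f ≡ 1 + b + d + e + (6 * c + f)
  eq = solve-∀

arith-160 : ∀ a b c d e → b + c ≡ d → 1 + a + b + (c + e) ≡ 1 + a + d + e
arith-160 a b c d e refl = eq a b c e
  where
  eq : ∀ a b c e → 1 + a + b + (c + e) ≡ 1 + a + (b + c) + e
  eq = solve-∀

arith-161 : ∀ a b c → a + 6 ≤ a + (12 * b + 17) + (c + 4 * b + 2)
arith-161 a b c  = lin (13 + 16 * b + c) (z≤n {0}) (eq a b c)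
  where
  eq : ∀ a b c → a + 6 + 0 + (13 + 16 * b + c) ≡ a + (12 * b + 17) + (c + 4 * b + 2) + 0
  eq = solve-∀

arith-162 : ∀ a b c d → a ≤ 6 * b + (1 + (6 * b + (a + (12 * c + 17) + (d + 4 * c + 2))))
arith-162 a b c d  = lin (20 + 12 * b + 16 * c + d) (z≤n {0}) (eq a b c d)
  where
  eq : ∀ a b c d → a + 0 + (20 + 12 * b + 16 * c + d) ≡ 6 * b + (1 + (6 * b + (a + (12 * c + 17) + (d + 4 * c + 2))))
      + 0
  eq = solve-∀

arith-163 : ∀ a b c d e → a + (6 * b + (1 + (6 * b + (c + (12 * d + 17) + (e + 4 * d + 2))))) ≤ e + 12 * b + 20 + 16 *
    d + a + c
arith-163 a b c d e  = lin 0 (z≤n {0}) (eq a b c d e)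
  where
  eq : ∀ a b c d e → a + (6 * b + (1 + (6 * b + (c + (12 * d + 17) + (e + 4 * d + 2))))) + 0 + 0 ≡ e + 12 * b + 20 +
      16 * d + a + c + 0
  eq = solve-∀

arith-164 : ∀ a b c d e → 6 * b + (c + (12 * d + 17) + (e + 4 * d + 2)) ≤ e + 12 * b + 20 + 16 * d + a + c
arith-164 a b c d e  = lin (1 + a + 6 * b) (z≤n {0}) (eq a b c d e)
  where
  eq : ∀ a b c d e → 6 * b + (c + (12 * d + 17) + (e + 4 * d + 2)) + 0 + (1 + a + 6 * b) ≡ e + 12 * b + 20 + 16 * d +
      a + c + 0
  eq = solve-∀

arith-165 : ∀ a b c d e → 6 * c + (1 + (6 * c + (a + b))) + 6 ≤ e + 12 * c + 20 + 16 * d + a + b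
arith-165 a b c d e  = lin (13 + 16 * d + e) (z≤n {0}) (eq a b c d e)
  where
  eq : ∀ a b c d e → 6 * c + (1 + (6 * c + (a + b))) + 6 + 0 + (13 + 16 * d + e) ≡ e + 12 * c + 20 + 16 * d + a + b +
      0
  eq = solve-∀

arith-166 : ∀ a b c d e → e + 12 * c + 20 + 16 * d + a + b ≡ e + 12 * c + 20 + 16 * d + (a + b)
arith-166 = solve-∀

arith-167 : ∀ a b c d e → a + b ≤ e + 12 * c + 20 + 16 * d + a + b
arith-167 a b c d e  = lin (20 + 12 * c + 16 * d + e) (z≤n {0}) (eq a b c d e)
  where
  eq : ∀ a b c d e → a + b + 0 + (20 + 12 * c + 16 * d + e) ≡ e + 12 * c + 20 + 16 * d + a + b + 0
  eq = solve-∀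

arith-168 : ∀ a b c d e → 1 + (6 * c + (a + b)) + (6 * c + (e + 4 * d + 2)) ≤ e + 12 * c + 20 + 16 * d + a + b
arith-168 a b c d e  = lin (17 + 12 * d) (z≤n {0}) (eq a b c d e)
  where
  eq : ∀ a b c d e → 1 + (6 * c + (a + b)) + (6 * c + (e + 4 * d + 2)) + 0 + (17 + 12 * d) ≡ e + 12 * c + 20 + 16 * d
      + a + b + 0
  eq = solve-∀

arith-169 : ∀ a b c d e f g h i j k l m n o p q → a ≡ b + e → b ≡ c + d → h ≡ f + g → i ≡ j + k → f + c + j + l ≤ q +
    o → g + d + k + o ≤ 0 + p → q + e + m ≤ n → a + (h + i + l + m) ≤ n + p
arith-169 a b c d e f g h i j k l m n o p q refl refl refl refl h4 h5 h6 = lin 0 (h4 ⊕ (h5 ⊕ h6)) (eq c d e f g j k l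
    m n o p q)
  where
  eq : ∀ c d e f g j k l m n o p q → ((c + d) + e) + ((f + g) + (j + k) + l + m) + ((q + o) + ((0 + p) + n)) + 0 ≡ n +
      p + ((f + c + j + l) + ((g + d + k + o) + (q + e + m)))
  eq = solve-∀

arith-170 : ∀ a b c d → d ≤ b + c → a + d ≤ b + a + c
arith-170 a b c d h0 = lin 0 h0 (eq a b c d)
  where
  eq : ∀ a b c d → a + d + (b + c) + 0 ≡ b + a + c + d
  eq = solve-∀

arith-171 : ∀ a b c d e f g h i j k l m → a ≡ b + c + d + f → g ≡ h + k → h ≡ i + j → e ≡ c + d → f + k +
    (e + h + b + l) ≤ m → a + g + l ≤ m
arith-171 a b c d e f g h i j k l m refl refl refl refl h4 = lin 0 h4 (eq b c d f i j k l m)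
  where
  eq : ∀ b c d f i j k l m → (b + c + d + f) + ((i + j) + k) + l + m + 0 ≡ m + (f + k + ((c + d) + (i + j) + b + l))
  eq = solve-∀

arith-172 : ∀ a b c d e → a ≤ b + 2 * e → b ≡ c + d → d ≡ 0 → a ≤ c + 2 * e
arith-172 a b c d e h0 refl refl = lin 0 h0 (eq a c e)
  where
  eq : ∀ a c e → a + ((c + 0) + 2 * e) + 0 ≡ c + 2 * e + a
  eq = solve-∀

arith-173 : ∀ a b c d e f g h i j k l m n o p → a ≡ 1 + b + c + d → e ≡ f + i → f ≡ g + h → j ≡ k + n → k ≡ l + m → b
    + l + g ≡ o → c + m + h ≡ p → d + i ≡ j → a + e ≡ 1 + o + p + n
arith-173 a b c d e f g h i j k l m n o p refl refl refl refl refl refl refl h7 = linE h7 (eq b c d g h i l m n)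
  where
  eq : ∀ b c d g h i l m n → (1 + b + c + d) + ((g + h) + i) + ((l + m) + n) ≡ 1 + (b + l + g) + (c + m + h) + n +
      (d + i)
  eq = solve-∀

arith-174 : ∀ a b c d e f g h i j k l m → a ≡ b + e → b ≡ c + d → f ≡ g + j → g ≡ h + i → h + c ≤ m + k → i + d ≤ 0 +
    l → e ≤ f → a ≤ m + (k + l) + j
arith-174 a b c d e f g h i j k l m refl refl refl refl h4 h5 h6 = lin 0 (h4 ⊕ (h5 ⊕ h6)) (eq c d e h i j k l m)
  where
  eq : ∀ c d e h i j k l m → (c + d) + e + ((m + k) + ((0 + l) + ((h + i) + j))) + 0 ≡ m + (k + l) + j +
      ((h + c) + ((i + d) + e))
  eq = solve-∀

arith-175 : ∀ a b c d e f → e ≡ b + f → f ≡ c + d → a + e ≡ a + b + c + d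
arith-175 a b c d e f refl refl = eq a b c d
  where
  eq : ∀ a b c d → a + (b + (c + d)) ≡ a + b + c + d
  eq = solve-∀

arith-176 : ∀ a b c d e → d ≡ a + e → e ≡ b + c → 1 + d ≡ 1 + a + b + c
arith-176 a b c d e refl refl = eq a b c
  where
  eq : ∀ a b c → 1 + (a + (b + c)) ≡ 1 + a + b + c
  eq = solve-∀

arith-177 : ∀ a b c d e f g h i j k l m n o p q r s → a ≡ c + b + j → b ≡ d + e → d ≡ q + h + m → e ≡ r + i + n → f ≡
    s + o → f ≡ g + j → g ≡ h + i → k ≡ l + o → l ≡ m + n → p ≡ c + q + r + s → a ≡ p + k
arith-177 a b c d e f g h i j k l m n o p q r s refl refl refl refl refl h5 refl refl refl refl = linE (sym h5)
    (eq c h i j m n o q r s)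
  where
  eq : ∀ c h i j m n o q r s → c + ((q + h + m) + (r + i + n)) + j + (s + o) ≡ (c + q + r + s) + ((m + n) + o) +
      ((h + i) + j)
  eq = solve-∀

arith-178 : ∀ a b c → 6 * b + (6 * a + (1 + (6 * (a + b) + (c + 6)))) ≤ 12 * (a + b) + 7 + c
arith-178 a b c  = lin 0 (z≤n {0}) (eq a b c)
  where
  eq : ∀ a b c → 6 * b + (6 * a + (1 + (6 * (a + b) + (c + 6)))) + 0 + 0 ≡ 12 * (a + b) + 7 + c + 0
  eq = solve-∀

arith-179 : ∀ a b c → 6 * (a + b) + (c + 6) ≡ 6 * a + (6 * b + (c + 6))
arith-179 = solve-∀

arith-180 : ∀ a b → a + (b + 0) ≡ b + (a + 0)
arith-180 = solve-∀

arith-181 : ∀ a b c → b + (a + c) ≤ a + b + c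
arith-181 a b c  = lin 0 (z≤n {0}) (eq a b c)
  where
  eq : ∀ a b c → b + (a + c) + 0 + 0 ≡ a + b + c + 0
  eq = solve-∀

arith-182 : ∀ a b c d → a + c ≤ d → a + (b + (c + 0)) ≤ b + d
arith-182 a b c d h0 = lin 0 h0 (eq a b c d)
  where
  eq : ∀ a b c d → a + (b + (c + 0)) + d + 0 ≡ b + d + (a + c)
  eq = solve-∀

arith-183 : ∀ a b c d e → a + c + d ≤ e → a + (b + (c + (d + 0))) ≤ b + e
arith-183 a b c d e h0 = lin 0 h0 (eq a b c d e)
  where
  eq : ∀ a b c d e → a + (b + (c + (d + 0))) + e + 0 ≡ b + e + (a + c + d)
  eq = solve-∀

arith-184 : ∀ a b c d e f → a + b ≤ c → e ≡ b + d → f ≡ c + d → a + e ≤ f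
arith-184 a b c d e f h0 refl refl = lin 0 h0 (eq a b c d)
  where
  eq : ∀ a b c d → a + (b + d) + c + 0 ≡ c + d + (a + b)
  eq = solve-∀

arith-185 : ∀ a b c → a + 4 ≤ b → b ≡ 2 + c → a + 2 ≤ c
arith-185 a b c h0 refl = lin 0 h0 (eq a c)
  where
  eq : ∀ a c → a + 2 + (2 + c) + 0 ≡ c + (a + 4)
  eq = solve-∀

arith-186 : ∀ a b → 1 ≡ b → a + 1 ≤ b → 2 ≤ a → ⊥
arith-186 a b refl h1 h2 = 1≰0 (lin 1 (h1 ⊕ h2) (eq a))
  where
  eq : ∀ a → 1 + (1 + a) + 1 ≡ 0 + ((a + 1) + 2)
  eq = solve-∀

arith-187 : ∀ a b c d → a ≤ b → b + 1 ≤ d → 2 + c ≡ d → a ≤ 1 + c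
arith-187 a b c d h0 h1 refl = lin 0 (h0 ⊕ h1) (eq a b c)
  where
  eq : ∀ a b c → a + (b + (2 + c)) + 0 ≡ 1 + c + (a + (b + 1))
  eq = solve-∀

arith-188 : ∀ a b c d e f g → e ≡ a + b + c → d ≡ c + g → f ≡ e + g → a + (b + d) ≤ f
arith-188 a b c d e f g refl refl refl = lin 0 (z≤n {0}) (eq a b c g)
  where
  eq : ∀ a b c g → a + (b + (c + g)) + 0 + 0 ≡ (a + b + c) + g + 0
  eq = solve-∀

arith-189 : ∀ a b c d e → d ≡ a + b + c → d ≡ b + e → a + c ≤ e
arith-189 a b c d e refl h1 = lin 0 (≤-reflexive h1) (eq a b c e)
  where
  eq : ∀ a b c e → a + c + (b + e) + 0 ≡ e + (a + b + c)
  eq = solve-∀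

arith-190 : ∀ a b c → 2 + a ≡ 1 + (b + c) → c + (1 + b) ≡ 2 + a
arith-190 a b c h0 = linE (sym h0) (eq a b c)
  where
  eq : ∀ a b c → c + (1 + b) + (2 + a) ≡ 2 + a + (1 + (b + c))
  eq = solve-∀

arith-191 : ∀ a b c d e f g → g ≡ c + (f + b) → a ≡ b + (d + c) → a ≤ d + e → g ≤ f + e
arith-191 a b c d e f g refl refl h2 = lin 0 h2 (eq b c d e f)
  where
  eq : ∀ b c d e f → c + (f + b) + (d + e) + 0 ≡ f + e + (b + (d + c))
  eq = solve-∀

arith-192 : ∀ a b c d e f g → c ≡ a + e → d ≡ c + g → f ≡ e + g → a + (b + f) ≤ b + d
arith-192 a b c d e f g refl refl refl = lin 0 (z≤n {0}) (eq a b e g)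
  where
  eq : ∀ a b e g → a + (b + (e + g)) + 0 + 0 ≡ b + ((a + e) + g) + 0
  eq = solve-∀

arith-193 : ∀ a b c → c + 5 ≤ a → a ≡ 1 + b → 1 + c + 4 ≤ 1 + b
arith-193 a b c h0 refl = lin 0 h0 (eq b c)
  where
  eq : ∀ b c → 1 + c + 4 + (1 + b) + 0 ≡ 1 + b + (c + 5)
  eq = solve-∀

arith-194 : ∀ a b c → a + c ≤ a + (b + c)
arith-194 a b c  = lin b (z≤n {0}) (eq a b c)
  where
  eq : ∀ a b c → a + c + 0 + b ≡ a + (b + c) + 0
  eq = solve-∀

arith-195 : ∀ a b c d e f g → e ≤ c → d ≡ c + g → f ≡ e + g → a + f ≤ a + (b + d)
arith-195 a b c d e f g h0 refl refl = lin b h0 (eq a b c e g)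
  where
  eq : ∀ a b c e g → a + (e + g) + c + b ≡ a + (b + (c + g)) + e
  eq = solve-∀

arith-196 : ∀ a b → a + 5 ≤ b → 2 + a + 4 ≤ 1 + b
arith-196 a b h0 = lin 0 h0 (eq a b)
  where
  eq : ∀ a b → 2 + a + 4 + b + 0 ≡ 1 + b + (a + 5)
  eq = solve-∀

arith-197 : ∀ a b c d e f g → a ≡ c + (b + 0) → g ≡ d + f → d + (e + c) ≤ g → a ≤ b + f
arith-197 a b c d e f g refl refl h2 = lin e h2 (eq b c d e f)
  where
  eq : ∀ b c d e f → c + (b + 0) + (d + f) + e ≡ b + f + (d + (e + c))
  eq = solve-∀

arith-198 : ∀ a b c d e f → f ≡ b + e → b + (c + d) ≤ a + f → d ≤ a + e
arith-198 a b c d e f refl h1 = lin c h1 (eq a b c d e)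
  where
  eq : ∀ a b c d e → d + (a + (b + e)) + c ≡ a + e + (b + (c + d))
  eq = solve-∀

arith-199 : ∀ a b c → a + 5 ≤ b → b ≡ 1 + c → a + 1 ≤ c
arith-199 a b c h0 refl = lin 3 h0 (eq a c)
  where
  eq : ∀ a c → a + 1 + (1 + c) + 3 ≡ c + (a + 5)
  eq = solve-∀

arith-200 : ∀ a b c → a + 5 ≤ b → b ≡ 1 + c → a + 4 ≤ c
arith-200 a b c h0 refl = lin 0 h0 (eq a c)
  where
  eq : ∀ a c → a + 4 + (1 + c) + 0 ≡ c + (a + 5)
  eq = solve-∀

arith-201 : ∀ a b c d e f g h i j → e ≡ a + g → g ≡ c + h → f ≡ e + j → i ≡ h + j → d ≤ i → a + (b + (c + d)) ≤ b + f
arith-201 a b c d e f g h i j refl refl refl refl h4 = lin 0 h4 (eq a b c d h j)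
  where
  eq : ∀ a b c d h j → a + (b + (c + d)) + (h + j) + 0 ≡ b + ((a + (c + h)) + j) + d
  eq = solve-∀

arith-202 : ∀ a b c → a + 5 ≤ b → b ≤ 1 + c → 1 + a + 1 ≤ c
arith-202 a b c h0 h1 = lin 2 (h0 ⊕ h1) (eq a b c)
  where
  eq : ∀ a b c → 1 + a + 1 + (b + (1 + c)) + 2 ≡ c + ((a + 5) + b)
  eq = solve-∀

arith-203 : ∀ a b → a + 5 ≤ b → 1 + a + 4 ≤ b
arith-203 a b h0 = lin 0 h0 (eq a b)
  where
  eq : ∀ a b → 1 + a + 4 + b + 0 ≡ b + (a + 5)
  eq = solve-∀

arith-204 : ∀ a b c d e f g h → d ≡ b + f → e ≡ d + h → g ≡ f + h → c ≤ g → a + (b + c) ≤ a + e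
arith-204 a b c d e f g h refl refl refl h3 = lin 0 h3 (eq a b c f h)
  where
  eq : ∀ a b c f h → a + (b + c) + (f + h) + 0 ≡ a + ((b + f) + h) + c
  eq = solve-∀

arith-205 : ∀ a → a + 4 + 1 ≤ a + 5
arith-205 a  = lin 0 (z≤n {0}) (eq a)
  where
  eq : ∀ a → a + 4 + 1 + 0 + 0 ≡ a + 5 + 0
  eq = solve-∀

arith-206 : ∀ a b → a + 5 ≤ b → 1 ≡ b → ⊥
arith-206 a b h0 refl = 1≰0 (lin (3 + a) h0 (eq a))
  where
  eq : ∀ a → 1 + 1 + (3 + a) ≡ 0 + (a + 5)
  eq = solve-∀

arith-207 : ∀ a b → a + 5 ≤ b → 2 ≡ b → ⊥
arith-207 a b h0 refl = 1≰0 (lin (2 + a) h0 (eq a))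
  where
  eq : ∀ a → 1 + 2 + (2 + a) ≡ 0 + (a + 5)
  eq = solve-∀

arith-208 : ∀ a b c d → b + 5 ≤ c → 3 + d ≡ c → a ≤ b → 3 + a ≤ 1 + d
arith-208 a b c d h0 refl h2 = lin 0 (h0 ⊕ h2) (eq a b d)
  where
  eq : ∀ a b d → 3 + a + ((3 + d) + b) + 0 ≡ 1 + d + ((b + 5) + a)
  eq = solve-∀

arith-209 : ∀ a b c → a ≤ 2 + b → 3 + b ≤ 1 + c → a ≤ 2 + c
arith-209 a b c h0 h1 = lin 2 (h0 ⊕ h1) (eq a b c)
  where
  eq : ∀ a b c → a + ((2 + b) + (1 + c)) + 2 ≡ 2 + c + (a + (3 + b))
  eq = solve-∀

arith-210 : ∀ a b c → a ≤ 2 + b → 3 + b ≤ 1 + c → a ≤ 1 + c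
arith-210 a b c h0 h1 = lin 1 (h0 ⊕ h1) (eq a b c)
  where
  eq : ∀ a b c → a + ((2 + b) + (1 + c)) + 1 ≡ 1 + c + (a + (3 + b))
  eq = solve-∀

arith-211 : ∀ a b c → a ≤ 2 + b → 3 + b ≤ 1 + c → a ≤ c
arith-211 a b c h0 h1 = lin 0 (h0 ⊕ h1) (eq a b c)
  where
  eq : ∀ a b c → a + ((2 + b) + (1 + c)) + 0 ≡ c + (a + (3 + b))
  eq = solve-∀

arith-212 : ∀ a b → 3 + a + 2 ≤ b → a + 5 ≤ b
arith-212 a b h0 = lin 0 h0 (eq a b)
  where
  eq : ∀ a b → a + 5 + b + 0 ≡ b + (3 + a + 2)
  eq = solve-∀

arith-213 : ∀ a b c d e f → f ≡ d + e → a + (b + (c + f)) ≡ a + (b + (c + e)) + d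
arith-213 a b c d e f refl = eq a b c d e
  where
  eq : ∀ a b c d e → a + (b + (c + (d + e))) ≡ a + (b + (c + e)) + d
  eq = solve-∀

arith-214 : ∀ a b c d e f g → g ≤ b + c → c ≡ d + e → e ≤ 2 + f → f ≡ 7 → a + 13 + (d + 9) ≤ g → 2 + a + 2 ≤ b
arith-214 a b c d e f g h0 refl h2 refl h4 = lin 9 (h0 ⊕ (h2 ⊕ h4)) (eq a b d e g)
  where
  eq : ∀ a b d e g → 2 + a + 2 + ((b + (d + e)) + ((2 + 7) + g)) + 9 ≡ b + (g + (e + (a + 13 + (d + 9))))
  eq = solve-∀

arith-215 : ∀ a b c → b + (a + c) ≤ a + (b + c)
arith-215 a b c  = lin 0 (z≤n {0}) (eq a b c)
  where
  eq : ∀ a b c → b + (a + c) + 0 + 0 ≡ a + (b + c) + 0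
  eq = solve-∀

arith-216 : ∀ a b c d e f → f ≤ b + c → c ≡ d + e → e ≤ 2 → a + 13 + (d + 2) ≤ f → a + 13 ≤ b
arith-216 a b c d e f h0 refl h2 h3 = lin 0 (h0 ⊕ (h2 ⊕ h3)) (eq a b d e f)
  where
  eq : ∀ a b d e f → a + 13 + ((b + (d + e)) + (2 + f)) + 0 ≡ b + (f + (e + (a + 13 + (d + 2))))
  eq = solve-∀

arith-217 : ∀ a b c → b + 13 ≤ c → a ≡ c → a < 7 → ⊥
arith-217 a b c h0 refl h2 = 1≰0 (lin (6 + b) (h0 ⊕ h2) (eq b c))
  where
  eq : ∀ b c → 1 + (c + 7) + (6 + b) ≡ 0 + ((b + 13) + (1 + c))
  eq = solve-∀

arith-218 : ∀ a b c d e f g h → f ≡ d + e → g ≡ e + d → g ≡ h → a + (b + (c + f)) ≡ a + (b + (c + 0)) + h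
arith-218 a b c d e f g h refl refl refl = eq a b c d e
  where
  eq : ∀ a b c d e → a + (b + (c + (d + e))) ≡ a + (b + (c + 0)) + (e + d)
  eq = solve-∀

arith-219 : ∀ a b c d → a + 13 ≤ d → 7 + c ≡ d → b ≡ a + 2 → 2 + b + 2 ≤ c
arith-219 a b c d h0 refl refl = lin 0 h0 (eq a c)
  where
  eq : ∀ a c → 2 + (a + 2) + 2 + (7 + c) + 0 ≡ c + (a + 13)
  eq = solve-∀

arith-220 : ∀ a b c → 3 + a + 10 + (b + 2) ≤ c → a + 13 + (b + 2) ≤ c
arith-220 a b c h0 = lin 0 h0 (eq a b c)
  where
  eq : ∀ a b c → a + 13 + (b + 2) + c + 0 ≡ c + (3 + a + 10 + (b + 2))
  eq = solve-∀

arith-221 : ∀ a b c d → 3 + a + 10 + (b + (2 + d)) ≤ c → d ≡ 7 → a + 13 + (b + 9) ≤ c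
arith-221 a b c d h0 refl = lin 0 h0 (eq a b c)
  where
  eq : ∀ a b c → a + 13 + (b + 9) + c + 0 ≡ c + (3 + a + 10 + (b + (2 + 7)))
  eq = solve-∀

arith-222 : ∀ a b c → a + b + c ≤ a + (c + b)
arith-222 a b c  = lin 0 (z≤n {0}) (eq a b c)
  where
  eq : ∀ a b c → a + b + c + 0 + 0 ≡ a + (c + b) + 0
  eq = solve-∀

arith-223 : ∀ a b c d e f g h → a + b + 10 + (c + (d + e)) ≤ f → g ≡ c + h → h ≤ e → a + 10 + (g + d) ≤ f
arith-223 a b c d e f g h h0 refl h2 = lin b (h0 ⊕ h2) (eq a b c d e f h)
  where
  eq : ∀ a b c d e f h → a + 10 + ((c + h) + d) + (f + e) + b ≡ f + ((a + b + 10 + (c + (d + e))) + h)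
  eq = solve-∀

arith-224 : ∀ a b c → a + c + b ≤ a + b + c
arith-224 a b c  = lin 0 (z≤n {0}) (eq a b c)
  where
  eq : ∀ a b c → a + c + b + 0 + 0 ≡ a + b + c + 0
  eq = solve-∀

arith-225 : ∀ a b c d e f g h i → a + b + 10 + (c + (d + e)) ≤ f → g ≡ c + h → h ≤ i → i ≡ a → b + 10 + (g + e) ≤ f
arith-225 a b c d e f g h i h0 refl h2 refl = lin d (h0 ⊕ h2) (eq a b c d e f h)
  where
  eq : ∀ a b c d e f h → b + 10 + ((c + h) + e) + (f + a) + d ≡ f + ((a + b + 10 + (c + (d + e))) + h)
  eq = solve-∀

arith-226 : ∀ a b c d → d ≡ b + c → a + d ≤ a + b + c
arith-226 a b c d refl = lin 0 (z≤n {0}) (eq a b c)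
  where
  eq : ∀ a b c → a + (b + c) + 0 + 0 ≡ a + b + c + 0
  eq = solve-∀

arith-227 : ∀ a b c d e → a + b + c + d ≤ 0 + e → b + (a + c + d) ≤ e
arith-227 a b c d e h0 = lin 0 h0 (eq a b c d e)
  where
  eq : ∀ a b c d e → b + (a + c + d) + (0 + e) + 0 ≡ e + (a + b + c + d)
  eq = solve-∀

arith-228 : ∀ a b c d e f g → b + d + (a + c + f) ≤ g → e ≡ c + d → f + a + b + e ≤ g
arith-228 a b c d e f g h0 refl = lin 0 h0 (eq a b c d f g)
  where
  eq : ∀ a b c d f g → f + a + b + (c + d) + g + 0 ≡ g + (b + d + (a + c + f))
  eq = solve-∀

arith-229 : ∀ a b c d e f g h i j k l m n → d ≤ 1 + e + f → i ≡ g + h → n ≡ l + m → e + j + g ≡ b → f + h ≡ j → k + l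
    ≤ 0 + c → m ≤ k → b + c + 11 ≤ a → i + 10 + (d + n) ≤ a
arith-229 a b c d e f g h i j k l m n h0 refl refl refl refl h5 h6 h7 = lin 0 (h0 ⊕ (h5 ⊕ (h6 ⊕ h7))) (eq a c d e f g
    h k l m)
  where
  eq : ∀ a c d e f g h k l m → (g + h) + 10 + (d + (l + m)) + ((1 + e + f) + ((0 + c) + (k + a))) + 0 ≡ a +
      (d + ((k + l) + (m + ((e + (f + h) + g) + c + 11))))
  eq = solve-∀

arith-230 : ∀ a b c d → 12 * c + (b + a) + 1 ≤ d → a + (6 * c + (1 + (6 * c + (b + 0)))) ≤ d
arith-230 a b c d h0 = lin 0 h0 (eq a b c d)
  where
  eq : ∀ a b c d → a + (6 * c + (1 + (6 * c + (b + 0)))) + d + 0 ≡ d + (12 * c + (b + a) + 1)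
  eq = solve-∀

arith-231 : ∀ a b c d e f g → a ≡ b + e → b ≡ c + d → c ≤ 1 → d ≤ f → e ≤ g → a ≤ 1 + f + g
arith-231 a b c d e f g refl refl h2 h3 h4 = lin 0 (h2 ⊕ (h3 ⊕ h4)) (eq c d e f g)
  where
  eq : ∀ c d e f g → (c + d) + e + (1 + (f + g)) + 0 ≡ 1 + f + g + (c + (d + e))
  eq = solve-∀

arith-232 : ∀ a b c d e f g h → b ≡ c + e + g → e ≡ d + h → f ≡ g + h → a + b ≤ a + c + d + f
arith-232 a b c d e f g h refl refl refl = lin 0 (z≤n {0}) (eq a c d g h)
  where
  eq : ∀ a c d g h → a + (c + (d + h) + g) + 0 + 0 ≡ a + c + d + (g + h) + 0
  eq = solve-∀

arith-233 : ∀ a b c d e f → a ≡ b + (c + 0) → b + e ≡ f + d → a + e ≡ d + f + c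
arith-233 a b c d e f refl h1 = linE h1 (eq b c d e f)
  where
  eq : ∀ b c d e f → (b + (c + 0)) + e + (f + d) ≡ d + f + c + (b + e)
  eq = solve-∀

arith-234 : ∀ a b c → a + (b + c) ≡ a + (b + 0) + c
arith-234 = solve-∀

arith-235 : ∀ a b c d e → a ≡ b + (c + d) → e ≡ b + (c + 0) → a ≡ e + d
arith-235 a b c d e refl refl = eq b c d
  where
  eq : ∀ b c d → b + (c + d) ≡ (b + (c + 0)) + d
  eq = solve-∀

arith-236 : ∀ a b c d e f g h i j → a ≡ b + (c + f) → f ≡ d + e → d ≡ g → h + i ≡ g + c → j ≡ b + (i + h) → a ≡ j + e
arith-236 a b c d e f g h i j refl refl refl h3 refl = linE (sym h3) (eq b c e g h i)
  where
  eq : ∀ b c e g h i → b + (c + (g + e)) + (h + i) ≡ (b + (i + h)) + e + (g + c)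
  eq = solve-∀

arith-237 : ∀ a b c d e f g → a ≡ b + c → b ≡ d + 0 + e → c ≡ f → g ≡ e + f → a ≡ d + g
arith-237 a b c d e f g refl refl refl refl = eq d e f
  where
  eq : ∀ d e f → (d + 0 + e) + f ≡ d + (e + f)
  eq = solve-∀

arith-238 : ∀ a b c d e f → a ≡ b + e → b ≡ c + (d + 0) → f ≡ e + 0 → a ≡ c + (d + f)
arith-238 a b c d e f refl refl refl = eq c d e
  where
  eq : ∀ c d e → (c + (d + 0)) + e ≡ c + (d + (e + 0))
  eq = solve-∀

arith-239 : ∀ a b c d e f g h i j k l m n → a ≡ b + c → c ≡ e + d → d ≡ f + g → e ≡ h + 0 + j → f ≡ i + 0 + k → g ≡ l
    → m ≡ j + (i + n) → n ≡ k + l → a ≡ b + (h + m)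
arith-239 a b c d e f g h i j k l m n refl refl refl refl refl refl refl refl = eq b h i j k l
  where
  eq : ∀ b h i j k l → b + ((h + 0 + j) + ((i + 0 + k) + l)) ≡ b + (h + (j + (i + (k + l))))
  eq = solve-∀

arith-240 : ∀ a b c d e f g h i j k l → d ≡ e + f → k ≡ g + h → e ≡ k → f ≡ i + j → j ≡ l → h ≡ 0 → i ≡ 0 → 6 * g ≤ a
    + 6 → 6 * l ≤ c + 6 → 6 * d ≤ a + 6 + b + c + 6
arith-240 a b c d e f g h i j k l refl refl refl refl refl refl refl h7 h8 = lin b (h7 ⊕ h8) (eq a b c g l)
  where
  eq : ∀ a b c g l → 6 * ((g + 0) + (0 + l)) + ((a + 6) + (c + 6)) + b ≡ a + 6 + b + c + 6 + ((6 * g) + (6 * l))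
  eq = solve-∀

arith-241 : ∀ a b c d e → a ≡ b + c → b ≡ 0 → 6 * c ≤ e + 6 → e ≤ d → 6 * a ≤ d + 6
arith-241 a b c d e refl refl h2 h3 = lin 0 (h2 ⊕ h3) (eq c d e)
  where
  eq : ∀ c d e → 6 * (0 + c) + ((e + 6) + d) + 0 ≡ d + 6 + ((6 * c) + e)
  eq = solve-∀

arith-242 : ∀ a b c d e f g h i j → a + b + 8 * c ≡ d + 8 * (c * c) → 12 * e + d ≤ f + 55 * g + 183 * h → g ≤ 2 + i →
    h + 2 ≤ 2 + i → 1 + f + 144 * ((2 + i) * (2 + i)) + 124 ≤ j + 280 * (2 + i) → c * c + (3 * i + 2) ≤ (3 * i + 2) *
    (3 * i + 2) + c → i ≤ i * i → 12 * e + (a + b) + 1 ≤ j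
arith-242 a b c d e f g h i j h0 h1 h2 h3 h4 h5 h6 = lin (14 + 58 * i * i) ((≤-reflexive h0) ⊕
    (h1 ⊕ ((55 ⊛ h2) ⊕ ((183 ⊛ h3) ⊕ (h4 ⊕ ((8 ⊛ h5) ⊕ (14 ⊛ h6))))))) (eq a b c d e f g h i j)
  where
  eq : ∀ a b c d e f g h i j → 12 * e + (a + b) + 1 + ((d + 8 * (c * c)) + ((f + 55 * g + 183 * h) + (55 * (2 + i) +
      (183 * (2 + i) + ((j + 280 * (2 + i)) + (8 * ((3 * i + 2) * (3 * i + 2) + c) + 14 * (i * i))))))) +
      (14 + 58 * i * i) ≡ j + ((a + b + 8 * c) + ((12 * e + d) +
      (55 * g + (183 * (h + 2) + ((1 + f + 144 * ((2 + i) * (2 + i)) + 124) + (8 * (c * c + (3 * i + 2)) + 14 *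
      i))))))
  eq = solve-∀

arith-243 : ∀ a b c d e f g → b ≡ c → c ≡ d → d ≡ e + f → f ≡ g → e ≡ 0 → 6 * g ≤ a + 6 → 2 * b < 3 + a
arith-243 a b c d e f g refl refl refl refl refl h5 = linG 2 (2 + 2 * a) h5 (eq a g)
  where
  eq : ∀ a g → 3 * (1 + (2 * (0 + g))) + (a + 6) + (2 + 2 * a) ≡ 3 * (3 + a) + (6 * g) + 2
  eq = solve-∀

arith-244 : ∀ a b c d e f → a ≤ b + c + 2 * e → b ≡ 0 → 6 * c ≤ 6 * f + 6 → d + 2 * a ≤ d + 4 * e + 2 + 6 * f
arith-244 a b c d e f h0 refl h2 = linG 2 (2 + 12 * f) ((6 ⊛ h0) ⊕ h2) (eq a c d e f)
  where
  eq : ∀ a c d e f → 3 * (d + 2 * a) + (6 * (0 + c + 2 * e) + (6 * f + 6)) + (2 + 12 * f) ≡ 3 * (d + 4 * e + 2 + 6 *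
      f) + (6 * a + (6 * c)) + 2
  eq = solve-∀

arith-245 : ∀ a b c d e f → a ≤ b + c + 2 * d → 6 * b ≤ e + 6 → 6 * c ≤ f + 6 → 6 * a + 5 ≤ e + (12 * d + 17) + f
arith-245 a b c d e f h0 h1 h2 = lin 0 ((6 ⊛ h0) ⊕ (h1 ⊕ h2)) (eq a b c d e f)
  where
  eq : ∀ a b c d e f → 6 * a + 5 + (6 * (b + c + 2 * d) + ((e + 6) + (f + 6))) + 0 ≡ e + (12 * d + 17) + f +
      (6 * a + ((6 * b) + (6 * c)))
  eq = solve-∀

arith-246 : ∀ a b c d e f → a ≤ c + b + 2 * e → b ≡ 0 → 6 * c ≤ 6 * f + 6 → d + 2 * a ≤ 6 * f + (d + 4 * e + 2)
arith-246 a b c d e f h0 refl h2 = linG 2 (2 + 12 * f) ((6 ⊛ h0) ⊕ h2) (eq a c d e f)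
  where
  eq : ∀ a c d e f → 3 * (d + 2 * a) + (6 * (c + 0 + 2 * e) + (6 * f + 6)) + (2 + 12 * f) ≡ 3 *
      (6 * f + (d + 4 * e + 2)) + (6 * a + (6 * c)) + 2
  eq = solve-∀

arith-247 : ∀ a b c d e f → a ≤ c + b + 2 * d → 6 * b ≤ e + 6 → 6 * c ≤ f + 6 → 6 * a + 5 ≤ f + (12 * d + 17 + e)
arith-247 a b c d e f h0 h1 h2 = lin 0 ((6 ⊛ h0) ⊕ (h1 ⊕ h2)) (eq a b c d e f)
  where
  eq : ∀ a b c d e f → 6 * a + 5 + (6 * (c + b + 2 * d) + ((e + 6) + (f + 6))) + 0 ≡ f + (12 * d + 17 + e) +
      (6 * a + ((6 * b) + (6 * c)))
  eq = solve-∀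


-- Sums over intervals and occurrence counts

bit : Bool → ℕ
bit true  = 1
bit false = 0

bit≤1 : ∀ b → bit b ≤ 1
bit≤1 true  = s≤s z≤n
bit≤1 false = z≤n

∑ : (ℕ → ℕ) → ℕ → ℕ → ℕ
∑ f a zero    = 0
∑ f a (suc w) = f a + ∑ f (suc a) w

∑-mono : ∀ {f g} a w → (∀ v → a ≤ v → v < a + w → f v ≤ g v) → ∑ f a w ≤ ∑ g a w
∑-mono a zero h = z≤n
∑-mono a (suc w) h = +-mono-≤ (h a ≤-refl (m<m+n a z<s))
  (∑-mono (suc a) w λ v p q → h v (<⇒≤ p) (subst (v <_) (sym (+-suc a w)) q))

∑-cong : ∀ {f g} a w → (∀ v → f v ≡ g v) → ∑ f a w ≡ ∑ g a w
∑-cong a zero h = refl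
∑-cong a (suc w) h = cong₂ _+_ (h a) (∑-cong (suc a) w h)

∑-+ : ∀ f g a w → ∑ (λ v → f v + g v) a w ≡ ∑ f a w + ∑ g a w
∑-+ f g a zero = refl
∑-+ f g a (suc w) = arith-1 (f a) (g a) (∑ f (suc a) w) (∑ g (suc a) w) (∑ (λ v → f v + g v) (suc a) w)
    (∑-+ f g (suc a) w)

∑-split : ∀ f a v w → ∑ f a (v + w) ≡ ∑ f a v + ∑ f (a + v) w
∑-split f a zero w = cong (λ z → ∑ f z w) (sym (+-identityʳ a))
∑-split f a (suc v) w = trans (cong (f a +_) (trans (∑-split f (suc a) v w)
  (cong (λ z → ∑ f (suc a) v + ∑ f z w) (sym (+-suc a v))))) (sym (+-assoc (f a) _ _))

∑-snoc : ∀ f a w → ∑ f a (suc w) ≡ ∑ f a w + f (a + w)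
∑-snoc f a w = trans (cong (∑ f a) (+-comm 1 w)) (trans (∑-split f a w 1) (cong (∑ f a w +_) (+-identityʳ _)))

∑-shift : ∀ f a b w → ∑ (λ v → f (a + v)) b w ≡ ∑ f (a + b) w
∑-shift f a b zero = refl
∑-shift f a b (suc w) = cong (f (a + b) +_) (trans (∑-shift f a (suc b) w) (cong (λ z → ∑ f z w) (+-suc a b)))

∑-zero : ∀ {f} a w → (∀ v → a ≤ v → v < a + w → f v ≡ 0) → ∑ f a w ≡ 0
∑-zero a zero h = refl
∑-zero a (suc w) h = cong₂ _+_ (h a ≤-refl (m<m+n a z<s))
  (∑-zero (suc a) w λ v p q → h v (<⇒≤ p) (subst (v <_) (sym (+-suc a w)) q))

∑-sub : ∀ f {a w b v} → a ≤ b → b + v ≤ a + w → ∑ f b v ≤ ∑ f a w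
∑-sub f {a} {w} {b} {v} a≤b h with m≤n⇒∃[o]m+o≡n a≤b
... | k , refl with m≤n⇒∃[o]m+o≡n (+-cancelˡ-≤ a (k + v) w (subst (_≤ a + w) (+-assoc a k v) h))
... | l , refl = arith-2 (∑ f (a + k) v) (∑ f a (k + v + l)) (∑ f a (k + v)) (∑ f a k) (∑ f (a + (k + v)) l)
    (∑-split f a (k + v) l) (∑-split f a k v)

∸-step : ∀ x w → w < x → x ∸ w ≡ suc (x ∸ suc w)
∸-step (suc x) zero    p       = refl
∸-step (suc x) (suc w) (s≤s p) = ∸-step x w p

-- Turns a search running leftwards from `x` into a sum over an ordinary interval, so that `near`
-- and `greedy` serve both directions.
∑-back : ∀ f x w → w ≤ x → ∑ (λ d → f (x ∸ suc d)) 0 w ≡ ∑ f (x ∸ w) w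
∑-back f x zero p = refl
∑-back f (suc x) (suc w) (s≤s p) = trans (∑-snoc (λ d → f (x ∸ d)) 0 w)
  (trans (cong (_+ f (x ∸ w)) (lem w p)) (+-comm (∑ f (suc (x ∸ w)) w) (f (x ∸ w))))
  where
  lem : ∀ w → w ≤ x → ∑ (λ d → f (x ∸ d)) 0 w ≡ ∑ f (suc (x ∸ w)) w
  lem zero q = refl
  lem (suc w) q = trans (∑-snoc (λ d → f (x ∸ d)) 0 w) (trans (cong (_+ f (x ∸ w)) (lem w (<⇒≤ q)))
    (trans (+-comm _ (f (x ∸ w))) (subst (λ z → f z + ∑ f (suc z) w ≡ ∑ f (suc (x ∸ suc w)) (suc w))
        (sym (∸-step x w q)) refl)))

δ : ℕ → ℕ → ℕ
δ x v = bit (does (x ≟ v))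

δ-refl : ∀ x → δ x x ≡ 1
δ-refl x = cong bit (dec-true (x ≟ x) refl)

δ-≢ : ∀ {x v} → x ≢ v → δ x v ≡ 0
δ-≢ {x} {v} n = cong bit (dec-false (x ≟ v) n)

δ≤1 : ∀ x v → δ x v ≤ 1
δ≤1 x v = bit≤1 _

∑δ≤1 : ∀ x a w → ∑ (δ x) a w ≤ 1
∑δ≤1 x a zero = z≤n
∑δ≤1 x a (suc w) with x ≟ a
... | no n = subst (λ z → z + ∑ (δ x) (suc a) w ≤ 1) (sym (δ-≢ n)) (∑δ≤1 x (suc a) w)
... | yes refl = ≤-reflexive (cong₂ _+_ (δ-refl x) (∑-zero (suc x) w λ v p q → δ-≢ {x} {v} λ q′ → <-irrefl q′ p))

-- Lists of vertices are compared through these multiplicities only: that several lists are disjoint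
-- and free of repetitions says that their `occ` add up to at most 1 everywhere, and the linear
-- arithmetic above can work with it.
occ : List ℕ → ℕ → ℕ
occ [] v = 0
occ (x ∷ xs) v = δ x v + occ xs v

occ-++ : ∀ xs ys v → occ (xs ++ ys) v ≡ occ xs v + occ ys v
occ-++ [] ys v = refl
occ-++ (x ∷ xs) ys v = trans (cong (δ x v +_) (occ-++ xs ys v)) (sym (+-assoc (δ x v) _ _))

-- Search along an interval

bool? : (b : Bool) → (b ≡ true) ⊎ (b ≡ false)
bool? true  = inj₁ refl
bool? false = inj₂ refl

search : ∀ {P : ℕ → Set} → (∀ v → Dec (P v)) → ∀ a w → Dec (∃ λ v → a ≤ v × v < a + w × P v)
search P? a zero = no λ (v , p , q , _) → <-irrefl refl (<-≤-trans q (≤-trans (≤-reflexive (+-identityʳ a)) p))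
search {P} P? a (suc w) with P? a | search P? (suc a) w
... | yes p | _ = yes (a , ≤-refl , m<m+n a z<s , p)
... | no _ | yes (v , p , q , r) = yes (v , <⇒≤ p , subst (v <_) (sym (+-suc a w)) q , r)
... | no ¬p | no ¬q = no λ (v , p , q , r) → ¬q (v , ≤∧≢⇒< p (λ { refl → ¬p r }) , subst (v <_) (+-suc a w) q , r)

∑-single : ∀ (f : ℕ → Bool) a w → (∀ v v′ → a ≤ v → v < v′ → v′ < a + w → f v ≡ true → f v′ ≡ true → ⊥) →
  ∑ (λ v → bit (f v)) a w ≤ 1
∑-single f a zero h = z≤n
∑-single f a (suc w) h with f a in eq
... | true = ≤-reflexive (cong suc (∑-zero (suc a) w λ v p q → lem v p q (bool? (f v))))
  where
  lem : ∀ v → suc a ≤ v → v < suc a + w → (f v ≡ true) ⊎ (f v ≡ false) → bit (f v) ≡ 0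
  lem v p q (inj₁ t) = ⊥-elim (h a v ≤-refl p (subst (v <_) (sym (+-suc a w)) q) eq t)
  lem v p q (inj₂ t) = cong bit t
... | false = ∑-single f (suc a) w λ v v′ p q r → h v v′ (<⇒≤ p) q (subst (v′ <_) (sym (+-suc a w)) r)

-- The search stops at the first neighbour that is free. All neighbours passed before are occupied,
-- so their number is at most that of the occupied positions, and by `half` the distance covered is
-- at most twice the latter.
near : ∀ (e : ℕ → Bool) (u : ℕ → ℕ) W → (∀ w → w ≤ W → w ≤ 2 * ∑ (λ v → bit (e v)) 0 w) → 2 * ∑ u 0 W < W →
  ∃ λ d → d < W × e d ≡ true × u d ≡ 0 × d ≤ 2 * ∑ u 0 d
near e u W half free = go W 0 refl z≤n
  where
  E : ℕ → ℕ
  E v = bit (e v)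
  go : ∀ k d → d + k ≡ W → ∑ E 0 d ≤ ∑ u 0 d → ∃ λ d → d < W × e d ≡ true × u d ≡ 0 × d ≤ 2 * ∑ u 0 d
  go zero d eq le = ⊥-elim (arith-3 d W (∑ E 0 W) (∑ u 0 W) (trans (sym (+-identityʳ d)) eq) (half W ≤-refl) free
      (subst (λ z → ∑ E 0 z ≤ ∑ u 0 z) (trans (sym (+-identityʳ d)) eq) le))
  go (suc k) d eq le = attempt (e d) (u d) refl refl
    where
    d<W : d < W
    d<W = subst (d <_) eq (m<m+n d z<s)
    next : E d ≤ u d → ∃ λ d → d < W × e d ≡ true × u d ≡ 0 × d ≤ 2 * ∑ u 0 d
    next q = go k (suc d) (trans (sym (+-suc d k)) eq)
      (subst₂ _≤_ (sym (∑-snoc E 0 d)) (sym (∑-snoc u 0 d)) (+-mono-≤ le q))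
    attempt : ∀ b n → e d ≡ b → u d ≡ n → ∃ λ d → d < W × e d ≡ true × u d ≡ 0 × d ≤ 2 * ∑ u 0 d
    attempt true zero p q = d , d<W , p , q , ≤-trans (half d (<⇒≤ d<W)) (*-monoʳ-≤ 2 le)
    attempt true (suc n) p q = next (≤-trans (bit≤1 _) (subst (1 ≤_) (sym q) (s≤s z≤n)))
    attempt false n p q = next (subst (λ b → bit b ≤ u d) (sym p) z≤n)

data Greedy (e : ℕ → ℕ → Bool) (u : ℕ → ℕ) : ℕ → List ℕ → ℕ → Set where
  []   : ∀ {i} → Greedy e u i [] i
  cons : ∀ {i j js l} → i < j → e i j ≡ true → u j ≡ 0 → Greedy e u j js l → Greedy e u i (j ∷ js) l

-- A skipped fresh vertex is not an out-neighbour, so in each step half of the skipped positions are occupied.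
greedy : ∀ (e : ℕ → ℕ → Bool) (u : ℕ → ℕ) B →
  (∀ i w → i + w ≤ B → w ≤ 2 * ∑ (λ v → bit (e i v)) (suc i) w) →
  ∀ c i W → i + W ≤ B → c + 2 * ∑ u (suc i) W ≤ W →
  ∃ λ js → ∃ λ l → length js ≡ c × Greedy e u i js l × l ≤ i + W
greedy e u B half zero i W b h = [] , i , refl , [] , m≤m+n i W
greedy e u B half (suc c) i W b h
  with near (λ d → e i (suc i + d)) (λ d → u (suc i + d)) W
         (λ w q → subst (λ z → w ≤ 2 * z) (sym (reindex (λ v → bit (e i v)) w)) (half i w (≤-trans (+-monoʳ-≤ i q)
             b)))
         (≤-trans (s≤s (≤-trans (≤-reflexive (cong (2 *_) (reindex u W))) (m≤n+m _ c))) h)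
  where
  reindex : ∀ f w → ∑ (λ d → f (suc i + d)) 0 w ≡ ∑ f (suc i) w
  reindex f w = trans (∑-shift f (suc i) 0 w) (cong (λ z → ∑ f z w) (+-identityʳ (suc i)))
... | d , d<W , p , q , r with m≤n⇒∃[o]m+o≡n d<W
... | W′ , refl = extend (greedy e u B half c (suc i + d) W′
        (arith-4 i d (W′) B b) key)
  where
  key : c + 2 * ∑ u (suc (suc i + d)) W′ ≤ W′
  key = arith-5 c d (W′) (∑ u (suc i) d) (∑ u (suc (suc i + d)) W′) (∑ u (suc i) (suc d + W′)) (∑ u (suc i) (suc d))
      (u (suc i + d)) (∑ (λ d → u (suc i + d)) 0 d) h (trans (∑-split u (suc i) (suc d) W′)
      (cong (λ z → S′ + ∑ u z W′) (+-suc (suc i) d))) (∑-snoc u (suc i) d) q r (trans (∑-shift u (suc i) 0 d)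
      (cong (λ z → ∑ u z d) (+-identityʳ (suc i))))
    where
    S′ : ℕ
    S′ = ∑ u (suc i) (suc d)
  extend : (∃ λ js → ∃ λ l → length js ≡ c × Greedy e u (suc i + d) js l × l ≤ suc i + d + W′) →
    ∃ λ js → ∃ λ l → length js ≡ suc c × Greedy e u i js l × l ≤ i + suc (d + W′)
  extend (js , l , len , g , le) = suc i + d ∷ js , l , cong suc len , cons (s≤s (m≤m+n i d)) p q g ,
    (arith-6 l i d (W′) le)

-- Tournaments in a locally median order and the jump of three arcs

data Path (arc : Bool → ℕ → ℕ → Set) : List Bool → ℕ → List ℕ → ℕ → Set where
  []  : ∀ {x} → Path arc [] x [] x
  _∷_ : ∀ {b bs x y ys z} → arc b x y → Path arc bs y ys z → Path arc (b ∷ bs) x (y ∷ ys) z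

-- The vertices are all natural numbers, so that neither half condition has a boundary case. That
-- only vertices below the order of the given tournament are used is enforced later, by `Cap`.
record Tour : Set where
  field
    R      : ℕ → ℕ → Bool
    irr    : ∀ i → R i i ≡ false
    tot    : ∀ {i j} → i ≢ j → R i j ≡ not (R j i)
    halfR  : ∀ x w → w ≤ 2 * ∑ (λ v → bit (R x v)) (suc x) w
    halfL  : ∀ x w → w ≤ 2 * ∑ (λ v → bit (R v (x + w))) x w

  Arc : Bool → ℕ → ℕ → Set
  Arc true  x y = R x y ≡ true
  Arc false x y = R y x ≡ true

  halfL′ : ∀ x w → w ≤ x → w ≤ 2 * ∑ (λ d → bit (R (x ∸ suc d) x)) 0 w
  halfL′ x w p = subst (λ z → w ≤ 2 * z)
    (trans (cong (λ y → ∑ (λ v → bit (R v y)) (x ∸ w) w) (m∸n+n≡m p)) (sym (∑-back (λ v → bit (R v x)) x w p)))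
    (halfL (x ∸ w) w)

  -- If no arc goes from A to B, then each gap between consecutive elements of A ∪ {lo}
  -- contains at least as many elements of neither set as elements of B.
  jump : ∀ lo s (u : ℕ → ℕ) → 6 * ∑ u (suc lo) s + 5 ≤ s →
    ∃ λ a → ∃ λ b → lo < a × a < suc lo + s × lo < b × b < suc lo + s × u a ≡ 0 × u b ≡ 0 ×
      R lo a ≡ true × R a b ≡ true × R b (suc lo + s) ≡ true
  jump lo s u big with search (λ a → inner? a) (suc lo) s
    where
    hi = suc lo + s
    Mid : ℕ → ℕ → Set
    Mid a b = u b ≡ 0 × R a b ≡ true × R b hi ≡ true
    mid? : ∀ a b → Dec (Mid a b)
    mid? a b with u b ≟ 0 | R a b Data.Bool.≟ true | R b hi Data.Bool.≟ true
      where import Data.Bool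
    ... | yes p | yes q | yes r = yes (p , q , r)
    ... | no n | _ | _ = no (n ∘ proj₁)
    ... | _ | no n | _ = no (n ∘ proj₁ ∘ proj₂)
    ... | _ | _ | no n = no (n ∘ proj₂ ∘ proj₂)
    Outer : ℕ → Set
    Outer a = u a ≡ 0 × R lo a ≡ true × ∃ λ b → suc lo ≤ b × b < suc lo + s × Mid a b
    inner? : ∀ a → Dec (Outer a)
    inner? a with u a ≟ 0 | R lo a Data.Bool.≟ true | search (mid? a) (suc lo) s
      where import Data.Bool
    ... | yes p | yes q | yes r = yes (p , q , r)
    ... | no n | _ | _ = no (n ∘ proj₁)
    ... | _ | no n | _ = no (n ∘ proj₁ ∘ proj₂)
    ... | _ | _ | no n = no (n ∘ proj₂ ∘ proj₂)
  ... | yes (a , p , q , f , r , b , p′ , q′ , f′ , r′ , r″) = a , b , p , q , p′ , q′ , f , f′ , r , r′ , r″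
  ... | no none = ⊥-elim contra
    where
    hi = suc lo + s
    free : ℕ → Bool
    free v = u v ≡ᵇ 0
    inA inB onlyB other both : ℕ → Bool
    inA v = free v ∧ R lo v
    inB v = free v ∧ R v hi
    onlyB v = inB v ∧ not (inA v)
    both v = inA v ∧ inB v
    other v = not (inA v) ∧ not (inB v)
    ∧-true : ∀ {a b} → a ∧ b ≡ true → a ≡ true × b ≡ true
    ∧-true {true} {true} p = refl , refl
    free⇒ : ∀ {v} → free v ≡ true → u v ≡ 0
    free⇒ {v} p = ≡ᵇ⇒≡ (u v) 0 (subst T (sym p) _)
      where open import Data.Bool using (T)
    noarc : ∀ a b → lo < a → a < hi → lo < b → b < hi → inA a ≡ true → inB b ≡ true → R a b ≡ false
    noarc a b p q p′ q′ A B with R a b in eq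
    ... | false = refl
    ... | true = ⊥-elim (none (a , p , q , free⇒ (proj₁ (∧-true A)) , proj₂ (∧-true {free a} A) ,
        b , p′ , q′ , free⇒ (proj₁ (∧-true B)) , eq , proj₂ (∧-true {free b} B)))
    partition : ∀ v → bit (inA v) + bit (onlyB v) + bit (other v) ≡ 1
    partition v with inA v | inB v
    ... | true | true = refl
    ... | true | false = refl
    ... | false | true = refl
    ... | false | false = refl
    count : ∀ a w → ∑ (λ v → bit (inA v)) a w + ∑ (λ v → bit (onlyB v)) a w + ∑ (λ v → bit (other v)) a w ≡ w
    count a zero = refl
    count a (suc w) = arith-7 (bit (inA a)) (bit (onlyB a)) (bit (other a)) (∑ (λ v → bit (inA v)) (suc a) w)
        (∑ (λ v → bit (onlyB v)) (suc a) w) (∑ (λ v → bit (other v)) (suc a) w) w (partition a) (count (suc a) w)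
    -- The out-neighbours of `a` make up at least half of the gap, and none of them is in B: the arc
    -- from `a` would go from A to B, or, when `a` is `lo`, it would put its end into A.
    gap : ∀ a w → lo ≤ a → a + w < hi → (a ≡ lo ⊎ inA a ≡ true) →
      (∀ v → a < v → v < suc a + w → inA v ≡ false) →
      ∑ (λ v → bit (onlyB v)) (suc a) w ≤ ∑ (λ v → bit (other v)) (suc a) w
    gap a w lo≤a a<hi start noA = arith-8 (∑ (λ v → bit (inA v)) (suc a) w) (∑ (λ v → bit (onlyB v)) (suc a) w)
        (∑ (λ v → bit (other v)) (suc a) w) (∑ (λ v → bit (R a v)) (suc a) w) w (count (suc a) w) (∑-zero (suc a) w
        (λ v p q → cong bit (noA v p q))) (halfR a w) (∑-mono (suc a) w below)
      where
      below : ∀ v → suc a ≤ v → v < suc a + w → bit (R a v) ≤ bit (other v)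
      below v p q with R a v in eq | inA v in eqA | inB v in eqB
      ... | false | _ | _ = z≤n
      ... | true | false | false = ≤-refl
      ... | true | true | _ = ⊥-elim (false≢true (trans (sym (noA v p q)) eqA))
        where
        false≢true : false ≡ true → ⊥
        false≢true ()
      ... | true | false | true = ⊥-elim (clash start)
        where
        false≢true : false ≡ true → ⊥
        false≢true ()
        clash : (a ≡ lo ⊎ inA a ≡ true) → ⊥
        clash (inj₁ refl) = false≢true (trans (sym eqA) (cong₂ _∧_ (proj₁ (∧-true eqB)) eq))
        clash (inj₂ A) with a ≟ lo
        ... | yes refl = clash (inj₁ refl)
        ... | no n = false≢true (trans (sym (noarc a v (≤∧≢⇒< lo≤a (n ∘ sym)) (≤-<-trans (m≤m+n a w) a<hi)
                (≤-<-trans lo≤a p) (<-≤-trans q a<hi) A eqB)) eq)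
    -- The scanned interval ends in an unfinished gap: `lo + k` is the last element of A met so far,
    -- or `lo`, and the `l` positions after it avoid A.
    record Scan (w : ℕ) : Set where
      pattern
      field
        k l   : ℕ
        k+l   : k + l ≡ w
        done  : ∑ (λ v → bit (onlyB v)) (suc lo) k ≤ ∑ (λ v → bit (other v)) (suc lo) k
        start : lo + k ≡ lo ⊎ inA (lo + k) ≡ true
        noA   : ∀ v → lo + k < v → v < suc (lo + k) + l → inA v ≡ false
    finish : ∀ {w} → w ≤ s → Scan w →
      ∑ (λ v → bit (onlyB v)) (suc lo) w ≤ ∑ (λ v → bit (other v)) (suc lo) w
    finish w≤s record { k = k ; l = l ; k+l = refl ; done = done ; start = start ; noA = noA } =
      subst₂ _≤_ (sym (∑-split _ (suc lo) k l)) (sym (∑-split _ (suc lo) k l))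
        (+-mono-≤ done (gap (lo + k) l (m≤m+n lo k)
          (arith-9 lo k l s w≤s) start noA))
    scan : ∀ w → w ≤ s → Scan w
    scan zero p = record { k = 0 ; l = 0 ; k+l = refl ; done = z≤n ; start = inj₁ (+-identityʳ lo)
      ; noA = λ v q r → ⊥-elim (<-irrefl refl (<-≤-trans r (≤-trans (≤-reflexive (+-identityʳ _)) q))) }
    scan (suc w) p with scan w (<⇒≤ p) | inA (suc lo + w) in eq
    ... | S | true = record { k = suc w ; l = 0 ; k+l = +-identityʳ _
      ; done = subst₂ _≤_ (sym (∑-snoc _ (suc lo) w)) (sym (∑-snoc _ (suc lo) w))
          (+-mono-≤ (finish (<⇒≤ p) S) (subst (λ z → bit z ≤ bit (other (suc lo + w))) (sym onlyB≡) z≤n))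
      ; start = inj₂ (trans (cong inA (+-suc lo w)) eq)
      ; noA = λ v q r → ⊥-elim (<-irrefl refl (<-≤-trans r (≤-trans (≤-reflexive (+-identityʳ _)) q))) }
      where
      onlyB≡ : onlyB (suc lo + w) ≡ false
      onlyB≡ rewrite eq = lem (inB (suc lo + w))
        where
        lem : ∀ b → b ∧ false ≡ false
        lem true = refl
        lem false = refl
    ... | S | false = record { k = k ; l = suc l ; k+l = trans (+-suc k l) (cong suc k+l) ; done = done ; start =
        start
      ; noA = λ v q r → ext v q (≤-trans r (≤-reflexive (+-suc (suc (lo + k)) l))) }
      where
      open Scan S
      ext : ∀ v → lo + k < v → v < suc (suc (lo + k) + l) → inA v ≡ false
      ext v q r with v ≟ suc (lo + k) + l
      ... | yes refl = subst (λ z → inA z ≡ false) (cong suc (trans (cong (lo +_) (sym k+l)) (sym (+-assoc lo k l))))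
          eq
      ... | no n = noA v q (≤∧≢⇒< (≤-pred r) n)
    -- Of two vertices in both sets one dominates the other, and this arc would go from A to B.
    both≤1 : ∑ (λ v → bit (both v)) (suc lo) s ≤ 1
    both≤1 = ∑-single both (suc lo) s λ v v′ p q r f g → lem v v′ p q r (∧-true f) (∧-true g)
      where
      lem : ∀ v v′ → lo < v → v < v′ → v′ < hi → inA v ≡ true × inB v ≡ true → inA v′ ≡ true × inB v′ ≡ true → ⊥
      lem v v′ p q r (A , B) (A′ , B′) with trans (sym (noarc v v′ p (<-trans q r) (<-trans p q) r A B′))
          (trans (tot (<⇒≢ q)) (cong not (noarc v′ v (<-trans p q) r p (<-trans q r) A′ B)))
      ... | ()
    A-large : ∀ v → bit (R lo v) ≤ bit (inA v) + u v
    A-large v with R lo v | u v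
    ... | false | _ = z≤n
    ... | true | zero = ≤-refl
    ... | true | suc n = s≤s z≤n
    B-large : ∀ v → bit (R v hi) ≤ bit (onlyB v) + bit (both v) + u v
    B-large v with R v hi | u v | R lo v
    ... | false | _ | _ = z≤n
    ... | true | zero | false = ≤-refl
    ... | true | zero | true = ≤-refl
    ... | true | suc n | _ = s≤s z≤n
    -- With `U` occupied vertices, A has at least `s / 2 - U` elements, B outside A at least
    -- `s / 2 - U - 1`, and the remainder is no smaller than the latter. The three add up to `s`,
    -- whence `s ≤ 6 * U + 4`; this is the origin of `6` and `5`.
    contra : ⊥
    contra = arith-10 (∑ (λ v → bit (inA v)) (suc lo) s) (∑ (λ v → bit (onlyB v)) (suc lo) s) (∑ (λ v → bit (other v))
        (suc lo) s) (∑ (λ v → bit (both v)) (suc lo) s) (∑ u (suc lo) s) (∑ (λ v → bit (R lo v)) (suc lo) s)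
        (∑ (λ v → bit (R v hi)) (suc lo) s) (∑ (λ v → bit (inA v) + u v) (suc lo) s) (∑ (λ v → bit (onlyB v) + bit
        (both v)) (suc lo) s) (∑ (λ v → bit (onlyB v) + bit (both v) + u v) (suc lo) s) s big (count (suc lo) s)
        both≤1 (finish ≤-refl (scan s ≤-refl)) (halfR lo s) (halfL (suc lo) s) (∑-mono (suc lo) s (λ v _ _ → A-large
        v)) (∑-+ _ u (suc lo) s) (∑-mono (suc lo) s (λ v _ _ → B-large v)) (∑-+ _ u (suc lo) s) (∑-+ _ _ (suc lo) s)

-- Plans, and the pieces they leave to later stages

data Ended : List Bool → Set where
  turn : ∀ b → Ended (b ∷ not b ∷ [])
  _∷_  : ∀ b {bs} → Ended bs → Ended (b ∷ bs)

-- A strategy for embedding a rooted tree below an already placed node.  `far s c P` is a directed path of 3 + c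
-- arcs to a node placed outside everything embedded so far; `leg s b bs` is a path to a leaf with signs
-- s, b, not b, bs; `zed s H P` is a path to a node of P, where H is the description of that path from its far
-- end, up to the arc before the last one, `close s b bs` being the final part of such a description.
data Plan : Set where
  stop  : Plan
  pick  : Bool → Plan → Plan
  both  : Plan → Plan → Plan
  far   : Bool → ℕ → Plan → Plan
  leg   : Bool → Bool → List Bool → Plan
  zed   : Bool → Plan → Plan → Plan
  close : Bool → ∀ b bs → Ended (b ∷ not b ∷ bs) → Plan

-- The number of vertices that the plan takes in the cluster of its origin, reserved neighbours
-- included: two candidates for the start of a path embedded last, seven for the end of a return
-- path. A `far` plan takes none, as it goes on in a cluster of its own. Each vertex costs six
-- positions on either side of the cluster.
cw : Plan → ℕ
cw stop            = 0
cw (pick s P)      = 1 + cw P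
cw (both P Q)      = cw P + cw Q
cw (far s c P)     = 0
cw (leg s b bs)    = 2
cw (zed s H P)     = 7
cw (close s b bs e) = 2

nodes : Plan → ℕ
nodes stop            = 0
nodes (pick s P)      = 1 + nodes P
nodes (both P Q)      = nodes P + nodes Q
nodes (far s c P)     = 3 + c + nodes P
nodes (leg s b bs)    = 3 + length bs
nodes (zed s H P)     = 1 + nodes H + nodes P
nodes (close s b bs e) = 3 + length bs

-- Unlike `cw` this runs through all clusters. It bounds the vertices held in reserve until the end,
-- which the last paths have to avoid.
fanSize : Plan → ℕ
fanSize stop            = 0
fanSize (pick s P)      = fanSize P
fanSize (both P Q)      = fanSize P + fanSize Q
fanSize (far s c P)     = fanSize P
fanSize (leg s b bs)    = 2
fanSize (zed s H P)     = 7 + fanSize H + fanSize P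
fanSize (close s b bs e) = 2

-- The zones to be reserved outside, with their fixed widths, in the order of their creation.
data Token : Set where
  farT : Bool → ℕ → Token
  zedT : ℕ → Token

-- In `far`, the `20` consists of `17 = 6 + 6 + 5` for the jump (the rounding in the densities of
-- two zones, and the constant of `jump`), `2` for rounding in the greedy part, and `1` for the
-- first vertex of the new cluster. In `zed`, the `7` is a gap of six and the vertex shared by the
-- two new clusters.
tokens : Plan → List Token
tokens stop             = []
tokens (pick s P)       = tokens P
tokens (both P Q)       = tokens P ++ tokens Q
tokens (far s c P)      = farT s (c + 12 * cw P + 20) ∷ tokens P
tokens (leg s b bs)     = []
tokens (zed s H P)      = zedT (12 * (cw H + cw P) + 7) ∷ tokens H ++ tokens P
tokens (close s b bs e) = []

-- `Y` is the set reserved for the end of a return path. It travels along the plan of that path to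
-- its `close`, where its size is asked for; side branches receive the empty set.
Fit : List ℕ → Plan → Set
Fit Y stop             = ⊤
Fit Y (pick s P)       = Fit Y P
Fit Y (both P Q)       = Fit Y P × Fit [] Q
Fit Y (far s c P)      = Fit Y P
Fit Y (leg s b bs)     = ⊤
Fit Y (zed s H P)      = (∀ Y′ → length Y′ ≡ 7 → Fit Y′ H) × Fit [] P
Fit Y (close s b bs e) = length Y ≡ 7

data Deferred : Set where
  farD : List ℕ → ℕ → Bool → ℕ → Plan → Deferred
  zedD : List ℕ → Plan → Plan → Deferred

-- `Y` holds the candidates for the first vertex, two of them because the theorem of Havet and
-- Thomassé promises only one origin out of two; `Y′` holds the candidates for the end.
data Final : Set where
  free : List ℕ → Bool → List Bool → Final
  into : List ℕ → ∀ b bs → Ended (b ∷ not b ∷ bs) → List ℕ → Final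

resD : Deferred → List ℕ
resD (farD Y x s c P) = Y
resD (zedD Y H P)     = Y

resF : Final → List ℕ
resF (free Y b bs)      = Y
resF (into Y b bs e Y′) = Y ++ Y′

tokensD : Deferred → List Token
tokensD (farD Y x s c P) = tokens (far s c P)
tokensD (zedD Y H P)     = tokens (zed true H P)

nodesD : Deferred → ℕ
nodesD (farD Y x s c P) = nodes (far s c P)
nodesD (zedD Y H P)     = nodes (zed true H P)

nodesF : Final → ℕ
nodesF (free Y b bs)      = 3 + length bs
nodesF (into Y b bs e Y′) = 3 + length bs

fanD : Deferred → ℕ
fanD (farD Y x s c P) = length Y + fanSize P
fanD (zedD Y H P)     = length Y + (fanSize H + fanSize P)

FitD : Deferred → Set
FitD (farD Y x s c P) = Fit Y P
FitD (zedD Y H P)     = Fit Y H × Fit [] P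

FitF : Final → Set
FitF (free Y b bs)      = length Y ≡ 2
FitF (into Y b bs e Y′) = length Y ≡ 2 × length Y′ ≡ 7

total : ∀ {A : Set} → (A → ℕ) → List A → ℕ
total f []       = 0
total f (x ∷ xs) = f x + total f xs

total-++ : ∀ {A : Set} (f : A → ℕ) xs ys → total f (xs ++ ys) ≡ total f xs + total f ys
total-++ f [] ys = refl
total-++ f (x ∷ xs) ys = trans (cong (f x +_) (total-++ f xs ys)) (sym (+-assoc (f x) _ _))

data Each {A : Set} (r : A → List ℕ → Set) : List A → List ℕ → Set where
  []  : Each r [] []
  _∷_ : ∀ {a as vs ws} → r a vs → Each r as ws → Each r (a ∷ as) (vs ++ ws)

Each-split : ∀ {A : Set} {r : A → List ℕ → Set} as {bs ws} → Each r (as ++ bs) ws →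
  ∃ λ us → ∃ λ vs → Each r as us × Each r bs vs × (∀ v → occ ws v ≡ occ us v + occ vs v)
Each-split [] e = _ , _ , [] , e , λ v → refl
Each-split (a ∷ as) {bs} (_∷_ {vs = us₁} p e) with Each-split as e
... | us , vs , e₁ , e₂ , eq = _ , vs , p ∷ e₁ , e₂ , λ v →
  trans (occ-++ us₁ _ v) (trans (cong (occ us₁ v +_) (eq v))
    (trans (sym (+-assoc (occ us₁ v) _ _)) (cong (_+ occ vs v) (sym (occ-++ us₁ us v)))))

-- Zones of density one sixth, and the room they need

-- The density is bounded only for intervals that start at the left end or stop at the right end:
-- every path leaves the zone across one of its ends, and one sixth is what `jump` tolerates.
record Zone (L T : ℕ) (u : ℕ → ℕ) : Set where
  field
    L≤T   : L ≤ T
    pre   : ∀ k → 6 * ∑ u L k ≤ k + 6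
    suf   : ∀ a k → a + k ≡ T → 6 * ∑ u a k ≤ k + 6
    below : ∀ v → v < L → u v ≡ 0
    above : ∀ v → T ≤ v → u v ≡ 0

  within : ∀ {x} → 1 ≤ u x → L ≤ x × x < T
  within {x} p = ≮⇒≥ (λ q → <-irrefl refl (subst (1 ≤_) (below x q) p)) ,
    ≰⇒> (λ q → <-irrefl refl (subst (1 ≤_) (above x q) p))

-- Six more positions on either side pay for one vertex wherever it is put: a prefix of length at
-- most six contains nothing but the new vertex, and a longer one contains six positions free of old
-- vertices.
Zone-add : ∀ {L T u} → Zone (6 + L) T u → ∀ v → L ≤ v → v < 6 + T → Zone L (6 + T) (λ w → δ v w + u w)
Zone-add {L} {T} {u} Z v L≤v v<T = record
  { L≤T = arith-11 L T L≤T
  ; pre = pre′ ; suf = suf′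
  ; below = λ w p → cong₂ _+_ (δ-≢ (λ e → <-irrefl (sym e) (<-≤-trans p L≤v))) (below w (≤-trans p (m≤n+m L 6)))
  ; above = λ w p → cong₂ _+_ (δ-≢ (λ e → <-irrefl e (<-≤-trans v<T p))) (above w (≤-trans (m≤n+m T 6) p)) }
  where
  open Zone Z
  pre′ : ∀ k → 6 * ∑ (λ w → δ v w + u w) L k ≤ k + 6
  pre′ k with ≤-total k 6
  ... | inj₁ k≤6 = arith-12 k (∑ (λ w → δ v w + u w) L k) (∑ (δ v) L k) (∑ u L k) (∑-+ (δ v) u L k) (∑δ≤1 v L k)
      (∑-zero L k (λ w p q → below w (<-≤-trans q (≤-trans (+-monoʳ-≤ L k≤6) (≤-reflexive (+-comm L 6))))))
  ... | inj₂ 6≤k with m≤n⇒∃[o]m+o≡n 6≤k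
  ... | k′ , refl = arith-13 (k′) (∑ (λ w → δ v w + u w) L (6 + k′)) (∑ (δ v) L (6 + k′)) (∑ u L (6 + k′)) (∑ u L 6)
      (∑ u (L + 6) k′) (∑ u (6 + L) k′) (∑-+ (δ v) u L (6 + k′)) (∑δ≤1 v L (6 + k′)) (∑-split u L 6 k′)
      (cong (λ a → ∑ u a k′) (+-comm L 6)) (∑-zero L 6 (λ w p q → below w (<-≤-trans q (≤-reflexive (+-comm L 6)))))
      (pre k′)
  suf′ : ∀ a k → a + k ≡ 6 + T → 6 * ∑ (λ w → δ v w + u w) a k ≤ k + 6
  suf′ a k eq with ≤-total k 6
  ... | inj₁ k≤6 = arith-12 k (∑ (λ w → δ v w + u w) a k) (∑ (δ v) a k) (∑ u a k) (∑-+ (δ v) u a k) (∑δ≤1 v a k)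
      (∑-zero a k (λ w p q → above w (arith-14 w a k T p k≤6 eq)))
  ... | inj₂ 6≤k with m≤n⇒∃[o]m+o≡n 6≤k
  ... | k′ , refl = arith-15 (k′) (∑ (λ w → δ v w + u w) a (6 + k′)) (∑ (δ v) a (6 + k′)) (∑ u a (6 + k′))
      (∑ u (a + k′) 6) (∑ u a k′) (∑ u a (k′ + 6)) (∑-+ (δ v) u a (6 + k′)) (∑δ≤1 v a (6 + k′)) (∑-split u a k′ 6)
      (cong (∑ u a) (+-comm 6 k′)) (∑-zero (a + k′) 6 (λ w p q → above w (≤-trans (≤-reflexive (sym at)) p)))
      (suf a k′ at)
    where
    at : a + k′ ≡ T
    at = arith-16 a (k′) T eq

Zone-point : ∀ x → Zone x (suc x) (δ x)
Zone-point x = record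
  { L≤T = n≤1+n x ; pre = λ k → lem x k ; suf = λ a k _ → lem a k
  ; below = λ v p → δ-≢ (λ e → <-irrefl (sym e) p) ; above = λ v p → δ-≢ (λ e → <-irrefl e p) }
  where
  lem : ∀ a k → 6 * ∑ (δ x) a k ≤ k + 6
  lem a k = arith-17 k (∑ (δ x) a k) (∑δ≤1 x a k)

-- An interval that meets both zones carries the rounding error `6` twice instead of once; the gap
-- of six pays for the second.
Zone-join : ∀ {L T u L′ T′ u′} → Zone L T u → Zone L′ T′ u′ → T + 6 ≤ L′ → Zone L T′ (λ v → u v + u′ v)
Zone-join {L} {T} {u} {L′} {T′} {u′} Z Z′ gap = record
  { L≤T = arith-18 L T L′ T′ Z.L≤T Z′.L≤T gap
  ; pre = pre ; suf = suf
  ; below = λ v p → cong₂ _+_ (Z.below v p) (Z′.below v (arith-19 v L T L′ p Z.L≤T gap))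
  ; above = λ v p → cong₂ _+_ (Z.above v (arith-20 v T T′ L′ p Z′.L≤T gap)) (Z′.above v p) }
  where
  module Z = Zone Z
  module Z′ = Zone Z′
  pre : ∀ k → 6 * ∑ (λ v → u v + u′ v) L k ≤ k + 6
  pre k with ≤-total (L + k) L′
  ... | inj₁ le = arith-21 k (∑ (λ v → u v + u′ v) L k) (∑ u L k) (∑ u′ L k) (∑-+ u u′ L k)
      (∑-zero L k (λ v p q → Z′.below v (<-≤-trans q le))) (Z.pre k)
  ... | inj₂ ge with m≤n⇒∃[o]m+o≡n Z.L≤T | m≤n⇒∃[o]m+o≡n gap
  ... | w , refl | g , refl with m≤n⇒∃[o]m+o≡n (arith-22 L w g k ge)
  ... | h , refl = arith-240 w g h (∑ (λ v → u v + u′ v) L (w + 6 + g + h)) (∑ u L (w + 6 + g + h))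
      (∑ u′ L (w + 6 + g + h)) (∑ u L w) (∑ u (L + w) (6 + g + h)) (∑ u′ L (w + 6 + g)) (∑ u′ (L + (w + 6 + g)) h)
      (∑ u L (w + (6 + g + h))) (∑ u′ (L + w + 6 + g) h) (∑-+ u u′ L (w + 6 + g + h)) (∑-split u L w (6 + g + h))
      (cong (∑ u L) (arith-23 w g h)) (∑-split u′ L (w + 6 + g) h) (cong (λ a → ∑ u′ a h) (arith-24 L w g))
      (∑-zero (L + w) (6 + g + h) (λ v p q → Z.above v p)) (∑-zero L (w + 6 + g) (λ v p q → Z′.below v
      (<-≤-trans q (≤-reflexive (arith-24 L w g))))) (Z.pre w) (Z′.pre h)
  suf : ∀ a k → a + k ≡ T′ → 6 * ∑ (λ v → u v + u′ v) a k ≤ k + 6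
  suf a k eq with ≤-total T a
  ... | inj₁ le = arith-25 k (∑ (λ v → u v + u′ v) a k) (∑ u a k) (∑ u′ a k) (∑-+ u u′ a k)
      (∑-zero a k (λ v p q → Z.above v (≤-trans le p))) (Z′.suf a k eq)
  ... | inj₂ ge with m≤n⇒∃[o]m+o≡n ge | m≤n⇒∃[o]m+o≡n gap
  ... | w , refl | g , refl with m≤n⇒∃[o]m+o≡n (arith-26 a w g k T′ Z′.L≤T eq)
  ... | h , refl = arith-240 w g h (∑ (λ v → u v + u′ v) a (w + 6 + g + h)) (∑ u a (w + 6 + g + h))
      (∑ u′ a (w + 6 + g + h)) (∑ u a w) (∑ u (a + w) (6 + g + h)) (∑ u′ a (w + 6 + g)) (∑ u′ (a + (w + 6 + g)) h)
      (∑ u a (w + (6 + g + h))) (∑ u′ (a + w + 6 + g) h) (∑-+ u u′ a (w + 6 + g + h)) (∑-split u a w (6 + g + h))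
      (cong (∑ u a) (arith-23 w g h)) (∑-split u′ a (w + 6 + g) h) (cong (λ a → ∑ u′ a h) (arith-24 a w g))
      (∑-zero (a + w) (6 + g + h) (λ v p q → Z.above v p)) (∑-zero a (w + 6 + g) (λ v p q → Z′.below v
      (<-≤-trans q (≤-reflexive (arith-24 a w g))))) (Z.suf a w refl) (Z′.suf (a + w + 6 + g) h
      (trans (arith-27 a w g h) eq))

jumps : List Token → ℕ
jumps []              = 0
jumps (farT s w ∷ ts) = suc (jumps ts)
jumps (zedT w ∷ ts)   = jumps ts

-- The room needed to the left (`false`) and to the right (`true`). A `farT` zone is widened by `16`
-- for each directed path settled before it, as each of these may drop its two jump vertices into
-- the stretch: `6 * 2` for the jump and `2 * 2` for the greedy part. A `zedT` zone could lie on
-- either side and is put to the right.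
demand : Bool → List Token → ℕ
demand s []                      = 0
demand true (farT true w ∷ ts)   = w + 16 * jumps ts + demand true ts
demand true (farT false w ∷ ts)  = demand true ts
demand true (zedT w ∷ ts)        = w + demand true ts
demand false (farT true w ∷ ts)  = demand false ts
demand false (farT false w ∷ ts) = w + 16 * jumps ts + demand false ts
demand false (zedT w ∷ ts)       = demand false ts

module _ {L T : ℕ} {u : ℕ → ℕ} (Z : Zone L T u) where
  open Zone Z

  ∑-above : ∀ a k → T ≤ a → ∑ u a k ≡ 0
  ∑-above a k p = ∑-zero a k λ v q _ → above v (≤-trans p q)

  ∑-below : ∀ a k → a + k ≤ L → ∑ u a k ≡ 0
  ∑-below a k p = ∑-zero a k λ v _ q → below v (<-≤-trans q p)

  ∑-prefix : ∀ a k b → a + k ≤ L + b → 6 * ∑ u a k ≤ b + 6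
  ∑-prefix a k b p with ≤-total L a
  ... | inj₁ L≤a = ≤-trans (*-monoʳ-≤ 6 (∑-sub u L≤a p)) (pre b)
  ... | inj₂ a≤L with m≤n⇒∃[o]m+o≡n a≤L
  ... | r , refl with ≤-total k r
  ... | inj₁ k≤r = subst (λ z → 6 * z ≤ b + 6) (sym (∑-below a k (+-monoʳ-≤ a k≤r))) z≤n
  ... | inj₂ r≤k with m≤n⇒∃[o]m+o≡n r≤k
  ... | q , refl = arith-241 (∑ u a (r + q)) (∑ u a r) (∑ u (a + r) q) b q (∑-split u a r q) (∑-below a r ≤-refl)
      (pre q) ((arith-28 a r q b p))

  ∑-suffix : ∀ a k b → T ≤ a + b → 6 * ∑ u a k ≤ b + 6
  ∑-suffix a k b p with ≤-total T a
  ... | inj₁ T≤a = subst (λ z → 6 * z ≤ b + 6) (sym (∑-above a k T≤a)) z≤n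
  ... | inj₂ a≤T with m≤n⇒∃[o]m+o≡n a≤T
  ... | r , refl with ≤-total k r
  ... | inj₁ k≤r = arith-29 (∑ u a k) (∑ u a r) a b r (∑-sub u {a} {r} {a} {k} ≤-refl (+-monoʳ-≤ a k≤r))
      (suf a r refl) p
  ... | inj₂ r≤k with m≤n⇒∃[o]m+o≡n r≤k
  ... | q , refl = arith-30 (∑ u a (r + q)) (∑ u a r) (∑ u (a + r) q) a b r (∑-split u a r q) (∑-above (a + r) q
      ≤-refl) (suf a r refl) p

∑-occ-outside : ∀ gs a k lo hi → (∀ v → occ gs v ≡ 0 ⊎ (lo ≤ v × v < hi)) → (a + k ≤ lo ⊎ hi ≤ a) → ∑ (occ gs) a k ≡ 0
∑-occ-outside gs a k lo hi loc out = ∑-zero a k λ v p q → lem v p q (loc v) out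
  where
  lem : ∀ v → a ≤ v → v < a + k → occ gs v ≡ 0 ⊎ (lo ≤ v × v < hi) → (a + k ≤ lo ⊎ hi ≤ a) → occ gs v ≡ 0
  lem v p q (inj₁ e) _ = e
  lem v p q (inj₂ (r , s)) (inj₁ t) = ⊥-elim (<-irrefl refl (<-≤-trans q (≤-trans t r)))
  lem v p q (inj₂ (r , s)) (inj₂ t) = ⊥-elim (<-irrefl refl (<-≤-trans s (≤-trans t p)))

-- Finite sets of vertices as lists

record In (A : List ℕ) (v : ℕ) : Set where
  constructor mk
  field hit : 1 ≤ occ A v
open In public

record Unique (A : List ℕ) : Set where
  constructor mk
  field once : ∀ v → occ A v ≤ 1
open Unique public

δ≤occ : ∀ {A a} → In A a → ∀ v → δ a v ≤ occ A v
δ≤occ {A} {a} p v with a ≟ v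
... | yes refl = ≤-trans (≤-reflexive (δ-refl a)) (hit p)
... | no n = subst (_≤ occ A v) (sym (δ-≢ n)) z≤n

In-here : ∀ a A → In (a ∷ A) a
In-here a A = mk (≤-trans (≤-reflexive (sym (δ-refl a))) (m≤m+n (δ a a) _))

In-there : ∀ {A v} a → In A v → In (a ∷ A) v
In-there {A} {v} a p = mk (≤-trans (hit p) (m≤n+m (occ A v) (δ a v)))

In-case : ∀ {a A v} → In (a ∷ A) v → v ≡ a ⊎ In A v
In-case {a} {A} {v} p with a ≟ v
... | yes q = inj₁ (sym q)
... | no n = inj₂ (mk (subst (λ z → 1 ≤ z + occ A v) (δ-≢ n) (hit p)))

δδ≤ : ∀ {a b v} {f : ℕ → ℕ} → a ≢ b → (∀ v → δ a v ≤ f v) → (∀ v → δ b v ≤ f v) → δ a v + δ b v ≤ f v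
δδ≤ {a} {b} {v} {f} n p q with a ≟ v
... | yes refl = ≤-trans (≤-reflexive (trans (cong (δ a a +_) (δ-≢ (n ∘ sym))) (+-identityʳ _))) (p v)
... | no m = subst (λ z → z + δ b v ≤ f v) (sym (δ-≢ m)) (q v)

fresh-head : ∀ {x A} → Unique (x ∷ A) → occ A x ≡ 0
fresh-head {x} {A} h = n≤0⇒n≡0 (≤-pred (subst (λ z → z + occ A x ≤ 1) (δ-refl x) (once h x)))

≢-head : ∀ {x A v} → Unique (x ∷ A) → In A v → v ≢ x
≢-head {x} {A} h p refl = <-irrefl refl (subst (1 ≤_) (fresh-head {x} {A} h) (hit p))

remove : ℕ → List ℕ → List ℕ
remove a [] = []
remove a (x ∷ xs) with a ≟ x
... | yes _ = xs
... | no _  = x ∷ remove a xs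

remove-occ : ∀ {a} A → In A a → ∀ v → occ A v ≡ δ a v + occ (remove a A) v
remove-occ {a} (x ∷ A) p v with a ≟ x
... | yes refl = refl
... | no n with In-case {x} {A} p
... | inj₁ q = ⊥-elim (n q)
... | inj₂ q = arith-31 (δ x v) (δ a v) (occ A v) (occ (remove a A) v) (remove-occ A q v)

remove-len : ∀ {a} A → In A a → length A ≡ suc (length (remove a A))
remove-len {a} (x ∷ A) p with a ≟ x
... | yes refl = refl
... | no n with In-case {x} {A} p
... | inj₁ q = ⊥-elim (n q)
... | inj₂ q = cong suc (remove-len A q)

remove≤ : ∀ a A v → occ (remove a A) v ≤ occ A v
remove≤ a [] v = z≤n
remove≤ a (x ∷ A) v with a ≟ x
... | yes _ = m≤n+m _ _
... | no _ = +-monoʳ-≤ (δ x v) (remove≤ a A v)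

remove-len≥ : ∀ a A → length A ≤ suc (length (remove a A))
remove-len≥ a [] = z≤n
remove-len≥ a (x ∷ A) with a ≟ x
... | yes _ = ≤-refl
... | no _ = s≤s (remove-len≥ a A)

remove-gone : ∀ {a} A → Unique A → occ (remove a A) a ≡ 0
remove-gone {a} A h with 1 ≤? occ A a
... | yes p = n≤0⇒n≡0 (≤-pred (subst (_≤ 1) (trans (remove-occ A (mk p) a) (cong (_+ occ (remove a A) a) (δ-refl a)))
    (once h a)))
... | no p = n≤0⇒n≡0 (≤-trans (remove≤ a A a) (≤-pred (≰⇒> p)))

remove-≢ : ∀ {a v} A → Unique A → In (remove a A) v → v ≢ a
remove-≢ A h p refl = <-irrefl refl (subst (1 ≤_) (remove-gone A h) (hit p))

In-remove : ∀ {a v} A → In A v → v ≢ a → In (remove a A) v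
In-remove {a} {v} A p n with 1 ≤? occ A a
... | yes q = mk (subst (1 ≤_) (trans (remove-occ A (mk q) v) (cong (_+ occ (remove a A) v) (δ-≢ (n ∘ sym)))) (hit p))
... | no q = mk (subst (1 ≤_) (none A q v) (hit p))
  where
  none : ∀ A → ¬ (1 ≤ occ A a) → ∀ v → occ A v ≡ occ (remove a A) v
  none [] q v = refl
  none (x ∷ A) q v with a ≟ x
  ... | yes refl = ⊥-elim (q (hit (In-here a A)))
  ... | no _ = cong (δ x v +_) (none A (λ r → q (hit (In-there {A} x (mk r)))) v)

Unique-remove : ∀ a {A} → Unique A → Unique (remove a A)
Unique-remove a {A} h = mk λ v → ≤-trans (remove≤ a A v) (once h v)

In-⊑ : ∀ {A B v} → (∀ v → occ A v ≤ occ B v) → In A v → In B v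
In-⊑ h i = mk (≤-trans (hit i) (h _))

findIn : ∀ {P : ℕ → Set} → (∀ v → Dec (P v)) → ∀ A → (∃ λ a → In A a × P a) ⊎ (∀ v → In A v → ¬ P v)
findIn P? [] = inj₂ λ v → λ { (mk ()) }
findIn P? (x ∷ A) with P? x | findIn P? A
... | yes p | _ = inj₁ (x , In-here x A , p)
... | no _ | inj₁ (a , i , p) = inj₁ (a , In-there x i , p)
... | no n | inj₂ h = inj₂ λ v i p → case In-case {x} {A} i of λ { (inj₁ refl) → n p ; (inj₂ j) → h v j p }

TwoIn : (ℕ → Set) → List ℕ → Set
TwoIn P A = ∃ λ a → ∃ λ b → In A a × In A b × a ≢ b × P a × P b

-- The dichotomy that drives the embedding of oriented paths: two candidates for the next vertex let
-- the induction go on, and otherwise almost the whole set is joined to the vertex in the opposite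
-- direction.
two : ∀ {P : ℕ → Set} → (∀ v → Dec (P v)) → ∀ A → Unique A → TwoIn P A ⊎ ∃ λ e → ∀ v → In A v → v ≢ e → ¬ P v
two P? A h with findIn P? A
... | inj₂ none = inj₂ (0 , λ v i _ → none v i)
... | inj₁ (a , i , p) with findIn P? (remove a A)
... | inj₁ (b , j , q) = inj₁ (a , b , i , In-⊑ (remove≤ a A) j , (λ e → remove-≢ A h j (sym e)) , p , q)
... | inj₂ none = inj₂ (a , λ v j n → none v (In-remove A j n))

run : Bool → List Bool → ℕ
run a [] = 0
run true (true ∷ bs) = suc (run true bs)
run true (false ∷ bs) = 0
run false (true ∷ bs) = 0
run false (false ∷ bs) = suc (run false bs)

run≤ : ∀ a bs → run a bs ≤ length bs
run≤ a [] = z≤n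
run≤ true (true ∷ bs) = s≤s (run≤ true bs)
run≤ true (false ∷ bs) = z≤n
run≤ false (true ∷ bs) = z≤n
run≤ false (false ∷ bs) = s≤s (run≤ false bs)

run-same : ∀ a bs → run a (a ∷ bs) ≡ suc (run a bs)
run-same true bs = refl
run-same false bs = refl

Unique-⊑ : ∀ {A B} → (∀ v → occ A v ≤ occ B v) → Unique B → Unique A
Unique-⊑ h u = mk λ v → ≤-trans (h v) (once u v)

Unique-tail : ∀ {x A} → Unique (x ∷ A) → Unique A
Unique-tail {x} u = mk λ v → ≤-trans (m≤n+m _ (δ x v)) (once u v)

Unique-swap : ∀ {x y A} → Unique (x ∷ y ∷ A) → Unique (y ∷ x ∷ A)
Unique-swap {x} {y} {A} u = mk λ v → subst (_≤ 1) (arith-32 (δ x v) (δ y v) (occ A v)) (once u v)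

Unique-left : ∀ A {B} → Unique (A ++ B) → Unique A
Unique-left A {B} u = mk λ v → ≤-trans (≤-trans (m≤m+n _ (occ B v)) (≤-reflexive (sym (occ-++ A B v)))) (once u v)

In-left : ∀ A {B v} → In A v → In (A ++ B) v
In-left A {B} {v} i = mk (≤-trans (hit i) (≤-trans (m≤m+n _ (occ B v)) (≤-reflexive (sym (occ-++ A B v)))))

δ+≤ : ∀ {a v n} {f : ℕ → ℕ} → 1 ≤ f a → n ≤ f v → (a ≡ v → n ≡ 0) → δ a v + n ≤ f v
δ+≤ {a} {v} {n} {f} p q z with a ≟ v
... | yes refl = subst₂ (λ m k → m + k ≤ f a) (sym (δ-refl a)) (sym (z refl)) p
... | no ne = subst (λ m → m + n ≤ f v) (sym (δ-≢ ne)) q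

pair-sub : ∀ {A Y a b} → Unique A → In A a → In A b → a ≢ b → (∀ v → occ Y v ≤ occ A v) →
  ∀ v → δ a v + δ b v + occ (remove b (remove a Y)) v ≤ occ A v
pair-sub {A} {Y} {a} {b} u ia ib n sub v = subst (_≤ occ A v) (sym (+-assoc (δ a v) _ _))
  (δ+≤ {f = occ A} (hit ia) (δ+≤ {f = occ A} (hit ib) (≤-trans (remove≤ b (remove a Y) v) (≤-trans (remove≤ a Y v)
      (sub v)))
    (λ { refl → remove-gone (remove a Y) (Unique-remove a uY) }))
    (λ { refl → cong₂ _+_ (δ-≢ (n ∘ sym)) (n≤0⇒n≡0 (≤-trans (remove≤ b (remove a Y) a) (≤-reflexive (remove-gone Y
        uY)))) }))
  where
  uY : Unique Y
  uY = Unique-⊑ sub u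

remove₂ : ℕ → ℕ → List ℕ → List ℕ
remove₂ a b S = remove b (remove a S)

remove₂-occ : ∀ {a b S} → In S a → In S b → a ≢ b → ∀ v → occ S v ≡ δ a v + δ b v + occ (remove₂ a b S) v
remove₂-occ {a} {b} {S} ia ib n v = arith-33 (occ S v) (δ a v) (δ b v) (occ (remove a S) v) (occ (remove₂ a b S) v)
    (remove-occ S ia v) (remove-occ (remove a S) (In-remove S ib (n ∘ sym)) v)

remove₂-len : ∀ {a b S} → In S a → In S b → a ≢ b → length S ≡ 2 + length (remove₂ a b S)
remove₂-len {a} {b} {S} ia ib n = trans (remove-len S ia) (cong suc (remove-len (remove a S) (In-remove S ib
    (n ∘ sym))))

remove₂-len≥ : ∀ a b S → length S ≤ 2 + length (remove₂ a b S)
remove₂-len≥ a b S = ≤-trans (remove-len≥ a S) (s≤s (remove-len≥ b (remove a S)))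

avoid : ∀ {S a} ps b → In S a → In S b → a ≢ b → (∀ v → occ ps v ≤ occ S v) → occ ps a ≡ 0 →
  ∀ v → occ ps v ≤ occ (b ∷ remove₂ a b S) v
avoid {S} {a} ps b ia ib n sub z v with a ≟ v
... | yes refl = ≤-trans (≤-reflexive z) z≤n
... | no ne = arith-34 (occ ps v) (occ S v) (δ a v) (δ b v) (occ (remove₂ a b S) v) (sub v) (remove₂-occ ia ib n v)
    (δ-≢ ne)

-- The invariant of the last stage, where `f` counts the vertices in use; those from `m` on belong
-- to the artificial tail of the order.
record Cap (m : ℕ) (f : ℕ → ℕ) : Set where
  constructor cap
  field
    ≤one : ∀ v → f v ≤ 1
    out  : ∀ v → m ≤ v → f v ≡ 0
open Cap public

Cap-⊑ : ∀ {m f g} → (∀ v → f v ≤ g v) → Cap m g → Cap m f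
Cap-⊑ h c = cap (λ v → ≤-trans (h v) (≤one c v)) λ v p → n≤0⇒n≡0 (≤-trans (h v) (≤-reflexive (out c v p)))

vacant : (ℕ → ℕ) → ℕ → List ℕ
vacant f zero = []
vacant f (suc m) with f m ≟ 0
... | yes _ = m ∷ vacant f m
... | no _  = vacant f m

vacant-occ : ∀ f m v → occ (vacant f m) v ≡ 0 ⊎ (occ (vacant f m) v ≡ 1 × f v ≡ 0 × v < m)
vacant-occ f zero v = inj₁ refl
vacant-occ f (suc m) v with f m ≟ 0 | vacant-occ f m v
... | no _ | inj₁ e = inj₁ e
... | no _ | inj₂ (e , z , p) = inj₂ (e , z , <-trans p ≤-refl)
... | yes z | r with m ≟ v
... | yes refl = inj₂ (cong₂ _+_ (δ-refl m) (lem r) , z , ≤-refl)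
  where
  lem : occ (vacant f m) m ≡ 0 ⊎ (occ (vacant f m) m ≡ 1 × f m ≡ 0 × m < m) → occ (vacant f m) m ≡ 0
  lem (inj₁ e) = e
  lem (inj₂ (_ , _ , p)) = ⊥-elim (<-irrefl refl p)
vacant-occ f (suc m) v | yes z | inj₁ e | no n = inj₁ (cong₂ _+_ (δ-≢ n) e)
vacant-occ f (suc m) v | yes z | inj₂ (e , z′ , p) | no n = inj₂ (cong₂ _+_ (δ-≢ n) e , z′ , <-trans p ≤-refl)

vacant-len : ∀ f m → m ≤ length (vacant f m) + ∑ f 0 m
vacant-len f zero = z≤n
vacant-len f (suc m) with f m ≟ 0
... | yes _ = arith-35 m (length (vacant f m)) (∑ f 0 m) (∑ f 0 (suc m)) (f m) (vacant-len f m) (∑-snoc f 0 m)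
... | no n = arith-36 m (length (vacant f m)) (∑ f 0 m) (∑ f 0 (suc m)) (f m) (vacant-len f m) (∑-snoc f 0 m)
    (n≢0⇒n>0 n)

vacant-cap : ∀ {m f} → Cap m f → Cap m (λ v → f v + occ (vacant f m) v)
vacant-cap {m} {f} c = cap one (λ v p → cong₂ _+_ (out c v p) (zero-out v p (vacant-occ f m v)))
  where
  one : ∀ v → f v + occ (vacant f m) v ≤ 1
  one v with vacant-occ f m v
  ... | inj₁ e = subst (λ t → f v + t ≤ 1) (sym e) (≤-trans (≤-reflexive (+-identityʳ _)) (≤one c v))
  ... | inj₂ (e , z , _) = ≤-reflexive (cong₂ _+_ z e)
  zero-out : ∀ v → m ≤ v → _ → occ (vacant f m) v ≡ 0
  zero-out v p (inj₁ e) = e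
  zero-out v p (inj₂ (_ , _ , q)) = ⊥-elim (<-irrefl refl (<-≤-trans q p))

∑-occ≤ : ∀ xs a w → ∑ (occ xs) a w ≤ length xs
∑-occ≤ [] a w = ≤-reflexive (∑-zero a w λ _ _ _ → refl)
∑-occ≤ (x ∷ xs) a w = ≤-trans (≤-reflexive (∑-+ (δ x) (occ xs) a w)) (+-mono-≤ (∑δ≤1 x a w) (∑-occ≤ xs a w))

In⇒∈ : ∀ {A v} → In A v → v ∈ A
In⇒∈ {[]} (mk ())
In⇒∈ {x ∷ A} i with In-case {x} {A} i
... | inj₁ refl = here refl
... | inj₂ j = there (In⇒∈ j)

ended : ∀ bs → Ended (bs ++ true ∷ false ∷ [])
ended [] = turn true
ended (b ∷ bs) = b ∷ ended bs

-- From rooted forests to plans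

-- The children of a node, in first-child / next-sibling form: sign of the arc to the child, its label, its own
-- children, its siblings.
data Forest (A : Set) : Set where
  nil : Forest A
  add : Bool → A → Forest A → Forest A → Forest A

order : ∀ {A} → Forest A → ℕ
order nil           = 0
order (add s a k b) = 1 + order k + order b

-- The primed versions take into account the node whose children form the forest. The root itself is
-- therefore counted neither as a leaf nor as a branching node.
leaves′ leaves branches′ branches : ∀ {A} → Forest A → ℕ
leaves nil           = 0
leaves (add s a k b) = leaves′ k + leaves b
leaves′ nil             = 1
leaves′ F@(add _ _ _ _) = leaves F
branches nil           = 0
branches (add s a k b) = branches′ k + branches b
branches′ nil                           = 0
branches′ F@(add _ _ _ nil)             = branches F
branches′ F@(add _ _ _ (add _ _ _ _)) = 1 + branches F

same : ∀ a b → a ≡ b ⊎ a ≡ not b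
same true  true  = inj₁ refl
same true  false = inj₂ refl
same false true  = inj₂ refl
same false false = inj₁ refl

not-not : ∀ b → not (not b) ≡ b
not-not true  = refl
not-not false = refl

-- In `bend` the first block has `n + 1` signs: its last arc is left to the path embedded last, so
-- that this path turns after its first arc.
data Runs : List Bool → Set where
  flat : ∀ n b → Runs (replicate n b)
  bend : ∀ n b bs → Runs (replicate n b ++ b ∷ not b ∷ bs)

runs : ∀ bs → Runs bs
runs [] = flat 0 true
runs (a ∷ bs) with runs bs
... | flat zero b = flat 1 a
... | flat (suc n) b with same a b
... | inj₁ refl = flat (2 + n) a
... | inj₂ refl = subst (λ c → Runs (not b ∷ c ∷ replicate n b)) (not-not b) (bend 0 (not b) (replicate n b))
runs (a ∷ _) | bend zero b bs with same a b
... | inj₁ refl = bend 1 a bs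
... | inj₂ refl = subst (λ c → Runs (not b ∷ c ∷ not b ∷ bs)) (not-not b) (bend 0 (not b) (not b ∷ bs))
runs (a ∷ _) | bend (suc n) b bs with same a b
... | inj₁ refl = bend (2 + n) a bs
... | inj₂ refl = subst (λ c → Runs (not b ∷ c ∷ replicate n b ++ b ∷ not b ∷ bs)) (not-not b)
  (bend 0 (not b) (replicate n b ++ b ∷ not b ∷ bs))

ended-++ : ∀ as {bs} → Ended bs → Ended (as ++ bs)
ended-++ []       e = e
ended-++ (a ∷ as) e = a ∷ ended-++ as e

record Bend (cs : List Bool) : Set where
  constructor bent
  field
    n   : ℕ
    b   : Bool
    bs  : List Bool
    eq  : cs ≡ replicate n b ++ b ∷ not b ∷ bs
    end : Ended (b ∷ not b ∷ bs)

-- There is a turn, namely the last one; cutting at the first turn instead keeps the last one at the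
-- end.
bend-ended : ∀ as c → Bend (as ++ c ∷ not c ∷ [])
bend-ended [] c = bent 0 c [] refl (turn c)
bend-ended (a ∷ as) c with bend-ended as c
... | bent n b bs eq end with same a b
... | inj₁ refl = bent (suc n) a bs (cong (a ∷_) eq) end
bend-ended (a ∷ as) c | bent zero b bs eq end | inj₂ refl = bent 0 (not b) (not b ∷ bs)
  (trans (cong (not b ∷_) eq) (cong (λ t → not b ∷ t ∷ not b ∷ bs) (sym (not-not b))))
  (not b ∷ subst (λ t → Ended (t ∷ not b ∷ bs)) (sym (not-not b)) end)
bend-ended (a ∷ as) c | bent (suc n) b bs eq end | inj₂ refl = bent 0 (not b) (replicate n b ++ b ∷ not b ∷ bs)
  (trans (cong (not b ∷_) eq) (cong (λ t → not b ∷ t ∷ replicate n b ++ b ∷ not b ∷ bs) (sym (not-not b))))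
  (not b ∷ subst (λ t → Ended (t ∷ replicate n b ++ b ∷ not b ∷ bs)) (sym (not-not b)) (b ∷ ended-++ (replicate n b)
      end))

-- The signs of a path read from its other end.
back : List Bool → List Bool
back []       = []
back (b ∷ bs) = back bs ++ not b ∷ []

back-turn : ∀ b bs → back (b ∷ not b ∷ bs) ≡ back bs ++ b ∷ not b ∷ []
back-turn b bs = trans (++-assoc (back bs) _ _) (cong (λ t → back bs ++ t ∷ not b ∷ []) (not-not b))

length-back : ∀ bs → length (back bs) ≡ length bs
length-back [] = refl
length-back (b ∷ bs) = trans (length-++ (back bs)) (trans (+-comm _ 1) (cong suc (length-back bs)))

-- A jump takes three arcs, so only a path with at least three can leave its cluster; a shorter one
-- stays, at the price of at most two vertices there.
move : Bool → ℕ → Plan → Plan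
move b 0                   K = K
move b 1                   K = pick b K
move b 2                   K = pick b (pick b K)
move b (suc (suc (suc m))) K = far b m K

-- Signs a, b, ..., b (n + 1 times), not b, bs: the path is followed up to two arcs before its turn.
head : (Bool → Plan) → Bool → ℕ → Bool → Plan
head T a zero    b = T a
head T a (suc n) b = pick a (move b n (T b))

legPlan : Bool → ∀ {cs} → Runs cs → Plan
legPlan a (flat n b)    = pick a (move b n stop)
legPlan a (bend n b bs) = head (λ s → leg s b bs) a n b

backPlan : Bool → ∀ {cs} → Bend cs → Plan
backPlan z (bent n b bs eq end) = head (λ s → close s b bs end) (not z) n b

-- A path with a turn is embedded from its far end, where `K` is placed somewhere new. Read
-- backwards it ends with `b`, `not b`, the reversal of its first turn, and this is the shape for
-- which the end can be forced into the seven reserved neighbours of the near end.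
edgePlan : Bool → ∀ {cs} → Runs cs → Bool → Plan → Plan
edgePlan a (flat n b)    z K = pick a (move b n (pick z K))
edgePlan a (bend n b bs) z K = head (λ s → zed s (backPlan z (bend-ended (back bs) b)) K) a n b

data Snoc : List Bool → Set where
  []   : Snoc []
  _∷ʳ_ : ∀ bs z → Snoc (bs ++ z ∷ [])

snoc : ∀ bs → Snoc bs
snoc [] = []
snoc (b ∷ bs) with snoc bs
... | [] = [] ∷ʳ b
... | bs′ ∷ʳ z = (b ∷ bs′) ∷ʳ z

edge : Bool → ∀ {cs} → Snoc cs → Plan → Plan
edge a []        K = pick a K
edge a (bs ∷ʳ z) K = edgePlan a (runs bs) z K

plan : ∀ {A} → Forest A → Plan
branchPlan : ∀ {A} → Bool → List Bool → Forest A → Plan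
plan nil           = stop
plan (add s a k b) = both (branchPlan s [] k) (plan b)
branchPlan s cs nil              = legPlan s (runs cs)
branchPlan s cs (add t a k nil)  = branchPlan s (cs ++ t ∷ []) k
branchPlan s cs (add t a k (add t′ a′ k′ b)) =
  edge s (snoc cs) (both (branchPlan t [] k) (both (branchPlan t′ [] k′) (plan b)))

-- The cost of a plan in terms of nodes, leaves and branching nodes

width : List Token → ℕ
width []              = 0
width (farT s w ∷ ts) = w + width ts
width (zedT w ∷ ts)   = w + width ts

width-++ : ∀ ss ts → width (ss ++ ts) ≡ width ss + width ts
width-++ [] ts = refl
width-++ (farT s w ∷ ss) ts = trans (cong (w +_) (width-++ ss ts)) (sym (+-assoc w _ _))
width-++ (zedT w ∷ ss) ts = trans (cong (w +_) (width-++ ss ts)) (sym (+-assoc w _ _))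

jumps-++ : ∀ ss ts → jumps (ss ++ ts) ≡ jumps ss + jumps ts
jumps-++ [] ts = refl
jumps-++ (farT s w ∷ ss) ts = cong suc (jumps-++ ss ts)
jumps-++ (zedT w ∷ ss) ts = jumps-++ ss ts

-- The terms `16 * j` for `j < J` sum to `8 * J * (J - 1)`; the equation is arranged to be free of
-- subtraction.
demands : ∀ ts → demand false ts + demand true ts + 8 * jumps ts ≡ width ts + 8 * (jumps ts * jumps ts)
demands [] = refl
demands (farT true w ∷ ts) = arith-37 (demand false ts) (demand true ts) (jumps ts) w (width ts) (demands ts)
demands (farT false w ∷ ts) = arith-38 (demand false ts) (demand true ts) (jumps ts) w (width ts) (demands ts)
demands (zedT w ∷ ts) = arith-39 (demand false ts) (demand true ts) (jumps ts) w (width ts) (demands ts)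

cost : Plan → ℕ
cost P = 12 * cw P + width (tokens P)

jumpsP : Plan → ℕ
jumpsP P = jumps (tokens P)

-- In `cost≤` the part `n` is one position per node, which is the term `n` of the theorem, and `c`
-- is waste.
record Extends (K K′ : Plan) (n c j f : ℕ) : Set where
  field
    nodes≡ : nodes K′ ≡ n + nodes K
    cost≤  : cost K′ ≤ n + c + cost K
    jumps≤ : jumpsP K′ ≤ j + jumpsP K
    fans≤  : fanSize K′ ≤ f + fanSize K

Extends-pick : ∀ b K → Extends K (pick b K) 1 11 0 0
Extends-pick b K = record { nodes≡ = refl ; cost≤ = (arith-40 (cw K) (width (tokens K))) ; jumps≤ = ≤-refl ; fans≤ =
    ≤-refl }

Extends-trans : ∀ {K K′ K″ n c j f n′ c′ j′ f′} → Extends K K′ n c j f → Extends K′ K″ n′ c′ j′ f′ → Extends K K″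
    (n′ + n) (c′ + c) (j′ + j) (f′ + f)
Extends-trans {K} {K′} {K″} {n} {c} {j} {f} {n′} {c′} {j′} {f′} E E′ = record
  { nodes≡ = trans E′.nodes≡ (trans (cong (n′ +_) E.nodes≡) (sym (+-assoc n′ n _)))
  ; cost≤ = arith-41 n c (n′) (c′) (cost K) (cost K′) (cost K″) E.cost≤ E′.cost≤
  ; jumps≤ = ≤-trans E′.jumps≤ (≤-trans (+-monoʳ-≤ j′ E.jumps≤) (≤-reflexive (sym (+-assoc j′ j _))))
  ; fans≤ = ≤-trans E′.fans≤ (≤-trans (+-monoʳ-≤ f′ E.fans≤) (≤-reflexive (sym (+-assoc f′ f _)))) }
  where
  module E = Extends E
  module E′ = Extends E′

Extends-move : ∀ b n K → Extends K (move b n K) n 22 1 0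
Extends-move b 0 K = record { nodes≡ = refl ; cost≤ = m≤n+m _ 22 ; jumps≤ = n≤1+n _ ; fans≤ = ≤-refl }
Extends-move b 1 K = record { nodes≡ = refl ; cost≤ = (arith-42 (cw K) (width (tokens K))) ; jumps≤ = n≤1+n _ ; fans≤
    = ≤-refl }
Extends-move b 2 K = record { nodes≡ = refl ; cost≤ = (arith-43 (cw K) (width (tokens K))) ; jumps≤ = n≤1+n _ ; fans≤
    = ≤-refl }
Extends-move b (suc (suc (suc n))) K = record { nodes≡ = refl
  ; cost≤ = (arith-44 n (cw K) (width (tokens K))) ; jumps≤ = ≤-refl ; fans≤ = ≤-refl }

-- The last arc before the turn is accounted for in T.
Extends-head : ∀ {K} T a n b {m c j f} → (∀ s → Extends K (T s) m c j f) → Extends K (head T a n b) (n + m) (33 + c)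
    (1 + j) f
Extends-head {K} T a zero b {m} {c} E = record { nodes≡ = nodes≡ ; cost≤ = (arith-45 m c (cost K) (cost (T a)) cost≤)
    ; jumps≤ = ≤-trans jumps≤ (n≤1+n _) ; fans≤ = fans≤ }
  where open Extends (E a)
Extends-head T a (suc n) b E = Extends-trans (E b) (Extends-trans (Extends-move b n (T b)) (Extends-pick a
    (move b n (T b))))

-- Waste: `33 = 11 + 22` for the first arc and the directed stretch before the turn, and
-- `21 = 12 * 2 - 3` for the reserved pair, less three nodes that it helps to place. The bound `55`
-- leaves one unit of slack.
Extends-leg : ∀ a {cs} (R : Runs cs) → Extends stop (legPlan a R) (1 + length cs) 55 1 2
Extends-leg a (flat n b) = subst (λ l → Extends stop (legPlan a (flat n b)) l 55 1 2)
    (cong suc (trans refl (sym (length-replicate n))))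
  record { nodes≡ = E.nodes≡ ; cost≤ = ≤-trans E.cost≤ (+-monoˡ-≤ 0 (+-monoʳ-≤ (1 + n) (m≤m+n 33 22))) ; jumps≤ =
      E.jumps≤ ; fans≤ = ≤-trans E.fans≤ z≤n }
  where module E = Extends (Extends-trans (Extends-move b n stop) (Extends-pick a (move b n stop)))
Extends-leg a (bend n b bs) = subst (λ l → Extends stop (head (λ s → leg s b bs) a n b) l 55 1 2) len
  record { nodes≡ = E.nodes≡ ; cost≤ = ≤-trans E.cost≤ (arith-46 (n + (3 + length bs))) ; jumps≤ = E.jumps≤ ; fans≤ =
      E.fans≤ }
  where
  E : Extends stop (head (λ s → leg s b bs) a n b) (n + (3 + length bs)) (33 + 21) 1 2
  E = Extends-head {stop} (λ s → leg s b bs) a n b {3 + length bs} {21} {0} {2} λ s →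
    record { nodes≡ = sym (+-identityʳ _) ; cost≤ = (arith-47 (length bs)) ; jumps≤ = z≤n ; fans≤ = ≤-refl }
  module E = Extends E
  len : n + (3 + length bs) ≡ 1 + length (replicate n b ++ b ∷ not b ∷ bs)
  len = arith-48 n (length bs) (length (replicate n b ++ b ∷ not b ∷ bs)) (length (replicate n b))
      (length-++ (replicate n b) {b ∷ not b ∷ bs}) (length-replicate n {b})

Extends-back : ∀ z {cs} (B : Bend cs) → Extends stop (backPlan z B) (1 + length cs) 54 1 2
Extends-back z {cs} (bent n b bs eq end) = subst (λ l → Extends stop (head (λ s → close s b bs end) (not z) n b) l 54
    1 2) len E
  where
  E = Extends-head {stop} (λ s → close s b bs end) (not z) n b {3 + length bs} {21} {0} {2} λ s →
    record { nodes≡ = sym (+-identityʳ _) ; cost≤ = (arith-47 (length bs)) ; jumps≤ = z≤n ; fans≤ = ≤-refl }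
  len : n + (3 + length bs) ≡ 1 + length cs
  len = arith-49 n (length bs) (length cs) (length (replicate n b ++ b ∷ not b ∷ bs)) (length (replicate n b))
      (cong length eq) (length-++ (replicate n b) {b ∷ not b ∷ bs}) (length-replicate n {b})

-- The worst case is a path with turns: `183 = 33 + 150`, where `150` covers the seven reserved
-- neighbours (`12 * 7`), the gap and the vertex of the new zone (`7`) and the waste of the return
-- path (`54`). There may be a jump at either end, and `9` counts the seven neighbours and the pair
-- of the return path.
Extends-edge : ∀ a {cs} (S : Snoc cs) K → Extends K (edge a S K) (1 + length cs) 183 2 9
Extends-edge a [] K = record { nodes≡ = E.nodes≡ ; cost≤ = ≤-trans E.cost≤ (arith-50 (cost K)) ; jumps≤ = ≤-trans
    E.jumps≤ (m≤n+m _ 2) ; fans≤ = ≤-trans E.fans≤ (m≤n+m _ 9) }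
  where module E = Extends (Extends-pick a K)
Extends-edge a (cs ∷ʳ z) K = go (runs cs)
  where
  go : ∀ {cs} (R : Runs cs) → Extends K (edgePlan a R z K) (1 + length (cs ++ z ∷ [])) 183 2 9
  go (flat n b) = subst (λ l → Extends K (edgePlan a (flat n b) z K) l 183 2 9) len
    record { nodes≡ = E.nodes≡ ; cost≤ = ≤-trans E.cost≤ (arith-51 n (cost K)) ; jumps≤ = ≤-trans E.jumps≤ (n≤1+n _) ;
        fans≤ = ≤-trans E.fans≤ (m≤n+m _ 9) }
    where
    module E = Extends (Extends-trans (Extends-pick z K) (Extends-trans (Extends-move b n (pick z K)) (Extends-pick a
        (move b n (pick z K)))))
    len : 1 + n + 1 ≡ 1 + length (replicate n b ++ z ∷ [])
    len = cong suc (sym (trans (length-++ (replicate n b)) (cong (_+ 1) (length-replicate n))))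
  go (bend n b bs) = subst (λ l → Extends K (edgePlan a (bend n b bs) z K) l 183 2 9) len E
    where
    B = bend-ended (back bs) b
    H = backPlan z B
    module H = Extends (Extends-back z B)
    l = length (back bs ++ b ∷ not b ∷ [])
    E : Extends K (head (λ s → zed s H K) a n b) (n + (2 + l)) 183 2 9
    E = Extends-head {K} (λ s → zed s H K) a n b {2 + l} {150} {1} {9} λ s → record
      { nodes≡ = arith-52 (nodes H) (nodes K) l H.nodes≡
      ; cost≤ = arith-53 (cw H) (cw K) (width (tokens H)) (width (tokens K)) (width (tokens H ++ tokens K)) l
          (width-++ (tokens H) (tokens K)) H.cost≤
      ; jumps≤ = ≤-trans (≤-reflexive (jumps-++ (tokens H) (tokens K))) (+-monoˡ-≤ _ H.jumps≤)
      ; fans≤ = (arith-54 (fanSize H) (fanSize K) H.fans≤) }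
    len : n + (2 + l) ≡ 1 + length ((replicate n b ++ b ∷ not b ∷ bs) ++ z ∷ [])
    len = arith-55 n l (length bs) (length (back bs)) (length ((replicate n b ++ b ∷ not b ∷ bs) ++ z ∷ []))
        (length (replicate n b ++ b ∷ not b ∷ bs)) (length (replicate n b)) (length-++ (back bs) {b ∷ not b ∷ []})
        (length-back bs) (length-++ (replicate n b ++ b ∷ not b ∷ bs) {z ∷ []}) (length-++ (replicate n b)
        {b ∷ not b ∷ bs}) (length-replicate n {b})

record Measured (P : Plan) (n l i : ℕ) : Set where
  field
    nodes≡ : nodes P ≡ n
    cost≤  : cost P ≤ n + 55 * l + 183 * i
    jumps≤ : jumpsP P ≤ l + 2 * i
    fans≤  : fanSize P ≤ 2 * l + 9 * i

Measured-both : ∀ {P Q n l i n′ l′ i′} → Measured P n l i → Measured Q n′ l′ i′ → Measured (both P Q) (n + n′)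
    (l + l′) (i + i′)
Measured-both {P} {Q} {n} {l} {i} {n′} {l′} {i′} A B = record
  { nodes≡ = cong₂ _+_ A.nodes≡ B.nodes≡
  ; cost≤ = arith-56 (cw P) (cw Q) (width (tokens P)) (width (tokens Q)) (width (tokens P ++ tokens Q)) n l i (n′)
      (l′) (i′) (width-++ (tokens P) (tokens Q)) A.cost≤ B.cost≤
  ; jumps≤ = arith-57 (jumpsP P) (jumpsP Q) (jumps (tokens P ++ tokens Q)) l i (l′) (i′) (jumps-++ (tokens P)
      (tokens Q)) A.jumps≤ B.jumps≤
  ; fans≤ = (arith-58 (fanSize P) (fanSize Q) l i (l′) (i′) A.fans≤ B.fans≤) }
  where
  module A = Measured A
  module B = Measured B

Measured-edge : ∀ {K K′ m n l i} → Extends K K′ m 183 2 9 → Measured K n l i → Measured K′ (m + n) l (1 + i)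
Measured-edge {K} {K′} {m} {n} {l} {i} E M = record
  { nodes≡ = trans E.nodes≡ (cong (m +_) M.nodes≡)
  ; cost≤ = arith-59 (cost K) (cost K′) m n l i E.cost≤ M.cost≤
  ; jumps≤ = arith-60 (jumpsP K) (jumpsP K′) l i E.jumps≤ M.jumps≤
  ; fans≤ = (arith-61 (fanSize K) (fanSize K′) l i E.fans≤ M.fans≤) }
  where
  module E = Extends E
  module M = Measured M

Measured-leg : ∀ {K n} → Extends stop K n 55 1 2 → Measured K n 1 0
Measured-leg {K} {n} E = record
  { nodes≡ = trans nodes≡ (+-identityʳ n) ; cost≤ = ≤-trans cost≤ (arith-62 n) ; jumps≤ = jumps≤ ; fans≤ = fans≤ }
  where open Extends E

plan-measured : ∀ {A} (F : Forest A) → Measured (plan F) (order F) (leaves F) (branches F)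
branchPlan-measured : ∀ {A} s cs (F : Forest A) → Measured (branchPlan s cs F) (1 + length cs + order F) (leaves′ F)
    (branches′ F)
plan-measured nil = record { nodes≡ = refl ; cost≤ = z≤n ; jumps≤ = z≤n ; fans≤ = z≤n }
plan-measured (add s a k b) = Measured-both (branchPlan-measured s [] k) (plan-measured b)
branchPlan-measured s cs nil = Measured-leg (subst (λ n → Extends stop (legPlan s (runs cs)) n 55 1 2)
    (sym (+-identityʳ _)) (Extends-leg s (runs cs)))
branchPlan-measured s cs F@(add t a k nil) = subst₂ (λ n p → Measured (branchPlan s (cs ++ t ∷ []) k) n (proj₁ p)
    (proj₂ p))
  (arith-63 (length cs) (length (cs ++ t ∷ [])) (order k) (length-++ cs {t ∷ []}))
  (cong₂ _,_ (sym (+-identityʳ _)) (sym (+-identityʳ _))) (branchPlan-measured s (cs ++ t ∷ []) k)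
branchPlan-measured s cs F@(add t a k (add t′ a′ k′ b)) =
  Measured-edge (Extends-edge s (snoc cs) _)
    (Measured-both (branchPlan-measured t [] k) (Measured-both (branchPlan-measured t′ [] k′) (plan-measured b)))

-- Each child of a branching node brings a leaf in excess of the branching nodes below it; with two
-- children one excess pays for the node and the other remains.
branches<leaves : ∀ {A} (F : Forest A) → 1 + branches′ F ≤ leaves′ F
branches≤leaves : ∀ {A} (F : Forest A) → branches F ≤ leaves F
branches<leaves nil = ≤-refl
branches<leaves (add s a k nil) = arith-64 (branches′ k) (leaves′ k) (branches<leaves k)
branches<leaves (add s a k (add s′ a′ k′ b)) = arith-65 (branches′ k) (leaves′ k) (branches′ k′) (leaves′ k′)
    (branches b) (leaves b) (branches<leaves k) (branches<leaves k′) (branches≤leaves b)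
branches≤leaves nil = z≤n
branches≤leaves (add s a k b) = +-mono-≤ (≤-trans (n≤1+n _) (branches<leaves k)) (branches≤leaves b)

Fit-move : ∀ {Y} b n {K} → Fit Y K → Fit Y (move b n K)
Fit-move b 0 f = f
Fit-move b 1 f = f
Fit-move b 2 f = f
Fit-move b (suc (suc (suc n))) f = f

Fit-head : ∀ {Y} (T : Bool → Plan) a n b → (∀ s → Fit Y (T s)) → Fit Y (head T a n b)
Fit-head T a zero b f = f a
Fit-head T a (suc n) b f = Fit-move b n (f b)

Fit-edge : ∀ a {cs} (S : Snoc cs) {K} → Fit [] K → Fit [] (edge a S K)
Fit-edge a [] f = f
Fit-edge a (cs ∷ʳ z) {K} f = go (runs cs)
  where
  go : ∀ {cs} (R : Runs cs) → Fit [] (edgePlan a R z K)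
  go (flat n b) = Fit-move b n f
  go (bend n b bs) = Fit-head _ a n b λ s → (λ Y′ seven → back-fit (bend-ended (back bs) b) seven) , f
    where
    back-fit : ∀ {cs Y′} (B : Bend cs) → length Y′ ≡ 7 → Fit Y′ (backPlan z B)
    back-fit (bent n b bs eq end) seven = Fit-head (λ s → close s b bs end) (not z) n b λ s → seven

plan-fit : ∀ {A} (F : Forest A) → Fit [] (plan F)
branchPlan-fit : ∀ {A} s cs (F : Forest A) → Fit [] (branchPlan s cs F)
plan-fit nil = tt
plan-fit (add s a k b) = branchPlan-fit s [] k , plan-fit b
branchPlan-fit s cs nil = leg-fit (runs cs)
  where
  leg-fit : ∀ {cs} (R : Runs cs) → Fit [] (legPlan s R)
  leg-fit (flat n b) = Fit-move b n tt
  leg-fit (bend n b bs) = Fit-head (λ s → leg s b bs) s n b λ _ → tt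
branchPlan-fit s cs (add t a k nil) = branchPlan-fit s (cs ++ t ∷ []) k
branchPlan-fit s cs (add t a k (add t′ a′ k′ b)) = Fit-edge s (snoc cs) (branchPlan-fit t [] k , branchPlan-fit t′ []
    k′ , plan-fit b)

-- Locally median orders

count : (ℕ → Bool) → List ℕ → ℕ
count f []       = 0
count f (x ∷ xs) = bit (f x) + count f xs

count-++ : ∀ f xs ys → count f (xs ++ ys) ≡ count f xs + count f ys
count-++ f [] ys = refl
count-++ f (x ∷ xs) ys = trans (cong (bit (f x) +_) (count-++ f xs ys)) (sym (+-assoc (bit (f x)) _ _))

count≤ : ∀ f xs → count f xs ≤ length xs
count≤ f [] = z≤n
count≤ f (x ∷ xs) = +-mono-≤ (bit≤1 (f x)) (count≤ f xs)

nth : List ℕ → ℕ → ℕ → ℕ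
nth []       i       d = d
nth (x ∷ xs) zero    d = x
nth (x ∷ xs) (suc i) d = nth xs i d

nth-out : ∀ l i d → length l ≤ i → nth l i d ≡ d
nth-out [] i d p = refl
nth-out (x ∷ l) (suc i) d (s≤s p) = nth-out l i d p

nth-In : ∀ l i d → i < length l → In l (nth l i d)
nth-In (x ∷ l) zero d p = In-here x l
nth-In (x ∷ l) (suc i) d (s≤s p) = In-there x (nth-In l i d p)

nth-inj : ∀ l → Unique l → ∀ i j d e → i < length l → j < length l → nth l i d ≡ nth l j e → i ≡ j
nth-inj (x ∷ l) u zero zero d e p q eq = refl
nth-inj (x ∷ l) u zero (suc j) d e p (s≤s q) eq = ⊥-elim (≢-head u (nth-In l j e q) (sym eq))
nth-inj (x ∷ l) u (suc i) zero d e (s≤s p) q eq = ⊥-elim (≢-head u (nth-In l i d p) eq)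
nth-inj (x ∷ l) u (suc i) (suc j) d e (s≤s p) (s≤s q) eq = cong suc (nth-inj l (Unique-tail u) i j d e p q eq)

nth-mid : ∀ pre x post d → nth (pre ++ x ∷ post) (length pre) d ≡ x
nth-mid [] x post d = refl
nth-mid (p ∷ pre) x post d = nth-mid pre x post d

split-at : ∀ (l : List ℕ) i → i ≤ length l → ∃ λ pre → ∃ λ post → l ≡ pre ++ post × length pre ≡ i
split-at l zero p = [] , l , refl , refl
split-at (x ∷ l) (suc i) (s≤s p) with split-at l i p
... | pre , post , refl , refl = x ∷ pre , post , refl , refl

∑-nth : ∀ (f : ℕ → Bool) pre mid post →
  ∑ (λ v → bit (f (nth (pre ++ mid ++ post) v v))) (length pre) (length mid) ≡ count f mid
∑-nth f pre [] post = refl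
∑-nth f pre (x ∷ mid) post = cong₂ _+_ (cong (λ t → bit (f t)) (nth-mid pre x (mid ++ post) (length pre)))
  (trans (cong (λ a → ∑ (λ v → bit (f (nth (pre ++ x ∷ mid ++ post) v v))) a (length mid)) (sym (trans (length-++ pre)
      (+-comm (length pre) 1))))
    (trans (∑-cong (length (pre ++ x ∷ [])) (length mid) λ v → cong (λ l → bit (f (nth l v v)))
        (sym (++-assoc pre (x ∷ []) (mid ++ post))))
      (∑-nth f (pre ++ x ∷ []) mid post)))

-- Of a median order only local optimality is used: no vertex gains forward arcs by moving to the right (BadR) or
-- to the left (BadL).
module Median (A : ℕ → ℕ → Bool) where
  outs inns : ℕ → List ℕ → ℕ
  outs x = count (A x)
  inns x = count (λ y → A y x)

  forward : List ℕ → ℕ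
  forward []      = 0
  forward (x ∷ l) = outs x l + forward l

  cross : List ℕ → List ℕ → ℕ
  cross [] ys = 0
  cross (x ∷ xs) ys = outs x ys + cross xs ys

  forward-++ : ∀ xs ys → forward (xs ++ ys) ≡ forward xs + cross xs ys + forward ys
  forward-++ [] ys = refl
  forward-++ (x ∷ xs) ys = arith-66 (outs x (xs ++ ys)) (outs x xs) (outs x ys) (forward (xs ++ ys)) (forward xs)
      (cross xs ys) (forward ys) (count-++ (A x) xs ys) (forward-++ xs ys)

  cross-cong : ∀ xs {ys zs} → (∀ f → count f ys ≡ count f zs) → cross xs ys ≡ cross xs zs
  cross-cong [] h = refl
  cross-cong (x ∷ xs) h = cong₂ _+_ (h (A x)) (cross-cong xs h)

  cross-one : ∀ xs x ys → cross xs (x ∷ ys) ≡ inns x xs + cross xs ys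
  cross-one [] x ys = refl
  cross-one (z ∷ xs) x ys = arith-1 (bit (A z x)) (outs z ys) (inns x xs) (cross xs ys) (cross xs (x ∷ ys))
      (cross-one xs x ys)

  count-move : ∀ f mid x post → count f (x ∷ mid ++ post) ≡ count f (mid ++ x ∷ post)
  count-move f mid x post = arith-67 (bit (f x)) (count f mid) (count f post) (count f (mid ++ post))
      (count f (mid ++ x ∷ post)) (count-++ f mid post) (count-++ f mid (x ∷ post))

  -- Only the pairs formed by `x` and an element of `mid` change their order.
  forward-move : ∀ pre mid x post →
    forward (pre ++ x ∷ mid ++ post) + inns x mid ≡ forward (pre ++ mid ++ x ∷ post) + outs x mid
  forward-move pre mid x post =
    (arith-68 (forward (pre ++ x ∷ mid ++ post)) (forward (pre ++ mid ++ x ∷ post)) (forward pre)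
        (cross pre (x ∷ mid ++ post)) (cross pre (mid ++ x ∷ post)) (outs x (mid ++ post)) (forward (mid ++ post))
        (forward (mid ++ x ∷ post)) (forward mid) (cross mid post) (cross mid (x ∷ post)) (forward post) (outs x mid)
        (outs x post) (inns x mid) (forward-++ pre (x ∷ mid ++ post)) (forward-++ pre (mid ++ x ∷ post))
        (cross-cong pre (λ f → count-move f mid x post)) (count-++ (A x) mid post) (forward-++ mid post)
        (forward-++ mid (x ∷ post)) (cross-one mid x post))

  forward≤ : ∀ l → forward l ≤ length l * length l
  forward≤ [] = z≤n
  forward≤ (x ∷ l) = arith-69 (outs x l) (forward l) (length l) (count≤ (A x) l) (forward≤ l)

  BadR BadL : List ℕ → Set
  BadR l = ∃ λ pre → ∃ λ x → ∃ λ mid → ∃ λ post → l ≡ pre ++ x ∷ mid ++ post × outs x mid < inns x mid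
  BadL l = ∃ λ pre → ∃ λ mid → ∃ λ x → ∃ λ post → l ≡ pre ++ mid ++ x ∷ post × inns x mid < outs x mid

  badR-head : ∀ x a b l → Dec (∃ λ mid → ∃ λ post → l ≡ mid ++ post × a + outs x mid < b + inns x mid)
  badR-head x a b l with a <? b
  ... | yes p = yes ([] , l , refl , subst₂ _<_ (sym (+-identityʳ a)) (sym (+-identityʳ b)) p)
  badR-head x a b [] | no n = no λ { ([] , _ , _ , p) → n (subst₂ _<_ (+-identityʳ a) (+-identityʳ b) p) }
  badR-head x a b (y ∷ l) | no n with badR-head x (a + bit (A x y)) (b + bit (A y x)) l
  ... | yes (mid , post , refl , p) = yes (y ∷ mid , post , refl , subst₂ _<_ (+-assoc a _ _) (+-assoc b _ _) p)
  ... | no m = no λ { ([] , _ , _ , p) → n (subst₂ _<_ (+-identityʳ a) (+-identityʳ b) p)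
                    ; (_ ∷ mid , post , refl , p) → m (mid , post , refl , subst₂ _<_ (sym (+-assoc a _ _))
                        (sym (+-assoc b _ _)) p) }

  badR? : ∀ l → Dec (BadR l)
  badR? [] = no λ { ([] , _ , _ , _ , () , _) ; (_ ∷ _ , _ , _ , _ , () , _) }
  badR? (x ∷ l) with badR-head x 0 0 l | badR? l
  ... | yes (mid , post , refl , p) | _ = yes ([] , x , mid , post , refl , p)
  ... | no _ | yes (pre , y , mid , post , refl , p) = yes (x ∷ pre , y , mid , post , refl , p)
  ... | no n | no m = no λ { ([] , _ , mid , post , refl , p) → n (mid , post , refl , p)
                           ; (_ ∷ pre , y , mid , post , refl , p) → m (pre , y , mid , post , refl , p) }

  badL-head : ∀ acc l → Dec (∃ λ mid → ∃ λ x → ∃ λ post → l ≡ mid ++ x ∷ post × inns x (acc ++ mid) < outs x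
      (acc ++ mid))
  badL-head acc [] = no λ { ([] , _ , _ , () , _) ; (_ ∷ _ , _ , _ , () , _) }
  badL-head acc (x ∷ l) with inns x (acc ++ []) <? outs x (acc ++ []) | badL-head (acc ++ x ∷ []) l
  ... | yes p | _ = yes ([] , x , l , refl , p)
  ... | no _ | yes (mid , y , post , refl , p) = yes (x ∷ mid , y , post , refl ,
    subst (λ t → inns y t < outs y t) (++-assoc acc (x ∷ []) mid) p)
  ... | no n | no m = no λ { ([] , _ , _ , refl , p) → n p
                           ; (_ ∷ mid , y , post , refl , p) → m (mid , y , post , refl , subst (λ t → inns y t < outs
                               y t) (sym (++-assoc acc (x ∷ []) mid)) p) }

  badL? : ∀ l → Dec (BadL l)
  badL? l with badL-head [] l
  ... | yes (mid , x , post , eq , p) = yes ([] , mid , x , post , eq , p)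
  badL? [] | no n = no λ { ([] , mid , x , post , eq , p) → n (mid , x , post , eq , p) ; (_ ∷ _ , _ , _ , _ , () , _)
      }
  badL? (y ∷ l) | no n with badL? l
  ... | yes (pre , mid , x , post , refl , p) = yes (y ∷ pre , mid , x , post , refl , p)
  ... | no m = no λ { ([] , mid , x , post , eq , p) → n (mid , x , post , eq , p)
                    ; (_ ∷ pre , mid , x , post , refl , p) → m (pre , mid , x , post , refl , p) }

  move-len : ∀ pre mid x (post : List ℕ) → length (pre ++ mid ++ x ∷ post) ≡ length (pre ++ x ∷ mid ++ post)
  move-len pre mid x post = arith-70 (length (pre ++ mid ++ x ∷ post)) (length (pre ++ x ∷ mid ++ post)) (length pre)
      (length (mid ++ x ∷ post)) (length (mid ++ post)) (length mid) (length post) (length-++ pre {mid ++ x ∷ post})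
      (length-++ pre {x ∷ mid ++ post}) (length-++ mid {x ∷ post}) (length-++ mid {post})

  move-occ : ∀ pre mid x post v → occ (pre ++ mid ++ x ∷ post) v ≡ occ (pre ++ x ∷ mid ++ post) v
  move-occ pre mid x post v = arith-71 (occ (pre ++ mid ++ x ∷ post) v) (occ (pre ++ x ∷ mid ++ post) v) (occ pre v)
      (occ (mid ++ x ∷ post) v) (occ (mid ++ post) v) (occ mid v) (occ post v) (δ x v) (occ-++ pre (mid ++ x ∷ post)
      v) (occ-++ pre (x ∷ mid ++ post) v) (occ-++ mid (x ∷ post) v) (occ-++ mid post v)

  -- Each improving move gains a forward arc, and their number is bounded by the square of the
  -- length; `k` is the remaining budget.
  improve : ∀ k l → length l * length l ≤ k + forward l →
    ∃ λ l′ → length l′ ≡ length l × (∀ v → occ l′ v ≡ occ l v) × ¬ BadR l′ × ¬ BadL l′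
  improve k l bound with badR? l | badL? l
  ... | no r | no s = l , refl , (λ v → refl) , r , s
  improve zero l bound | yes (pre , x , mid , post , refl , p) | _ = ⊥-elim
    (arith-72 (length l * length l) (forward l) (forward (pre ++ mid ++ x ∷ post)) (inns x mid) (outs x mid) bound p
        (forward-move pre mid x post) (subst (λ t → forward (pre ++ mid ++ x ∷ post) ≤ t * t) (move-len pre mid x
        post) (forward≤ (pre ++ mid ++ x ∷ post))))
  improve (suc k) l bound | yes (pre , x , mid , post , refl , p) | _ with improve k (pre ++ mid ++ x ∷ post)
      (subst (λ t → t * t ≤ k + forward (pre ++ mid ++ x ∷ post)) (sym (move-len pre mid x post))
      (arith-73 (length l * length l) (forward l) (forward (pre ++ mid ++ x ∷ post)) (inns x mid) (outs x mid) k bound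
          p (forward-move pre mid x post)))
  ... | l′ , len , eq , r , s = l′ , trans len (move-len pre mid x post) , (λ v → trans (eq v) (move-occ pre mid x
      post v)) , r , s
  improve zero l bound | no _ | yes (pre , mid , x , post , refl , p) = ⊥-elim
    (arith-74 (length l * length l) (forward l) (forward (pre ++ x ∷ mid ++ post)) (inns x mid) (outs x mid) bound p
        (forward-move pre mid x post) (subst (λ t → forward (pre ++ x ∷ mid ++ post) ≤ t * t)
        (sym (move-len pre mid x post)) (forward≤ (pre ++ x ∷ mid ++ post))))
  improve (suc k) l bound | no _ | yes (pre , mid , x , post , refl , p) with improve k (pre ++ x ∷ mid ++ post)
      (subst (λ t → t * t ≤ k + forward (pre ++ x ∷ mid ++ post)) (move-len pre mid x post)
      (arith-75 (length l * length l) (forward l) (forward (pre ++ x ∷ mid ++ post)) (inns x mid) (outs x mid) k bound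
          p (forward-move pre mid x post)))
  ... | l′ , len , eq , r , s = l′ , trans len (sym (move-len pre mid x post)) , (λ v → trans (eq v)
      (sym (move-occ pre mid x post v))) , r , s

  module _ (irr : ∀ i → A i i ≡ false) (tot : ∀ {i j} → i ≢ j → A i j ≡ not (A j i)) where
    outs+inns : ∀ x l → (∀ v → In l v → v ≢ x) → outs x l + inns x l ≡ length l
    outs+inns x [] h = refl
    outs+inns x (y ∷ l) h = arith-76 (bit (A x y)) (bit (A y x)) (outs x l) (inns x l) (length l)
        (one (tot (h y (In-here y l)))) (outs+inns x l (λ v i → h v (In-there y i)))
      where
      one : ∀ {a b} → a ≡ not b → bit b + bit a ≡ 1
      one {b = true} refl = refl
      one {b = false} refl = refl

    -- The vertices are the numbers below m; A extends the tournament so that all arcs leaving [0, m) go forward.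
    module _ (m : ℕ) (below : ∀ {i j} → i < m → m ≤ j → A i j ≡ true) (above : ∀ {i j} → m ≤ i → i < j → A i j ≡ true)
      (l : List ℕ) (len : length l ≡ m) (uq : Unique l) (small : ∀ v → In l v → v < m) (okR : ¬ BadR l) (okL : ¬ BadL l) where

      -- The default value of `nth` is the index itself, which continues the order by the identity
      -- from `m` on.
      σ : ℕ → ℕ
      σ i = nth l i i

      σ-in : ∀ {i} → i < m → σ i < m
      σ-in {i} p = small (σ i) (nth-In l i i (subst (i <_) (sym len) p))

      σ-out : ∀ {i} → m ≤ i → σ i ≡ i
      σ-out {i} p = nth-out l i i (subst (_≤ i) (sym len) p)

      σ-inj : ∀ {i j} → σ i ≡ σ j → i ≡ j
      σ-inj {i} {j} eq with i <? m | j <? m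
      ... | yes p | yes q = nth-inj l uq i j i j (subst (i <_) (sym len) p) (subst (j <_) (sym len) q) eq
      ... | yes p | no q = ⊥-elim (<-irrefl refl (<-≤-trans (σ-in p) (≤-trans (≮⇒≥ q)
          (≤-reflexive (sym (trans eq (σ-out (≮⇒≥ q))))))))
      ... | no p | yes q = ⊥-elim (<-irrefl refl (<-≤-trans (σ-in q) (≤-trans (≮⇒≥ p)
          (≤-reflexive (trans (sym (σ-out (≮⇒≥ p))) eq)))))
      ... | no p | no q = trans (sym (σ-out (≮⇒≥ p))) (trans eq (σ-out (≮⇒≥ q)))

      R : ℕ → ℕ → Bool
      R i j = A (σ i) (σ j)

      all-one : ∀ (f : ℕ → Bool) a w → (∀ v → a ≤ v → v < a + w → f v ≡ true) → ∑ (λ v → bit (f v)) a w ≡ w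
      all-one f a zero h = refl
      all-one f a (suc w) h = cong₂ _+_ (cong bit (h a ≤-refl (m<m+n a z<s))) (all-one f (suc a) w λ v p q → h v
          (<⇒≤ p) (subst (v <_) (sym (+-suc a w)) q))

      ∑≤ : ∀ (f : ℕ → Bool) a w → ∑ (λ v → bit (f v)) a w ≡ w → w ≤ 2 * ∑ (λ v → bit (f v)) a w
      ∑≤ f a w e = arith-77 w (∑ (λ v → bit (f v)) a w) e

      distinct : ∀ {pre x mid post} → l ≡ pre ++ x ∷ mid ++ post → ∀ v → In mid v → v ≢ x
      distinct {pre} {x} {mid} {post} refl v i = ≢-head {x} {mid ++ post}
          (Unique-⊑ (λ t → ≤-trans (m≤n+m _ (occ pre t)) (≤-reflexive (sym (occ-++ pre _ t)))) uq)
        (In-left mid i)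

      distinct′ : ∀ {pre x mid post} → l ≡ pre ++ mid ++ x ∷ post → ∀ v → In mid v → v ≢ x
      distinct′ {pre} {x} {mid} {post} refl v i = ≢-head {x} {mid ++ post} (Unique-⊑ (λ t → ≤-trans
          (arith-78 (δ x t) (occ mid t) (occ post t) (occ (mid ++ post) t) (occ (mid ++ x ∷ post) t) (occ pre t)
              (occ-++ mid post t) (occ-++ mid (x ∷ post) t)) (≤-reflexive (sym (occ-++ pre _ t)))) uq)
        (In-left mid i)

      -- Moving the vertex at position `x` behind the next `w` ones gains nothing (`okR`), so among
      -- these it has at least as many out-neighbours as in-neighbours.
      right-in : ∀ x w → suc x + w ≤ m → w ≤ 2 * ∑ (λ v → bit (R x v)) (suc x) w
      right-in x w p with split-at l x (≤-trans (m≤m+n x (suc w)) (≤-trans (≤-reflexive (+-suc x w))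
          (subst (suc x + w ≤_) (sym len) p)))
      ... | pre , rest , eq , len-pre with split-at rest (suc w) (+-cancelˡ-≤ x (suc w) _
          (≤-trans (≤-reflexive (+-suc x w)) (≤-trans p (≤-reflexive (trans (sym len) (trans (cong length eq)
          (trans (length-++ pre) (cong (_+ length rest) len-pre))))))))
      ... | y ∷ mid , post , refl , len-mid = arith-79 w (∑ (λ v → bit (R x v)) (suc x) w) (outs y mid) (inns y mid)
          (length mid) sum (outs+inns y mid (distinct {pre} {y} {mid} {post} eq)) (suc-injective len-mid)
          (≮⇒≥ (λ q → okR (pre , y , mid , post , eq , q)))
        where
        eq′ : l ≡ (pre ++ y ∷ []) ++ mid ++ post
        eq′ = trans eq (sym (++-assoc pre (y ∷ []) (mid ++ post)))
        σx : σ x ≡ y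
        σx = trans (cong₂ (λ l i → nth l i x) eq (sym len-pre)) (nth-mid pre y (mid ++ post) x)
        sum : ∑ (λ v → bit (R x v)) (suc x) w ≡ outs y mid
        sum = trans (cong₂ (λ a k → ∑ (λ v → bit (R x v)) a k) (sym (trans (length-++ pre) (trans (+-comm _ 1)
            (cong suc len-pre)))) (sym (suc-injective len-mid)))
          (trans (∑-cong (length (pre ++ y ∷ [])) (length mid) λ v → cong₂ (λ s l → bit (A s (nth l v v))) σx eq′)
              (∑-nth (A y) (pre ++ y ∷ []) mid post))

      left-in : ∀ x w → x + w < m → w ≤ 2 * ∑ (λ v → bit (R v (x + w))) x w
      left-in x w p with split-at l x (≤-trans (m≤m+n x w) (≤-trans (<⇒≤ p) (≤-reflexive (sym len))))
      ... | pre , rest , eq , len-pre = go (split-at rest w (≤-trans (m≤m+n w 1) w+1≤))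
        where
        w+1≤ : w + 1 ≤ length rest
        w+1≤ = arith-80 x w m (length rest) (length pre) (length l) (length (pre ++ rest)) p len (cong length eq)
            (length-++ pre {rest}) len-pre
        go : (∃ λ mid → ∃ λ post → rest ≡ mid ++ post × length mid ≡ w) → w ≤ 2 * ∑ (λ v → bit (R v (x + w))) x w
        go (mid , [] , refl , len-mid) = ⊥-elim (arith-81 w (length (mid ++ [])) (length mid) w+1≤ (length-++ mid
            {[]}) len-mid)
        go (mid , y ∷ post , refl , len-mid) = arith-82 w (∑ (λ v → bit (R v (x + w))) x w) (outs y mid) (inns y mid)
            (length mid) sum (outs+inns y mid (distinct′ {pre} {y} {mid} {post} eq)) len-mid
            (≮⇒≥ (λ q → okL (pre , mid , y , post , eq , q)))
          where
          eq′ : l ≡ (pre ++ mid) ++ y ∷ post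
          eq′ = trans eq (sym (++-assoc pre mid (y ∷ post)))
          σy : σ (x + w) ≡ y
          σy = trans (cong₂ (λ l i → nth l i (x + w)) eq′ (sym (trans (length-++ pre) (cong₂ _+_ len-pre len-mid))))
              (nth-mid (pre ++ mid) y post (x + w))
          sum : ∑ (λ v → bit (R v (x + w))) x w ≡ inns y mid
          sum = trans (cong₂ (λ a k → ∑ (λ v → bit (R v (x + w))) a k) (sym len-pre) (sym len-mid))
            (trans (∑-cong (length pre) (length mid) λ v → cong₂ (λ s l → bit (A (nth l v v) s)) σy eq)
                (∑-nth (λ z → A z y) pre mid (y ∷ post)))

      out-true : ∀ {x v} → x < v → m ≤ v → R x v ≡ true
      out-true {x} {v} p q with x <? m
      ... | yes r = subst (λ t → A (σ x) t ≡ true) (sym (σ-out q)) (below (σ-in r) q)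
      ... | no r = subst₂ (λ s t → A s t ≡ true) (sym (σ-out (≮⇒≥ r))) (sym (σ-out q)) (above (≮⇒≥ r) p)

      tour : Tour
      tour = record { R = R ; irr = λ i → irr (σ i) ; tot = λ n → tot (n ∘ σ-inj) ; halfR = halfR ; halfL = halfL }
        where
        halfR : ∀ x w → w ≤ 2 * ∑ (λ v → bit (R x v)) (suc x) w
        halfR x w with ≤-total (suc x + w) m
        ... | inj₁ p = right-in x w p
        ... | inj₂ q with ≤-total (suc x) m
        ... | inj₂ r = ∑≤ (R x) (suc x) w (all-one (R x) (suc x) w λ v p _ → out-true p (≤-trans r p))
        -- The interval crosses `m` and is cut there: the first part satisfies the half condition,
        -- and the second consists of out-neighbours only.
        ... | inj₁ r with m≤n⇒∃[o]m+o≡n r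
        ... | w₁ , refl with m≤n⇒∃[o]m+o≡n (+-cancelˡ-≤ (suc x) w₁ w q)
        ... | w₂ , refl = arith-83 (w₁) (w₂) (∑ (λ v → bit (R x v)) (suc x) (w₁ + w₂)) (∑ (λ v → bit (R x v)) (suc x)
            w₁) (∑ (λ v → bit (R x v)) (suc x + w₁) w₂) (∑-split (λ v → bit (R x v)) (suc x) w₁ w₂) (right-in x w₁
            ≤-refl) (all-one (R x) (suc x + w₁) w₂ (λ v p _ → out-true (≤-trans (m≤m+n (suc x) w₁) p) p))
        halfL : ∀ x w → w ≤ 2 * ∑ (λ v → bit (R v (x + w))) x w
        halfL x w with x + w <? m
        ... | yes p = left-in x w p
        ... | no q = ∑≤ (λ v → R v (x + w)) x w (all-one (λ v → R v (x + w)) x w λ v _ r → out-true r (≮⇒≥ q))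

-- Rooting an oriented tree and counting its leaves

length≤ : ∀ {A : Set} {xs ys : List A} → UP.Unique xs → (∀ {x} → x ∈ xs → x ∈ ys) → length xs ≤ length ys
length≤ {xs = []} u h = z≤n
length≤ {xs = x ∷ xs} (nx ∷ u) h with ∈-∃++ (h (here refl))
... | as , bs , refl = arith-84 (length xs) (length (as ++ x ∷ bs)) (length (as ++ bs)) (length as) (length bs)
    (length≤ u keep) (length-++ as {x ∷ bs}) (length-++ as {bs})
  where
  keep : ∀ {y} → y ∈ xs → y ∈ as ++ bs
  keep {y} i with ∈-++⁻ as (h (there i))
  ... | inj₁ j = ∈-++⁺ˡ j
  ... | inj₂ (here refl) = ⊥-elim (lookup nx i refl)
  ... | inj₂ (there j) = ∈-++⁺ʳ as j

T⇒ : ∀ {b} → IsTrue b → b ≡ true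
T⇒ {true} _ = refl

⇒T : ∀ {b} → b ≡ true → IsTrue b
⇒T refl = tt

module Growth {n : ℕ} (D : Digraph n) where
  Arcs : Bool → Fin n → Fin n → Set
  Arcs true  u v = D u v ≡ true
  Arcs false u v = D v u ≡ true

  nums : Forest (Fin n) → List ℕ
  nums nil           = []
  nums (add s a k b) = toℕ a ∷ nums k ++ nums b

  data Valid : Fin n → Forest (Fin n) → Set where
    nil : ∀ {r} → Valid r nil
    add : ∀ {r s a k b} → Arcs s r a → Valid a k → Valid r b → Valid r (add s a k b)

  nums-length : ∀ F → length (nums F) ≡ order F
  nums-length nil = refl
  nums-length (add s a k b) = cong suc (trans (length-++ (nums k)) (cong₂ _+_ (nums-length k) (nums-length b)))

  -- The search goes on below and beside a hit, so the new child appears once for each occurrence of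
  -- `w`. `insert-occ` keeps this number as a factor; it is 1 when labels are distinct. The root is
  -- not a label of the forest and is treated separately in `grow`.
  insert : Fin n → Bool → Fin n → Forest (Fin n) → Forest (Fin n)
  insert w s v nil = nil
  insert w s v (add t a k b) with toℕ a ≟ toℕ w
  ... | yes _ = add t a (add s v nil (insert w s v k)) (insert w s v b)
  ... | no _  = add t a (insert w s v k) (insert w s v b)

  insert-occ : ∀ w s v F x → occ (nums (insert w s v F)) x ≡ occ (nums F) x + occ (nums F) (toℕ w) * δ (toℕ v) x
  insert-occ w s v nil x = refl
  insert-occ w s v (add t a k b) x with toℕ a ≟ toℕ w
  ... | yes eq = arith-85 (δ (toℕ a) x) (δ (toℕ v) x) (occ (nums (insert w s v k)) x) (occ (nums (insert w s v b)) x)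
      (occ (nums (insert w s v k) ++ nums (insert w s v b)) x) (occ (nums k) x) (occ (nums b) x)
      (occ (nums k ++ nums b) x) ((δ (toℕ a) (toℕ w) + occ (nums k ++ nums b) (toℕ w)) * δ (toℕ v) x) (occ (nums k)
      (toℕ w) * δ (toℕ v) x) (occ (nums b) (toℕ w) * δ (toℕ v) x) (insert-occ w s v k x) (insert-occ w s v b x)
      (occ-++ (nums (insert w s v k)) (nums (insert w s v b)) x) (occ-++ (nums k) (nums b) x) expand
    where
    expand : (δ (toℕ a) (toℕ w) + occ (nums k ++ nums b) (toℕ w)) * δ (toℕ v) x ≡ δ (toℕ v) x + occ (nums k) (toℕ w) *
        δ (toℕ v) x + occ (nums b) (toℕ w) * δ (toℕ v) x
    expand = trans (cong₂ (λ c d → (c + d) * δ (toℕ v) x) (trans (cong (δ (toℕ a)) (sym eq)) (δ-refl (toℕ a)))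
        (occ-++ (nums k) (nums b) (toℕ w)))
      (arith-86 (occ (nums k) (toℕ w)) (occ (nums b) (toℕ w)) (δ (toℕ v) x))
  ... | no ne = arith-87 (δ (toℕ a) x) (occ (nums (insert w s v k)) x) (occ (nums (insert w s v b)) x)
      (occ (nums (insert w s v k) ++ nums (insert w s v b)) x) (occ (nums k) x) (occ (nums b) x)
      (occ (nums k ++ nums b) x) ((δ (toℕ a) (toℕ w) + occ (nums k ++ nums b) (toℕ w)) * δ (toℕ v) x) (occ (nums k)
      (toℕ w) * δ (toℕ v) x) (occ (nums b) (toℕ w) * δ (toℕ v) x) (insert-occ w s v k x) (insert-occ w s v b x)
      (occ-++ (nums (insert w s v k)) (nums (insert w s v b)) x) (occ-++ (nums k) (nums b) x) expand
    where
    expand : (δ (toℕ a) (toℕ w) + occ (nums k ++ nums b) (toℕ w)) * δ (toℕ v) x ≡ occ (nums k) (toℕ w) * δ (toℕ v) x +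
        occ (nums b) (toℕ w) * δ (toℕ v) x
    expand = trans (cong₂ (λ c d → (c + d) * δ (toℕ v) x) (δ-≢ ne) (occ-++ (nums k) (nums b) (toℕ w)))
      (arith-88 (occ (nums k) (toℕ w)) (occ (nums b) (toℕ w)) (δ (toℕ v) x))

  insert-valid : ∀ {w s v} → Arcs s w v → ∀ {r F} → Valid r F → Valid r (insert w s v F)
  insert-valid e nil = nil
  insert-valid {w} e (add {a = a} e′ V W) with toℕ a ≟ toℕ w
  ... | yes eq = add e′ (add (subst (λ t → Arcs _ t _) (sym (toℕ-injective eq)) e) nil (insert-valid e V))
      (insert-valid e W)
  ... | no _ = add e′ (insert-valid e V) (insert-valid e W)

  adj-arc : ∀ {u v} → adj D u v ≡ true → ∃ λ s → Arcs s u v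
  adj-arc {u} {v} p with D u v in eq
  ... | true = true , eq
  ... | false = false , p

  arc-adj : ∀ s {u v} → Arcs s u v → adj D u v ≡ true × adj D v u ≡ true
  arc-adj true {u} {v} p rewrite p = refl , lem (D v u)
    where
    lem : ∀ b → b ∨ true ≡ true
    lem true = refl
    lem false = refl
  arc-adj false {u} {v} p = proj₂ (arc-adj true p) , proj₁ (arc-adj true p)

  record Spanning (r : Fin n) (F : Forest (Fin n)) : Set where
    field
      unique : Unique (toℕ r ∷ nums F)
      valid  : Valid r F

  crossing : ∀ L {u v} → In L (toℕ u) → ¬ In L (toℕ v) → Walk D u v → ∃ λ w → ∃ λ z → adj D w z ≡ true × In L (toℕ w)
      × ¬ In L (toℕ z)
  crossing L i o here = ⊥-elim (o i)
  crossing L i o (step {w = w} e walk) with 1 ≤? occ L (toℕ w)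
  ... | yes j = crossing L (mk j) o walk
  ... | no j = _ , w , e , i , λ k → j (hit k)

  missing : ∀ L → length L < n → ∃ λ (v : Fin n) → ¬ In L (toℕ v)
  missing L short with search (λ v → occ L v ≟ 0) 0 n
  ... | yes (v , _ , v<n , z) = fromℕ< v<n , λ i → <-irrefl refl (subst (1 ≤_) (trans (cong (occ L) (toℕ-fromℕ< v<n))
      z) (hit i))
  ... | no none = ⊥-elim (<-irrefl refl (<-≤-trans short (≤-trans (all 0 n λ v _ p → n≢0⇒n>0 λ z → none (v , z≤n , p ,
      z)) (∑-occ≤ L 0 n))))
    where
    all : ∀ a w → (∀ v → a ≤ v → v < a + w → 1 ≤ occ L v) → w ≤ ∑ (occ L) a w
    all a zero h = z≤n
    all a (suc w) h = +-mono-≤ (h a ≤-refl (m<m+n a z<s)) (all (suc a) w λ v p q → h v (<⇒≤ p) (subst (v <_)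
        (sym (+-suc a w)) q))

  -- A walk from the root to a missing vertex leaves the spanned set along some edge, and the outer
  -- end of this edge becomes a new child of the inner one.
  grow : (∀ u v → Walk D u v) → ∀ r F → Spanning r F → 1 + order F < n → ∃ λ F′ → Spanning r F′ × order F′ ≡ 1 + order
      F
  grow conn r F S small with missing (toℕ r ∷ nums F) (subst (_< n) (cong suc (sym (nums-length F))) small)
  ... | u , u∉ with crossing (toℕ r ∷ nums F) (In-here (toℕ r) (nums F)) u∉ (conn r u)
  ... | w , v , e , w∈ , v∉ with adj-arc e
  ... | s , a = result (toℕ w ≟ toℕ r)
    where
    open Spanning S
    v0 : occ (toℕ r ∷ nums F) (toℕ v) ≡ 0
    v0 = n≤0⇒n≡0 (≤-pred (≰⇒> λ p → v∉ (mk p)))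
    unique′ : ∀ G → (∀ x → occ (nums G) x ≡ occ (nums F) x + δ (toℕ v) x) → Unique (toℕ r ∷ nums G)
    unique′ G eq = mk λ x → go x (toℕ v ≟ x)
      where
      go : ∀ x → Dec (toℕ v ≡ x) → occ (toℕ r ∷ nums G) x ≤ 1
      go x (yes refl) = ≤-reflexive (arith-89 (δ (toℕ r) (toℕ v)) (occ (nums G) (toℕ v)) (occ (nums F) (toℕ v))
          (δ (toℕ v) (toℕ v)) (eq (toℕ v)) v0 (δ-refl (toℕ v)))
      go x (no ne) = arith-90 (δ (toℕ r) x) (occ (nums G) x) (occ (nums F) x) (δ (toℕ v) x) (eq x) (δ-≢ ne)
          (once unique x)
    sized : ∀ G → (∀ x → occ (nums G) x ≡ occ (nums F) x + δ (toℕ v) x) → Valid r G → order G ≡ 1 + order F → ∃ λ F′ →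
        Spanning r F′ × order F′ ≡ 1 + order F
    sized G eq V sz = G , record { unique = unique′ G eq ; valid = V } , sz
    size-insert : ∀ G → order (insert w s v G) ≡ order G + occ (nums G) (toℕ w)
    size-insert nil = refl
    size-insert (add t a k b) with toℕ a ≟ toℕ w
    ... | yes eq = arith-91 (order (insert w s v k)) (order (insert w s v b)) (order k) (order b) (occ (nums k)
        (toℕ w)) (occ (nums b) (toℕ w)) (occ (nums k ++ nums b) (toℕ w)) (δ (toℕ a) (toℕ w)) (size-insert k)
        (size-insert b) (occ-++ (nums k) (nums b) (toℕ w)) (trans (cong (δ (toℕ a)) (sym eq)) (δ-refl (toℕ a)))
    ... | no ne = arith-92 (order (insert w s v k)) (order (insert w s v b)) (order k) (order b) (occ (nums k)
        (toℕ w)) (occ (nums b) (toℕ w)) (occ (nums k ++ nums b) (toℕ w)) (δ (toℕ a) (toℕ w)) (size-insert k)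
        (size-insert b) (occ-++ (nums k) (nums b) (toℕ w)) (δ-≢ ne)
    result : Dec (toℕ w ≡ toℕ r) → ∃ λ F′ → Spanning r F′ × order F′ ≡ 1 + order F
    result (yes eq) = sized (add s v nil F) (λ x → +-comm (δ (toℕ v) x) _) (add (subst (λ t → Arcs s t v)
        (toℕ-injective eq) a) nil valid) refl
    result (no ne) = sized (insert w s v F)
        (λ x → trans (insert-occ w s v F x) (cong (occ (nums F) x +_) (trans (cong (_* δ (toℕ v) x) w1)
            (+-identityʳ _))))
        (insert-valid a valid) (trans (size-insert F) (trans (cong (order F +_) w1) (+-comm (order F) 1)))
      where
      w1 : occ (nums F) (toℕ w) ≡ 1
      w1 = ≤-antisym (once (Unique-tail unique) (toℕ w)) (case In-case {toℕ r} {nums F} w∈ of λ { (inj₁ e) → ⊥-elim (ne e) ; (inj₂ (mk i)) → i })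

  spanning : (∀ u v → Walk D u v) → ∀ r → ∃ λ F → Spanning r F × n ≤ 1 + order F
  spanning conn r = go n nil (record { unique = mk λ v → ≤-trans (≤-reflexive (+-identityʳ _)) (δ≤1 (toℕ r) v) ; valid
      = nil }) (m≤m+n n 1)
    where
    go : ∀ k F → Spanning r F → n ≤ k + (1 + order F) → ∃ λ F → Spanning r F × n ≤ 1 + order F
    go zero F S le = F , S , le
    go (suc k) F S le with 1 + order F <? n
    ... | no p = F , S , ≮⇒≥ p
    ... | yes p with grow conn r F S p
    ... | F′ , S′ , eq = go k F′ S′ (arith-93 n k (order F) (order F′) le eq)

  -- edgeCount counts the pairs (u , v) with u < v.
  ordered : Fin n → Fin n → Fin n × Fin n
  ordered u v with toℕ u <? toℕ v
  ... | yes _ = u , v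
  ... | no _  = v , u

  pairs : Fin n → Forest (Fin n) → List (Fin n × Fin n)
  pairs r nil           = []
  pairs r (add s a k b) = ordered r a ∷ pairs a k ++ pairs r b

  pairs-length : ∀ r F → length (pairs r F) ≡ order F
  pairs-length r nil = refl
  pairs-length r (add s a k b) = cong suc (trans (length-++ (pairs a k)) (cong₂ _+_ (pairs-length a k) (pairs-length r
      b)))

  Touch : Fin n → Fin n × Fin n → Set
  Touch x (u , v) = x ≡ u ⊎ x ≡ v

  ordered-left : ∀ u v → Touch u (ordered u v)
  ordered-left u v with toℕ u <? toℕ v
  ... | yes _ = inj₁ refl
  ... | no _ = inj₂ refl

  ordered-right : ∀ u v → Touch v (ordered u v)
  ordered-right u v with toℕ u <? toℕ v
  ... | yes _ = inj₂ refl
  ... | no _ = inj₁ refl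

  touch-ordered : ∀ {x} u v → Touch x (ordered u v) → x ≡ u ⊎ x ≡ v
  touch-ordered u v t with toℕ u <? toℕ v
  ... | yes _ = t
  touch-ordered u v (inj₁ e) | no _ = inj₂ e
  touch-ordered u v (inj₂ e) | no _ = inj₁ e

  pairs-In : ∀ {x e} r F → e ∈ pairs r F → Touch x e → In (toℕ r ∷ nums F) (toℕ x)
  pairs-In r (add s a k b) (here refl) t with touch-ordered r a t
  ... | inj₁ refl = In-here (toℕ r) _
  ... | inj₂ refl = In-there (toℕ r) (In-here (toℕ a) _)
  pairs-In {x} r (add s a k b) (there i) t with ∈-++⁻ (pairs a k) i
  ... | inj₁ j = In-⊑ (λ v → (arith-94 (δ (toℕ r) v) (δ (toℕ a) v) (occ (nums k) v) (occ (nums b) v)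
      (occ (nums k ++ nums b) v) (occ-++ (nums k) (nums b) v))) (pairs-In a k j t)
  ... | inj₂ j = In-⊑ (λ v → (arith-95 (δ (toℕ r) v) (δ (toℕ a) v) (occ (nums k) v) (occ (nums b) v)
      (occ (nums k ++ nums b) v) (occ-++ (nums k) (nums b) v))) (pairs-In r b j t)

  module Parts {r : Fin n} {s : Bool} {a : Fin n} {k b : Forest (Fin n)} (u : Unique (toℕ r ∷ nums (add s a k b))) where
    left : Unique (toℕ a ∷ nums k)
    left = Unique-⊑ (λ v → (arith-94 (δ (toℕ r) v) (δ (toℕ a) v) (occ (nums k) v) (occ (nums b) v)
        (occ (nums k ++ nums b) v) (occ-++ (nums k) (nums b) v))) u
    right : Unique (toℕ r ∷ nums b)
    right = Unique-⊑ (λ v → (arith-95 (δ (toℕ r) v) (δ (toℕ a) v) (occ (nums k) v) (occ (nums b) v)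
        (occ (nums k ++ nums b) v) (occ-++ (nums k) (nums b) v))) u
    apart : ∀ {v} → In (toℕ a ∷ nums k) v → In (toℕ r ∷ nums b) v → ⊥
    apart {v} (mk i) (mk j) = arith-96 (δ (toℕ r) v) (δ (toℕ a) v) (occ (nums k) v) (occ (nums b) v)
        (occ (nums k ++ nums b) v) (occ-++ (nums k) (nums b) v) (once u v) i j

  pairs-unique : ∀ r F → Unique (toℕ r ∷ nums F) → UP.Unique (pairs r F)
  pairs-unique r nil u = []
  pairs-unique r (add s a k b) u = tabulate (λ {e} i → first e (∈-++⁻ (pairs a k) i)) ∷ both-unique (pairs-unique a k
      left) (pairs-unique r b right)
      (λ {e} i j → apart (pairs-In a k i (inj₁ {B = proj₁ e ≡ proj₂ e} refl)) (pairs-In r b j (inj₁ refl)))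
    where
    open Parts {r} {s} {a} {k} {b} u
    first : ∀ e → e ∈ pairs a k ⊎ e ∈ pairs r b → ordered r a ≢ e
    first e (inj₁ i) refl = apart (pairs-In a k i (ordered-left r a)) (In-here (toℕ r) (nums b))
    first e (inj₂ i) refl = apart (In-here (toℕ a) (nums k)) (pairs-In r b i (ordered-right r a))
    both-unique : ∀ {xs ys : List (Fin n × Fin n)} → UP.Unique xs → UP.Unique ys → (∀ {e} → e ∈ xs → e ∈ ys → ⊥) →
        UP.Unique (xs ++ ys)
    both-unique [] v h = v
    both-unique {x ∷ xs} {ys} (nx ∷ u) v h = tabulate (λ {y} i → case ∈-++⁻ xs i of λ { (inj₁ j) → lookup nx j ; (inj₂ j) refl → h (here refl) j }) ∷ both-unique u v (λ i → h (there i))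

  pairs-adj : ∀ r F → Valid r F → Unique (toℕ r ∷ nums F) → ∀ {e} → e ∈ pairs r F → adj D (proj₁ e) (proj₂ e) ≡ true ×
      toℕ (proj₁ e) < toℕ (proj₂ e)
  pairs-adj r (add s a k b) (add e V W) u (here refl) with toℕ r <? toℕ a
  ... | yes p = proj₁ (arc-adj s e) , p
  ... | no p = proj₂ (arc-adj s e) , ≤∧≢⇒< (≮⇒≥ p) (≢-head u (In-here (toℕ a) (nums k ++ nums b)))
  pairs-adj r (add s a k b) (add e V W) u (there i) with ∈-++⁻ (pairs a k) i
  ... | inj₁ j = pairs-adj a k V (Parts.left {r} {s} {a} {k} {b} u) j
  ... | inj₂ j = pairs-adj r b W (Parts.right {r} {s} {a} {k} {b} u) j

  leafs leafs′ : Fin n → Forest (Fin n) → List (Fin n)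
  leafs r nil           = []
  leafs r (add s a k b) = leafs′ a k ++ leafs r b
  leafs′ a nil             = a ∷ []
  leafs′ a F@(add _ _ _ _) = leafs a F

  leafs-length : ∀ r F → length (leafs r F) ≡ leaves F
  leafs′-length : ∀ r F → length (leafs′ r F) ≡ leaves′ F
  leafs-length r nil = refl
  leafs-length r (add s a k b) = trans (length-++ (leafs′ a k)) (cong₂ _+_ (leafs′-length a k) (leafs-length r b))
  leafs′-length r nil = refl
  leafs′-length r F@(add _ _ _ _) = leafs-length r F

  leafs-In : ∀ r F {x} → x ∈ leafs r F → In (nums F) (toℕ x)
  leafs′-In : ∀ a F {x} → x ∈ leafs′ a F → In (toℕ a ∷ nums F) (toℕ x)
  leafs-In r (add s a k b) i with ∈-++⁻ (leafs′ a k) i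
  ... | inj₁ j = In-left (toℕ a ∷ nums k) (leafs′-In a k j)
  ... | inj₂ j = In-there (toℕ a) (In-⊑ (λ v → ≤-trans (m≤n+m _ (occ (nums k) v))
      (≤-reflexive (sym (occ-++ (nums k) (nums b) v)))) (leafs-In r b j))
  leafs′-In a nil (here refl) = In-here (toℕ a) []
  leafs′-In a F@(add _ _ _ _) i = In-there (toℕ a) (leafs-In a F i)

  -- A pair recorded in another part of the forest would put the vertex there as well, against
  -- uniqueness; what remains is the pair recorded together with the leaf.
  leaf-parent : ∀ r F → Unique (toℕ r ∷ nums F) → ∀ {x} → x ∈ leafs r F → ∃ λ p → ∀ {y} → ordered x y ∈ pairs r F ⊎
      ordered y x ∈ pairs r F → y ≡ p
  leaf-parent r (add s a k b) u {x} i with ∈-++⁻ (leafs′ a k) i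
  ... | inj₂ j with leaf-parent r b (Parts.right {r} {s} {a} {k} {b} u) j
  ... | p , only = p , λ { {y} (inj₁ e) → go {y} e (ordered-left x y) inj₁ ; {y} (inj₂ e) → go {y} e (ordered-right y
      x) inj₂ }
    where
    open Parts {r} {s} {a} {k} {b} u
    xb : In (nums b) (toℕ x)
    xb = leafs-In r b j
    go : ∀ {y e} → e ∈ pairs r (add s a k b) → Touch x e → (e ∈ pairs r b → ordered x y ∈ pairs r b ⊎ ordered y x ∈
        pairs r b) → y ≡ p
    go {y} (here refl) t f with touch-ordered r a t
    ... | inj₁ refl = ⊥-elim (≢-head right xb refl)
    ... | inj₂ refl = ⊥-elim (apart (In-here (toℕ a) (nums k)) (In-there (toℕ r) xb))
    go {y} (there e∈) t f with ∈-++⁻ (pairs a k) e∈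
    ... | inj₁ e∈′ = ⊥-elim (apart (pairs-In a k e∈′ t) (In-there (toℕ r) xb))
    ... | inj₂ e∈′ = only {y} (f e∈′)
  leaf-parent r (add s a nil b) u {x} i | inj₁ (here refl) = r , λ { {y} (inj₁ e) → go e (ordered-left x y)
      (ordered-right x y) (endpoints {y}) ; {y} (inj₂ e) → go e (ordered-right y x) (ordered-left y x)
      (endpoints′ {y}) }
    where
    open Parts {r} {s} {a} {nil} {b} u
    ≢ra : r ≢ a
    ≢ra refl = ≢-head u (In-here (toℕ a) _) refl
    endpoints : ∀ {y} → ordered a y ≡ ordered r a → y ≡ r
    endpoints {y} q with touch-ordered a y (subst (Touch r) (sym q) (ordered-left r a))
    ... | inj₁ e = ⊥-elim (≢ra e)
    ... | inj₂ e = sym e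
    endpoints′ : ∀ {y} → ordered y a ≡ ordered r a → y ≡ r
    endpoints′ {y} q with touch-ordered y a (subst (Touch r) (sym q) (ordered-left r a))
    ... | inj₁ e = sym e
    ... | inj₂ e = ⊥-elim (≢ra e)
    go : ∀ {y e} → e ∈ pairs r (add s a nil b) → Touch a e → Touch y e → (e ≡ ordered r a → y ≡ r) → y ≡ r
    go (here q) t _ f = f q
    go (there e∈) t _ f = ⊥-elim (apart (In-here (toℕ a) []) (pairs-In r b e∈ t))
  leaf-parent r (add s a K@(add _ _ _ _) b) u {x} i | inj₁ j with leaf-parent a K (Parts.left {r} {s} {a} {K} {b} u) j
  ... | p , only = p , λ { {y} (inj₁ e) → go {y} e (ordered-left x y) inj₁ ; {y} (inj₂ e) → go {y} e (ordered-right y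
      x) inj₂ }
    where
    open Parts {r} {s} {a} {K} {b} u
    xk : In (nums K) (toℕ x)
    xk = leafs-In a K j
    go : ∀ {y e} → e ∈ pairs r (add s a K b) → Touch x e → (e ∈ pairs a K → ordered x y ∈ pairs a K ⊎ ordered y x ∈
        pairs a K) → y ≡ p
    go {y} (here refl) t f with touch-ordered r a t
    ... | inj₁ refl = ⊥-elim (apart (In-there (toℕ a) xk) (In-here (toℕ r) (nums b)))
    ... | inj₂ refl = ⊥-elim (≢-head left xk refl)
    go {y} (there e∈) t f with ∈-++⁻ (pairs a K) e∈
    ... | inj₁ e∈′ = only {y} (f e∈′)
    ... | inj₂ e∈′ = ⊥-elim (apart (In-there (toℕ a) xk) (pairs-In r b e∈′ t))

  Unique-nums : ∀ {xs : List (Fin n)} → Unique (map toℕ xs) → UP.Unique xs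
  Unique-nums {[]} u = []
  Unique-nums {x ∷ xs} u = tabulate (λ { {y} i refl → ≢-head u (∈⇒In i) refl }) ∷ Unique-nums (Unique-tail u)
    where
    ∈⇒In : ∀ {y xs} → y ∈ xs → In (map toℕ xs) (toℕ y)
    ∈⇒In {xs = z ∷ xs} (here refl) = In-here (toℕ z) _
    ∈⇒In {xs = z ∷ xs} (there i) = In-there (toℕ z) (∈⇒In i)

  leafs⊑ : ∀ r F v → occ (map toℕ (leafs r F)) v ≤ occ (nums F) v
  leafs′⊑ : ∀ a F v → occ (map toℕ (leafs′ a F)) v ≤ occ (toℕ a ∷ nums F) v
  leafs⊑ r nil v = z≤n
  leafs⊑ r (add s a k b) v = arith-97 (occ (map toℕ (leafs′ a k ++ leafs r b)) v) (occ (map toℕ (leafs′ a k) ++ map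
      toℕ (leafs r b)) v) (occ (map toℕ (leafs′ a k)) v) (occ (map toℕ (leafs r b)) v) (δ (toℕ a) v) (occ (nums k) v)
      (occ (nums b) v) (occ (nums k ++ nums b) v) (cong (λ l → occ l v) (map-++ toℕ (leafs′ a k) (leafs r b)))
      (occ-++ (map toℕ (leafs′ a k)) (map toℕ (leafs r b)) v) (occ-++ (nums k) (nums b) v) (leafs′⊑ a k v)
      (leafs⊑ r b v)
  leafs′⊑ a nil v = ≤-refl
  leafs′⊑ a F@(add _ _ _ _) v = ≤-trans (leafs⊑ a F v) (m≤n+m _ (δ (toℕ a) v))

  length≤-below : ∀ L → Unique L → (∀ v → In L v → v < n) → length L ≤ n
  length≤-below L u h = subst (_≤ n) (inside L h) (bounded 0 n)
    where
    bounded : ∀ a w → ∑ (occ L) a w ≤ w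
    bounded a zero = z≤n
    bounded a (suc w) = +-mono-≤ (once u a) (bounded (suc a) w)
    point : ∀ x a w → a ≤ x → x < a + w → ∑ (δ x) a w ≡ 1
    point x a w p q = ≤-antisym (∑δ≤1 x a w) (≤-trans (≤-reflexive (sym (trans (+-identityʳ _) (δ-refl x))))
        (∑-sub (δ x) {a} {w} {x} {1} p (≤-trans (≤-reflexive (+-comm x 1)) q)))
    inside : ∀ L → (∀ v → In L v → v < n) → ∑ (occ L) 0 n ≡ length L
    inside [] h = ∑-zero 0 n λ _ _ _ → refl
    inside (x ∷ L) h = trans (∑-+ (δ x) (occ L) 0 n) (cong₂ _+_ (point x 0 n z≤n (h x (In-here x L))) (inside L λ v i
        → h v (In-there x i)))

  nums-below : ∀ F v → In (nums F) v → v < n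
  nums-below (add s a k b) v i with In-case {toℕ a} {nums k ++ nums b} i
  ... | inj₁ refl = toℕ<n a
  ... | inj₂ (mk j) with 1 ≤? occ (nums k) v
  ... | yes p = nums-below k v (mk p)
  ... | no p = nums-below b v (mk (arith-98 (occ (nums k) v) (occ (nums b) v) (occ (nums k ++ nums b) v)
      (occ-++ (nums k) (nums b) v) j (≰⇒> p)))

record Rooted {n : ℕ} (T : OrientedTree n) : Set where
  open OrientedTree T renaming (arc to D)
  open Growth D
  field
    root       : Fin n
    kids       : Forest (Fin n)
    unique     : Unique (toℕ root ∷ nums kids)
    valid      : Valid root kids
    whole      : 1 + order kids ≡ n
    covers     : ∀ {u v} → adj D u v ≡ true → ordered u v ∈ pairs root kids
    leaves≤    : leaves kids ≤ leafCount D
    branches≤  : branches kids + 2 ≤ leafCount D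

-- Connectedness yields a spanning forest, and the edge count says that the `n - 1` pairs of that
-- forest are all edges. This is where acyclicity enters: it makes `covers` hold and bounds the
-- degree of the leaves of the forest.
rooted-at : ∀ {n} → Fin n → 2 ≤ n → (T : OrientedTree n) → Rooted T
rooted-at {n} r n≥2 T = build (spanning connected r)
  where
  open OrientedTree T renaming (arc to D)
  open Growth D
  n≥1 : 1 ≤ n
  n≥1 = <⇒≤ n≥2
  build : (∃ λ F → Spanning r F × n ≤ 1 + order F) → Rooted T
  build (F , S , n≤) = record { root = r ; kids = F ; unique = unique ; valid = valid ; whole = whole ; covers =
      covers
      ; leaves≤ = leaves≤
      ; branches≤ = branching F refl }
    where
    open Spanning S
    whole : 1 + order F ≡ n
    whole = ≤-antisym (subst (_≤ n) (cong suc (nums-length F)) (length≤-below (toℕ r ∷ nums F) unique λ v i → case In-case {toℕ r} {nums F} i of λ { (inj₁ refl) → toℕ<n r ; (inj₂ j) → nums-below F v j })) n≤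
    all : List (Fin n × Fin n)
    all = concatMap (λ u → map (λ v → (u , v)) (allFin n)) (allFin n)
    small : Fin n × Fin n → Bool
    small p = does (toℕ (proj₁ p) <? toℕ (proj₂ p))
    near′ : Fin n × Fin n → Bool
    near′ p = adj D (proj₁ p) (proj₂ p)
    edges-list : List (Fin n × Fin n)
    edges-list = filterᵇ near′ (filterᵇ small all)
    listed : ∀ {e} → adj D (proj₁ e) (proj₂ e) ≡ true → toℕ (proj₁ e) < toℕ (proj₂ e) → e ∈ edges-list
    listed {u , v} a p = ∈-filter⁺ (T? ∘ near′) (∈-filter⁺ (T? ∘ small) (∈-concat⁺′ (∈-map⁺ (λ v → u , v)
        (∈-allFin v)) (∈-map⁺ (λ u → map (λ v → u , v) (allFin n)) (∈-allFin u)))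
      (⇒T (dec-true (toℕ u <? toℕ v) p))) (⇒T a)
    uqL : Unique (map toℕ (r ∷ leafs r F))
    uqL = Unique-⊑ (λ v → +-monoʳ-≤ (δ (toℕ r) v) (leafs⊑ r F v)) unique
    Unique-tail′ : ∀ {x : Fin n} {xs} → UP.Unique (x ∷ xs) → UP.Unique xs
    Unique-tail′ (_ ∷ u) = u
    open Data.List.Membership.DecPropositional (Data.Product.Properties.≡-dec (Data.Fin.Properties._≟_ {n})
        (Data.Fin.Properties._≟_ {n})) using (_∈?_)
    pair-in : ∀ {e} → adj D (proj₁ e) (proj₂ e) ≡ true → toℕ (proj₁ e) < toℕ (proj₂ e) → e ∈ pairs r F
    pair-in {e} a p with e ∈? pairs r F
    ... | yes i = i
    -- Together with the pairs of the forest, `e` would be the last of `n` distinct edges.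
    ... | no ni = ⊥-elim (arith-99 (length (pairs r F)) (length edges-list) (order F) n (n ∸ 1)
        (length≤ {xs = e ∷ pairs r F} {ys = edges-list} (tabulate (λ i q → ni (subst (_∈ pairs r F) (sym q) i)) ∷
        pairs-unique r F unique) in-list) edges (pairs-length r F) whole (m+[n∸m]≡n n≥1))
      where
      in-list : ∀ {e′} → e′ ∈ e ∷ pairs r F → e′ ∈ edges-list
      in-list (here refl) = listed a p
      in-list (there i) = listed (proj₁ (pairs-adj r F valid unique i)) (proj₂ (pairs-adj r F valid unique i))
    covers : ∀ {u v} → adj D u v ≡ true → ordered u v ∈ pairs r F
    covers {u} {v} a with toℕ u <? toℕ v
    ... | yes p = pair-in a p
    ... | no p with adj-arc a
    ... | s , e = pair-in (proj₂ (arc-adj s e)) (≤∧≢⇒< (≮⇒≥ p) λ q → loop s (subst (λ t → Arcs s t v)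
        (sym (toℕ-injective q)) e))
      where
      loop : ∀ s → Arcs s v v → ⊥
      loop true e with trans (sym e) (loopless v)
      ... | ()
      loop false e = loop true e
    few : ∀ x p → (∀ {y} → ordered x y ∈ pairs r F → y ≡ p) → degree D x ≤ 1
    few x p only = length≤ {ys = p ∷ []} (Unique-filter (T? ∘ adj D x) (allFin⁺ n)) λ {y} i →
      here (only {y} (covers {x} {y} (T⇒ (proj₂ (∈-filter⁻ (T? ∘ adj D x) {xs = allFin n} i)))))
    counted : ∀ x → degree D x ≤ 1 → x ∈ filterᵇ (λ u → does (degree D u ≤? 1)) (allFin n)
    counted x d = ∈-filter⁺ (T? ∘ (λ u → does (degree D u ≤? 1))) (∈-allFin x) (⇒T (dec-true (degree D x ≤? 1) d))
    leaf-counted : ∀ {x} → x ∈ leafs r F → x ∈ filterᵇ (λ u → does (degree D u ≤? 1)) (allFin n)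
    leaf-counted {x} i with leaf-parent r F unique i
    ... | p , only = counted x (few x p λ {y} e → only {y} (inj₁ e))
    leaves≤ : leaves F ≤ leafCount D
    leaves≤ = ≤-trans (≤-reflexive (sym (leafs-length r F))) (length≤ (Unique-tail′ (Unique-nums uqL)) leaf-counted)
    -- A root with a single child is a leaf of the tree that `leaves` misses; at a root with more
    -- children at least two branches have a leaf in excess. The difference is 2 in both cases,
    -- whichever vertex is the root.
    branching : ∀ G → G ≡ F → branches G + 2 ≤ leafCount D
    branching nil eq = ⊥-elim (<-irrefl refl (≤-trans n≥2 (≤-trans n≤ (≤-reflexive (cong (λ t → suc (order t))
        (sym eq))))))
    branching (add s a k nil) eq = arith-100 (branches′ k) (leaves′ k) (leafCount D) (length (leafs r F)) (leaves F)
        (length≤ (Unique-nums uqL) with-root) (branches<leaves k) (leafs-length r F) (cong leaves (sym eq))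
      where
      root-only : ∀ {y} → ordered r y ∈ pairs r (add s a k nil) → y ≡ a
      root-only {y} (here q) = case touch-ordered r y (subst (Touch a) (sym q) (ordered-right r a)) of λ
        { (inj₂ e) → sym e ; (inj₁ e) → ⊥-elim (≢-head (subst (λ t → Unique (toℕ r ∷ nums t)) (sym eq) unique)
            (In-here (toℕ a) _) (cong toℕ e)) }
      root-only {y} (there i) with ∈-++⁻ (pairs a k) i
      ... | inj₁ j = ⊥-elim (Parts.apart {r} {s} {a} {k} {nil} (subst (λ t → Unique (toℕ r ∷ nums t)) (sym eq) unique)
          (pairs-In a k j (ordered-left r y)) (In-here (toℕ r) []))
      with-root : ∀ {x} → x ∈ r ∷ leafs r F → x ∈ filterᵇ (λ u → does (degree D u ≤? 1)) (allFin n)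
      with-root (here refl) = counted r (few r a λ {y} e → root-only (subst (λ t → ordered r y ∈ pairs r t) (sym eq)
          e))
      with-root (there i) = leaf-counted i
    branching (add s a k (add s′ a′ k′ b)) eq = arith-101 (branches′ k) (leaves′ k) (branches′ k′) (leaves′ k′)
        (branches b) (leaves b) (leafCount D) (leaves F) (branches<leaves k) (branches<leaves k′) (branches≤leaves b)
        leaves≤ (cong leaves (sym eq))

rooted : ∀ {n} → 2 ≤ n → (T : OrientedTree n) → Rooted T
rooted {suc n} n≥2 T = rooted-at Fin.zero n≥2 T

-- The numerical bounds

-- Monotonicity of `x * x - x`, the expression in which the number of jumps enters through
-- `demands`.
square-mono : ∀ {a b} → a ≤ b → a * a + b ≤ b * b + a
square-mono {a} {b} p with m≤n⇒∃[o]m+o≡n p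
... | d , refl = arith-102 a d (square d)
  where
  square : ∀ d → d ≤ d * d
  square zero = z≤n
  square (suc d) = m≤m+n (suc d) (d * suc d)

module Bounds {P : Plan} {n l i k m : ℕ} (M : Measured P n l i) (l≤k : l ≤ k) (i+2≤k : i + 2 ≤ k) (big : 1 + n + 144 * (k * k) + 124 ≤ m + 280 * k) where
  open Measured M

  -- The estimates add up to `n + 72 * k * k + 22 * k - 205`. The bound that `big` gives for `m`
  -- exceeds this for every `k` from 2 on, by 14 when `k` is 2.
  room : 12 * cw P + (demand false (tokens P) + demand true (tokens P)) + 1 ≤ m
  room with m≤n⇒∃[o]m+o≡n (≤-trans (m≤n+m 2 i) i+2≤k)
  -- With `k = t + 2` the number of jumps is at most `k + 2 * (k - 2) = 3 * t + 2`.
  ... | t , refl = arith-242 (demand false (tokens P)) (demand true (tokens P)) (jumps (tokens P)) (width (tokens P))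
      (cw P) n l i t m (demands (tokens P)) cost≤ l≤k i+2≤k big (square-mono {jumps (tokens P)} {3 * t + 2}
      (arith-103 (jumps (tokens P)) l i t jumps≤ l≤k i+2≤k)) (t≤t*t t)
    where
    t≤t*t : ∀ d → d ≤ d * d
    t≤t*t zero = z≤n
    t≤t*t (suc d) = m≤m+n (suc d) (d * suc d)

  enough : nodes P + fanSize P + 11 ≤ m
  enough with m≤n⇒∃[o]m+o≡n (≤-trans (m≤n+m 2 i) i+2≤k)
  ... | t , refl = arith-104 (nodes P) (fanSize P) n l i t m nodes≡ fans≤ l≤k i+2≤k big

-- Filling in a directed path

module Strategy (𝒯 : Tour) where
  open Tour 𝒯

  P⟦_⟧ : List Bool → ℕ → List ℕ → ℕ → Set
  P⟦_⟧ = Path Arc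

  -- The greedy search runs from the end of the path towards its origin, so the path is read off in
  -- reverse. `at` translates search positions into vertices; it is a reflection when the search
  -- goes to the left.
  backtrack : ∀ {e u i js l} (at : ℕ → ℕ) s → (∀ i j → e i j ≡ true → Arc s (at j) (at i)) →
    ∀ {k ps z} → Greedy e u i js l → P⟦ replicate k s ⟧ (at i) ps z →
    ∃ λ qs → P⟦ replicate (length js + k) s ⟧ (at l) qs z ×
      (∀ v → occ (at l ∷ qs) v ≡ occ (map at js) v + occ (at i ∷ ps) v)
  backtrack at s arcs [] p = _ , p , λ v → refl
  backtrack {i = i} {l = l} at s arcs {k} {ps} {z} (cons {j = j} {js = js} _ a _ g) p with backtrack at s arcs g
      (arcs _ _ a ∷ p)
  ... | qs , q , eq = qs , subst (λ n → P⟦ replicate n s ⟧ (at l) qs z) (+-suc (length js) k) q ,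
    λ v → (arith-105 (occ (map at js) v) (δ (at j) v) (δ (at i) v) (occ ps v) (occ (at _ ∷ qs) v) (eq v))

  Greedy-fresh : ∀ {e u B} (at : ℕ → ℕ) → (∀ {i j} → i ≤ B → j ≤ B → at i ≡ at j → i ≡ j) →
    ∀ {i js l} → Greedy e u i js l → l ≤ B →
    ∀ v → occ (map at js) v ≡ 0 ⊎ (occ (map at js) v ≡ 1 × ∃ λ j → i < j × j ≤ l × v ≡ at j × u j ≡ 0)
  Greedy-fresh at inj [] l≤B v = inj₁ refl
  Greedy-fresh {e} {u} {B} at inj (cons {j = j} {js = js} {l = l} i<j _ fr g) l≤B v
    with Greedy-fresh at inj g l≤B v | at j ≟ v
  ... | inj₁ o | no n = inj₁ (cong₂ _+_ (δ-≢ n) o)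
  ... | inj₂ (o , j′ , p , q , r , f) | no n = inj₂ (cong₂ _+_ (δ-≢ n) o , j′ , <-trans i<j p , q , r , f)
  ... | inj₁ o | yes refl = inj₂ (cong₂ _+_ (δ-refl (at j)) o , j , i<j , last≥ g , refl , fr)
    where
    last≥ : ∀ {i js l} → Greedy e u i js l → i ≤ l
    last≥ [] = ≤-refl
    last≥ (cons p _ _ g) = ≤-trans (<⇒≤ p) (last≥ g)
  ... | inj₂ (o , j′ , p , q , r , f) | yes refl =
    ⊥-elim (<-irrefl (inj (≤-trans (<⇒≤ p) (≤-trans q l≤B)) (≤-trans q l≤B) r) p)

  -- `a` and `b` are the inner vertices of the jump, of whose place nothing is known beyond `top`;
  -- the greedy vertices `gs` stay in a stretch of their own.
  record Filled (u : ℕ → ℕ) (s : Bool) (c y z lo hi top : ℕ) : Set where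
    field
      a b     : ℕ
      gs vs   : List ℕ
      path    : P⟦ replicate (3 + c) s ⟧ y vs z
      content : ∀ v → occ vs v ≡ δ a v + δ b v + occ gs v + δ z v
      fresh   : ∀ v → δ a v + δ b v + occ gs v ≡ 0 ⊎ (δ a v + δ b v + occ gs v ≡ 1 × u v ≡ 0 × v < top)
      local   : ∀ v → occ gs v ≡ 0 ⊎ (lo ≤ v × v < hi)
      size    : length gs ≡ c

  δδ-fresh : ∀ {u : ℕ → ℕ} {a b top} → a ≢ b → u a ≡ 0 → u b ≡ 0 → a < top → b < top →
    ∀ v → δ a v + δ b v ≡ 0 ⊎ (δ a v + δ b v ≡ 1 × u v ≡ 0 × (v ≡ a ⊎ v ≡ b))
  δδ-fresh {a = a} {b} a≢b ua ub a<t b<t v with a ≟ v | b ≟ v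
  ... | yes refl | yes refl = ⊥-elim (a≢b refl)
  ... | yes refl | no n = inj₂ (cong₂ _+_ (δ-refl a) (δ-≢ n) , ua , inj₁ refl)
  ... | no n | yes refl = inj₂ (cong₂ _+_ (δ-≢ n) (δ-refl b) , ub , inj₂ refl)
  ... | no n | no n′ = inj₁ (cong₂ _+_ (δ-≢ n) (δ-≢ n′))

  R⇒≢ : ∀ {a b} → R a b ≡ true → a ≢ b
  R⇒≢ {a} r refl with trans (sym r) (irr a)
  ... | ()

  fillR : ∀ u c y G W → c + 2 * ∑ u (suc y + G) W ≤ W →
    (∀ t → t ≤ W → 6 * ∑ u (suc y) (G + t) + 5 ≤ G + t) →
    Filled u true c y (suc y + G + W) (suc y + G) (suc y + G + W) (suc y + G + W)
  fillR u c y G W h gap = build (greedy e (λ j → u (z ∸ j)) z half c 0 W (m≤n+m W (suc y + G))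
      (subst (λ t → c + 2 * t ≤ W) (sym used) h))
    where
    z = suc y + G + W
    z∸W : z ∸ W ≡ suc y + G
    z∸W = m+n∸n≡m (suc y + G) W
    e : ℕ → ℕ → Bool
    e i j = R (z ∸ j) (z ∸ i)
    half : ∀ i w → i + w ≤ z → w ≤ 2 * ∑ (λ v → bit (e i v)) (suc i) w
    half i w le = subst (λ t → w ≤ 2 * t)
      (trans (∑-cong 0 w λ d → cong (λ t → bit (R t (z ∸ i))) (trans (∸-+-assoc z i (suc d))
          (cong (z ∸_) (+-suc i d))))
        (trans (∑-shift (λ v → bit (e i v)) (suc i) 0 w) (cong (λ t → ∑ (λ v → bit (e i v)) t w)
            (+-identityʳ (suc i)))))
      (halfL′ (z ∸ i) w (subst (_≤ z ∸ i) (m+n∸m≡n i w) (∸-monoˡ-≤ i le)))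
    used : ∑ (λ j → u (z ∸ j)) 1 W ≡ ∑ u (suc y + G) W
    used = trans (sym (∑-shift (λ j → u (z ∸ j)) 1 0 W))
      (trans (∑-back u z W (m≤n+m W (suc y + G))) (cong (λ t → ∑ u t W) z∸W))
    build : (∃ λ js → ∃ λ l → length js ≡ c × Greedy e (λ j → u (z ∸ j)) 0 js l × l ≤ W) →
      Filled u true c y z (suc y + G) z z
    build (js , l , len , g , l≤W) = conclude (backtrack (z ∸_) true (λ i j r → r) {0} g [])
        (jump y (G + t) u (gap t (m∸n≤m W l)))
      where
      t = W ∸ l
      l≤z : l ≤ z
      l≤z = ≤-trans l≤W (m≤n+m W (suc y + G))
      hi≡ : suc y + (G + t) ≡ z ∸ l
      hi≡ = trans (sym (+-assoc (suc y) G t)) (sym (+-∸-assoc (suc y + G) l≤W))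
      conclude : (∃ λ qs → P⟦ replicate (length js + 0) true ⟧ (z ∸ l) qs z ×
          (∀ v → occ (z ∸ l ∷ qs) v ≡ occ (map (z ∸_) js) v + occ (z ∷ []) v)) →
        (∃ λ a → ∃ λ b → y < a × a < suc y + (G + t) × y < b × b < suc y + (G + t) × u a ≡ 0 × u b ≡ 0 ×
          R y a ≡ true × R a b ≡ true × R b (suc y + (G + t)) ≡ true) → Filled u true c y z (suc y + G) z z
      conclude (qs , p , eq) (a , b , y<a , a<w , y<b , b<w , ua , ub , ya , ab , bw) = record
        { a = a ; b = b ; gs = map (z ∸_) js ; vs = a ∷ b ∷ (z ∸ l) ∷ qs
        ; path = ya ∷ (ab ∷ (subst (λ w → R b w ≡ true) hi≡ bw ∷
            subst (λ n → P⟦ replicate n true ⟧ _ qs z) (trans (+-identityʳ _) len) p))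
        ; content = λ v → (arith-106 (δ a v) (δ b v) (occ (map (z ∸_) js) v) (δ z v) (occ (z ∸ l ∷ qs) v) (eq v))
        ; fresh = fr
        ; local = λ v → lo v (gsF v)
        ; size = trans (length-map _ js) len }
        where
        a<w′ : a < z ∸ l
        a<w′ = subst (a <_) hi≡ a<w
        b<w′ : b < z ∸ l
        b<w′ = subst (b <_) hi≡ b<w
        gsF : ∀ v → occ (map (z ∸_) js) v ≡ 0 ⊎ (occ (map (z ∸_) js) v ≡ 1 ×
          ∃ λ j → 0 < j × j ≤ l × v ≡ z ∸ j × u (z ∸ j) ≡ 0)
        gsF = Greedy-fresh (z ∸_) (λ p q → ∸-cancelˡ-≡ p q) g l≤z
        lo : ∀ v → _ → occ (map (z ∸_) js) v ≡ 0 ⊎ (suc y + G ≤ v × v < z)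
        lo v (inj₁ o) = inj₁ o
        lo v (inj₂ (_ , suc j , 0<j , j≤l , refl , _)) = inj₂
          ( ≤-trans (≤-reflexive (sym z∸W)) (∸-monoʳ-≤ z (≤-trans j≤l l≤W)) , s≤s (m∸n≤m (y + G + W) j))
        fr : ∀ v → δ a v + δ b v + occ (map (z ∸_) js) v ≡ 0 ⊎
          (δ a v + δ b v + occ (map (z ∸_) js) v ≡ 1 × u v ≡ 0 × v < z)
        fr v with δδ-fresh {u} (R⇒≢ ab) ua ub a<w′ b<w′ v | gsF v | lo v (gsF v)
        ... | inj₁ o | inj₁ o′ | _ = inj₁ (cong₂ _+_ o o′)
        ... | inj₁ o | inj₂ (o′ , _) | inj₁ o″ = inj₁ (cong₂ _+_ o o″)
        ... | inj₁ o | inj₂ (o′ , j , _ , _ , refl , f) | inj₂ (_ , v<z) = inj₂ (cong₂ _+_ o o′ , f , v<z)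
        ... | inj₂ (o , f , w) | inj₁ o′ | _ = inj₂ (cong₂ _+_ o o′ , f , <-≤-trans (v< w) (m∸n≤m z l))
          where
          v< : v ≡ a ⊎ v ≡ b → v < z ∸ l
          v< (inj₁ refl) = a<w′
          v< (inj₂ refl) = b<w′
        ... | inj₂ (o , f , w) | inj₂ (_ , j , _ , j≤l , v≡ , _) | _ =
          ⊥-elim (<-irrefl v≡ (<-≤-trans (v< w) (∸-monoʳ-≤ z j≤l)))
          where
          v< : v ≡ a ⊎ v ≡ b → v < z ∸ l
          v< (inj₁ refl) = a<w′
          v< (inj₂ refl) = b<w′

  -- The path is traversed against its arcs: the greedy part runs to the right from its end `z`, and
  -- the jump goes from the last greedy vertex forward to `y`.
  fillL : ∀ u c z G W → c + 2 * ∑ u (suc z) W ≤ W →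
    (∀ t t′ → t + t′ ≡ W → 6 * ∑ u (suc z + t) (t′ + G) + 5 ≤ t′ + G) →
    Filled u false c (suc z + W + G) z (suc z) (suc z + W) (suc z + W + G)
  fillL u c z G W h gap = build (greedy e (λ j → u (z + j)) W half c 0 W ≤-refl
      (subst (λ t → c + 2 * t ≤ W) (sym used) h))
    where
    y = suc z + W + G
    e : ℕ → ℕ → Bool
    e i j = R (z + i) (z + j)
    half : ∀ i w → i + w ≤ W → w ≤ 2 * ∑ (λ v → bit (e i v)) (suc i) w
    half i w le = subst (λ t → w ≤ 2 * t)
      (trans (cong (λ t → ∑ (λ v → bit (R (z + i) v)) t w) (sym (+-suc z i))) (sym (∑-shift (λ v → bit (R (z + i) v))
          z (suc i) w)))
      (halfR (z + i) w)
    used : ∑ (λ j → u (z + j)) 1 W ≡ ∑ u (suc z) W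
    used = trans (∑-shift u z 1 W) (cong (λ t → ∑ u t W) (+-comm z 1))
    build : (∃ λ js → ∃ λ l → length js ≡ c × Greedy e (λ j → u (z + j)) 0 js l × l ≤ W) →
      Filled u false c y z (suc z) (suc z + W) y
    build (js , l , len , g , l≤W) = conclude (backtrack (z +_) false (λ i j r → r) {0} g [])
        (jump (z + l) (t + G) u (subst (λ n → 6 * ∑ u n (t + G) + 5 ≤ t + G) refl (gap l t (m+[n∸m]≡n l≤W))))
      where
      t = W ∸ l
      hi≡ : suc (z + l) + (t + G) ≡ y
      hi≡ = cong suc (trans (+-assoc z l (t + G)) (trans (cong (z +_) (trans (sym (+-assoc l t G))
        (cong (_+ G) (m+[n∸m]≡n l≤W)))) (sym (+-assoc z W G))))
      z+0 : z + 0 ≡ z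
      z+0 = +-identityʳ z
      conclude : (∃ λ qs → P⟦ replicate (length js + 0) false ⟧ (z + l) qs (z + 0) ×
          (∀ v → occ (z + l ∷ qs) v ≡ occ (map (z +_) js) v + occ (z + 0 ∷ []) v)) →
        (∃ λ a → ∃ λ b → z + l < a × a < suc (z + l) + (t + G) × z + l < b × b < suc (z + l) + (t + G) × u a ≡ 0 × u b
            ≡ 0 ×
          R (z + l) a ≡ true × R a b ≡ true × R b (suc (z + l) + (t + G)) ≡ true) →
        Filled u false c y z (suc z) (suc z + W) y
      conclude (qs , p , eq) (a , b , w<a , a<y , w<b , b<y , ua , ub , wa , ab , by) = record
        { a = a ; b = b ; gs = map (z +_) js ; vs = b ∷ a ∷ (z + l) ∷ qs
        ; path = subst (λ w → R b w ≡ true) hi≡ by ∷ (ab ∷ (wa ∷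
            subst₂ (λ n x → P⟦ replicate n false ⟧ (z + l) qs x) (trans (+-identityʳ _) len) z+0 p))
        ; content = λ v → (arith-107 (δ a v) (δ b v) (occ (map (z +_) js) v) (δ (z + 0) v) (δ z v) (occ (z + l ∷ qs)
            v) (eq v) (cong (λ x → δ x v) z+0))
        ; fresh = fr
        ; local = λ v → lo v (gsF v)
        ; size = trans (length-map _ js) len }
        where
        a<y′ : a < y
        a<y′ = subst (a <_) hi≡ a<y
        b<y′ : b < y
        b<y′ = subst (b <_) hi≡ b<y
        gsF : ∀ v → occ (map (z +_) js) v ≡ 0 ⊎ (occ (map (z +_) js) v ≡ 1 ×
          ∃ λ j → 0 < j × j ≤ l × v ≡ z + j × u (z + j) ≡ 0)
        gsF = Greedy-fresh {B = W} (z +_) (λ {i} {j} _ _ → +-cancelˡ-≡ z i j) g l≤W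
        lo : ∀ v → _ → occ (map (z +_) js) v ≡ 0 ⊎ (suc z ≤ v × v < suc z + W)
        lo v (inj₁ o) = inj₁ o
        lo v (inj₂ (_ , j , 0<j , j≤l , refl , _)) = inj₂
          ( ≤-trans (≤-reflexive (+-comm 1 z)) (+-monoʳ-≤ z 0<j) , s≤s (+-monoʳ-≤ z (≤-trans j≤l l≤W)))
        fr : ∀ v → δ a v + δ b v + occ (map (z +_) js) v ≡ 0 ⊎
          (δ a v + δ b v + occ (map (z +_) js) v ≡ 1 × u v ≡ 0 × v < y)
        fr v with δδ-fresh {u} (R⇒≢ ab) ua ub a<y′ b<y′ v | gsF v | lo v (gsF v)
        ... | inj₁ o | inj₁ o′ | _ = inj₁ (cong₂ _+_ o o′)
        ... | inj₁ o | inj₂ (o′ , _) | inj₁ o″ = inj₁ (cong₂ _+_ o o″)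
        ... | inj₁ o | inj₂ (o′ , j , _ , _ , refl , f) | inj₂ (_ , v<z) =
          inj₂ (cong₂ _+_ o o′ , f , <-≤-trans v<z (m≤m+n (suc z + W) G))
        ... | inj₂ (o , f , inj₁ refl) | inj₁ o′ | _ = inj₂ (cong₂ _+_ o o′ , f , a<y′)
        ... | inj₂ (o , f , inj₂ refl) | inj₁ o′ | _ = inj₂ (cong₂ _+_ o o′ , f , b<y′)
        ... | inj₂ (o , f , inj₁ refl) | inj₂ (_ , j , _ , j≤l , v≡ , _) | _ =
          ⊥-elim (<-irrefl (sym v≡) (≤-<-trans (+-monoʳ-≤ z j≤l) w<a))
        ... | inj₂ (o , f , inj₂ refl) | inj₂ (_ , j , _ , j≤l , v≡ , _) | _ =
          ⊥-elim (<-irrefl (sym v≡) (≤-<-trans (+-monoʳ-≤ z j≤l) w<b))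

  -- Realisations of plans, and the greedy construction of a cluster

  -- The list contains the vertices other than the origin `x`. In `zed` all of `Y′` are neighbours
  -- of `x`, because it is known only at the very end in which of them the return path from `v`
  -- stops.
  data Real : List ℕ → Plan → ℕ → List ℕ → Set where
    stop  : ∀ {Y x} → Real Y stop x []
    pick  : ∀ {Y s P x y vs} → Arc s x y → Real Y P y vs → Real Y (pick s P) x (y ∷ vs)
    both  : ∀ {Y P Q x vs ws} → Real Y P x vs → Real [] Q x ws → Real Y (both P Q) x (vs ++ ws)
    far   : ∀ {Y s c P x z ps vs} → P⟦ replicate (3 + c) s ⟧ x ps z → Real Y P z vs → Real Y (far s c P) x (ps ++ vs)
    leg   : ∀ {Y s b bs x y ws z} → Arc s x y → P⟦ b ∷ not b ∷ bs ⟧ y ws z → Real Y (leg s b bs) x (y ∷ ws)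
    zed   : ∀ {Y Y′ s H P x v ws us} → All (Arc s x) Y′ → Real Y′ H v ws → Real [] P v us →
            Real Y (zed s H P) x (v ∷ ws ++ us)
    close : ∀ {Y s b bs e x y ws z} → Arc s x y → P⟦ b ∷ not b ∷ bs ⟧ y ws z → z ∈ Y →
            Real Y (close s b bs e) x (y ∷ ws)

  data RealD : Deferred → List ℕ → Set where
    farD : ∀ {Y x s c P vs} → Real Y (far s c P) x vs → RealD (farD Y x s c P) vs
    zedD : ∀ {Y H P v ws us} → Real Y H v ws → Real [] P v us → RealD (zedD Y H P) (v ∷ ws ++ us)

  data RealF : Final → List ℕ → Set where
    free : ∀ {Y b bs y ws z} → y ∈ Y → P⟦ b ∷ not b ∷ bs ⟧ y ws z → RealF (free Y b bs) (y ∷ ws)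
    into : ∀ {Y b bs e Y′ y ws z} → y ∈ Y → P⟦ b ∷ not b ∷ bs ⟧ y ws z → z ∈ Y′ → RealF (into Y b bs e Y′) (y ∷ ws)

  -- After `x` the zone contains at most `(k + 6) / 6` occupied vertices, and twice this number is
  -- less than `k + 3`: three positions beyond the end of the zone are enough to find a free
  -- neighbour.
  neighbourR : ∀ x k {L u} → Zone (6 + L) (suc x + k) u → 6 + L ≤ x →
    ∃ λ y → Arc true x y × u y ≡ 0 × L ≤ y × y < 6 + (suc x + k)
  neighbourR x k {L} {u} Z L≤x = result
    (near (λ d → R x (suc x + d)) (λ d → u (suc x + d)) (k + 3)
      (λ w _ → subst (λ t → w ≤ 2 * t) (sym (reindex (λ v → bit (R x v)) w)) (halfR x w)) small)
    where
    reindex : ∀ f w → ∑ (λ d → f (suc x + d)) 0 w ≡ ∑ f (suc x) w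
    reindex f w = trans (∑-shift f (suc x) 0 w) (cong (λ z → ∑ f z w) (+-identityʳ (suc x)))
    small : 2 * ∑ (λ d → u (suc x + d)) 0 (k + 3) < k + 3
    small = arith-108 k (∑ (λ d → u (suc x + d)) 0 (k + 3)) (∑ u (suc x) (k + 3)) (∑ u (suc x) k) (∑ u (suc x + k) 3)
        (reindex u (k + 3)) (∑-split u (suc x) k 3) (∑-zero (suc x + k) 3 (λ v p _ → Zone.above Z v p))
        (Zone.suf Z (suc x) k refl)
    result : (∃ λ d → d < k + 3 × R x (suc x + d) ≡ true × u (suc x + d) ≡ 0 × d ≤ 2 * ∑ (λ d → u (suc x + d)) 0 d) →
      ∃ λ y → Arc true x y × u y ≡ 0 × L ≤ y × y < 6 + (suc x + k)
    result (d , d< , r , f , _) = suc x + d , r , f , (arith-109 L x d L≤x) ,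
        (arith-110 x d k d<)

  neighbourL : ∀ x k {L T u} → Zone (6 + L) T u → 6 + L + k ≡ x → x < T →
    ∃ λ y → Arc false x y × u y ≡ 0 × L ≤ y × y < 6 + T
  neighbourL x k {L} {T} {u} Z x≡ x<T = result
    (near (λ d → R (x ∸ suc d) x) (λ d → u (x ∸ suc d)) (3 + k) (λ w p → halfL′ x w (≤-trans p W≤)) small)
    where
    W≤ : 3 + k ≤ x
    W≤ = arith-111 x k L x≡
    left : x ∸ (3 + k) ≡ 3 + L
    left = trans (cong (_∸ (3 + k)) (arith-112 x k L x≡)) (m+n∸n≡m (3 + L) (3 + k))
    small : 2 * ∑ (λ d → u (x ∸ suc d)) 0 (3 + k) < 3 + k
    small = arith-243 k (∑ (λ d → u (x ∸ suc d)) 0 (3 + k)) (∑ u (x ∸ (3 + k)) (3 + k)) (∑ u (3 + L) (3 + k))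
        (∑ u (3 + L) 3) (∑ u (3 + L + 3) k) (∑ u (6 + L) k) (∑-back u x (3 + k) W≤) (cong (λ a → ∑ u a (3 + k)) left)
        (∑-split u (3 + L) 3 k) (cong (λ a → ∑ u a k) (arith-113 L)) (∑-zero (3 + L) 3 (λ v _ p → Zone.below Z v
        (<-≤-trans p (≤-reflexive (arith-113 L))))) (Zone.pre Z k)
    result : (∃ λ d → d < 3 + k × R (x ∸ suc d) x ≡ true × u (x ∸ suc d) ≡ 0 × d ≤ 2 * ∑ (λ d → u (x ∸ suc d)) 0 d) →
      ∃ λ y → Arc false x y × u y ≡ 0 × L ≤ y × y < 6 + T
    result (d , d< , r , f , _) = x ∸ suc d , r , f ,
        m+n≤o⇒m≤o∸n L (arith-114 L d k x d< x≡) ,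
        ≤-<-trans (m∸n≤m x (suc d)) (<-≤-trans x<T (m≤n+m T 6))

  neighbour : ∀ s {L T u x} → Zone (6 + L) T u → 1 ≤ u x →
    ∃ λ y → Arc s x y × u y ≡ 0 × L ≤ y × y < 6 + T
  neighbour true {x = x} Z ux with Zone.within Z ux
  ... | L≤x , x<T with m≤n⇒∃[o]m+o≡n x<T
  ... | k , refl = neighbourR x k Z L≤x
  neighbour false {x = x} Z ux with Zone.within Z ux
  ... | L≤x , x<T with m≤n⇒∃[o]m+o≡n L≤x
  ... | k , eq = neighbourL x k Z eq x<T

  Single : (ℕ → ℕ) → Set
  Single u = ∀ v → u v ≤ 1

  add-single : ∀ {u y} → u y ≡ 0 → Single u → Single (λ w → δ y w + u w)
  add-single {u} {y} f h v with y ≟ v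
  ... | yes refl = subst₂ (λ a b → a + b ≤ 1) (sym (δ-refl y)) (sym f) ≤-refl
  ... | no n = subst (λ a → a + u v ≤ 1) (sym (δ-≢ n)) (h v)

  record Fan (k : ℕ) (s : Bool) (L T : ℕ) (u : ℕ → ℕ) (x : ℕ) : Set where
    field
      ys     : List ℕ
      u′     : ℕ → ℕ
      size   : length ys ≡ k
      arcs   : All (Arc s x) ys
      zone   : Zone L (6 * k + T) u′
      used   : ∀ v → u′ v ≡ occ ys v + u v
      single : Single u → Single u′

  fan : ∀ k s {L T u x} → Zone (6 * k + L) T u → 1 ≤ u x → Fan k s L T u x
  fan zero s {u = u} Z ux = record { ys = [] ; u′ = u ; size = refl ; arcs = [] ; zone = Z ; used = λ v → refl ;
      single = id }
  fan (suc k) s {L} {T} {u} {x} Z ux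
    with subst (λ a → Zone a T u) (arith-115 k L) Z
  ... | Z′ with neighbour s Z′ ux
  ... | y , r , f , y≥ , y< = record
    { ys = y ∷ ys ; u′ = u′ ; size = cong suc size ; arcs = r ∷ arcs
    ; zone = subst (λ a → Zone L a u′) (arith-116 k T) zone
    ; used = λ v → (arith-117 (δ y v) (u v) (occ ys v) (u′ v) (used v))
    ; single = single ∘ add-single f }
    where
    open Fan (fan k s (Zone-add Z′ y y≥ y<) (≤-trans ux (m≤n+m (u x) _)))

  Placed : (ℕ → ℕ) → Deferred → Set
  Placed u (farD Y x s c P) = 1 ≤ u x
  Placed u (zedD Y H P)     = ⊤

  occD : List Deferred → ℕ → ℕ
  occD ds v = total (λ d → occ (resD d) v) ds

  occF : List Final → ℕ → ℕ
  occF hs v = total (λ h → occ (resF h) v) hs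

  lenF : List Final → ℕ
  lenF = total (λ h → length (resF h))

  tokensAll : List Deferred → List Token
  tokensAll []       = []
  tokensAll (d ∷ ds) = tokensD d ++ tokensAll ds

  tokensAll-++ : ∀ ds es → tokensAll (ds ++ es) ≡ tokensAll ds ++ tokensAll es
  tokensAll-++ [] es = refl
  tokensAll-++ (d ∷ ds) es = trans (cong (tokensD d ++_) (tokensAll-++ ds es)) (sym (++-assoc (tokensD d) _ _))

  Placed-mono : ∀ {u u′} → (∀ v → u v ≤ u′ v) → ∀ {ds} → All (Placed u) ds → All (Placed u′) ds
  Placed-mono le [] = []
  Placed-mono le {farD Y x s c P ∷ ds} (p ∷ ps) = ≤-trans p (le x) ∷ Placed-mono le ps
  Placed-mono le {zedD Y H P ∷ ds} (p ∷ ps) = tt ∷ Placed-mono le ps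

  -- In `acct` the new vertices, the reserves and the old `u` are disjoint parts of `u′`, except
  -- that the reserve `Y` handed down is still counted by the caller. `recon` assembles a
  -- realisation once the deferred and the final pieces have been realised.
  record Clustered (Y : List ℕ) (P : Plan) (x L T : ℕ) (u : ℕ → ℕ) : Set where
    field
      u′     : ℕ → ℕ
      ds     : List Deferred
      hs     : List Final
      new    : List ℕ
      zone   : Zone L (6 * cw P + T) u′
      single : Single u → Single u′
      grow   : ∀ v → u v ≤ u′ v
      acct   : ∀ v → occ new v + occD ds v + occF hs v + u v ≤ occ Y v + u′ v
      placed : All (Placed u′) ds
      fitD   : All FitD ds
      fitF   : All FitF hs
      toks   : tokensAll ds ≡ tokens P
      size   : length new + total nodesD ds + total nodesF hs ≡ nodes P
      fans   : total fanD ds + lenF hs ≤ length Y + fanSize P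
      recon  : ∀ {V W} → Each RealD ds V → Each RealF hs W →
               ∃ λ vs → Real Y P x vs × (∀ v → occ vs v ≡ occ new v + occ V v + occ W v)

  cluster-pick : ∀ {s P Y x y L T u} → Arc s x y → u y ≡ 0 → Clustered Y P y L (6 + T) (λ w → δ y w + u w) →
    Clustered Y (pick s P) x L T u
  cluster-pick {s} {P} {Y} {x} {y} {L} {T} {u} r f C = record
    { u′ = u′ ; ds = ds ; hs = hs ; new = y ∷ new
    ; zone = subst (λ a → Zone L a u′) (arith-116 (cw P) T) zone
    ; single = single ∘ add-single f ; grow = λ v → ≤-trans (m≤n+m (u v) (δ y v)) (grow v)
    ; acct = λ v → (arith-118 (occ new v) (occD ds v) (occF hs v) (u v) (δ y v) (occ Y v) (u′ v) (acct v))
    ; placed = placed ; fitD = fitD ; fitF = fitF ; toks = toks ; size = cong suc size ; fans = fans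
    ; recon = λ {V} {W} ev ew → case recon ev ew of λ (vs , real , eq) → y ∷ vs , pick r real , λ v →
        (arith-119 (δ y v) (occ new v) (occ vs v) (occ V v) (occ W v) (eq v)) }
    where
    open Clustered C
    open import Function using (case_of_)

  cluster-both : ∀ {P Q Y x L T u} (A : Clustered Y P x (6 * cw Q + L) T u) →
    Clustered [] Q x L (6 * cw P + T) (Clustered.u′ A) → Clustered Y (both P Q) x L T u
  cluster-both {P} {Q} {Y} {x} {L} {T} {u} A B = record
    { u′ = B.u′ ; ds = A.ds ++ B.ds ; hs = A.hs ++ B.hs ; new = A.new ++ B.new
    ; zone = subst (λ a → Zone L a B.u′) (arith-120 (cw P) (cw Q) T) B.zone
    ; single = B.single ∘ A.single ; grow = λ v → ≤-trans (A.grow v) (B.grow v)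
    ; acct = λ v → (arith-121 (occ A.new v) (occ B.new v) (occ (A.new ++ B.new) v) (occD A.ds v) (occD B.ds v)
        (occD (A.ds ++ B.ds) v) (occF A.hs v) (occF B.hs v) (occF (A.hs ++ B.hs) v) (u v) (A.u′ v) (B.u′ v) (occ Y v)
        (occ-++ A.new B.new v) (total-++ (λ d → occ (resD d) v) A.ds B.ds) (total-++ (λ d → occ (resF d) v) A.hs B.hs)
        (A.acct v) (B.acct v))
    ; placed = All-++ (Placed-mono B.grow A.placed) B.placed ; fitD = All-++ A.fitD B.fitD ; fitF = All-++ A.fitF
        B.fitF
    ; toks = trans (tokensAll-++ A.ds B.ds) (cong₂ _++_ A.toks B.toks)
    ; size = arith-122 (length A.new) (length B.new) (length (A.new ++ B.new)) (total nodesD A.ds) (total nodesD B.ds)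
        (total nodesD (A.ds ++ B.ds)) (total nodesF A.hs) (total nodesF B.hs) (total nodesF (A.hs ++ B.hs)) (nodes P)
        (nodes Q) (length-++ A.new {B.new}) (total-++ nodesD A.ds B.ds) (total-++ nodesF A.hs B.hs) A.size B.size
    ; fans = arith-123 (total fanD A.ds) (total fanD B.ds) (total fanD (A.ds ++ B.ds)) (lenF A.hs) (lenF B.hs)
        (lenF (A.hs ++ B.hs)) (fanSize P) (fanSize Q) (length Y) (total-++ fanD A.ds B.ds)
        (total-++ (λ h → length (resF h)) A.hs B.hs) A.fans B.fans
    ; recon = re }
    where
    module A = Clustered A
    module B = Clustered B
    re : ∀ {V W} → Each RealD (A.ds ++ B.ds) V → Each RealF (A.hs ++ B.hs) W →
      ∃ λ vs → Real Y (both P Q) x vs × (∀ v → occ vs v ≡ occ (A.new ++ B.new) v + occ V v + occ W v)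
    re {V} {W} ev ew with Each-split A.ds ev | Each-split A.hs ew
    ... | V₁ , V₂ , e₁ , e₂ , eqV | W₁ , W₂ , f₁ , f₂ , eqW with A.recon e₁ f₁ | B.recon e₂ f₂
    ... | vs , p , eqA | ws , q , eqB = vs ++ ws , both p q , λ v →
      (arith-124 (occ (vs ++ ws) v) (occ vs v) (occ ws v) (occ V v) (occ W v) (occ V₁ v) (occ V₂ v) (occ W₁ v)
          (occ W₂ v) (occ A.new v) (occ B.new v) (occ (A.new ++ B.new) v) (occ-++ vs ws v) (eqA v) (eqB v) (eqV v)
          (eqW v) (occ-++ A.new B.new v))

  cluster-leg : ∀ {s b bs} Y {x L T u} → Fan 2 s L T u x → Clustered Y (leg s b bs) x L T u
  cluster-leg {s} {b} {bs} Y {x} {L} {T} {u} F = record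
    { u′ = u′ ; ds = [] ; hs = free ys b bs ∷ [] ; new = [] ; zone = zone ; single = single
    ; grow = λ v → subst (u v ≤_) (sym (used v)) (m≤n+m (u v) _)
    ; acct = λ v → (arith-125 (occ Y v) (u v) (u′ v) (occ ys v) (used v))
    ; placed = [] ; fitD = [] ; fitF = size ∷ []
    ; toks = refl ; size = arith-126 (length bs)
    ; fans = arith-127 (length Y) (length ys) size
    ; recon = λ { [] (_∷_ {vs = vs} (free y∈ p) []) → vs , leg (lookup arcs y∈) p , λ v →
        (arith-128 (occ vs v) (occ (vs ++ []) v) (occ-++ vs [] v)) } }
    where
    open Fan F
    open import Data.List.Relation.Unary.All using (lookup)

  cluster-close : ∀ {s b bs e} Y {x L T u} → length Y ≡ 7 → Fan 2 s L T u x → Clustered Y (close s b bs e) x L T u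
  cluster-close {s} {b} {bs} {e} Y {x} {L} {T} {u} fit F = record
    { u′ = u′ ; ds = [] ; hs = into ys b bs e Y ∷ [] ; new = [] ; zone = zone ; single = single
    ; grow = λ v → subst (u v ≤_) (sym (used v)) (m≤n+m (u v) _)
    ; acct = λ v → (arith-129 (occ Y v) (u v) (u′ v) (occ ys v) (occ (ys ++ Y) v) (used v) (occ-++ ys Y v))
    ; placed = [] ; fitD = [] ; fitF = (size , fit) ∷ []
    ; toks = refl ; size = arith-126 (length bs)
    ; fans = arith-130 (length Y) (length ys) (length (ys ++ Y)) size (length-++ ys {Y})
    ; recon = λ { [] (_∷_ {vs = vs} (into y∈ p z∈) []) → vs , close (lookup arcs y∈) p z∈ , λ v →
        (arith-128 (occ vs v) (occ (vs ++ []) v) (occ-++ vs [] v)) } }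
    where
    open Fan F
    open import Data.List.Relation.Unary.All using (lookup)

  cluster-zed : ∀ {s H P} Y {x L T u} → Fit Y (zed s H P) → Fan 7 s L T u x → Clustered Y (zed s H P) x L T u
  cluster-zed {s} {H} {P} Y {x} {L} {T} {u} (fitH , fitP) F = record
    { u′ = u′ ; ds = zedD ys H P ∷ [] ; hs = [] ; new = [] ; zone = zone ; single = single
    ; grow = λ v → subst (u v ≤_) (sym (used v)) (m≤n+m (u v) _)
    ; acct = λ v → (arith-131 (occ Y v) (u v) (u′ v) (occ ys v) (used v))
    ; placed = tt ∷ [] ; fitD = (fitH ys size , fitP) ∷ [] ; fitF = []
    ; toks = ++-identityʳ _ ; size = arith-132 (nodes (zed s H P))
    ; fans = arith-133 (length Y) (length ys) (fanSize H) (fanSize P) size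
    ; recon = λ { (_∷_ {vs = vs} (zedD p q) []) [] → vs , zed arcs p q , λ v →
        (arith-134 (occ vs v) (occ (vs ++ []) v) (occ-++ vs [] v)) } }
    where
    open Fan F

  cluster : ∀ P Y {x L T u} → Fit Y P → Zone (6 * cw P + L) T u → 1 ≤ u x → Clustered Y P x L T u
  cluster stop Y {u = u} fit Z ux = record
    { u′ = u ; ds = [] ; hs = [] ; new = [] ; zone = Z ; single = id ; grow = λ v → ≤-refl
    ; acct = λ v → m≤n+m (u v) (occ Y v) ; placed = [] ; fitD = [] ; fitF = [] ; toks = refl ; size = refl ; fans =
        z≤n
    ; recon = λ { [] [] → [] , stop , λ v → refl } }
  cluster (pick s P) Y {x} {L} {T} {u} fit Z ux
    with subst (λ a → Zone a T u) (arith-115 (cw P) L) Z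
  ... | Z′ with neighbour s Z′ ux
  ... | y , r , f , y≥ , y< = cluster-pick r f
    (cluster P Y {y} fit (Zone-add Z′ y y≥ y<) (subst (λ a → 1 ≤ a + u y) (sym (δ-refl y)) (s≤s z≤n)))
  cluster (both P Q) Y {x} {L} {T} {u} (fitP , fitQ) Z ux = cluster-both A
    (cluster Q [] {x} fitQ (Clustered.zone A) (≤-trans ux (Clustered.grow A x)))
    where
    A : Clustered Y P x (6 * cw Q + L) T u
    A = cluster P Y {x} fitP (subst (λ a → Zone a T u) (arith-135 (cw P) (cw Q) L) Z) ux
  cluster (far s c P) Y {x} {u = u} fit Z ux = record
    { u′ = u ; ds = farD Y x s c P ∷ [] ; hs = [] ; new = [] ; zone = Z ; single = id ; grow = λ v → ≤-refl
    ; acct = λ v → (arith-136 (occ Y v) (u v)) ; placed = ux ∷ [] ; fitD = fit ∷ [] ; fitF = []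
    ; toks = ++-identityʳ _ ; size = arith-137 c (nodes P)
    ; fans = arith-138 (length Y) (fanSize P)
    ; recon = λ { {V} (_∷_ {vs = vs} (farD r) []) [] → vs , r , λ v →
        (arith-134 (occ vs v) (occ (vs ++ []) v) (occ-++ vs [] v)) } }
  cluster (leg s b bs) Y fit Z ux = cluster-leg Y (fan 2 s Z ux)
  cluster (close s b bs e) Y fit Z ux = cluster-close Y fit (fan 2 s Z ux)
  cluster (zed s H P) Y fit Z ux = cluster-zed Y fit (fan 7 s Z ux)

  -- Settling the deferred pieces outside everything placed so far

  -- `ub` counts vertices of `u` that are accounted for outside `ds`; reserves held by `ds` pass to
  -- `hs`. The crucial field is `few`: within the old zone only jump vertices are added, two for
  -- each directed path.
  record Done (lo hi top J : ℕ) (u ub : ℕ → ℕ) (ds : List Deferred) : Set where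
    field
      u′     : ℕ → ℕ
      N      : List ℕ
      hs     : List Final
      single : Single u′
      grow   : ∀ v → u v ≤ u′ v
      above  : ∀ v → top ≤ v → u′ v ≡ 0
      acct   : ∀ v → occ N v + occF hs v + ub v ≤ u′ v
      few    : ∀ a k → lo ≤ a → a + k ≤ hi → ∑ u′ a k ≤ ∑ u a k + 2 * J
      fitF   : All FitF hs
      size   : length N + total nodesF hs ≡ total nodesD ds
      fans   : lenF hs ≤ total fanD ds
      recon  : ∀ {W} → Each RealF hs W → ∃ λ V → Each RealD ds V × (∀ v → occ V v ≡ occ N v + occ W v)

  Single-join : ∀ {L T u L′ T′ u′} → Zone L T u → Zone L′ T′ u′ → T ≤ L′ → Single u → Single u′ → Single
      (λ v → u v + u′ v)
  Single-join {L′ = L′} {u′ = u′} Z Z′ gap s s′ v with v <? L′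
  ... | yes p = subst (λ z → _ + z ≤ 1) (sym (Zone.below Z′ v p)) (≤-trans (≤-reflexive (+-identityʳ _)) (s v))
  ... | no p = subst (λ z → z + u′ v ≤ 1) (sym (Zone.above Z v (≤-trans gap (≮⇒≥ p)))) (s′ v)

  base : (new : List ℕ) (hs : List Final) (z : ℕ) (ub : ℕ → ℕ) → ℕ → ℕ
  base new hs z ub v = occ new v + occF hs v + δ z v + ub v

  -- Joins the new cluster at `z`, the settlement of everything else, and the path leading to `z`.
  -- By the last hypothesis the greedy part of this path avoids the old zone, so that in `few` the
  -- path contributes just its two jump vertices and `J` grows by one.
  assemble : ∀ {Y x s c P z L₂ T₂ ds u ub lo hi top lo′ hi′ top′ J g h ft}
    (C : Clustered Y P z L₂ T₂ (δ z)) (um : ℕ → ℕ) (umE : ∀ v → um v ≡ u v + Clustered.u′ C v)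
    (D : Done lo′ hi′ top′ J um (base (Clustered.new C) (Clustered.hs C) z ub) (Clustered.ds C ++ ds)) →
    Filled (Done.u′ D) s c x z g h ft →
    (∀ v → occ Y v + occD ds v + ub v ≤ u v) →
    lo′ ≤ lo → hi ≤ hi′ → top′ ≤ top → ft ≤ top →
    (∀ a k → lo ≤ a → a + k ≤ hi → ∑ (Clustered.u′ C) a k ≡ 0) →
    hi ≤ g ⊎ h ≤ lo → Done lo hi top (suc J) u ub (farD Y x s c P ∷ ds)
  assemble {Y} {x} {s} {c} {P} {z} {ds = ds} {u} {ub} {lo} {hi} {top} {J = J} {g} {h} C um umE D F acct lo≤ hi≤ top≤
      ft≤ empty out = record
    { u′ = uf ; N = N ; hs = C.hs ++ D.hs ; single = single
    ; grow = λ v → (arith-139 (u v) (um v) (C.u′ v) (D.u′ v) (F′ v) (umE v) (D.grow v))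
    ; above = λ v p → cong₂ _+_ (D.above v (≤-trans top≤ p)) (fabove v p (F.fresh v))
    ; acct = λ v → (arith-140 (occ N v) (occF (C.hs ++ D.hs) v) (occF C.hs v) (occF D.hs v) (ub v) (D.u′ v)
        (occ C.new v) (occ D.N v) (δ z v) (δ F.a v) (δ F.b v) (occ F.gs v) (occN v) (total-++ (λ h → occ (resF h) v)
        C.hs D.hs) (D.acct v))
    ; few = few ; fitF = All-++ C.fitF D.fitF
    ; size = arith-141 (length N) c (length C.new) (length D.N) (total nodesF C.hs) (total nodesF D.hs) (total nodesF
        (C.hs ++ D.hs)) (total nodesD C.ds) (total nodesD ds) (total nodesD (C.ds ++ ds)) (nodes P) lenN
        (total-++ nodesF C.hs D.hs) (total-++ nodesD C.ds ds) C.size D.size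
    ; fans = arith-142 (lenF C.hs) (lenF D.hs) (lenF (C.hs ++ D.hs)) (total fanD C.ds) (total fanD ds)
        (total fanD (C.ds ++ ds)) (length Y) (fanSize P) (total-++ (λ h → length (resF h)) C.hs D.hs) (total-++ fanD
        C.ds ds) C.fans D.fans
    ; recon = recon }
    where
    module C = Clustered C
    module D = Done D
    module F = Filled F
    F′ : ℕ → ℕ
    F′ v = δ F.a v + δ F.b v + occ F.gs v
    uf : ℕ → ℕ
    uf v = D.u′ v + F′ v
    N : List ℕ
    N = F.a ∷ F.b ∷ F.gs ++ z ∷ C.new ++ D.N
    lenN : length N ≡ 3 + c + length C.new + length D.N
    lenN = arith-143 (length (F.gs ++ z ∷ C.new ++ D.N)) (length F.gs) (length (C.new ++ D.N)) (length C.new)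
        (length D.N) c (length-++ F.gs {z ∷ C.new ++ D.N}) (length-++ C.new {D.N}) F.size
    occN : ∀ v → occ N v ≡ δ F.a v + δ F.b v + occ F.gs v + δ z v + occ C.new v + occ D.N v
    occN v = arith-144 (δ F.a v) (δ F.b v) (occ F.gs v) (δ z v) (occ C.new v) (occ D.N v)
        (occ (F.gs ++ z ∷ C.new ++ D.N) v) (occ (C.new ++ D.N) v) (occ-++ F.gs (z ∷ C.new ++ D.N) v) (occ-++ C.new D.N
        v)
    single : Single uf
    single v with F.fresh v
    ... | inj₁ e = subst (λ t → D.u′ v + t ≤ 1) (sym e) (≤-trans (≤-reflexive (+-identityʳ _)) (D.single v))
    ... | inj₂ (e , f , _) = ≤-reflexive (cong₂ _+_ f e)
    fabove : ∀ v → top ≤ v → F′ v ≡ 0 ⊎ (F′ v ≡ 1 × D.u′ v ≡ 0 × v < _) → F′ v ≡ 0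
    fabove v p (inj₁ e) = e
    fabove v p (inj₂ (_ , _ , q)) = ⊥-elim (<-irrefl refl (<-≤-trans q (≤-trans ft≤ p)))
    few : ∀ a k → lo ≤ a → a + k ≤ hi → ∑ uf a k ≤ ∑ u a k + 2 * suc J
    few a k p q = arith-145 (∑ uf a k) (∑ D.u′ a k) (∑ F′ a k) (∑ um a k) (∑ (λ v → u v + C.u′ v) a k) (∑ u a k)
        (∑ C.u′ a k) (∑ (λ v → δ F.a v + δ F.b v) a k) (∑ (δ F.a) a k) (∑ (δ F.b) a k) (∑ (occ F.gs) a k) J
        (∑-+ D.u′ F′ a k) (D.few a k (≤-trans lo≤ p) (≤-trans q hi≤)) (∑-cong a k umE) (∑-+ u C.u′ a k)
        (empty a k p q) (∑-+ _ (occ F.gs) a k) (∑-+ (δ F.a) (δ F.b) a k) (∑δ≤1 F.a a k) (∑δ≤1 F.b a k) (∑-occ-outside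
        F.gs a k g h F.local (side out))
      where
      side : hi ≤ g ⊎ h ≤ lo → a + k ≤ g ⊎ h ≤ a
      side (inj₁ t) = inj₁ (≤-trans q t)
      side (inj₂ t) = inj₂ (≤-trans t p)
    recon : ∀ {W} → Each RealF (C.hs ++ D.hs) W → ∃ λ V → Each RealD (farD Y x s c P ∷ ds) V × (∀ v → occ V v ≡ occ N
        v + occ W v)
    recon {W} ew with Each-split C.hs ew
    ... | W₁ , W₂ , e₁ , e₂ , eqW with D.recon e₂
    ... | V , ev , eqV with Each-split C.ds ev
    ... | V₁ , V₂ , f₁ , f₂ , eqV′ with C.recon f₁ e₁
    ... | vs , real , eqR = (F.vs ++ vs) ++ V₂ , farD (far F.path real) ∷ f₂ , λ v →
      (arith-146 (occ ((F.vs ++ vs) ++ V₂) v) (occ (F.vs ++ vs) v) (occ F.vs v) (occ vs v) (occ V v) (occ V₁ v)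
          (occ V₂ v) (occ W v) (occ W₁ v) (occ W₂ v) (occ N v) (occ C.new v) (occ D.N v) (δ z v) (δ F.a v) (δ F.b v)
          (occ F.gs v) (occ-++ (F.vs ++ vs) V₂ v) (occ-++ F.vs vs v) (F.content v) (eqR v) (eqV v) (eqV′ v) (eqW v)
          (occN v))

  -- The reserve `Y` passes from the deferred piece to the pieces left over by its cluster; it
  -- occurs on the right of `Clustered.acct` and on the left of `acct`, and cancels.
  base-acct : ∀ {Y P z L₂ T₂ ds} {u um ub : ℕ → ℕ} (C : Clustered Y P z L₂ T₂ (δ z)) → (∀ v → um v ≡ u v +
      Clustered.u′ C v) →
    (∀ v → occ Y v + occD ds v + ub v ≤ u v) →
    ∀ v → occD (Clustered.ds C ++ ds) v + base (Clustered.new C) (Clustered.hs C) z ub v ≤ um v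
  base-acct {Y} {z = z} {ds = ds} {u} {um} {ub} C umE acct v = arith-147 (occD (C.ds ++ ds) v) (occD C.ds v)
      (occD ds v) (occ C.new v) (occF C.hs v) (δ z v) (ub v) (occ Y v) (um v) (u v) (C.u′ v)
      (total-++ (λ d → occ (resD d) v) C.ds ds) (C.acct v) (acct v) (umE v)
    where module C = Clustered C

  single-δ : ∀ z → Single (δ z)
  single-δ z v = δ≤1 z v

  right-filled : ∀ {u u₂ ud x T c p J Lo L₂ T₂} k₀ → Zone Lo T u → Zone L₂ T₂ u₂ → Lo ≤ x → suc x + k₀ ≡ T →
    L₂ ≡ T + (12 * J + 17) + (c + 4 * J + 2) → T₂ ≡ 6 * p + suc (6 * p + L₂) →
    (∀ a k → Lo ≤ a → a + k ≤ T₂ → ∑ ud a k ≤ ∑ u a k + ∑ u₂ a k + 2 * J) →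
    Filled ud true c x (6 * p + L₂) (T + (12 * J + 17)) (6 * p + L₂) (6 * p + L₂)
  right-filled {u} {u₂} {ud} {x} {T} {c} {p} {J} {Lo} {L₂} {T₂} k₀ Z Z₂ lo≤x T≡ L₂≡ T₂≡ count =
    subst₂ (λ g z → Filled ud true c x z g z z) g≡ z≡ (fillR ud c x G W near-enough far-enough)
    where
    G = k₀ + (12 * J + 17)
    W = c + 4 * J + 2 + 6 * p
    g≡ : suc x + G ≡ T + (12 * J + 17)
    g≡ = trans (sym (+-assoc (suc x) k₀ _)) (cong (_+ (12 * J + 17)) T≡)
    z≡ : suc x + G + W ≡ 6 * p + L₂
    z≡ = arith-148 x (k₀) J c p T (L₂) T≡ L₂≡
    z≤ : suc x + G + W ≤ T₂
    z≤ = arith-149 (suc x + G + W) p (L₂) (T₂) z≡ T₂≡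
    -- The old zone ends before this stretch. The new zone contributes at most `p + 1` vertices and
    -- the jumps `2 * J`; doubled, this is at most `6 * p + 2 + 4 * J`.
    near-enough : c + 2 * ∑ ud (suc x + G) W ≤ W
    near-enough = arith-244 (∑ ud (suc x + G) W) (∑ u (suc x + G) W) (∑ u₂ (suc x + G) W) c J p (count (suc x + G) W
        (arith-150 (Lo) x G lo≤x) z≤) (∑-above Z (suc x + G) W (arith-151 T x (k₀) J T≡)) (∑-prefix Z₂ (suc x + G) W
        (6 * p) (≤-reflexive (trans z≡ (+-comm (6 * p) L₂))))
    -- Under the jump lie the rest of the old zone, the beginning of the new one and `2 * J` jump
    -- vertices. The two densities cost `6` each in rounding and `jump` asks for `5`, which gives
    -- `12 * J + 17`.
    far-enough : ∀ t → t ≤ W → 6 * ∑ ud (suc x) (G + t) + 5 ≤ G + t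
    far-enough t t≤W = arith-245 (∑ ud (suc x) (G + t)) (∑ u (suc x) (G + t)) (∑ u₂ (suc x) (G + t)) J (k₀) t
        (count (suc x) (G + t) (≤-trans lo≤x (n≤1+n x)) (arith-152 x G t W (T₂) t≤W z≤)) (∑-suffix Z (suc x) (G + t)
        k₀ (≤-reflexive (sym T≡))) (∑-prefix Z₂ (suc x) (G + t) t (arith-153 x (k₀) J t T c (L₂) T≡ L₂≡))

  left-filled : ∀ {u u₂ ud x T c p J L₀ L₂ T₂} k₀ → Zone L₀ T u → Zone L₂ T₂ u₂ → x < T → L₀ + k₀ ≡ x →
    T₂ ≡ 6 * p + suc (6 * p + L₂) → L₀ ≡ c + 12 * p + 20 + 16 * J + L₂ →
    (∀ a k → L₂ ≤ a → a + k ≤ T → ∑ ud a k ≤ ∑ u₂ a k + ∑ u a k + 2 * J) →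
    Filled ud false c x (6 * p + L₂) (suc (6 * p + L₂)) (suc (6 * p + L₂) + (6 * p + (c + 4 * J + 2))) x
  left-filled {u} {u₂} {ud} {x} {T} {c} {p} {J} {L₀} {L₂} {T₂} k₀ Z Z₂ x<T x≡ T₂≡ L₀≡ count =
    subst (λ y → Filled ud false c y z (suc z) (suc z + W) y) x≡′ (fillL ud c z G W near-enough far-enough)
    where
    z = 6 * p + L₂
    G = 12 * J + 17 + k₀
    W = 6 * p + (c + 4 * J + 2)
    x≡′ : suc z + W + G ≡ x
    x≡′ = arith-154 (L₂) (L₀) p J c (k₀) x x≡ L₀≡
    z+W≤L₀ : suc z + W ≤ L₀
    z+W≤L₀ = arith-155 (L₂) (L₀) p J c L₀≡
    near-enough : c + 2 * ∑ ud (suc z) W ≤ W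
    near-enough = arith-246 (∑ ud (suc z) W) (∑ u (suc z) W) (∑ u₂ (suc z) W) c J p (count (suc z) W
        (arith-156 p (L₂)) (arith-157 (suc z + W) (L₀) x (k₀) T z+W≤L₀ x≡ x<T)) (∑-below Z (suc z) W z+W≤L₀)
        (∑-suffix Z₂ (suc z) W (6 * p) (≤-reflexive (trans T₂≡ (+-comm (6 * p) (suc z)))))
    far-enough : ∀ t t′ → t + t′ ≡ W → 6 * ∑ ud (suc z + t) (t′ + G) + 5 ≤ t′ + G
    far-enough t t′ t≡ = arith-247 (∑ ud (suc z + t) (t′ + G)) (∑ u (suc z + t) (t′ + G)) (∑ u₂ (suc z + t) (t′ + G))
        J (k₀) (t′) (count (suc z + t) (t′ + G) (arith-158 p (L₂) t) (≤-trans (≤-reflexive end) (<⇒≤ x<T)))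
        (∑-prefix Z (suc z + t) (t′ + G) k₀ (≤-reflexive (trans end (sym x≡)))) (∑-suffix Z₂ (suc z + t) (t′ + G) t′
        (arith-159 (T₂) z p t (t′) (c + 4 * J + 2) T₂≡ t≡))
      where
      end : suc z + t + (t′ + G) ≡ x
      end = trans (arith-160 z t (t′) W G t≡) x≡′

  toks-++ : ∀ {Y P x L T u} (C : Clustered Y P x L T u) ds → tokensAll (Clustered.ds C ++ ds) ≡ tokens P ++ tokensAll
      ds
  toks-++ C ds = trans (tokensAll-++ (Clustered.ds C) ds) (cong (_++ tokensAll ds) (Clustered.toks C))

  -- The induction is on the number of tokens, not of pieces: settling a piece may defer several new
  -- ones, but all of them are covered by the tokens of its plan, and one token has been consumed.
  Goal : ℕ → Set
  Goal n = ∀ ds {L T u ub} → length (tokensAll ds) ≡ n → Zone (demand false (tokensAll ds) + L) T u → Single u →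
    All (Placed u) ds → All FitD ds → (∀ v → occD ds v + ub v ≤ u v) →
    Done (demand false (tokensAll ds) + L) T (demand true (tokensAll ds) + T) (jumps (tokensAll ds)) u ub ds

  -- The induction is applied to the old zone joined with the new cluster. Later clusters then lie
  -- outside both, and nothing but jump vertices can enter the stretch between the two.
  far-right : ∀ {n} → Goal n → ∀ {Y x c P ds L T u ub} →
    length (tokens P ++ tokensAll ds) ≡ n → Zone (demand false (tokens P ++ tokensAll ds) + L) T u → Single u →
    1 ≤ u x → All (Placed u) ds → All FitD ds → (∀ v → occ Y v + occD ds v + ub v ≤ u v) →
    let ts = tokens P ++ tokensAll ds ; J = jumps ts ; L₂ = T + (12 * J + 17) + (c + 4 * J + 2) ; z = 6 * cw P + L₂ in
    Clustered Y P z L₂ (suc z) (δ z) →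
    Done (demand false ts + L) T (c + 12 * cw P + 20 + 16 * J + demand true ts + T) (suc J) u ub (farD Y x true c P ∷
        ds)
  far-right {n} rec {Y} {x} {c} {P} {ds} {L} {T} {u} {ub} eq Z single ux placed fits acct C =
    finish (m≤n⇒∃[o]m+o≡n (proj₂ (Zone.within Z ux)))
    where
    module C = Clustered C
    ts = tokens P ++ tokensAll ds
    J = jumps ts
    L₂ = T + (12 * J + 17) + (c + 4 * J + 2)
    z = 6 * cw P + L₂
    T₂ = 6 * cw P + suc z
    um : ℕ → ℕ
    um v = u v + C.u′ v
    T≤L₂ : T + 6 ≤ L₂
    T≤L₂ = arith-161 T J c
    D : Done (demand false ts + L) T₂ (demand true ts + T₂) J um (base C.new C.hs z ub) (C.ds ++ ds)
    D = subst (λ t → Done (demand false t + L) T₂ (demand true t + T₂) (jumps t) um (base C.new C.hs z ub)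
        (C.ds ++ ds)) (toks-++ C ds)
      (rec (C.ds ++ ds) (trans (cong length (toks-++ C ds)) eq)
        (subst (λ t → Zone (demand false t + L) T₂ um) (sym (toks-++ C ds)) (Zone-join Z C.zone T≤L₂))
        (Single-join Z C.zone (≤-trans (m≤m+n T 6) T≤L₂) single (C.single (single-δ z)))
        (All-++ (Placed-mono (λ v → m≤n+m _ (u v)) C.placed) (Placed-mono (λ v → m≤m+n (u v) _) placed))
        (All-++ C.fitD fits) (base-acct {ds = ds} {u} C (λ v → refl) acct))
    finish : (∃ λ k₀ → suc x + k₀ ≡ T) →
      Done (demand false ts + L) T (c + 12 * cw P + 20 + 16 * J + demand true ts + T) (suc J) u ub (farD Y x true c P
          ∷ ds)
    finish (k₀ , T≡) = assemble {ds = ds} C um (λ v → refl) D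
      (right-filled {p = cw P} {J} k₀ Z C.zone (proj₁ (Zone.within Z ux)) T≡ refl refl
        (λ a k q r → subst (λ t → ∑ (Done.u′ D) a k ≤ t + 2 * J) (∑-+ u C.u′ a k) (Done.few D a k q r))) acct ≤-refl
      (arith-162 T (cw P) J c)
      (arith-163 (demand true ts) (cw P) T J c)
      (arith-164 (demand true ts) (cw P) T J c)
      (λ a k _ q → ∑-below C.zone a k (≤-trans q (≤-trans (m≤m+n T 6) T≤L₂)))
      (inj₁ (m≤m+n T _))

  far-left : ∀ {n} → Goal n → ∀ {Y x c P ds L T u ub} →
    let ts = tokens P ++ tokensAll ds ; J = jumps ts ; L₂ = demand false ts + L ; z = 6 * cw P + L₂ in
    length ts ≡ n → Zone (c + 12 * cw P + 20 + 16 * J + demand false ts + L) T u → Single u →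
    1 ≤ u x → All (Placed u) ds → All FitD ds → (∀ v → occ Y v + occD ds v + ub v ≤ u v) →
    Clustered Y P z L₂ (suc z) (δ z) →
    Done (c + 12 * cw P + 20 + 16 * J + demand false ts + L) T (demand true ts + T) (suc J) u ub (farD Y x false c P ∷
        ds)
  far-left {n} rec {Y} {x} {c} {P} {ds} {L} {T} {u} {ub} eq Z single ux placed fits acct C =
    finish (m≤n⇒∃[o]m+o≡n (proj₁ (Zone.within Z ux)))
    where
    module C = Clustered C
    ts = tokens P ++ tokensAll ds
    J = jumps ts
    L₂ = demand false ts + L
    L₀ = c + 12 * cw P + 20 + 16 * J + demand false ts + L
    z = 6 * cw P + L₂
    T₂ = 6 * cw P + suc z
    um : ℕ → ℕ
    um v = C.u′ v + u v
    T₂≤L₀ : T₂ + 6 ≤ L₀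
    T₂≤L₀ = arith-165 (demand false ts) L (cw P) J c
    D : Done L₂ T (demand true ts + T) J um (base C.new C.hs z ub) (C.ds ++ ds)
    D = subst (λ t → Done (demand false t + L) T (demand true t + T) (jumps t) um (base C.new C.hs z ub) (C.ds ++ ds))
        (toks-++ C ds)
      (rec (C.ds ++ ds) (trans (cong length (toks-++ C ds)) eq)
        (subst (λ t → Zone (demand false t + L) T um) (sym (toks-++ C ds)) (Zone-join C.zone Z T₂≤L₀))
        (Single-join C.zone Z (≤-trans (m≤m+n T₂ 6) T₂≤L₀) (C.single (single-δ z)) single)
        (All-++ (Placed-mono (λ v → m≤m+n _ (u v)) C.placed) (Placed-mono (λ v → m≤n+m (u v) _) placed))
        (All-++ C.fitD fits) (base-acct {ds = ds} {u} C (λ v → +-comm (C.u′ v) (u v)) acct))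
    finish : (∃ λ k₀ → L₀ + k₀ ≡ x) → Done L₀ T (demand true ts + T) (suc J) u ub (farD Y x false c P ∷ ds)
    finish (k₀ , x≡) = assemble {ds = ds} C um (λ v → +-comm (C.u′ v) (u v)) D
      (left-filled {p = cw P} {J} k₀ Z C.zone (proj₂ (Zone.within Z ux)) x≡ refl
        (arith-166 (demand false ts) L (cw P) J c)
        (λ a k q r → subst (λ t → ∑ (Done.u′ D) a k ≤ t + 2 * J) (∑-+ C.u′ u a k) (Done.few D a k q r))) acct
      (arith-167 (demand false ts) L (cw P) J c) ≤-refl ≤-refl
      (≤-trans (<⇒≤ (proj₂ (Zone.within Z ux))) (m≤n+m T _))
      (λ a k q _ → ∑-above C.zone a k (≤-trans (≤-trans (m≤m+n T₂ 6) T₂≤L₀) q))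
      (inj₂ (arith-168 (demand false ts) L (cw P) J c))

  base-acct₂ : ∀ {Y H P z L₁ L₂ T₁ T₂ ds} {u ub : ℕ → ℕ} (A : Clustered Y H z L₁ T₁ (δ z)) (B : Clustered [] P z L₂ T₂
      (Clustered.u′ A)) →
    (∀ v → occ Y v + occD ds v + ub v ≤ u v) →
    ∀ v → occD ((Clustered.ds A ++ Clustered.ds B) ++ ds) v
      + base (Clustered.new A ++ Clustered.new B) (Clustered.hs A ++ Clustered.hs B) z ub v ≤ u v + Clustered.u′ B v
  base-acct₂ {Y} {z = z} {ds = ds} {u} {ub} A B acct v =
    (arith-169 (occD ((A.ds ++ B.ds) ++ ds) v) (occD (A.ds ++ B.ds) v) (occD A.ds v) (occD B.ds v) (occD ds v)
        (occ A.new v) (occ B.new v) (occ (A.new ++ B.new) v) (occF (A.hs ++ B.hs) v) (occF A.hs v) (occF B.hs v)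
        (δ z v) (ub v) (u v) (A.u′ v) (B.u′ v) (occ Y v) (total-++ (λ d → occ (resD d) v) (A.ds ++ B.ds) ds)
        (total-++ (λ d → occ (resD d) v) A.ds B.ds) (occ-++ A.new B.new v) (total-++ (λ h → occ (resF h) v) A.hs B.hs)
        (A.acct v) (B.acct v) (acct v))
    where
    module A = Clustered A
    module B = Clustered B

  zed-assemble : ∀ {Y H P ds lo hi top T₂ J u ub z L₁ L₂ T₁ T₀}
    (A : Clustered Y H z L₁ T₁ (δ z)) (B : Clustered [] P z L₂ T₀ (Clustered.u′ A)) →
    Done lo T₂ (top + T₂) J (λ v → u v + Clustered.u′ B v)
      (base (Clustered.new A ++ Clustered.new B) (Clustered.hs A ++ Clustered.hs B) z ub)
      ((Clustered.ds A ++ Clustered.ds B) ++ ds) →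
    hi + 6 ≤ L₂ → hi ≤ T₂ → T₂ ≤ 12 * (cw H + cw P) + 7 + hi →
    Done lo hi (12 * (cw H + cw P) + 7 + top + hi) J u ub (zedD Y H P ∷ ds)
  zed-assemble {Y} {H} {P} {ds} {lo} {T} {top} {T₂} {J} {u} {ub} {z} A B D T≤L₂ T≤T₂ T₂≤ = record
    { u′ = D.u′ ; N = N ; hs = (A.hs ++ B.hs) ++ D.hs ; single = D.single
    ; grow = λ v → ≤-trans (m≤m+n (u v) _) (D.grow v)
    ; above = λ v p → D.above v (≤-trans (arith-170 (top) (12 * (cw H + cw P) + 7) T (T₂) T₂≤) p)
    ; acct = λ v → (arith-171 (occ N v) (δ z v) (occ A.new v) (occ B.new v) (occ (A.new ++ B.new) v) (occ D.N v)
        (occF ((A.hs ++ B.hs) ++ D.hs) v) (occF (A.hs ++ B.hs) v) (occF A.hs v) (occF B.hs v) (occF D.hs v) (ub v)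
        (D.u′ v) (occN v) (total-++ (λ h → occ (resF h) v) (A.hs ++ B.hs) D.hs) (total-++ (λ h → occ (resF h) v) A.hs
        B.hs) (occ-++ A.new B.new v) (D.acct v))
    ; few = λ a k p q → (arith-172 (∑ D.u′ a k) (∑ um a k) (∑ u a k) (∑ B.u′ a k) J (D.few a k p (≤-trans q T≤T₂))
        (∑-+ u B.u′ a k) (∑-below B.zone a k (≤-trans q (≤-trans (m≤m+n T 6) T≤L₂))))
    ; fitF = All-++ (All-++ A.fitF B.fitF) D.fitF
    ; size = arith-173 (length N) (length A.new) (length B.new) (length D.N) (total nodesF ((A.hs ++ B.hs) ++ D.hs))
        (total nodesF (A.hs ++ B.hs)) (total nodesF A.hs) (total nodesF B.hs) (total nodesF D.hs) (total nodesD
        ((A.ds ++ B.ds) ++ ds)) (total nodesD (A.ds ++ B.ds)) (total nodesD A.ds) (total nodesD B.ds) (total nodesD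
        ds) (nodes H) (nodes P) lenN (total-++ nodesF (A.hs ++ B.hs) D.hs) (total-++ nodesF A.hs B.hs)
        (total-++ nodesD (A.ds ++ B.ds) ds) (total-++ nodesD A.ds B.ds) A.size B.size D.size
    ; fans = arith-174 (lenF ((A.hs ++ B.hs) ++ D.hs)) (lenF (A.hs ++ B.hs)) (lenF A.hs) (lenF B.hs) (lenF D.hs)
        (total fanD ((A.ds ++ B.ds) ++ ds)) (total fanD (A.ds ++ B.ds)) (total fanD A.ds) (total fanD B.ds)
        (total fanD ds) (fanSize H) (fanSize P) (length Y) (total-++ (λ h → length (resF h)) (A.hs ++ B.hs) D.hs)
        (total-++ (λ h → length (resF h)) A.hs B.hs) (total-++ fanD (A.ds ++ B.ds) ds) (total-++ fanD A.ds B.ds)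
        A.fans B.fans D.fans
    ; recon = recon }
    where
    module A = Clustered A
    module B = Clustered B
    um : ℕ → ℕ
    um v = u v + B.u′ v
    module D = Done D
    N : List ℕ
    N = z ∷ A.new ++ B.new ++ D.N
    occN : ∀ v → occ N v ≡ δ z v + occ A.new v + occ B.new v + occ D.N v
    occN v = arith-175 (δ z v) (occ A.new v) (occ B.new v) (occ D.N v) (occ (A.new ++ B.new ++ D.N) v)
        (occ (B.new ++ D.N) v) (occ-++ A.new (B.new ++ D.N) v) (occ-++ B.new D.N v)
    lenN : length N ≡ 1 + length A.new + length B.new + length D.N
    lenN = arith-176 (length A.new) (length B.new) (length D.N) (length (A.new ++ B.new ++ D.N))
        (length (B.new ++ D.N)) (length-++ A.new {B.new ++ D.N}) (length-++ B.new {D.N})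
    recon : ∀ {W} → Each RealF ((A.hs ++ B.hs) ++ D.hs) W → ∃ λ V → Each RealD (zedD Y H P ∷ ds) V × (∀ v → occ V v ≡
        occ N v + occ W v)
    recon {W} ew with Each-split (A.hs ++ B.hs) ew
    ... | W₀ , W₃ , e₀ , e₃ , eqW with Each-split A.hs e₀ | D.recon e₃
    ... | W₁ , W₂ , e₁ , e₂ , eqW₀ | V , ev , eqV with Each-split (A.ds ++ B.ds) ev
    ... | V₀ , V₃ , f₀ , f₃ , eqV′ with Each-split A.ds f₀
    ... | V₁ , V₂ , f₁ , f₂ , eqV₀ with A.recon f₁ e₁ | B.recon f₂ e₂
    ... | vs , p , eqA | ws , q , eqB = (z ∷ vs ++ ws) ++ V₃ , zedD p q ∷ f₃ , λ v →
      (arith-177 (occ ((z ∷ vs ++ ws) ++ V₃) v) (occ (vs ++ ws) v) (δ z v) (occ vs v) (occ ws v) (occ V v) (occ V₀ v)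
          (occ V₁ v) (occ V₂ v) (occ V₃ v) (occ W v) (occ W₀ v) (occ W₁ v) (occ W₂ v) (occ W₃ v) (occ N v)
          (occ A.new v) (occ B.new v) (occ D.N v) (occ-++ (z ∷ vs ++ ws) V₃ v) (occ-++ vs ws v) (eqA v) (eqB v)
          (eqV v) (eqV′ v) (eqV₀ v) (eqW v) (eqW₀ v) (occN v))

  -- No arc joins the new zone to the old one yet: the return path will do so at the end, through
  -- the reserve `Y`. The gap of six required by `Zone-join` is therefore the whole distance between
  -- them.
  zed-right : ∀ {n} → Goal n → ∀ {Y H P ds L T u ub z L₁ L₂ T₁ T₂} →
    length (tokens H ++ tokens P ++ tokensAll ds) ≡ n → Zone (demand false (tokens H ++ tokens P ++ tokensAll ds) + L)
        T u → Single u →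
    All (Placed u) ds → All FitD ds → (∀ v → occ Y v + occD ds v + ub v ≤ u v) →
    T + 6 ≤ L₂ → 6 * cw P + T₂ ≤ 12 * (cw H + cw P) + 7 + T →
    (A : Clustered Y H z L₁ T₁ (δ z)) → Clustered [] P z L₂ T₂ (Clustered.u′ A) →
    Done (demand false (tokens H ++ tokens P ++ tokensAll ds) + L) T (12 * (cw H + cw P) + 7 + demand true
        (tokens H ++ tokens P ++ tokensAll ds) + T)
      (jumps (tokens H ++ tokens P ++ tokensAll ds)) u ub (zedD Y H P ∷ ds)
  zed-right {n} rec {Y} {H} {P} {ds} {L} {T} {u} {ub} {z} {L₁} {L₂} {T₁} {T₀} eq Z single placed fits acct T≤L₂ T₂≤ A
      B =
    zed-assemble {ds = ds} A B D T≤L₂ T≤T₂ T₂≤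
    where
    module A = Clustered A
    module B = Clustered B
    ts = tokens H ++ tokens P ++ tokensAll ds
    J = jumps ts
    T₂ = 6 * cw P + T₀
    T≤T₂ : T ≤ T₂
    T≤T₂ = ≤-trans (≤-trans (m≤m+n T 6) T≤L₂) (Zone.L≤T B.zone)
    es = (A.ds ++ B.ds) ++ ds
    um : ℕ → ℕ
    um v = u v + B.u′ v
    ub′ : ℕ → ℕ
    ub′ = base (A.new ++ B.new) (A.hs ++ B.hs) z ub
    toks≡ : tokensAll es ≡ ts
    toks≡ = trans (tokensAll-++ (A.ds ++ B.ds) ds) (trans (cong (_++ tokensAll ds) (trans (tokensAll-++ A.ds B.ds)
        (cong₂ _++_ A.toks B.toks)))
      (++-assoc (tokens H) (tokens P) (tokensAll ds)))
    joined : Zone (demand false ts + L) T₂ um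
    joined = Zone-join {demand false ts + L} {T} {u} {L₂} {T₂} {B.u′} Z B.zone T≤L₂
    D : Done (demand false ts + L) T₂ (demand true ts + T₂) J um ub′ es
    D = subst (λ t → Done (demand false t + L) T₂ (demand true t + T₂) (jumps t) um ub′ es) toks≡
      (rec es {L} {T₂} {um} {ub′} (trans (cong length toks≡) eq)
        (subst (λ t → Zone (demand false t + L) T₂ um) (sym toks≡) joined)
        (Single-join Z B.zone (≤-trans (m≤m+n T 6) T≤L₂) single (B.single (A.single (single-δ z))))
        (All-++ (Placed-mono {B.u′} {um} (λ v → m≤n+m (B.u′ v) (u v)) (All-++ (Placed-mono {A.u′} {B.u′} B.grow
            A.placed) B.placed)) (Placed-mono {u} {um} (λ v → m≤m+n (u v) (B.u′ v)) placed))
        (All-++ (All-++ A.fitD B.fitD) fits) (base-acct₂ {ds = ds} {u} A B acct))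

  cluster-at : ∀ P Y L → Fit Y P → Clustered Y P (6 * cw P + L) L (suc (6 * cw P + L)) (δ (6 * cw P + L))
  cluster-at P Y L fit = cluster P Y fit (Zone-point (6 * cw P + L)) (≤-reflexive (sym (δ-refl (6 * cw P + L))))

  -- A deferred zone is settled before the path leading to it is filled in, so that at that time the part of the
  -- tournament lying between contains few vertices besides those of the core.
  settle : ∀ n → Goal n
  settle n [] {u = u} eq Z single placed fit acct = record
    { u′ = u ; N = [] ; hs = [] ; single = single ; grow = λ v → ≤-refl ; above = Zone.above Z ; acct = acct
    ; few = λ a k _ _ → m≤m+n _ 0 ; fitF = [] ; size = refl ; fans = z≤n ; recon = λ { [] → [] , [] , λ v → refl } }
  settle (suc n) (farD Y x true c P ∷ ds) eq Z single (ux ∷ placed) (fit ∷ fits) acct =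
    far-right (settle n) (suc-injective eq) Z single ux placed fits acct
      (cluster-at P Y _ fit)
  settle (suc n) (farD Y x false c P ∷ ds) eq Z single (ux ∷ placed) (fit ∷ fits) acct =
    far-left (settle n) (suc-injective eq) Z single ux placed fits acct
      (cluster-at P Y _ fit)
  settle (suc n) (zedD Y H P ∷ ds) {L} {T} {u} {ub} eq Z single (_ ∷ placed) ((fitH , fitP) ∷ fits) acct =
    subst (λ t → Done (demand false t + L) T (w + demand true t + T) (jumps t) u ub (zedD Y H P ∷ ds)) (sym assoc)
      (zed-right (settle n) (trans (cong length (sym assoc)) (suc-injective eq))
        (subst (λ t → Zone (demand false t + L) T u) assoc Z) single placed fits acct ≤-refl
        (arith-178 (cw H) (cw P) T) A
        (cluster P [] fitP (Clustered.zone A) (≤-trans (≤-reflexive (sym (δ-refl z))) (Clustered.grow A z))))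
    where
    w = 12 * (cw H + cw P) + 7
    -- Room to the left of `z` for two clusters sharing this vertex: that of the return path and
    -- that of the subtree.
    z = 6 * (cw H + cw P) + (T + 6)
    assoc : (tokens H ++ tokens P) ++ tokensAll ds ≡ tokens H ++ tokens P ++ tokensAll ds
    assoc = ++-assoc (tokens H) (tokens P) (tokensAll ds)
    A : Clustered Y H z (6 * cw P + (T + 6)) (suc z) (δ z)
    A = cluster H Y fitH (subst (λ a → Zone a (suc z) (δ z)) (arith-179 (cw H) (cw P) T) (Zone-point z))
      (≤-reflexive (sym (δ-refl z)))

  -- Origins of oriented paths with a prescribed set of ends

  arc? : ∀ s x y → Dec (Arc s x y)
  arc? true x y = R x y Data.Bool.≟ true
    where import Data.Bool
  arc? false x y = R y x Data.Bool.≟ true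
    where import Data.Bool

  private
    R-or : ∀ {x y} → x ≢ y → ¬ (R x y ≡ true) → R y x ≡ true
    R-or {x} {y} n h with R x y in eq
    ... | true = ⊥-elim (h refl)
    ... | false = trans (tot (n ∘ sym)) (cong not eq)

  arc-irr : ∀ s {x} → ¬ Arc s x x
  arc-irr true {x} p with trans (sym p) (irr x)
  ... | ()
  arc-irr false {x} p = arc-irr true p

  arc-or : ∀ s {x y} → x ≢ y → ¬ Arc s x y → Arc s y x
  arc-or true n h = R-or n h
  arc-or false n h = R-or (n ∘ sym) h

  arc-flip : ∀ s {x y} → Arc s y x → Arc (not s) x y
  arc-flip true p = p
  arc-flip false p = p

  data Dir (s : Bool) : ℕ → ℕ → List ℕ → ℕ → Set where
    []  : ∀ {x} → Dir s 0 x [] x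
    _∷_ : ∀ {k x y ys z} → Arc s x y → Dir s k y ys z → Dir s (suc k) x (y ∷ ys) z

  Dir-++ : ∀ {s i j x y z ps qs} → Dir s i x ps y → Dir s j y qs z → Dir s (i + j) x (ps ++ qs) z
  Dir-++ [] q = q
  Dir-++ (a ∷ p) q = a ∷ Dir-++ p q

  Dir-take : ∀ {s n x ps z} k → k ≤ n → Dir s n x ps z → ∃ λ qs → ∃ λ w → Dir s k x qs w × (∀ v → occ qs v ≤ occ ps v)
  Dir-take zero _ p = [] , _ , [] , λ v → z≤n
  Dir-take (suc k) (s≤s le) (_∷_ {y = y} a p) with Dir-take k le p
  ... | qs , w , q , h = y ∷ qs , w , a ∷ q , λ v → +-monoʳ-≤ (δ y v) (h v)

  Dir-end : ∀ {s k x ps z} → Dir s (suc k) x ps z → In ps z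
  Dir-end {z = z} (_ ∷ []) = In-here z []
  Dir-end (_∷_ {y = y} _ (a ∷ p)) = In-there y (Dir-end (a ∷ p))

  Dir-split : ∀ {s k x ps z y} → Dir s k x ps z → In ps y →
    ∃ λ i → ∃ λ j → ∃ λ qs → ∃ λ rs → ∃ λ w → Dir s i x qs w × Dir s j y rs z × k ≡ suc (i + j) ×
      (∀ v → occ ps v ≡ occ qs v + (δ y v + occ rs v))
  Dir-split {y = y} (_∷_ {y = p} {ys = ps} a d) i with In-case {p} {ps} i
  ... | inj₁ refl = 0 , _ , [] , _ , _ , [] , d , refl , λ v → refl
  ... | inj₂ i′ with Dir-split d i′
  ... | i , j , qs , rs , w , d₁ , d₂ , refl , eq = suc i , j , p ∷ qs , rs , w , a ∷ d₁ , d₂ , refl ,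
    λ v → trans (cong (δ p v +_) (eq v)) (sym (+-assoc (δ p v) _ _))

  -- The theorem of Rédei: `x` is inserted before the first vertex of the path to which it has an
  -- arc of sign `s`, or else at the end.
  ham : ∀ s A → Unique A → 1 ≤ length A →
    ∃ λ d → ∃ λ ps → ∃ λ z → Dir s (length ps) d ps z × suc (length ps) ≡ length A × (∀ v → occ A v ≡ occ (d ∷ ps) v)
  ham s (x ∷ []) h _ = x , [] , x , [] , refl , λ v → refl
  ham s (x ∷ A@(_ ∷ _)) h _ with ham s A (mk λ v → ≤-trans (m≤n+m _ (δ x v)) (once h v)) (s≤s z≤n)
  ... | d , ps , z , path , len , eq with insert path (λ v i → ≢-head {x} {A} h (mk (subst (1 ≤_) (sym (eq v))
      (hit i))))
    where
    Ins : ∀ (d : ℕ) (ps : List ℕ) → Set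
    Ins d ps = ∃ λ d′ → ∃ λ ps′ → ∃ λ z → Dir s (suc (length ps)) d′ ps′ z × length ps′ ≡ suc (length ps) ×
      (d′ ≡ x ⊎ d′ ≡ d) × (∀ v → occ (d′ ∷ ps′) v ≡ δ x v + occ (d ∷ ps) v)
    insert : ∀ {d ps z} → Dir s (length ps) d ps z → (∀ v → In (d ∷ ps) v → v ≢ x) → Ins d ps
    insert {d} {ps} path ne with arc? s x d
    ... | yes a = x , d ∷ ps , _ , a ∷ path , refl , inj₁ refl , λ v → refl
    insert {d} {[]} [] ne | no n = d , x ∷ [] , x , arc-or s (ne d (In-here d []) ∘ sym) n ∷ [] , refl , inj₂ refl ,
      λ v → (arith-180 (δ d v) (δ x v))
    insert {d} {p ∷ ps} (a ∷ path) ne | no n with insert path (λ v i → ne v (In-there d i))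
    ... | d′ , ps′ , z , path′ , len′ , inj₁ refl , eq′ = d , d′ ∷ ps′ , z , arc-or s (ne d (In-here d (p ∷ ps)) ∘
        sym) n ∷ path′ , cong suc len′ , inj₂ refl ,
      λ v → (arith-31 (δ d v) (δ x v) (occ (d′ ∷ ps′) v) (occ (p ∷ ps) v) (eq′ v))
    ... | d′ , ps′ , z , path′ , len′ , inj₂ refl , eq′ = d , d′ ∷ ps′ , z , a ∷ path′ , cong suc len′ , inj₂ refl ,
      λ v → (arith-31 (δ d v) (δ x v) (occ (d′ ∷ ps′) v) (occ (p ∷ ps) v) (eq′ v))
  ... | d′ , ps′ , z′ , path′ , len′ , _ , eq′ = d′ , ps′ , z′ , subst (λ n → Dir s n d′ ps′ z′) (sym len′) path′ ,
    cong suc (trans len′ len) , λ v → trans (cong (δ x v +_) (eq v)) (sym (eq′ v))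

  data Good (Y : List ℕ) (bs : List Bool) (x : ℕ) (A : List ℕ) : Set where
    good : ∀ {vs z} → P⟦ bs ⟧ x vs z → In Y z → (∀ v → occ vs v ≤ occ A v) → Good Y bs x A

  good-step : ∀ {Y Y′ s bs x a A B} → Arc s x a → (∀ v → In Y′ v → In Y v) → (∀ v → δ a v + occ B v ≤ occ A v) →
    Good Y′ bs a B → Good Y (s ∷ bs) x A
  good-step {a = a} r inc sub (good p i h) = good (r ∷ p) (inc _ i) λ v → ≤-trans (+-monoʳ-≤ (δ a v) (h v)) (sub v)

  good-pair : ∀ {Y Y′ s bs x a b A B} → Arc s x a → Arc s x b → (∀ v → In Y′ v → In Y v) → (∀ v → δ a v + δ b v + occ
      B v ≤ occ A v) →
    Good Y′ bs a (b ∷ B) ⊎ Good Y′ bs b (a ∷ B) → Good Y (s ∷ bs) x A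
  good-pair {a = a} {b} r r′ inc sub (inj₁ g) = good-step r inc (λ v → ≤-trans
      (≤-reflexive (sym (+-assoc (δ a v) _ _))) (sub v)) g
  good-pair {a = a} {b} {B = B} r r′ inc sub (inj₂ g) = good-step r′ inc (λ v →
    ≤-trans (arith-181 (δ a v) (δ b v) (occ B v)) (sub v)) g

  one-of : ∀ Y e → Unique Y → 2 ≤ length Y → ∃ λ b → In Y b × b ≢ e
  one-of Y e h len with remove e Y in eq | remove-len≥ e Y
  ... | [] | le = ⊥-elim (<-irrefl refl (≤-trans len le))
  ... | b ∷ _ | _ = b , In-⊑ (remove≤ e Y) i , remove-≢ Y h i
    where
    i : In (remove e Y) b
    i = subst (λ A → In A b) (sym eq) (In-here b _)

  arc-of : ∀ s Y e → Unique Y → 3 ≤ length Y → ∃ λ b → ∃ λ c → In Y b × In Y c × b ≢ e × c ≢ e × b ≢ c × Arc s b c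
  arc-of s Y e h len with one-of Y e h (<⇒≤ len)
  ... | b , ib , nb with one-of (remove b Y) e (Unique-remove b h) (≤-pred (≤-trans len (remove-len≥ b Y)))
  ... | c , ic , nc with arc? s b c
  ... | yes r = b , c , ib , In-⊑ (remove≤ b Y) ic , nb , nc , (λ q → remove-≢ Y h ic (sym q)) , r
  ... | no r = c , b , In-⊑ (remove≤ b Y) ic , ib , nc , nb , remove-≢ Y h ic , arc-or s (λ q → remove-≢ Y h ic
      (sym q)) r

  non-arc : ∀ s {v b} → v ≢ b → ¬ Arc s v b → Arc (not s) v b
  non-arc s n h = arc-flip s (arc-or s n h)

  -- Two neighbours of the origin in `Y` are joined by an arc, which gives a turn inside `Y`. If
  -- neither `x` nor `y` has two, the path takes the arc between them and turns into a vertex of `Y`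
  -- joined to the second one the other way. Both cases rest on the two signs being different, hence
  -- the shape `Ended`.
  last-two : ∀ s Y x y → Unique (x ∷ y ∷ Y) → 3 ≤ length Y →
    Good Y (s ∷ not s ∷ []) x (y ∷ Y) ⊎ Good Y (s ∷ not s ∷ []) y (x ∷ Y)
  last-two s Y x y h len = result (two (arc? s x) Y hY) (two (arc? s y) Y hY)
    where
    hY : Unique Y
    hY = mk λ v → ≤-trans (≤-trans (m≤n+m _ (δ y v)) (m≤n+m _ (δ x v))) (once h v)
    hy : Unique (y ∷ Y)
    hy = mk λ v → ≤-trans (m≤n+m _ (δ x v)) (once h v)
    hx : Unique (x ∷ Y)
    hx = mk λ v → ≤-trans (+-monoʳ-≤ (δ x v) (m≤n+m _ (δ y v))) (once h v)
    inside : ∀ u w → TwoIn (Arc s u) Y → Good Y (s ∷ not s ∷ []) u (w ∷ Y)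
    inside u w (a , b , ia , ib , n , ra , rb) with arc? s a b
    ... | yes r = good (rb ∷ (arc-flip s r ∷ [])) ia λ v →
      ≤-trans (≤-reflexive (cong (δ b v +_) (+-identityʳ _))) (≤-trans (δδ≤ {f = occ Y} (n ∘ sym) (δ≤occ {Y} ib)
          (δ≤occ {Y} ia)) (m≤n+m _ (δ w v)))
    ... | no r = good (ra ∷ (arc-flip s (arc-or s n r) ∷ [])) ib λ v →
      ≤-trans (≤-reflexive (cong (δ a v +_) (+-identityʳ _))) (≤-trans (δδ≤ {f = occ Y} n (δ≤occ {Y} ia)
          (δ≤occ {Y} ib)) (m≤n+m _ (δ w v)))
    through : ∀ u w → Arc s u w → (∀ b → In Y b → w ≢ b) → (e : ℕ) → (∀ v → In Y v → v ≢ e → ¬ Arc s w v) → Good Y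
        (s ∷ not s ∷ []) u (w ∷ Y)
    through u w r ne e h′ with one-of Y e hY (<⇒≤ len)
    ... | b , ib , nb = good (r ∷ (non-arc s (ne b ib) (h′ b ib nb) ∷ [])) ib λ v →
      +-monoʳ-≤ (δ w v) (≤-trans (≤-reflexive (+-identityʳ _)) (δ≤occ {Y} ib v))
    x≢y : x ≢ y
    x≢y q = ≢-head {x} {y ∷ Y} h (In-here y Y) (sym q)
    result : _ → _ → _
    result (inj₁ t) _ = inj₁ (inside x y t)
    result (inj₂ _) (inj₁ t) = inj₂ (inside y x t)
    result (inj₂ (e , p)) (inj₂ (e′ , p′)) with arc? s x y
    ... | yes r = inj₁ (through x y r (λ b i q → ≢-head {y} {Y} hy i (sym q)) e′ p′)
    ... | no r = inj₂ (through y x (arc-or s x≢y r) (λ b i q → ≢-head {x} {Y} hx i (sym q)) e p)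

  -- Both candidates for the next vertex are withdrawn from the reserve, which is why it has to be
  -- larger by two.
  short-pair : ∀ {s bs x Y A k} → (∀ Y′ a b → Unique (a ∷ b ∷ Y′) → k ≤ length Y′ → Good Y′ bs a (b ∷ Y′) ⊎ Good Y′ bs
      b (a ∷ Y′)) →
    2 + k ≤ length Y → Unique A → (∀ v → occ Y v ≤ occ A v) → TwoIn (Arc s x) A → Good Y (s ∷ bs) x A
  short-pair {Y = Y} {A} lem len u sub (a , b , ia , ib , n , ra , rb) =
    good-pair ra rb (λ v → In-⊑ λ v → ≤-trans (remove≤ b (remove a Y) v) (remove≤ a Y v)) (pair-sub {Y = Y} u ia ib n
        sub)
      (lem (remove₂ a b Y) a b (Unique-⊑ (λ v → ≤-trans (≤-reflexive (sym (+-assoc (δ a v) _ _))) (pair-sub {Y = Y} u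
          ia ib n sub v)) u)
        (≤-pred (≤-pred (≤-trans len (remove₂-len≥ a b Y)))))

  non-arc′ : ∀ b {v w} → v ≢ w → ¬ Arc (not b) v w → Arc b v w
  non-arc′ true n h = arc-or false n h
  non-arc′ false n h = arc-or true n h

  arc-flip′ : ∀ b {v w} → Arc (not b) w v → Arc b v w
  arc-flip′ true p = p
  arc-flip′ false p = p

  -- If neither given vertex has two neighbours, the path takes the arc between them; the second one
  -- has the opposite arc to all other vertices but one, and so it can enter an arc inside `Y` at
  -- the right end.
  zigzag : ∀ b Y x y A → Unique (x ∷ y ∷ A) → (∀ v → occ Y v ≤ occ A v) → 5 ≤ length Y →
    Good Y (not b ∷ b ∷ not b ∷ []) x (y ∷ A) ⊎ Good Y (not b ∷ b ∷ not b ∷ []) y (x ∷ A)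
  zigzag b Y x y A u sub len = result (two (arc? (not b) x) (y ∷ A) (Unique-tail u)) (two (arc? (not b) y) (x ∷ A)
      (Unique-tail (Unique-swap u)))
    where
    uY : Unique Y
    uY = Unique-⊑ sub (Unique-tail (Unique-tail u))
    x≢y : x ≢ y
    x≢y q = ≢-head u (In-here y A) (sym q)
    direct : ∀ u v e → Arc (not b) u v → Unique (v ∷ A) → (∀ w → In A w → w ≢ e → ¬ Arc (not b) v w) → Good Y
        (not b ∷ b ∷ not b ∷ []) u (v ∷ A)
    direct u v e r uv none with arc-of (not b) Y e uY (≤-trans (s≤s (s≤s (s≤s z≤n))) len)
    ... | c , d , ic , id , nc , nd , n , rcd = good (r ∷ (non-arc′ b (λ q → ≢-head uv (In-⊑ sub ic) (sym q))
        (none c (In-⊑ sub ic) nc) ∷ (rcd ∷ []))) id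
      λ w → +-monoʳ-≤ (δ v w) (≤-trans (≤-reflexive (cong (δ c w +_) (+-identityʳ _)))
        (≤-trans (δδ≤ {f = occ Y} n (δ≤occ ic) (δ≤occ id)) (sub w)))
    result : TwoIn _ _ ⊎ _ → TwoIn _ _ ⊎ _ → _
    result (inj₁ t) _ = inj₁ (short-pair (λ Y′ a c → last-two b Y′ a c) len (Unique-tail u) (λ v → ≤-trans (sub v)
        (m≤n+m _ (δ y v))) t)
    result (inj₂ _) (inj₁ t) = inj₂ (short-pair (λ Y′ a c → last-two b Y′ a c) len (Unique-tail (Unique-swap u))
        (λ v → ≤-trans (sub v) (m≤n+m _ (δ x v))) t)
    result (inj₂ (e , p)) (inj₂ (e′ , p′)) with arc? (not b) x y
    ... | yes r = inj₁ (direct x y e′ r (Unique-tail u) λ w i → p′ w (In-there x i))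
    ... | no r = inj₂ (direct y x e (arc-or (not b) x≢y r) (Unique-tail (Unique-swap u)) λ w i → p w (In-there y i))

  -- The first block has length two: unless x or y has two suitable neighbours, some u of x, y is dominated by all
  -- of A, and the other can be followed by a vertex dominating u.
  double : ∀ {Gx Gy : Set} s x y A → Unique (x ∷ y ∷ A) → (TwoIn (Arc s x) (y ∷ A) → Gx) → (TwoIn (Arc s y) (x ∷ A) →
      Gy) →
    ∀ {p q} → Arc s x p → Arc s p q → In (y ∷ A) p → In (y ∷ A) q → p ≢ q →
    (∀ w → In A w → Arc s x w → Arc s w y → (∀ v → In A v → Arc s v y) → Gx) →
    (∀ w → In A w → Arc s y w → Arc s w x → (∀ v → In A v → Arc s v x) → Gy) → Gx ⊎ Gy
  double s x y A u twoX twoY {p} {q} xp pq ip iq p≢q fcx fcy with two (arc? s x) (y ∷ A) (Unique-tail u)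
  ... | inj₁ t = inj₁ (twoX t)
  ... | inj₂ (e , none) with p ≟ e
  ... | no n = ⊥-elim (none p ip n xp)
  ... | yes refl with p ≟ y
  -- The only neighbour of `x` is `y`: all of `A` has arcs to `x`, and the path from `y` goes
  -- through `q` to `x`.
  ... | yes refl = inj₂ (fcy q iq′ pq (arc-or s (λ z → ≢-head u iq (sym z)) (none q iq (p≢q ∘ sym)))
      λ v i → arc-or s (λ z → ≢-head u (In-there y i) (sym z)) (none v (In-there y i)
          (λ { refl → ≢-head (Unique-tail u) i refl })))
    where
    iq′ : In A q
    iq′ = case In-case {y} {A} iq of λ { (inj₁ z) → ⊥-elim (p≢q (sym z)) ; (inj₂ i) → i }
  ... | no p≢y with two (arc? s y) (x ∷ A) (Unique-tail (Unique-swap u))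
  ... | inj₁ t = inj₂ (twoY t)
  ... | inj₂ (e , none′) with x ≟ e
  ... | no n = ⊥-elim (none′ x (In-here x A) n (arc-or s (λ z → ≢-head u (In-here y A) (sym z)) (none y (In-here y A)
      (p≢y ∘ sym))))
  -- The only neighbour of `y` is `x`: all of `A` has arcs to `y`, and the path from `x` goes
  -- through `p` to `y`.
  ... | yes refl = inj₁ (fcx p ip′ xp (dom p ip′) dom)
    where
    ip′ : In A p
    ip′ = case In-case {y} {A} ip of λ { (inj₁ z) → ⊥-elim (p≢y z) ; (inj₂ i) → i }
    dom : ∀ v → In A v → Arc s v y
    dom v i = arc-or s (λ { refl → ≢-head (Unique-tail u) i refl }) (none′ v (In-there x i)
        (≢-head (Unique-tail (Unique-swap u)) i))

  ends-at : ∀ b Y u v w A → Arc (not b) v w → Arc (not b) w u → In A w → (∀ v → In A v → Arc (not b) v u) →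
    Unique A → (∀ v → occ Y v ≤ occ A v) → 5 ≤ length Y →
    Good Y (not b ∷ not b ∷ b ∷ []) v (u ∷ A)
  ends-at b Y u v w A r r′ iw dom uA sub len with one-of Y w (Unique-⊑ sub uA) (≤-trans (s≤s (s≤s z≤n)) len)
  ... | y , iy , ny = good (r ∷ (r′ ∷ (arc-flip′ b (dom y (In-⊑ sub iy)) ∷ []))) iy λ t →
    (arith-182 (δ w t) (δ u t) (δ y t) (occ A t) (δδ≤ {f = occ A} (ny ∘ sym) (δ≤occ iw) (δ≤occ {A} (In-⊑ sub iy))))

  ends-at₂ : ∀ b Y u v w A → Arc (not b) v w → Arc (not b) w u → In A w → (∀ v → In A v → Arc (not b) v u) →
    Unique A → (∀ v → occ Y v ≤ occ A v) → 5 ≤ length Y →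
    Good Y (not b ∷ not b ∷ b ∷ not b ∷ []) v (u ∷ A)
  ends-at₂ b Y u v w A r r′ iw dom uA sub len with arc-of (not b) Y w (Unique-⊑ sub uA) (≤-trans (s≤s (s≤s (s≤s z≤n))) len)
  ... | c , d , ic , id , nc , nd , n , rcd = good (r ∷ (r′ ∷ (arc-flip′ b (dom c (In-⊑ sub ic)) ∷ (rcd ∷ [])))) id λ
      t →
    (arith-183 (δ w t) (δ u t) (δ c t) (δ d t) (occ A t) (three t))
    where
    three : ∀ t → δ w t + δ c t + δ d t ≤ occ A t
    three t = subst (_≤ occ A t) (sym (+-assoc (δ w t) _ _)) (δ+≤ {f = occ A} (hit iw)
      (δδ≤ {f = occ A} n (δ≤occ {A} (In-⊑ sub ic)) (δ≤occ {A} (In-⊑ sub id))) λ { refl → cong₂ _+_ (δ-≢ nc) (δ-≢ nd)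
          })

  run-arcs : ∀ s {bs x ps z S} → Dir s (suc (suc (run s bs))) x ps z → Unique (x ∷ S) → (∀ v → occ ps v ≤ occ S v) →
    ∃ λ p → ∃ λ q → Arc s x p × Arc s p q × In S p × In S q × p ≢ q
  run-arcs s (_∷_ {y = p} r (_∷_ {y = q} {ys = qs} r′ d)) u sub = p , q , r , r′ ,
    In-⊑ sub (In-here p (q ∷ qs)) , In-⊑ sub (In-there p (In-here q qs)) , λ { refl → arc-irr s r′ }

  triple : ∀ b Y x y A → Unique (x ∷ y ∷ A) → (∀ v → occ Y v ≤ occ A v) → 5 ≤ length Y →
    ∀ {ps z} → Dir (not b) 2 x ps z → (∀ v → occ ps v ≤ occ (y ∷ A) v) →
    Good Y (not b ∷ not b ∷ b ∷ []) x (y ∷ A) ⊎ Good Y (not b ∷ not b ∷ b ∷ []) y (x ∷ A)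
  triple b Y x y A u sub len d ps≤ with run-arcs (not b) {[]} d u ps≤
  ... | p , q , r , r′ , ip , iq , n = double (not b) x y A u
    (short-pair last len (Unique-tail u) (λ v → ≤-trans (sub v) (m≤n+m _ (δ y v))))
    (short-pair last len (Unique-tail (Unique-swap u)) (λ v → ≤-trans (sub v) (m≤n+m _ (δ x v)))) r r′ ip iq n
    (λ w iw a a′ dom → ends-at b Y y x w A a a′ iw dom (Unique-tail (Unique-tail u)) sub len)
    (λ w iw a a′ dom → ends-at b Y x y w A a a′ iw dom (Unique-tail (Unique-tail u)) sub len)
    where
    nn : not (not b) ≡ b
    nn = lem b
      where
      lem : ∀ b → not (not b) ≡ b
      lem true = refl
      lem false = refl
    last : ∀ Y′ a c → Unique (a ∷ c ∷ Y′) → 3 ≤ length Y′ → Good Y′ (not b ∷ b ∷ []) a (c ∷ Y′) ⊎ Good Y′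
        (not b ∷ b ∷ []) c (a ∷ Y′)
    last Y′ a c h l = subst (λ t → Good Y′ (not b ∷ t ∷ []) a (c ∷ Y′) ⊎ Good Y′ (not b ∷ t ∷ []) c (a ∷ Y′)) nn
        (last-two (not b) Y′ a c h l)

  -- The source of the number seven: two elements of the reserve may be lost here, two more in
  -- `zigzag`, and `last-two` asks for three.
  quadruple : ∀ b Y x y A → Unique (x ∷ y ∷ A) → (∀ v → occ Y v ≤ occ A v) → 7 ≤ length Y →
    ∀ {ps z} → Dir (not b) 2 x ps z → (∀ v → occ ps v ≤ occ (y ∷ A) v) →
    Good Y (not b ∷ not b ∷ b ∷ not b ∷ []) x (y ∷ A) ⊎ Good Y (not b ∷ not b ∷ b ∷ not b ∷ []) y (x ∷ A)
  quadruple b Y x y A u sub len d ps≤ with run-arcs (not b) {[]} d u ps≤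
  ... | p , q , r , r′ , ip , iq , n = double (not b) x y A u
    (short-pair (λ Y′ a c h l → zigzag b Y′ a c Y′ h (λ v → ≤-refl) l) len (Unique-tail u) (λ v → ≤-trans (sub v)
        (m≤n+m _ (δ y v))))
    (short-pair (λ Y′ a c h l → zigzag b Y′ a c Y′ h (λ v → ≤-refl) l) len (Unique-tail (Unique-swap u))
        (λ v → ≤-trans (sub v) (m≤n+m _ (δ x v)))) r r′ ip iq n
    (λ w iw a a′ dom → ends-at₂ b Y y x w A a a′ iw dom (Unique-tail (Unique-tail u)) sub
        (≤-trans (s≤s (s≤s (s≤s (s≤s (s≤s z≤n))))) len))
    (λ w iw a a′ dom → ends-at₂ b Y x y w A a a′ iw dom (Unique-tail (Unique-tail u)) sub
        (≤-trans (s≤s (s≤s (s≤s (s≤s (s≤s z≤n))))) len))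

  -- In place of the usual bound on the number of vertices reachable along the first block, a
  -- directed path of the length of this block is asked for, or nothing if the block is a single
  -- arc.
  data Cert : List Bool → ℕ → List ℕ → Set where
    block : ∀ {a bs x ps z S} → Dir a (run a (a ∷ bs)) x ps z → (∀ v → occ ps v ≤ occ S v) → Cert (a ∷ bs) x S
    turn  : ∀ {a b bs x S} → a ≢ b → Cert (a ∷ b ∷ bs) x S

  cert-of : ∀ {a n bs x ps z S} → Dir a n x ps z → run a (a ∷ bs) ≤ n → (∀ v → occ ps v ≤ occ S v) → Cert (a ∷ bs) x S
  cert-of d le sub with Dir-take _ le d
  ... | qs , w , d′ , h = block d′ λ v → ≤-trans (h v) (sub v)

  -- The theorem of Havet and Thomassé: of two given vertices, one is the origin of a prescribed oriented path, provided
  -- the first block can be followed from the first of them. The end is required to lie in a reserved set Y.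
  module Havet (Y : List ℕ) (seven : 7 ≤ length Y) where

    -- A step withdraws two candidates for the next vertex and adds the given vertex that was not
    -- taken, so the surplus of two in `D` over the length of the path is preserved.
    HTfor : List Bool → Set
    HTfor bs = ∀ x y D → Unique (x ∷ y ∷ D ++ Y) → length bs + 2 ≤ length D → Cert bs x (y ∷ D) →
      Good Y bs x (y ∷ D ++ Y) ⊎ Good Y bs y (x ∷ D ++ Y)

    Y⊑ : ∀ D v → occ Y v ≤ occ (D ++ Y) v
    Y⊑ D v = ≤-trans (m≤n+m _ (occ D v)) (≤-reflexive (sym (occ-++ D Y v)))

    ++-⊑ : ∀ {f : ℕ → ℕ} {A B v} → f v + occ A v ≤ occ B v → f v + occ (A ++ Y) v ≤ occ (B ++ Y) v
    ++-⊑ {f} {A} {B} {v} h = arith-184 (f v) (occ A v) (occ B v) (occ Y v) (occ (A ++ Y) v) (occ (B ++ Y) v) h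
        (occ-++ A Y v) (occ-++ B Y v)

    step-pair : ∀ {s bs x S a b} → HTfor bs → Unique (S ++ Y) → In S a → In S b → a ≢ b → Arc s x a → Arc s x b →
      length bs + 4 ≤ length S → Cert bs a (b ∷ remove₂ a b S) → Good Y (s ∷ bs) x (S ++ Y)
    step-pair {bs = bs} {S = S} {a} {b} IH u ia ib n ra rb len cert =
      good-pair ra rb (λ v i → i) sub (IH a b (remove₂ a b S)
          (Unique-⊑ (λ v → ≤-trans (≤-reflexive (sym (+-assoc (δ a v) _ _))) (sub v)) u)
        (arith-185 (length bs) (length S) (length (remove₂ a b S)) len (remove₂-len ia ib n)) cert)
      where
      sub : ∀ v → δ a v + δ b v + occ (remove₂ a b S ++ Y) v ≤ occ (S ++ Y) v
      sub v = ++-⊑ {λ v → δ a v + δ b v} {remove₂ a b S} {S} (≤-reflexive (sym (remove₂-occ ia ib n v)))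

    -- A free choice of the next vertex: any long enough list W of candidates contains an origin.
    choose : ∀ {bs} → Ended bs → HTfor bs → ∀ D W → Unique (D ++ Y) → (∀ v → occ W v ≤ occ D v) →
      length bs + 1 ≤ length W → length bs + 4 ≤ length D → ∃ λ w → In W w × Good Y bs w (remove w D ++ Y)
    choose {a ∷ bs} e IH D W u sub lenW lenD = result (ham a W (Unique-⊑ sub uD) (≤-trans (m≤n+m 1 (length (a ∷ bs)))
        lenW))
      where
      uD : Unique D
      uD = Unique-left D u
      two≤ : ∀ {bs} → Ended bs → 2 ≤ length bs
      two≤ (turn b) = ≤-refl
      two≤ (b ∷ e) = ≤-trans (two≤ e) (n≤1+n _)
      result : (∃ λ d → ∃ λ ps → ∃ λ z → Dir a (length ps) d ps z × suc (length ps) ≡ length W × (∀ v → occ W v ≡ occ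
          (d ∷ ps) v)) →
        ∃ λ w → In W w × Good Y (a ∷ bs) w (remove w D ++ Y)
      result (d , [] , z , p , l , eq) = ⊥-elim (arith-186 (length (a ∷ bs)) (length W) l lenW (two≤ e))
      -- A Hamiltonian path of `W` in the direction of the first block certifies its first vertex
      -- `d`; the second vertex `p` serves as the alternative origin.
      result (d , p ∷ ps , z , path , l , eq) = pick-one (IH d p (remove₂ d p D) (Unique-⊑ pairs u)
          (arith-185 (length (a ∷ bs)) (length D) (length (remove₂ d p D)) lenD (remove₂-len id′ ip n))
          (cert-of path (arith-187 (run a (a ∷ bs)) (length (a ∷ bs)) (length ps) (length W) (run≤ a (a ∷ bs)) lenW l) (avoid {D} (p ∷ ps) p id′ ip n tail-sub (fresh-head uW))))
        where
        uW : Unique (d ∷ p ∷ ps)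
        uW = Unique-⊑ (λ v → ≤-trans (≤-reflexive (sym (eq v))) (sub v)) uD
        inW : ∀ {v} → In (d ∷ p ∷ ps) v → In W v
        inW = In-⊑ λ v → ≤-reflexive (sym (eq v))
        id′ : In D d
        id′ = In-⊑ sub (inW (In-here d _))
        ip : In D p
        ip = In-⊑ sub (inW (In-there d (In-here p _)))
        n : d ≢ p
        n q = ≢-head uW (In-here p ps) (sym q)
        tail-sub : ∀ v → occ (p ∷ ps) v ≤ occ D v
        tail-sub v = ≤-trans (m≤n+m _ (δ d v)) (≤-trans (≤-reflexive (sym (eq v))) (sub v))
        pairs : ∀ v → occ (d ∷ p ∷ remove₂ d p D ++ Y) v ≤ occ (D ++ Y) v
        pairs v = arith-188 (δ d v) (δ p v) (occ (remove₂ d p D) v) (occ (remove₂ d p D ++ Y) v) (occ D v)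
            (occ (D ++ Y) v) (occ Y v) (remove₂-occ id′ ip n v) (occ-++ (remove₂ d p D) Y v) (occ-++ D Y v)
        widen : ∀ {w A B} → (∀ v → occ A v ≤ occ B v) → Good Y (a ∷ bs) w A → Good Y (a ∷ bs) w B
        widen h (good q i k) = good q i λ v → ≤-trans (k v) (h v)
        pick-one : Good Y (a ∷ bs) d (p ∷ remove₂ d p D ++ Y) ⊎ Good Y (a ∷ bs) p (d ∷ remove₂ d p D ++ Y) → _
        pick-one (inj₁ g) = d , inW (In-here d _) , widen (λ v → ++-⊑ {δ p} {remove₂ d p D} {remove d D}
          (≤-reflexive (sym (remove-occ (remove d D) (In-remove D ip (n ∘ sym)) v)))) g
        pick-one (inj₂ g) = p , inW (In-there d (In-here p _)) , widen (λ v → ++-⊑ {δ d} {remove₂ d p D} {remove p D}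
          (arith-189 (δ d v) (δ p v) (occ (remove₂ d p D) v) (occ D v) (occ (remove p D) v) (remove₂-occ id′ ip n v)
              (remove-occ D ip v))) g

    -- If `y` is off the path, it is put in front of `x` and the end of the path is dropped. If `y`
    -- is on the path, the arc from the last vertex to `x` closes a cycle, which is opened at `y`;
    -- the last vertex is not `p`, as the path has at least two arcs.
    rotate : ∀ {s k x y D p ps z} → Dir s (suc (suc k)) x (p ∷ ps) z → Unique (x ∷ y ∷ D) → (∀ v → occ (p ∷ ps) v ≤
        occ (y ∷ D) v) →
      p ≢ y → (∀ v → In (y ∷ D) v → v ≢ p → Arc s v x) → ∃ λ qs → ∃ λ w → Dir s (suc (suc k)) y qs w × (∀ v → occ qs v
          ≤ occ (x ∷ D) v)
    rotate {s} {k} {x} {y} {D} {p} {ps} {z} path u sub p≢y dom with 1 ≤? occ (p ∷ ps) y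
    ... | no out = conclude (Dir-take (suc k) (n≤1+n _) path)
      where
      conclude : (∃ λ qs → ∃ λ w → Dir s (suc k) x qs w × (∀ v → occ qs v ≤ occ (p ∷ ps) v)) → _
      conclude (qs , w , d , h) = x ∷ qs , w , dom y (In-here y D) (p≢y ∘ sym) ∷ d , λ v → +-monoʳ-≤ (δ x v) (inD v)
        where
        inD : ∀ v → occ qs v ≤ occ D v
        inD v with y ≟ v
        ... | yes refl = ≤-trans (h y) (≤-trans (≤-pred (≰⇒> out)) z≤n)
        ... | no n = ≤-trans (h v) (subst (λ t → occ (p ∷ ps) v ≤ t + occ D v) (δ-≢ n) (sub v))
    ... | yes i with Dir-split path (mk i)
    ... | i , j , qs , rs , w , d₁ , d₂ , k≡ , eq = rs ++ x ∷ qs , w ,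
      subst (λ n → Dir s n y (rs ++ x ∷ qs) w) (arith-190 k i j k≡) (Dir-++ d₂ (dom z inz z≢p ∷ d₁)) , sub′
      where
      up : Unique (p ∷ ps)
      up = Unique-⊑ sub (Unique-tail u)
      last-in : ∀ {p ps} → Dir s (suc (suc k)) x (p ∷ ps) z → In ps z
      last-in (_ ∷ d) = Dir-end d
      z≢p : z ≢ p
      z≢p = ≢-head up (last-in path)
      inz : In (y ∷ D) z
      inz = In-⊑ sub (Dir-end path)
      sub′ : ∀ v → occ (rs ++ x ∷ qs) v ≤ occ (x ∷ D) v
      sub′ v = arith-191 (occ (p ∷ ps) v) (occ qs v) (occ rs v) (δ y v) (occ D v) (δ x v) (occ (rs ++ x ∷ qs) v)
          (occ-++ rs (x ∷ qs) v) (eq v) (sub v)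

    -- Even if `v` has a single neighbour `w`, two candidates arise one step later, since `w` has
    -- arcs both to `q` and to the other given vertex `u`.
    chain : ∀ {a cs u v w q D qs z} → HTfor (a ∷ cs) → Unique (u ∷ v ∷ D ++ Y) → length cs + 5 ≤ length D →
      Arc a v w → In D w → In D q → q ≢ w → Arc a w q → Arc a w u → Dir a (run a (a ∷ cs)) q qs z →
      (∀ t → occ qs t ≤ occ (u ∷ remove w D) t) → occ qs q ≡ 0 → Good Y (a ∷ a ∷ a ∷ cs) v (u ∷ D ++ Y)
    chain {a} {cs} {u} {v} {w} {q} {D} {qs} IH uq len r iw iq q≢w r′ r″ d sub z = good-step r (λ t i → i)
      (λ t → (arith-192 (δ w t) (δ u t) (occ D t) (occ (D ++ Y) t) (occ (remove w D) t) (occ (remove w D ++ Y) t)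
          (occ Y t) (remove-occ D iw t) (occ-++ D Y t) (occ-++ (remove w D) Y t)))
      (step-pair {S = S} IH uS iqS (In-here u (remove w D)) q≢u r′ r″
        (arith-193 (length D) (length (remove w D)) (length cs) len (remove-len D iw))
        (block d (avoid {S} qs u iqS (In-here u (remove w D)) q≢u sub z)))
      where
      S = u ∷ remove w D
      u0 : Unique (u ∷ D)
      u0 = Unique-left (u ∷ D) (Unique-⊑ (λ t → (arith-194 (δ u t) (δ v t) (occ (D ++ Y) t))) uq)
      uS : Unique (S ++ Y)
      uS = Unique-⊑ (λ t → (arith-195 (δ u t) (δ v t) (occ D t) (occ (D ++ Y) t) (occ (remove w D) t)
          (occ (remove w D ++ Y) t) (occ Y t) (remove≤ w D t) (occ-++ D Y t) (occ-++ (remove w D) Y t))) uq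
      iqS : In S q
      iqS = In-there u (In-remove D iq q≢w)
      q≢u : q ≢ u
      q≢u = ≢-head u0 iq

    swap : ∀ {A B : Set} → A ⊎ B → B ⊎ A
    swap (inj₁ a) = inj₂ a
    swap (inj₂ b) = inj₁ b

    -- If `x` has a neighbour besides the first vertex `p` of its directed path, the induction goes
    -- on with these two. Otherwise all other vertices have arcs to `x`. Then, if `p` is `y`, the
    -- path from `y` uses `x` as the second candidate (`first`); if not, `rotate` gives `y` a
    -- directed path too, and should `y` have only one neighbour, then `y` is the second candidate
    -- for the path from `x` (`second`).
    long-block : ∀ {a cs} → HTfor (a ∷ a ∷ cs) → HTfor (a ∷ cs) → ∀ {x y D k ps z} → Unique (x ∷ y ∷ D ++ Y) → length
        cs + 5 ≤ length D →
      Dir a k x ps z → k ≡ 2 + run a (a ∷ cs) → (∀ v → occ ps v ≤ occ (y ∷ D) v) →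
      Good Y (a ∷ a ∷ a ∷ cs) x (y ∷ D ++ Y) ⊎ Good Y (a ∷ a ∷ a ∷ cs) y (x ∷ D ++ Y)
    long-block {a} {cs} IH₁ IH₂ {x} {y} {D} {z = z} uq len (_∷_ {y = p} xp (_∷_ {y = w} {ys = ws} pw d)) refl sub =
        result (findIn (arc? a x) (remove p (y ∷ D)))
      where
      u0 : Unique (x ∷ y ∷ D)
      u0 = Unique-left (x ∷ y ∷ D) uq
      uyD : Unique (y ∷ D)
      uyD = Unique-tail u0
      upw : Unique (p ∷ w ∷ ws)
      upw = Unique-⊑ sub uyD
      run≡ : run a (a ∷ a ∷ cs) ≡ suc (run a (a ∷ cs))
      run≡ = run-same a (a ∷ cs)
      other : ∀ {u v p′ ps z′} → Unique (u ∷ v ∷ D ++ Y) → Dir a (2 + run a (a ∷ cs)) u (p′ ∷ ps) z′ →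
          (∀ t → occ (p′ ∷ ps) t ≤ occ (v ∷ D) t) →
        (∃ λ b → In (remove p′ (v ∷ D)) b × Arc a u b) → Good Y (a ∷ a ∷ a ∷ cs) u (v ∷ D ++ Y)
      other {u} {v} {p′} {ps} {z′} uq′ (r ∷ d′) sub′ (b , ib , ub) = step-pair {S = v ∷ D} IH₁ (Unique-tail uq′) ip′
          ib′ n r ub
        (arith-196 (length cs) (length D) len)
        (block (subst (λ k → Dir a k p′ ps z′) (sym run≡) d′)
          (avoid {v ∷ D} ps b ip′ ib′ n (λ t → ≤-trans (m≤n+m _ (δ p′ t)) (sub′ t)) (fresh-head (Unique-⊑ {p′ ∷ ps}
              sub′ uD))))
        where
        uD : Unique (v ∷ D)
        uD = Unique-left (v ∷ D) (Unique-tail uq′)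
        ip′ : In (v ∷ D) p′
        ip′ = In-⊑ sub′ (In-here p′ ps)
        ib′ : In (v ∷ D) b
        ib′ = In-⊑ (remove≤ p′ (v ∷ D)) ib
        n : p′ ≢ b
        n q = remove-≢ (v ∷ D) uD ib (sym q)
      ip : In (y ∷ D) p
      ip = In-⊑ sub (In-here p (w ∷ ws))
      peel : ∃ λ q → ∃ λ qs → ws ≡ q ∷ qs × Arc a w q × Dir a (run a cs) q qs z
      peel = go (subst (λ k → Dir a k w ws z) (run-same a cs) d)
        where
        go : ∀ {ws} → Dir a (suc (run a cs)) w ws z → ∃ λ q → ∃ λ qs → ws ≡ q ∷ qs × Arc a w q × Dir a (run a cs) q qs
            z
        go (r ∷ d) = _ , _ , refl , r , d
      dominated : (∀ v → In (remove p (y ∷ D)) v → ¬ Arc a x v) → ∀ v → In (y ∷ D) v → v ≢ p → Arc a v x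
      dominated none v i n = arc-or a (λ q → ≢-head u0 i (sym q)) (none v (In-remove (y ∷ D) i n))
      first : p ≡ y → (∀ v → In (y ∷ D) v → v ≢ p → Arc a v x) →
        (∃ λ q → ∃ λ qs → ws ≡ q ∷ qs × Arc a w q × Dir a (run a cs) q qs z) → Good Y (a ∷ a ∷ a ∷ cs) y (x ∷ D ++ Y)
      first refl dom (q , qs , refl , wq , d′) = chain {qs = qs ++ x ∷ []} IH₂ uq len pw (inD (In-here w _))
          (inD (In-there w (In-here q qs)))
        (λ e → arc-irr a (subst (Arc a w) e wq)) wq (toX (In-here w _))
        (subst (λ k → Dir a k q (qs ++ x ∷ []) x) (trans (+-comm (run a cs) 1) (sym (run-same a cs)))
            (Dir-++ d′ (toX (In-there w (Dir-end (wq ∷ d′))) ∷ [])))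
        (λ t → (arith-197 (occ (qs ++ x ∷ []) t) (δ x t) (occ qs t) (δ w t) (δ q t) (occ (remove w D) t) (occ D t)
            (occ-++ qs (x ∷ []) t) (remove-occ D (inD (In-here w _)) t) (inside t)))
        (trans (occ-++ qs (x ∷ []) q) (cong₂ _+_ (fresh-head (Unique-tail (Unique-tail upw)))
          (trans (+-identityʳ _) (δ-≢ λ e → ≢-head u0 (In-there y (inD (In-there w (In-here q qs)))) (sym e)))))
        where
        inside : ∀ v → occ (w ∷ q ∷ qs) v ≤ occ D v
        inside v = +-cancelˡ-≤ (δ p v) _ _ (sub v)
        inD : ∀ {t} → In (w ∷ q ∷ qs) t → In D t
        inD = In-⊑ inside
        toX : ∀ {t} → In (w ∷ q ∷ qs) t → Arc a t x
        toX {t} i = dom t (In-there y (inD i)) (≢-head uyD (inD i))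
      second : p ≢ y → (∀ v → In (y ∷ D) v → v ≢ p → Arc a v x) →
        (∃ λ q → ∃ λ qs → ws ≡ q ∷ qs × Arc a w q × Dir a (run a cs) q qs z) →
        (∀ v → In D v → ¬ Arc a y v) → Good Y (a ∷ a ∷ a ∷ cs) x (y ∷ D ++ Y)
      second p≢y dom (q , qs , refl , wq , d′) none = chain IH₂ (Unique-swap uq) len xp pD wD (λ e → arc-irr a
          (subst (Arc a p) e pw)) pw
        (arc-or a (p≢y ∘ sym) (none p pD)) d
        (λ t → (arith-198 (δ y t) (δ p t) (δ w t) (occ (q ∷ qs) t) (occ (remove p D) t) (occ D t) (remove-occ D pD t)
            (sub t)))
        (fresh-head {w} {q ∷ qs} (Unique-tail upw))
        where
        pD : In D p
        pD = case In-case {y} {D} ip of λ { (inj₁ e) → ⊥-elim (p≢y e) ; (inj₂ i) → i }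
        iq : In (y ∷ D) q
        iq = In-⊑ sub (In-there p (In-there w (In-here q qs)))
        wD : In D w
        wD = case In-case {y} {D} (In-⊑ sub (In-there p (In-here w (q ∷ qs)))) of λ
          { (inj₂ i) → i
          ; (inj₁ e) → case In-case {y} {D} iq of λ
            { (inj₁ e′) → ⊥-elim (arc-irr a (subst₂ (Arc a) e e′ wq)) ; (inj₂ i) → ⊥-elim
                (none q i (subst (λ t → Arc a t q) e wq)) } }
      rotated : p ≢ y → (∀ v → In (y ∷ D) v → v ≢ p → Arc a v x) →
        (∃ λ qs → ∃ λ t → Dir a (2 + run a (a ∷ cs)) y qs t × (∀ v → occ qs v ≤ occ (x ∷ D) v)) →
        Good Y (a ∷ a ∷ a ∷ cs) x (y ∷ D ++ Y) ⊎ Good Y (a ∷ a ∷ a ∷ cs) y (x ∷ D ++ Y)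
      rotated p≢y dom (q₁ ∷ qs , t , (yq ∷ dq) , sub′) with findIn (arc? a y) (remove q₁ (x ∷ D))
      ... | inj₁ o = inj₂ (other (Unique-swap uq) (yq ∷ dq) sub′ o)
      ... | inj₂ none with x ≟ q₁
      ... | no n = ⊥-elim (none x (In-remove (x ∷ D) (In-here x D) n) (dom y (In-here y D) (p≢y ∘ sym)))
      ... | yes refl = inj₁ (second p≢y dom peel λ v i → none v (In-remove (x ∷ D) (In-there x i)
          (≢-head (Unique-tail (Unique-swap u0)) i)))
      result : (∃ λ b → In (remove p (y ∷ D)) b × Arc a x b) ⊎ (∀ v → In (remove p (y ∷ D)) v → ¬ Arc a x v) →
        Good Y (a ∷ a ∷ a ∷ cs) x (y ∷ D ++ Y) ⊎ Good Y (a ∷ a ∷ a ∷ cs) y (x ∷ D ++ Y)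
      result (inj₁ t) = inj₁ (other uq (xp ∷ (pw ∷ d)) sub t)
      result (inj₂ none) = branch (p ≟ y)
        where
        branch : Dec (p ≡ y) → Good Y (a ∷ a ∷ a ∷ cs) x (y ∷ D ++ Y) ⊎ Good Y (a ∷ a ∷ a ∷ cs) y (x ∷ D ++ Y)
        branch (yes e) = inj₂ (first e (dominated none) peel)
        branch (no n) = rotated n (dominated none) (rotate (xp ∷ (pw ∷ d)) u0 sub n (dominated none))

    -- Two neighbours leave a block of one arc, which needs no directed path as a certificate.
    -- Otherwise `double` provides a first block ending in a vertex to which all of `D` has arcs:
    -- the turn there may lead to any vertex, in particular to an origin found by `choose`.
    block-two : ∀ {b bs} → Ended bs → HTfor (not b ∷ b ∷ bs) → HTfor bs → ∀ {x y D ps z} → Unique (x ∷ y ∷ D ++ Y) →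
        length bs + 5 ≤ length D →
      Dir (not b) 2 x ps z → (∀ v → occ ps v ≤ occ (y ∷ D) v) →
      Good Y (not b ∷ not b ∷ b ∷ bs) x (y ∷ D ++ Y) ⊎ Good Y (not b ∷ not b ∷ b ∷ bs) y (x ∷ D ++ Y)
    block-two {b} {bs} e IH₁ IH₂ {x} {y} {D} uq len d sub with run-arcs (not b) {[]} d (Unique-left (x ∷ y ∷ D) uq)
        sub
    ... | p , q , r , r′ , ip , iq , n = double (not b) x y D (Unique-left (x ∷ y ∷ D) uq) (both-ways x y uq)
        (both-ways y x (Unique-swap uq)) r r′ ip iq n
        (λ w iw a a′ dom → via y x (Unique-swap uq) w iw a a′ dom) (λ w iw a a′ dom → via x y uq w iw a a′ dom)
      where
      b≢ : ∀ b → not b ≢ b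
      b≢ true ()
      b≢ false ()
      both-ways : ∀ x y → Unique (x ∷ y ∷ D ++ Y) → TwoIn (Arc (not b) x) (y ∷ D) → Good Y (not b ∷ not b ∷ b ∷ bs) x
          (y ∷ D ++ Y)
      both-ways x y uq (a , c , ia , ic , n , ra , rc) = step-pair {S = y ∷ D} IH₁ (Unique-tail uq) ia ic n ra rc
        (arith-196 (length bs) (length D) len) (turn (b≢ b))
      via : ∀ u v → Unique (u ∷ v ∷ D ++ Y) → ∀ w → In D w → Arc (not b) v w → Arc (not b) w u → (∀ t → In D t → Arc
          (not b) t u) →
        Good Y (not b ∷ not b ∷ b ∷ bs) v (u ∷ D ++ Y)
      via u v uq w iw a a′ dom = finish (choose e IH₂ (remove w D) (remove w D) (Unique-⊑ drop
          (Unique-tail (Unique-tail uq))) (λ t → ≤-refl)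
          (arith-199 (length bs) (length D) (length (remove w D)) len (remove-len D iw))
          (arith-200 (length bs) (length D) (length (remove w D)) len (remove-len D iw)))
        where
        drop : ∀ t → occ (remove w D ++ Y) t ≤ occ (D ++ Y) t
        drop t = ++-⊑ {λ _ → 0} {remove w D} {D} (remove≤ w D t)
        finish : (∃ λ c → In (remove w D) c × Good Y bs c (remove c (remove w D) ++ Y)) → _
        finish (c , ic , good {vs} p i h) = good (a ∷ (a′ ∷ (arc-flip′ b (dom c (In-⊑ (remove≤ w D) ic)) ∷ p))) i λ t
            →
          (arith-201 (δ w t) (δ u t) (δ c t) (occ vs t) (occ D t) (occ (D ++ Y) t) (occ (remove w D) t)
              (occ (remove c (remove w D)) t) (occ (remove c (remove w D) ++ Y) t) (occ Y t) (remove-occ D iw t)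
              (remove-occ (remove w D) ic t) (occ-++ D Y t) (occ-++ (remove c (remove w D)) Y t) (h t))

    -- If neither given vertex has two neighbours, the path takes the arc between them. The second
    -- one is joined in the direction of the next sign to all of `D` but one vertex, enough for
    -- `choose` to find an origin of the rest.
    one-one : ∀ {b d bs} → Ended (d ∷ bs) → b ≢ d → HTfor (b ∷ d ∷ bs) → HTfor (d ∷ bs) → ∀ {x y D} → Unique
        (x ∷ y ∷ D ++ Y) →
      length bs + 5 ≤ length D →
      Good Y (not b ∷ b ∷ d ∷ bs) x (y ∷ D ++ Y) ⊎ Good Y (not b ∷ b ∷ d ∷ bs) y (x ∷ D ++ Y)
    one-one {b} {d} {bs} e b≢d IH₁ IH₂ {x} {y} {D} uq len =
      result (two (arc? (not b) x) (y ∷ D) (Unique-tail u0)) (two (arc? (not b) y) (x ∷ D)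
          (Unique-tail (Unique-swap u0)))
      where
      u0 : Unique (x ∷ y ∷ D)
      u0 = Unique-left (x ∷ y ∷ D) uq
      both-ways : ∀ x y → Unique (x ∷ y ∷ D ++ Y) → TwoIn (Arc (not b) x) (y ∷ D) → Good Y (not b ∷ b ∷ d ∷ bs) x
          (y ∷ D ++ Y)
      both-ways x y uq (a , c , ia , ic , n , ra , rc) = step-pair {S = y ∷ D} IH₁ (Unique-tail uq) ia ic n ra rc
        (arith-196 (length bs) (length D) len) (turn b≢d)
      via : ∀ u v → Unique (u ∷ v ∷ D ++ Y) → Arc (not b) u v → (ε : ℕ) → (∀ w → In D w → w ≢ ε → ¬ Arc (not b) v w) →
        Good Y (not b ∷ b ∷ d ∷ bs) u (v ∷ D ++ Y)
      via u v uq r ε none = finish (choose e IH₂ D (remove ε D) (Unique-tail (Unique-tail uq)) (remove≤ ε D)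
          (arith-202 (length bs) (length D) (length (remove ε D)) len (remove-len≥ ε D))
          (arith-203 (length bs) (length D) len))
        where
        uD : Unique (v ∷ D)
        uD = Unique-left (v ∷ D) (Unique-tail uq)
        finish : (∃ λ c → In (remove ε D) c × Good Y (d ∷ bs) c (remove c D ++ Y)) → Good Y (not b ∷ b ∷ d ∷ bs) u
            (v ∷ D ++ Y)
        finish (c , ic , good {vs} p i h) = good (r ∷ (non-arc′ b (λ q → ≢-head uD iD (sym q))
            (none c iD (remove-≢ D (Unique-tail uD) ic)) ∷ p)) i λ t →
          (arith-204 (δ v t) (δ c t) (occ vs t) (occ D t) (occ (D ++ Y) t) (occ (remove c D) t) (occ (remove c D ++ Y)
              t) (occ Y t) (remove-occ D iD t) (occ-++ D Y t) (occ-++ (remove c D) Y t) (h t))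
          where
          iD : In D c
          iD = In-⊑ (remove≤ ε D) ic
      result : TwoIn _ _ ⊎ _ → TwoIn _ _ ⊎ _ → _
      result (inj₁ t) _ = inj₁ (both-ways x y uq t)
      result (inj₂ _) (inj₁ t) = inj₂ (both-ways y x (Unique-swap uq) t)
      result (inj₂ (ε , p)) (inj₂ (ε′ , p′)) with arc? (not b) x y
      ... | yes r = inj₁ (via x y uq r ε′ λ w i → p′ w (In-there x i))
      ... | no r = inj₂ (via y x (Unique-swap uq) (arc-or (not b) (λ q → ≢-head u0 (In-here y D) (sym q)) r) ε λ w i →
          p w (In-there y i))

    -- The next vertex must be certified for the long second block. The first three vertices of a
    -- Hamiltonian path of `D` all are, even with up to two vertices cut off. Three are used: one
    -- may be the only neighbour of `x`, and then the other two are the candidates after the arc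
    -- from `y` to `x`.
    one-long : ∀ {b bs} → HTfor (b ∷ b ∷ bs) → HTfor (b ∷ bs) → ∀ {x y D} → Unique (x ∷ y ∷ D ++ Y) → length bs + 5 ≤
        length D →
      Good Y (not b ∷ b ∷ b ∷ bs) x (y ∷ D ++ Y) ⊎ Good Y (not b ∷ b ∷ b ∷ bs) y (x ∷ D ++ Y)
    one-long {b} {bs} IH₁ IH₂ {x} {y} {D} uq len = result (ham b D uD (≤-trans (m≤n+m 1 _)
        (≤-trans (arith-205 (length bs)) len)))
      where
      u0 : Unique (x ∷ y ∷ D)
      u0 = Unique-left (x ∷ y ∷ D) uq
      uD : Unique D
      uD = Unique-tail (Unique-tail u0)
      k = run b bs
      Tail : ℕ → ℕ → Set
      Tail n e = In D e × ∃ λ m → ∃ λ ps → ∃ λ z → Dir b m e ps z × n ≤ m × (∀ v → occ ps v ≤ occ D v) × occ ps e ≡ 0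
      cert : ∀ {n e cs} c → Tail n e → In D c → e ≢ c → run b (b ∷ cs) ≤ n → Cert (b ∷ cs) e (c ∷ remove₂ e c D)
      cert c (ie , m , ps , z , d , le , sub , zero′) ic n r≤ = cert-of d (≤-trans r≤ le) (avoid {D} ps c ie ic n sub zero′)
      cert′ : ∀ {n e cs} c v → Tail n e → In (v ∷ D) c → e ≢ c → run b (b ∷ cs) ≤ n → Cert (b ∷ cs) e (c ∷ remove₂ e c
          (v ∷ D))
      cert′ c v (ie , m , ps , z , d , le , sub , zero′) ic n r≤ =
        cert-of d (≤-trans r≤ le) (avoid {v ∷ D} ps c (In-there v ie) ic n (λ t → ≤-trans (sub t) (m≤n+m _ (δ v t))) zero′)
      r₁ : run b (b ∷ bs) ≡ 1 + k
      r₁ = run-same b bs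
      r₂ : run b (b ∷ b ∷ bs) ≡ 2 + k
      r₂ = trans (run-same b (b ∷ bs)) (cong suc r₁)
      via : ∀ u v → Unique (u ∷ v ∷ D ++ Y) → Arc (not b) u v → ∀ {w w′} → Tail (1 + k) w → In D w′ → w ≢ w′ → Arc
          (not b) w v → Arc (not b) w′ v →
        Good Y (not b ∷ b ∷ b ∷ bs) u (v ∷ D ++ Y)
      via u v uq r t@(iw , _) iw′ n rw rw′ = good-step {A = v ∷ D ++ Y} r (λ t i → i) (λ t → ≤-refl)
        (step-pair {S = D} IH₂ (Unique-tail (Unique-tail uq)) iw iw′ n (arc-flip′ b rw) (arc-flip′ b rw′)
          (arith-203 (length bs) (length D) len) (cert _ t iw′ n (≤-reflexive r₁)))
      alpha : ∀ x y → Unique (x ∷ y ∷ D ++ Y) → ∀ {e w w′} → Arc (not b) x e → Tail (2 + k) e → Tail (1 + k) w → In D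
          w′ → w ≢ w′ → w ≢ e → w′ ≢ e →
        Good Y (not b ∷ b ∷ b ∷ bs) x (y ∷ D ++ Y) ⊎ Good Y (not b ∷ b ∷ b ∷ bs) y (x ∷ D ++ Y)
      alpha x y uq {e} {w} {w′} r te@(ie , _) tw@(iw , _) iw′ n ne ne′ with findIn (arc? (not b) x) (remove e (y ∷ D))
      ... | inj₁ (c , ic , rc) = inj₁ (step-pair {S = y ∷ D} IH₁ (Unique-tail uq) (In-there y ie) ic′ n′ r rc
              (arith-196 (length bs) (length D) len) (cert′ c y te ic′ n′ (≤-reflexive r₂)))
        where
        ic′ : In (y ∷ D) c
        ic′ = In-⊑ (remove≤ e (y ∷ D)) ic
        n′ : e ≢ c
        n′ q = remove-≢ (y ∷ D) (Unique-left (y ∷ D) (Unique-tail uq)) ic (sym q)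
      ... | inj₂ none = inj₂ (via y x (Unique-swap uq) (dom (In-here y D) λ q → ≢-head uyD ie (sym q)) tw iw′ n
          (dom (In-there y iw) ne) (dom (In-there y iw′) ne′))
        where
        uyD : Unique (y ∷ D)
        uyD = Unique-left (y ∷ D) (Unique-tail uq)
        dom : ∀ {v} → In (y ∷ D) v → v ≢ e → Arc (not b) v x
        dom {v} i n = arc-or (not b) (λ q → ≢-head (Unique-left (x ∷ y ∷ D) uq) i (sym q))
            (none v (In-remove (y ∷ D) i n))
      swap-alpha : ∀ {e w w′} → Arc (not b) y e → Tail (2 + k) e → Tail (1 + k) w → In D w′ → w ≢ w′ → w ≢ e → w′ ≢ e
          → _
      swap-alpha r te tw iw n n′ n″ = swap (alpha y x (Unique-swap uq) r te tw iw n n′ n″)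
      result : (∃ λ d → ∃ λ ps → ∃ λ z → Dir b (length ps) d ps z × suc (length ps) ≡ length D × (∀ v → occ D v ≡ occ
          (d ∷ ps) v)) →
        Good Y (not b ∷ b ∷ b ∷ bs) x (y ∷ D ++ Y) ⊎ Good Y (not b ∷ b ∷ b ∷ bs) y (x ∷ D ++ Y)
      result (d₀ , [] , z , p , l , eq) = ⊥-elim (arith-206 (length bs) (length D) len l)
      result (d₀ , _ ∷ [] , z , p , l , eq) = ⊥-elim (arith-207 (length bs) (length D) len l)
      result (d₀ , d₁ ∷ d₂ ∷ ps , z , p₀@(_ ∷ p₁@(_ ∷ p₂)) , l , eq) = cases (arc? (not b) x d₀) (arc? (not b) x d₁)
          (arc? (not b) x d₂) (arc? (not b) y d₀) (arc? (not b) y d₁) (arc? (not b) y d₂)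
        where
        big : 3 + k ≤ 1 + length ps
        big = arith-208 k (length bs) (length D) (length ps) len l (run≤ b bs)
        uu : Unique (d₀ ∷ d₁ ∷ d₂ ∷ ps)
        uu = Unique-⊑ (λ v → ≤-reflexive (sym (eq v))) uD
        inD : ∀ {v} → In (d₀ ∷ d₁ ∷ d₂ ∷ ps) v → In D v
        inD = In-⊑ λ v → ≤-reflexive (sym (eq v))
        le₁ : ∀ v → occ (d₁ ∷ d₂ ∷ ps) v ≤ occ D v
        le₁ v = ≤-trans (m≤n+m _ (δ d₀ v)) (≤-reflexive (sym (eq v)))
        le₂ : ∀ v → occ (d₂ ∷ ps) v ≤ occ D v
        le₂ v = ≤-trans (m≤n+m _ (δ d₁ v)) (le₁ v)
        le₃ : ∀ v → occ ps v ≤ occ D v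
        le₃ v = ≤-trans (m≤n+m _ (δ d₂ v)) (le₂ v)
        i₀ = inD (In-here d₀ _)
        i₁ = inD (In-there d₀ (In-here d₁ _))
        i₂ = inD (In-there d₀ (In-there d₁ (In-here d₂ ps)))
        t₀ : ∀ {n} → n ≤ 2 + k → Tail n d₀
        t₀ {n} le = i₀ , _ , _ , z , p₀ , (arith-209 n k (length ps) le big) , le₁ , fresh-head uu
        t₁ : ∀ {n} → n ≤ 2 + k → Tail n d₁
        t₁ {n} le = i₁ , _ , _ , z , p₁ , (arith-210 n k (length ps) le big) , le₂ , fresh-head (Unique-tail uu)
        t₂ : ∀ {n} → n ≤ 2 + k → Tail n d₂
        t₂ {n} le = i₂ , _ , _ , z , p₂ , (arith-211 n k (length ps) le big) , le₃ , fresh-head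
            (Unique-tail (Unique-tail uu))
        n₁₀ : d₁ ≢ d₀
        n₁₀ = ≢-head uu (In-here d₁ _)
        n₂₀ : d₂ ≢ d₀
        n₂₀ = ≢-head uu (In-there d₁ (In-here d₂ ps))
        n₂₁ : d₂ ≢ d₁
        n₂₁ = ≢-head (Unique-tail uu) (In-here d₂ ps)
        cases : _ → _ → _ → _ → _ → _ → Good Y (not b ∷ b ∷ b ∷ bs) x (y ∷ D ++ Y) ⊎ Good Y (not b ∷ b ∷ b ∷ bs) y
            (x ∷ D ++ Y)
        cases (yes r) _ _ _ _ _ = alpha x y uq r (t₀ ≤-refl) (t₁ (n≤1+n _)) i₂ (n₂₁ ∘ sym) n₁₀ n₂₀
        cases _ (yes r) _ _ _ _ = alpha x y uq r (t₁ ≤-refl) (t₀ (n≤1+n _)) i₂ (n₂₀ ∘ sym) (n₁₀ ∘ sym) n₂₁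
        cases _ _ (yes r) _ _ _ = alpha x y uq r (t₂ ≤-refl) (t₀ (n≤1+n _)) i₁ (n₁₀ ∘ sym) (n₂₀ ∘ sym) (n₂₁ ∘ sym)
        cases _ _ _ (yes r) _ _ = swap-alpha r (t₀ ≤-refl) (t₁ (n≤1+n _)) i₂ (n₂₁ ∘ sym) n₁₀ n₂₀
        cases _ _ _ _ (yes r) _ = swap-alpha r (t₁ ≤-refl) (t₀ (n≤1+n _)) i₂ (n₂₀ ∘ sym) (n₁₀ ∘ sym) n₂₁
        cases _ _ _ _ _ (yes r) = swap-alpha r (t₂ ≤-refl) (t₀ (n≤1+n _)) i₁ (n₁₀ ∘ sym) (n₂₀ ∘ sym) (n₂₁ ∘ sym)
        cases (no a) (no c) (no _) (no a′) (no c′) (no _) with arc? (not b) x y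
        ... | yes r = inj₁ (via x y uq r (t₀ (n≤1+n _)) i₁ (n₁₀ ∘ sym) (arc-or (not b) (ny i₀) a′) (arc-or (not b)
            (ny i₁) c′))
          where
          ny : ∀ {v} → In D v → y ≢ v
          ny i q = ≢-head (Unique-tail u0) i (sym q)
        ... | no r = inj₂ (via y x (Unique-swap uq) (arc-or (not b) (λ q → ≢-head u0 (In-here y D) (sym q)) r)
            (t₀ (n≤1+n _)) i₁ (n₁₀ ∘ sym) (arc-or (not b) (nx i₀) a) (arc-or (not b) (nx i₁) c))
          where
          nx : ∀ {v} → In D v → x ≢ v
          nx i q = ≢-head (Unique-tail (Unique-swap u0)) i (sym q)

    private
      same? : ∀ a b → a ≡ b ⊎ a ≡ not b
      same? true true = inj₁ refl
      same? true false = inj₂ refl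
      same? false true = inj₂ refl
      same? false false = inj₁ refl
      run-two : ∀ a bs → run a (a ∷ a ∷ not a ∷ bs) ≡ 2
      run-two true bs = refl
      run-two false bs = refl
      cert-dir : ∀ {a bs x S} → Cert (a ∷ a ∷ bs) x S → ∃ λ ps → ∃ λ z → Dir a (run a (a ∷ a ∷ bs)) x ps z ×
          (∀ v → occ ps v ≤ occ S v)
      cert-dir (block d sub) = _ , _ , d , sub
      cert-dir (turn n) = ⊥-elim (n refl)
      five≤ : 5 ≤ length Y
      five≤ = ≤-trans (s≤s (s≤s (s≤s (s≤s (s≤s z≤n))))) seven
      twice : ∀ a {bs x y D} → Ended bs ⊎ bs ≡ not (not a) ∷ [] → HTfor (a ∷ not a ∷ bs) → (Ended bs → HTfor bs) →
          Unique (x ∷ y ∷ D ++ Y) →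
        length bs + 5 ≤ length D → (∃ λ ps → ∃ λ z → Dir a 2 x ps z × (∀ v → occ ps v ≤ occ (y ∷ D) v)) →
        Good Y (a ∷ a ∷ not a ∷ bs) x (y ∷ D ++ Y) ⊎ Good Y (a ∷ a ∷ not a ∷ bs) y (x ∷ D ++ Y)
      twice true (inj₁ e) IH₁ IH₂ uq len (ps , z , d , sub) = block-two {false} e IH₁ (IH₂ e) uq len d sub
      twice false (inj₁ e) IH₁ IH₂ uq len (ps , z , d , sub) = block-two {true} e IH₁ (IH₂ e) uq len d sub
      twice true {x = x} {y} {D} (inj₂ refl) IH₁ IH₂ uq len (ps , z , d , sub) =
        quadruple false Y x y (D ++ Y) uq (Y⊑ D) seven d λ v → ≤-trans (sub v) (ambient {y} {D} v)
        where
        ambient : ∀ {y D} v → occ (y ∷ D) v ≤ occ (y ∷ D ++ Y) v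
        ambient {y} {D} v = ≤-trans (m≤m+n _ (occ Y v)) (≤-reflexive (sym (occ-++ (y ∷ D) Y v)))
      twice false {x = x} {y} {D} (inj₂ refl) IH₁ IH₂ uq len (ps , z , d , sub) =
        quadruple true Y x y (D ++ Y) uq (Y⊑ D) seven d λ v → ≤-trans (sub v) (≤-trans (m≤m+n _ (occ Y v))
            (≤-reflexive (sym (occ-++ (y ∷ D) Y v))))
      twice-end : ∀ b {x y D} → Unique (x ∷ y ∷ D ++ Y) → (∃ λ ps → ∃ λ z → Dir b 2 x ps z × (∀ v → occ ps v ≤ occ
          (y ∷ D) v)) →
        Good Y (b ∷ b ∷ not b ∷ []) x (y ∷ D ++ Y) ⊎ Good Y (b ∷ b ∷ not b ∷ []) y (x ∷ D ++ Y)
      twice-end true {x} {y} {D} uq (ps , z , d , sub) =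
        triple false Y x y (D ++ Y) uq (Y⊑ D) five≤ d λ v → ≤-trans (sub v) (≤-trans (m≤m+n _ (occ Y v))
            (≤-reflexive (sym (occ-++ (y ∷ D) Y v))))
      twice-end false {x} {y} {D} uq (ps , z , d , sub) =
        triple true Y x y (D ++ Y) uq (Y⊑ D) five≤ d λ v → ≤-trans (sub v) (≤-trans (m≤m+n _ (occ Y v))
            (≤-reflexive (sym (occ-++ (y ∷ D) Y v))))
      once-then : ∀ a d {bs x y D} → Ended (d ∷ bs) → HTfor (not a ∷ d ∷ bs) → HTfor (d ∷ bs) → Unique (x ∷ y ∷ D ++
          Y) → length bs + 5 ≤ length D →
        Good Y (a ∷ not a ∷ d ∷ bs) x (y ∷ D ++ Y) ⊎ Good Y (a ∷ not a ∷ d ∷ bs) y (x ∷ D ++ Y)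
      once-then true true e IH₁ IH₂ = one-one {false} {true} e (λ ()) IH₁ IH₂
      once-then true false e IH₁ IH₂ = one-long {false} IH₁ IH₂
      once-then false true e IH₁ IH₂ = one-long {true} IH₁ IH₂
      once-then false false e IH₁ IH₂ = one-one {true} {false} e (λ ()) IH₁ IH₂
      four : ∀ a c d {bs} → Ended (d ∷ bs) → Ended bs ⊎ bs ≡ not d ∷ [] → HTfor (c ∷ d ∷ bs) → HTfor (d ∷ bs) →
          (Ended bs → HTfor bs) →
        HTfor (a ∷ c ∷ d ∷ bs)
      four a c d {bs} e tail IH₁ IH₂ IH₃ x y D uq len cert with same? c a
      ... | inj₂ refl = once-then a d e IH₁ IH₂ uq (arith-212 (length bs) (length D) len)
      ... | inj₁ refl with same? d a | cert-dir cert
      ... | inj₁ refl | ps , z , dir , sub = long-block IH₁ IH₂ uq (arith-212 (length bs) (length D) len) dir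
            (trans (run-same a (a ∷ a ∷ bs)) (cong suc (run-same a (a ∷ bs)))) sub
      ... | inj₂ refl | ps , z , dir , sub = twice a tail IH₁ IH₃ uq (arith-212 (length bs) (length D) len)
            (ps , z , subst (λ k → Dir a k x ps z) (run-two a bs) dir , sub)

    origins : ∀ {bs} → Ended bs → HTfor bs
    origins (turn b) x y D uq len cert =
      reserve (last-two b Y x y (Unique-⊑ (λ v → +-monoʳ-≤ (δ x v) (+-monoʳ-≤ (δ y v) (Y⊑ D v))) uq)
          (≤-trans (s≤s (s≤s (s≤s z≤n))) seven))
      where
      reserve : Good Y (b ∷ not b ∷ []) x (y ∷ Y) ⊎ Good Y (b ∷ not b ∷ []) y (x ∷ Y) → _
      reserve (inj₁ (good p i h)) = inj₁ (good p i λ v → ≤-trans (h v) (+-monoʳ-≤ (δ y v) (Y⊑ D v)))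
      reserve (inj₂ (good p i h)) = inj₂ (good p i λ v → ≤-trans (h v) (+-monoʳ-≤ (δ x v) (Y⊑ D v)))
    origins (a ∷ turn b) x y D uq len cert with same? a b
    ... | inj₂ refl = zigzag b Y x y (D ++ Y) uq (Y⊑ D) five≤
    ... | inj₁ refl with cert-dir cert
    ... | ps , z , d , sub = twice-end b uq (ps , z , subst (λ k → Dir b k x ps z) (run-two b []) d , sub)
    origins (a ∷ (c ∷ turn d)) = four a c d (turn d) (inj₂ refl) (origins (c ∷ turn d)) (origins (turn d)) λ
        { (_ ∷ ()) }
    origins (a ∷ (c ∷ (d ∷ e))) = four a c d (d ∷ e) (inj₁ e) (origins (c ∷ (d ∷ e))) (origins (d ∷ e)) λ _ → origins
        e

  -- Embedding the paths kept for the end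

  Path-length : ∀ {bs x vs z} → P⟦ bs ⟧ x vs z → length vs ≡ length bs
  Path-length [] = refl
  Path-length (_ ∷ p) = cong suc (Path-length p)

  Path-prefix : ∀ bs {cs x vs z} → P⟦ bs ++ cs ⟧ x vs z → ∃ λ ws → ∃ λ w → P⟦ bs ⟧ x ws w × (∀ v → occ ws v ≤ occ vs
      v)
  Path-prefix [] p = [] , _ , [] , λ v → z≤n
  Path-prefix (b ∷ bs) (_∷_ {y = y} r p) with Path-prefix bs p
  ... | ws , w , q , h = y ∷ ws , w , r ∷ q , λ v → +-monoʳ-≤ (δ y v) (h v)

  not≢ : ∀ b → b ≢ not b
  not≢ true ()
  not≢ false ()

  -- The path turns after its first arc, so the theorem applies to the reserved pair without a
  -- directed path as certificate. This is the reason for reserving the pair one arc ahead of the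
  -- turn.
  into-one : ∀ {m} f x y b bs (e : Ended (b ∷ not b ∷ bs)) Y → length Y ≡ 7 →
    Cap m (λ v → f v + occ ((x ∷ y ∷ []) ++ Y) v) → length bs + 13 + (∑ f 0 m + 9) ≤ m →
    ∃ λ vs → RealF (into (x ∷ y ∷ []) b bs e Y) vs × length vs ≡ 3 + length bs × Cap m (λ v → f v + occ vs v)
  into-one {m} f x y b bs e Y seven c big = result (Havet.origins Y (≤-reflexive (sym seven)) e x y F unique enough
      (turn (not≢ b)))
    where
    g : ℕ → ℕ
    g v = f v + occ ((x ∷ y ∷ []) ++ Y) v
    F = vacant g m
    cF : Cap m (λ v → g v + occ F v)
    cF = vacant-cap c
    all≡ : ∀ v → f v + (δ x v + (δ y v + occ (F ++ Y) v)) ≡ g v + occ F v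
    all≡ v = arith-213 (f v) (δ x v) (δ y v) (occ F v) (occ Y v) (occ (F ++ Y) v) (occ-++ F Y v)
    unique : Unique (x ∷ y ∷ F ++ Y)
    unique = mk λ v → ≤-trans (≤-trans (m≤n+m _ (f v)) (≤-reflexive (all≡ v))) (≤one cF v)
    enough : length (b ∷ not b ∷ bs) + 2 ≤ length F
    enough = arith-214 (length bs) (length F) (∑ g 0 m) (∑ f 0 m) (∑ (occ ((x ∷ y ∷ []) ++ Y)) 0 m) (length Y) m
        (vacant-len g m) (∑-+ f (occ ((x ∷ y ∷ []) ++ Y)) 0 m) (∑-occ≤ ((x ∷ y ∷ []) ++ Y) 0 m) seven big
    result : Good Y (b ∷ not b ∷ bs) x (y ∷ F ++ Y) ⊎ Good Y (b ∷ not b ∷ bs) y (x ∷ F ++ Y) → _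
    result (inj₁ (good {vs} p i h)) = x ∷ vs , into (here refl) p (In⇒∈ i) , cong suc (Path-length p) ,
      Cap-⊑ (λ v → ≤-trans (+-monoʳ-≤ (f v) (+-monoʳ-≤ (δ x v) (h v))) (≤-reflexive (all≡ v))) cF
    result (inj₂ (good {vs} p i h)) = y ∷ vs , into (there (here refl)) p (In⇒∈ i) , cong suc (Path-length p) ,
      Cap-⊑ (λ v → ≤-trans (+-monoʳ-≤ (f v) (≤-trans (+-monoʳ-≤ (δ y v) (h v))
        (arith-215 (δ x v) (δ y v) (occ (F ++ Y) v)))) (≤-reflexive (all≡ v))) cF

  -- The end of a path to a leaf is arbitrary. Two signs are appended to make the path end in a
  -- turn, seven vacant vertices serve as its set of ends, and the extra arcs are cut off. Hence
  -- `13 = 7 + 2 + 2 + 2`: the ends, the first two signs, the appended ones, and the surplus of the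
  -- theorem.
  free-one : ∀ {m} f x y b bs → Cap m (λ v → f v + occ (x ∷ y ∷ []) v) → length bs + 13 + (∑ f 0 m + 2) ≤ m →
    ∃ λ vs → RealF (free (x ∷ y ∷ []) b bs) vs × length vs ≡ 3 + length bs × Cap m (λ v → f v + occ vs v)
  free-one {m} f x y b bs c big = split (vacant g m) refl
    where
    g : ℕ → ℕ
    g v = f v + occ (x ∷ y ∷ []) v
    cF : Cap m (λ v → g v + occ (vacant g m) v)
    cF = vacant-cap c
    long : length bs + 13 ≤ length (vacant g m)
    long = arith-216 (length bs) (length (vacant g m)) (∑ g 0 m) (∑ f 0 m) (∑ (occ (x ∷ y ∷ [])) 0 m) m (vacant-len g
        m) (∑-+ f (occ (x ∷ y ∷ [])) 0 m) (∑-occ≤ (x ∷ y ∷ []) 0 m) big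
    short : ∀ {k} {A : Set} → k < 7 → k ≡ length (vacant g m) → A
    short {k} k<7 eq = ⊥-elim (arith-217 k (length bs) (length (vacant g m)) long eq k<7)
    split : ∀ F → F ≡ vacant g m → ∃ λ vs → RealF (free (x ∷ y ∷ []) b bs) vs × length vs ≡ 3 + length bs × Cap m
        (λ v → f v + occ vs v)
    split [] eq = short (s≤s z≤n) (cong length eq)
    split (_ ∷ []) eq = short (s≤s (s≤s z≤n)) (cong length eq)
    split (_ ∷ _ ∷ []) eq = short (s≤s (s≤s (s≤s z≤n))) (cong length eq)
    split (_ ∷ _ ∷ _ ∷ []) eq = short (s≤s (s≤s (s≤s (s≤s z≤n)))) (cong length eq)
    split (_ ∷ _ ∷ _ ∷ _ ∷ []) eq = short (s≤s (s≤s (s≤s (s≤s (s≤s z≤n))))) (cong length eq)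
    split (_ ∷ _ ∷ _ ∷ _ ∷ _ ∷ []) eq = short (s≤s (s≤s (s≤s (s≤s (s≤s (s≤s z≤n)))))) (cong length eq)
    split (_ ∷ _ ∷ _ ∷ _ ∷ _ ∷ _ ∷ []) eq = short ≤-refl (cong length eq)
    split (y₁ ∷ y₂ ∷ y₃ ∷ y₄ ∷ y₅ ∷ y₆ ∷ y₇ ∷ D) eq = result (Havet.origins Y ≤-refl (ended (b ∷ not b ∷ bs)) x y D
        unique enough (turn (not≢ b)))
      where
      Y : List ℕ
      Y = y₁ ∷ y₂ ∷ y₃ ∷ y₄ ∷ y₅ ∷ y₆ ∷ y₇ ∷ []
      all≡ : ∀ v → f v + (δ x v + (δ y v + occ (D ++ Y) v)) ≡ g v + occ (vacant g m) v
      all≡ v = arith-218 (f v) (δ x v) (δ y v) (occ D v) (occ Y v) (occ (D ++ Y) v) (occ (Y ++ D) v) (occ (vacant g m)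
          v) (occ-++ D Y v) (occ-++ Y D v) (cong (λ F → occ F v) eq)
      unique : Unique (x ∷ y ∷ D ++ Y)
      unique = mk λ v → ≤-trans (≤-trans (m≤n+m _ (f v)) (≤-reflexive (all≡ v))) (≤one cF v)
      enough : length (b ∷ not b ∷ bs ++ true ∷ false ∷ []) + 2 ≤ length D
      enough = arith-219 (length bs) (length (bs ++ true ∷ false ∷ [])) (length D) (length (vacant g m)) long
          (cong length eq) (length-++ bs {true ∷ false ∷ []})
      result : Good Y (b ∷ not b ∷ bs ++ true ∷ false ∷ []) x (y ∷ D ++ Y) ⊎ Good Y (b ∷ not b ∷ bs ++ true ∷ false ∷
          []) y (x ∷ D ++ Y) →
        ∃ λ vs → RealF (free (x ∷ y ∷ []) b bs) vs × length vs ≡ 3 + length bs × Cap m (λ v → f v + occ vs v)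
      result (inj₁ (good {vs} p i h)) with Path-prefix (b ∷ not b ∷ bs) p
      ... | ws , w , q , k = x ∷ ws , free (here refl) q , cong suc (Path-length q) ,
        Cap-⊑ (λ v → ≤-trans (+-monoʳ-≤ (f v) (+-monoʳ-≤ (δ x v) (≤-trans (k v) (h v)))) (≤-reflexive (all≡ v))) cF
      result (inj₂ (good {vs} p i h)) with Path-prefix (b ∷ not b ∷ bs) p
      ... | ws , w , q , k = y ∷ ws , free (there (here refl)) q , cong suc (Path-length q) ,
        Cap-⊑ (λ v → ≤-trans (+-monoʳ-≤ (f v) (≤-trans (+-monoʳ-≤ (δ y v) (≤-trans (k v) (h v)))
          (arith-215 (δ x v) (δ y v) (occ (D ++ Y) v)))) (≤-reflexive (all≡ v))) cF

  one-final : ∀ {m} f h → FitF h → Cap m (λ v → f v + occ (resF h) v) → nodesF h + 10 + (∑ f 0 m + length (resF h)) ≤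
      m →
    ∃ λ vs → RealF h vs × length vs ≡ nodesF h × Cap m (λ v → f v + occ vs v)
  one-final {m} f (free (x ∷ y ∷ []) b bs) fit c big = free-one f x y b bs c
    (arith-220 (length bs) (∑ f 0 m) m big)
  one-final {m} f (into (x ∷ y ∷ []) b bs e Y) (fit , seven) c big = into-one f x y b bs e Y seven c
    (arith-221 (length bs) (∑ f 0 m) m (length Y) big seven)

  -- Reserves of paths still to come count as used. Once a path is placed its reserve is released,
  -- except for the vertices that it has taken, so the inequality survives each step.
  finals : ∀ {m} f hs → All FitF hs → Cap m (λ v → f v + occF hs v) → total nodesF hs + 10 + (∑ f 0 m + lenF hs) ≤ m →
    ∃ λ W → Each RealF hs W × Cap m (λ v → f v + occ W v)
  finals f [] _ c big = [] , [] , c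
  finals {m} f (h ∷ hs) (fit ∷ fits) c big = next (one-final (λ v → f v + occF hs v) h fit
      (Cap-⊑ (λ v → (arith-222 (f v) (occF hs v) (occ (resF h) v))) c)
      (arith-223 (nodesF h) (total nodesF hs) (∑ f 0 m) (length (resF h)) (lenF hs) m (∑ (λ v → f v + occF hs v) 0 m)
          (∑ (occF hs) 0 m) big (∑-+ f (occF hs) 0 m) (occF-sum hs)))
    where
    occF-sum : ∀ hs → ∑ (occF hs) 0 m ≤ lenF hs
    occF-sum [] = ≤-reflexive (∑-zero 0 m λ _ _ _ → refl)
    occF-sum (h ∷ hs) = ≤-trans (≤-reflexive (∑-+ (occ (resF h)) (occF hs) 0 m)) (+-mono-≤ (∑-occ≤ (resF h) 0 m)
        (occF-sum hs))
    next : (∃ λ vs → RealF h vs × length vs ≡ nodesF h × Cap m (λ v → f v + occF hs v + occ vs v)) → _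
    next (vs , real , len , c′) with finals (λ v → f v + occ vs v) hs fits
        (Cap-⊑ (λ v → (arith-224 (f v) (occF hs v) (occ vs v))) c′)
        (arith-225 (nodesF h) (total nodesF hs) (∑ f 0 m) (length (resF h)) (lenF hs) m (∑ (λ v → f v + occ vs v) 0 m)
            (∑ (occ vs) 0 m) (length vs) big (∑-+ f (occ vs) 0 m) (∑-occ≤ vs 0 m) len)
    ... | W , each , c″ = vs ++ W , real ∷ each , Cap-⊑ (λ v →
      (arith-226 (f v) (occ vs v) (occ W v) (occ (vs ++ W) v) (occ-++ vs W v))) c″

  realise : ∀ m P → Fit [] P → 12 * cw P + (demand false (tokens P) + demand true (tokens P)) + 1 ≤ m →
    nodes P + fanSize P + 11 ≤ m → ∃ λ x → ∃ λ vs → Real [] P x vs × Cap m (λ v → δ x v + occ vs v)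
  realise m P fit room count = place (cluster P [] fit (Zone-point x) (≤-reflexive (sym (δ-refl x))))
    where
    lo = demand false (tokens P) + 0
    -- The leftmost reserved position is 0: the starting vertex has to its left the demand of that
    -- side and half of its own cluster.
    x = 6 * cw P + lo
    place : Clustered [] P x lo (suc x) (δ x) → ∃ λ x → ∃ λ vs → Real [] P x vs × Cap m (λ v → δ x v + occ vs v)
    place C = done (settle _ C.ds {L = 0} {ub = ub} refl (subst (λ t → Zone (demand false t + 0) T C.u′) (sym C.toks)
        C.zone)
        (C.single (single-δ x)) C.placed C.fitD
        λ v → (arith-227 (occ C.new v) (occD C.ds v) (occF C.hs v) (δ x v) (C.u′ v) (C.acct v)))
      where
      module C = Clustered C
      T = 6 * cw P + suc x
      ub : ℕ → ℕ
      ub v = occ C.new v + occF C.hs v + δ x v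
      done : Done (demand false (tokensAll C.ds) + 0) T (demand true (tokensAll C.ds) + T) (jumps (tokensAll C.ds))
          C.u′ ub C.ds →
        ∃ λ x → ∃ λ vs → Real [] P x vs × Cap m (λ v → δ x v + occ vs v)
      done D = answer (finals f (C.hs ++ D.hs) (All-++ C.fitF D.fitF) (Cap-⊑ (λ v →
          (arith-228 (occ C.new v) (occ D.N v) (occF C.hs v) (occF D.hs v) (occF (C.hs ++ D.hs) v) (δ x v) (D.u′ v)
              (D.acct v) (total-++ (λ h → occ (resF h) v) C.hs D.hs)))
          (cap D.single λ v p → D.above v (≤-trans top p)))
          (arith-229 m (nodes P) (fanSize P) (∑ f 0 m) (length C.new) (length D.N) (total nodesF C.hs) (total nodesF
              D.hs) (total nodesF (C.hs ++ D.hs)) (total nodesD C.ds) (total fanD C.ds) (lenF C.hs) (lenF D.hs)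
              (lenF (C.hs ++ D.hs)) f-sum (total-++ nodesF C.hs D.hs) (total-++ (λ h → length (resF h)) C.hs D.hs)
              C.size D.size C.fans D.fans count))
        where
        module D = Done D
        f : ℕ → ℕ
        f v = δ x v + occ C.new v + occ D.N v
        top : demand true (tokensAll C.ds) + T ≤ m
        top = subst (λ t → demand true t + T ≤ m) (sym C.toks)
          (arith-230 (demand true (tokens P)) (demand false (tokens P)) (cw P) m room)
        f-sum : ∑ f 0 m ≤ 1 + length C.new + length D.N
        f-sum = arith-231 (∑ f 0 m) (∑ (λ v → δ x v + occ C.new v) 0 m) (∑ (δ x) 0 m) (∑ (occ C.new) 0 m)
            (∑ (occ D.N) 0 m) (length C.new) (length D.N) (∑-+ _ (occ D.N) 0 m) (∑-+ (δ x) (occ C.new) 0 m)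
            (∑δ≤1 x 0 m) (∑-occ≤ C.new 0 m) (∑-occ≤ D.N 0 m)
        answer : (∃ λ W → Each RealF (C.hs ++ D.hs) W × Cap m (λ v → f v + occ W v)) → ∃ λ x → ∃ λ vs → Real [] P x vs
            × Cap m (λ v → δ x v + occ vs v)
        answer (W , each , c) with Each-split C.hs each
        ... | W₁ , W₂ , e₁ , e₂ , eqW with D.recon e₂
        ... | V , ev , eqV with C.recon ev e₁
        ... | vs , real , eq = x , vs , real , Cap-⊑ (λ v →
          (arith-232 (δ x v) (occ vs v) (occ C.new v) (occ D.N v) (occ V v) (occ W v) (occ W₁ v) (occ W₂ v) (eq v)
              (eqV v) (eqW v))) c

  -- From a realised plan to an embedding of the tree

  data Emb {A : Set} : Forest A → ℕ → List ℕ → Set where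
    nil : ∀ {x} → Emb nil x []
    add : ∀ {s a k b x y vs ws} → Arc s x y → Emb k y vs → Emb b x ws → Emb (add s a k b) x (y ∷ vs ++ ws)

  Path-++ : ∀ {as bs x y z vs ws} → P⟦ as ⟧ x vs y → P⟦ bs ⟧ y ws z → P⟦ as ++ bs ⟧ x (vs ++ ws) z
  Path-++ [] q = q
  Path-++ (r ∷ p) q = r ∷ Path-++ p q

  Path-split : ∀ as {bs x z vs} → P⟦ as ++ bs ⟧ x vs z → ∃ λ us → ∃ λ y → ∃ λ ws → P⟦ as ⟧ x us y × P⟦ bs ⟧ y ws z ×
      vs ≡ us ++ ws
  Path-split [] p = [] , _ , _ , [] , p , refl
  Path-split (a ∷ as) (r ∷ p) with Path-split as p
  ... | us , y , ws , q , q′ , refl = _ ∷ us , y , ws , r ∷ q , q′ , refl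

  Arc-back : ∀ b {x y} → Arc b x y → Arc (not b) y x
  Arc-back true r = r
  Arc-back false r = r

  Path-back : ∀ {bs x vs z} → P⟦ bs ⟧ x vs z → ∃ λ ws → P⟦ back bs ⟧ z ws x × (∀ v → occ ws v + δ z v ≡ occ vs v + δ x
      v)
  Path-back [] = [] , [] , λ v → refl
  Path-back {bs = b ∷ bs} {x} {vs = y ∷ vs} {z} (r ∷ p) with Path-back p
  ... | ws , q , eq = ws ++ x ∷ [] , Path-++ q (Arc-back b r ∷ []) , λ v →
    (arith-233 (occ (ws ++ x ∷ []) v) (occ ws v) (δ x v) (δ y v) (δ z v) (occ vs v) (occ-++ ws (x ∷ []) v) (eq v))

  -- Realising K′ at x amounts to following the path with the given signs and realising K at its end.
  record Reach (Y : List ℕ) (bs : List Bool) (K : Plan) (x : ℕ) (vs : List ℕ) : Set where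
    constructor reach
    field
      {ps ws} : List ℕ
      {y}     : ℕ
      path-to : P⟦ bs ⟧ x ps y
      rest    : Real Y K y ws
      occ≡    : ∀ v → occ vs v ≡ occ ps v + occ ws v

  reach-move : ∀ {Y} b n {K x vs} → Real Y (move b n K) x vs → Reach Y (replicate n b) K x vs
  reach-move b 0 r = reach [] r λ v → refl
  reach-move b 1 (pick {y = y} a r) = reach (a ∷ []) r λ v → cong (_+ _) (sym (+-identityʳ (δ y v)))
  reach-move b 2 (pick {y = y} a (pick {y = z} {vs = vs} a′ r)) = reach (a ∷ (a′ ∷ [])) r λ v →
    (arith-234 (δ y v) (δ z v) (occ vs v))
  reach-move b (suc (suc (suc n))) (far {ps = ps} p r) = reach p r (occ-++ ps _)

  reach-pick-move : ∀ {Y a} b n {K x vs} → Real Y (pick a (move b n K)) x vs → Reach Y (a ∷ replicate n b) K x vs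
  reach-pick-move b n (pick {y = y} a r) with reach-move b n r
  ... | reach p r′ eq = reach (a ∷ p) r′ λ v → trans (cong (δ y v +_) (eq v)) (sym (+-assoc (δ y v) _ _))

  replicate-snoc : ∀ n (b : Bool) → replicate n b ++ b ∷ [] ≡ b ∷ replicate n b
  replicate-snoc zero b = refl
  replicate-snoc (suc n) b = cong (b ∷_) (replicate-snoc n b)

  record Head (Y : List ℕ) (T : Bool → Plan) (bs : List Bool) (x : ℕ) (vs : List ℕ) : Set where
    constructor headed
    field
      {as}  : List Bool
      {s}   : Bool
      at    : Reach Y as (T s) x vs
      signs : as ++ s ∷ [] ≡ bs

  reach-head : ∀ {Y} T a n b {x vs} → Real Y (head T a n b) x vs → Head Y T (a ∷ replicate n b) x vs
  reach-head T a zero b r = headed (reach [] r λ v → refl) refl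
  reach-head T a (suc n) b r = headed (reach-pick-move b n r) (cong (a ∷_) (replicate-snoc n b))

  Follow : List Bool → ℕ → List ℕ → Set
  Follow bs x vs = ∃ λ ps → ∃ λ y → P⟦ bs ⟧ x ps y × (∀ v → occ vs v ≡ occ ps v)

  follow-leg : ∀ a {cs x vs} (R : Runs cs) → Real [] (legPlan a R) x vs → Follow (a ∷ cs) x vs
  follow-leg a (flat n b) r with reach-pick-move b n r
  ... | reach {ps} p stop eq = ps , _ , p , λ v → trans (eq v) (+-identityʳ _)
  follow-leg a {x = x} (bend n b bs) r with reach-head (λ s → leg s b bs) a n b r
  ... | headed {as} {s} (reach {ps} p (leg {y = y} {ws = ws} r′ q) eq) signs = ps ++ y ∷ ws , _ ,
    subst (λ l → P⟦ l ⟧ x (ps ++ y ∷ ws) _) (trans (sym (++-assoc as (s ∷ []) _)) (cong (_++ b ∷ not b ∷ bs) signs))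
        (Path-++ p (r′ ∷ q)) ,
    λ v → trans (eq v) (sym (occ-++ ps (y ∷ ws) v))

  follow-back : ∀ {Y} z {cs x vs} (B : Bend cs) → Real Y (backPlan z B) x vs →
    ∃ λ ps → ∃ λ y → P⟦ not z ∷ cs ⟧ x ps y × y ∈ Y × (∀ v → occ vs v ≡ occ ps v)
  follow-back z {cs} {x} (bent n b bs eq′ end) r with reach-head (λ s → close s b bs end) (not z) n b r
  ... | headed {as} {s} (reach {ps} p (close {y = y} {ws = ws} r′ q i) eq) signs = ps ++ y ∷ ws , _ ,
    subst (λ l → P⟦ l ⟧ x (ps ++ y ∷ ws) _) (trans (trans (sym (++-assoc as (s ∷ []) _)) (cong (_++ b ∷ not b ∷ bs)
        signs)) (cong (not z ∷_) (sym eq′)))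
      (Path-++ p (r′ ∷ q)) , i , λ v → trans (eq v) (sym (occ-++ ps (y ∷ ws) v))

  back-back : ∀ bs → back (back bs) ≡ bs
  back-back [] = refl
  back-back (b ∷ bs) = trans (back-++ (back bs) (not b ∷ [])) (cong₂ _∷_ (not-not b) (back-back bs))
    where
    back-++ : ∀ as bs → back (as ++ bs) ≡ back bs ++ back as
    back-++ [] bs = sym (++-identityʳ (back bs))
    back-++ (a ∷ as) bs = trans (cong (_++ not a ∷ []) (back-++ as bs)) (++-assoc (back bs) (back as) _)

  back-z : ∀ z b bs → back (not z ∷ back bs ++ b ∷ not b ∷ []) ≡ b ∷ not b ∷ bs ++ z ∷ []
  back-z z b bs = trans (cong (_++ not (not z) ∷ []) (trans (cong back (sym (back-turn b bs)))
      (back-back (b ∷ not b ∷ bs))))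
    (cong (λ t → b ∷ not b ∷ bs ++ t ∷ []) (not-not z))

  -- For a path with a turn, the return path is turned round by `Path-back` and attached to the arc
  -- from the origin to the reserved neighbour in which it stops; `back-z` identifies its signs.
  reach-edge : ∀ a {cs} (S : Snoc cs) {K x vs} → Real [] (edge a S K) x vs → Reach [] (a ∷ cs) K x vs
  reach-edge a [] r = reach-pick-move a 0 r
  reach-edge a (cs ∷ʳ z) {K} r = go (runs cs) r
    where
    go : ∀ {cs x vs} (R : Runs cs) → Real [] (edgePlan a R z K) x vs → Reach [] (a ∷ cs ++ z ∷ []) K x vs
    go {vs = vs} (flat n b) r with reach-pick-move b n r
    ... | reach {ps} p (pick {y = y} {vs = ws} r′ k) eq = reach (Path-++ p (r′ ∷ [])) k λ v →
      (arith-235 (occ vs v) (occ ps v) (δ y v) (occ ws v) (occ (ps ++ y ∷ []) v) (eq v) (occ-++ ps (y ∷ []) v))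
    go {x = x} {vs} (bend n b bs) r with reach-head _ a n b r
    ... | headed {as} {s} (reach {ps} p (zed {v = c} {ws = ws} {us = us} all rH rK) eq) signs with follow-back z
        (bend-ended (back bs) b) rH
    ... | qs , y , q , y∈ , eqH with Path-back q
    ... | rs , q′ , eq′ = reach (subst (λ l → P⟦ l ⟧ x (ps ++ y ∷ rs) c) sg (Path-++ p (lookup all y∈ ∷ q′))) rK λ v →
      (arith-236 (occ vs v) (occ ps v) (δ c v) (occ ws v) (occ us v) (occ (ws ++ us) v) (occ qs v) (occ rs v) (δ y v)
          (occ (ps ++ y ∷ rs) v) (eq v) (occ-++ ws us v) (eqH v) (eq′ v) (occ-++ ps (y ∷ rs) v))
      where
      open import Data.List.Relation.Unary.All using (lookup)
      sg : as ++ s ∷ back (not z ∷ back bs ++ b ∷ not b ∷ []) ≡ a ∷ (replicate n b ++ b ∷ not b ∷ bs) ++ z ∷ []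
      sg = trans (cong (λ t → as ++ s ∷ t) (back-z z b bs)) (trans (sym (++-assoc as (s ∷ []) _))
        (trans (cong (_++ b ∷ not b ∷ bs ++ z ∷ []) signs) (cong (a ∷_) (sym (++-assoc (replicate n b)
            (b ∷ not b ∷ bs) (z ∷ []))))))

  Settled : ∀ {A} → List Bool → Forest A → ℕ → List ℕ → Set
  Settled bs F x vs = ∃ λ ps → ∃ λ y → ∃ λ ws → P⟦ bs ⟧ x ps y × Emb F y ws × (∀ v → occ vs v ≡ occ ps v + occ ws v)

  plan-correct : ∀ {A} (F : Forest A) {x vs} → Real [] (plan F) x vs → ∃ λ ws → Emb F x ws × (∀ v → occ vs v ≡ occ ws
      v)
  branchPlan-correct : ∀ {A} s cs (F : Forest A) {x vs} → Real [] (branchPlan s cs F) x vs → Settled (s ∷ cs) F x vs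
  plan-correct nil stop = [] , nil , λ v → refl
  plan-correct (add s a k b) (both {vs = us} {ws} r r′) with branchPlan-correct s [] k r | plan-correct b r′
  ... | y ∷ [] , _ , ws₁ , (e ∷ []) , E , eq | ws₂ , E′ , eq′ = y ∷ ws₁ ++ ws₂ , add e E E′ , λ v →
    (arith-237 (occ (us ++ ws) v) (occ us v) (occ ws v) (δ y v) (occ ws₁ v) (occ ws₂ v) (occ (ws₁ ++ ws₂) v)
        (occ-++ us ws v) (eq v) (eq′ v) (occ-++ ws₁ ws₂ v))
  branchPlan-correct s cs nil r with follow-leg s (runs cs) r
  ... | ps , y , p , eq = ps , y , [] , p , nil , λ v → trans (eq v) (sym (+-identityʳ _))
  branchPlan-correct s cs (add t a k nil) {vs = vs} r with branchPlan-correct s (cs ++ t ∷ []) k r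
  ... | ps , y , ws , p , E , eq with Path-split (s ∷ cs) p
  ... | us , y′ , (z ∷ []) , q , (e ∷ []) , refl = us , y′ , z ∷ ws ++ [] , q , add e E nil , λ v →
    (arith-238 (occ vs v) (occ (us ++ z ∷ []) v) (occ us v) (δ z v) (occ ws v) (occ (ws ++ []) v) (eq v)
        (occ-++ us (z ∷ []) v) (occ-++ ws [] v))
  branchPlan-correct s cs (add t a k (add t′ a′ k′ b)) {vs = vs} r with reach-edge s (snoc cs) r
  ... | reach {ps} p (both {vs = us} {ws} r₁ (both {vs = us′} {ws′} r₂ r₃)) eq with branchPlan-correct t [] k r₁ |
      branchPlan-correct t′ [] k′ r₂ | plan-correct b r₃
  ... | y ∷ [] , _ , w₁ , (e₁ ∷ []) , E₁ , eq₁ | y′ ∷ [] , _ , w₂ , (e₂ ∷ []) , E₂ , eq₂ | w₃ , E₃ , eq₃ =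
    ps , _ , y ∷ w₁ ++ (y′ ∷ w₂ ++ w₃) , p , add e₁ E₁ (add e₂ E₂ E₃) , λ v →
    (arith-239 (occ vs v) (occ ps v) (occ (us ++ (us′ ++ ws′)) v) (occ (us′ ++ ws′) v) (occ us v) (occ us′ v)
        (occ ws′ v) (δ y v) (δ y′ v) (occ w₁ v) (occ w₂ v) (occ w₃ v) (occ (w₁ ++ (y′ ∷ w₂ ++ w₃)) v) (occ (w₂ ++ w₃)
        v) (eq v) (occ-++ us (us′ ++ ws′) v) (occ-++ us′ ws′ v) (eq₁ v) (eq₂ v) (eq₃ v) (occ-++ w₁ (y′ ∷ w₂ ++ w₃) v)
        (occ-++ w₂ w₃ v))

  module Assignment {n : ℕ} (D : Digraph n) where
    open Growth D

    -- The embedded forest becomes a map through this association list: distinct keys make it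
    -- single-valued, distinct values make it injective.
    Table : Set
    Table = List (Fin n × ℕ)

    table : ∀ {F x vs} → Emb F x vs → Table
    table nil = []
    table (add {a = a} {y = y} e E E′) = (a , y) ∷ table E ++ table E′

    keys values : Table → List ℕ
    keys []             = []
    keys ((u , p) ∷ t)   = toℕ u ∷ keys t
    values []           = []
    values ((u , p) ∷ t) = p ∷ values t

    keys-++ : ∀ s t → keys (s ++ t) ≡ keys s ++ keys t
    keys-++ [] t = refl
    keys-++ ((u , _) ∷ s) t = cong (toℕ u ∷_) (keys-++ s t)

    values-++ : ∀ s t → values (s ++ t) ≡ values s ++ values t
    values-++ [] t = refl
    values-++ ((_ , p) ∷ s) t = cong (p ∷_) (values-++ s t)

    table-keys : ∀ {F x vs} (E : Emb F x vs) → keys (table E) ≡ nums F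
    table-keys nil = refl
    table-keys (add {a = a} e E E′) = cong (toℕ a ∷_) (trans (keys-++ (table E) (table E′)) (cong₂ _++_ (table-keys E)
        (table-keys E′)))

    table-values : ∀ {F x vs} (E : Emb F x vs) → values (table E) ≡ vs
    table-values nil = refl
    table-values (add {y = y} e E E′) = cong (y ∷_) (trans (values-++ (table E) (table E′))
        (cong₂ _++_ (table-values E) (table-values E′)))

    key-In : ∀ {u p t} → (u , p) ∈ t → In (keys t) (toℕ u)
    key-In {t = (u , _) ∷ t} (here refl) = In-here (toℕ u) (keys t)
    key-In {t = (u , _) ∷ t} (there i) = In-there (toℕ u) (key-In i)

    value-In : ∀ {u p t} → (u , p) ∈ t → In (values t) p
    value-In {t = (_ , p) ∷ t} (here refl) = In-here p (values t)
    value-In {t = (_ , p) ∷ t} (there i) = In-there p (value-In i)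

    functional : ∀ {u p q t} → Unique (keys t) → (u , p) ∈ t → (u , q) ∈ t → p ≡ q
    functional uq (here refl) (here refl) = refl
    functional {u} {t = _ ∷ t} uq (here refl) (there j) = ⊥-elim (≢-head uq (key-In j) refl)
    functional {u} {t = _ ∷ t} uq (there i) (here refl) = ⊥-elim (≢-head uq (key-In i) refl)
    functional uq (there i) (there j) = functional (Unique-tail uq) i j

    injective : ∀ {u v p t} → Unique (values t) → (u , p) ∈ t → (v , p) ∈ t → u ≡ v
    injective uq (here refl) (here refl) = refl
    injective uq (here refl) (there j) = ⊥-elim (≢-head uq (value-In j) refl)
    injective uq (there i) (here refl) = ⊥-elim (≢-head uq (value-In i) refl)
    injective uq (there i) (there j) = injective (Unique-tail uq) i j

    entry : ∀ t u → In (keys t) (toℕ u) → ∃ λ p → (u , p) ∈ t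
    entry [] u (mk ())
    entry ((v , p) ∷ t) u i with In-case {toℕ v} {keys t} i
    ... | inj₁ e with toℕ-injective e
    ... | refl = p , here refl
    entry ((v , p) ∷ t) u i | inj₂ j with entry t u j
    ... | q , k = q , there k

    -- The pair in the forest is unordered, while the forest stores a sign for it; `asym` excludes
    -- that the sign and the given arc disagree.
    arcs-kept : (∀ u v → D u v ≡ true → D v u ≡ false) → ∀ {r F x vs} (E : Emb F x vs) → Valid r F → ∀ {u v} → D u v ≡
        true →
      ordered u v ∈ pairs r F → ∃ λ p → ∃ λ q → (u , p) ∈ (r , x) ∷ table E × (v , q) ∈ (r , x) ∷ table E × R p q ≡
          true
    arcs-kept asym {r} {add s a k b} {x} (add {y = y} e E E′) (add e′ V V′) {u} {v} d (here eq) = ends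
      (touch-ordered r a (subst (Touch u) eq (ordered-left u v))) (touch-ordered r a (subst (Touch v) eq
          (ordered-right u v)))
      where
      false≢true : ∀ {b} → b ≡ true → b ≡ false → ⊥
      false≢true refl ()
      loop : ∀ {w} → D w w ≡ true → ⊥
      loop d = false≢true d (asym _ _ d)
      forward-arc : ∀ s → Arcs s r a → Arc s x y → D r a ≡ true → R x y ≡ true
      forward-arc true _ e _ = e
      forward-arc false e′ _ d = ⊥-elim (false≢true e′ (asym _ _ d))
      backward-arc : ∀ s → Arcs s r a → Arc s x y → D a r ≡ true → R y x ≡ true
      backward-arc true e′ _ d = ⊥-elim (false≢true e′ (asym _ _ d))
      backward-arc false _ e _ = e
      ends : u ≡ r ⊎ u ≡ a → v ≡ r ⊎ v ≡ a → ∃ λ p → ∃ λ q → (u , p) ∈ (r , x) ∷ table (add {s = s} {a} {k} {b} e E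
          E′) × (v , q) ∈ (r , x) ∷ table (add {s = s} {a} {k} {b} e E E′) × R p q ≡ true
      ends (inj₁ refl) (inj₁ refl) = ⊥-elim (loop d)
      ends (inj₁ refl) (inj₂ refl) = x , y , here refl , there (here refl) , forward-arc s e′ e d
      ends (inj₂ refl) (inj₁ refl) = y , x , there (here refl) , here refl , backward-arc s e′ e d
      ends (inj₂ refl) (inj₂ refl) = ⊥-elim (loop d)
    arcs-kept asym {r} {add s a k b} {x} (add {y = y} e E E′) (add e′ V V′) d (there i) with ∈-++⁻ (pairs a k) i
    ... | inj₁ j with arcs-kept asym E V d j
    ... | p , q , pi , qi , pq = p , q , below pi , below qi , pq
      where
      below : ∀ {z} → z ∈ (a , y) ∷ table E → z ∈ (r , x) ∷ (a , y) ∷ table E ++ table E′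
      below (here refl) = there (here refl)
      below (there i) = there (there (∈-++⁺ˡ i))
    arcs-kept asym {r} {add s a k b} {x} (add {y = y} e E E′) (add e′ V V′) d (there i) | inj₂ j with arcs-kept asym
        E′ V′ d j
    ... | p , q , pi , qi , pq = p , q , beside pi , beside qi , pq
      where
      beside : ∀ {z} → z ∈ (r , x) ∷ table E′ → z ∈ (r , x) ∷ (a , y) ∷ table E ++ table E′
      beside (here refl) = here refl
      beside (there i) = there (there (∈-++⁺ʳ (table E) i))

  placement : ∀ {n m} (𝒪 : OrientedTree n) (𝓡 : Rooted 𝒪) →
    n + 144 * (leafCount (OrientedTree.arc 𝒪) * leafCount (OrientedTree.arc 𝒪)) + 124 ≤ m + 280 * leafCount
        (OrientedTree.arc 𝒪) →
    ∃ λ (pos : Fin n → ℕ) → (∀ u → pos u < m) × (∀ u v → pos u ≡ pos v → u ≡ v) ×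
      (∀ u v → OrientedTree.arc 𝒪 u v ≡ true → R (pos u) (pos v) ≡ true)
  placement {n} {m} 𝒪 𝓡 big = found (realise m (plan kids) (plan-fit kids) room-enough count-enough)
    where
    open OrientedTree 𝒪 renaming (arc to D)
    open Rooted 𝓡
    open Growth D
    open Assignment D
    big′ : 1 + order kids + 144 * (leafCount D * leafCount D) + 124 ≤ m + 280 * leafCount D
    big′ = subst (λ z → z + 144 * (leafCount D * leafCount D) + 124 ≤ m + 280 * leafCount D) (sym whole) big
    room-enough : 12 * cw (plan kids) + (demand false (tokens (plan kids)) + demand true (tokens (plan kids))) + 1 ≤ m
    room-enough = Bounds.room (plan-measured kids) leaves≤ branches≤ big′
    count-enough : nodes (plan kids) + fanSize (plan kids) + 11 ≤ m
    count-enough = Bounds.enough (plan-measured kids) leaves≤ branches≤ big′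
    found : (∃ λ x → ∃ λ vs → Real [] (plan kids) x vs × Cap m (λ v → δ x v + occ vs v)) → _
    found (x , vs , real , c) with plan-correct kids real
    ... | ws , E , eq = pos , pos< , pos-inj , pos-arc
      where
      t : Table
      t = (root , x) ∷ table E
      keys-unique : Unique (keys t)
      keys-unique = subst (λ k → Unique (toℕ root ∷ k)) (sym (table-keys E)) unique
      values-cap : ∀ v → occ (values t) v ≡ δ x v + occ vs v
      values-cap v = cong (δ x v +_) (trans (cong (λ k → occ k v) (table-values E)) (sym (eq v)))
      values-unique : Unique (values t)
      values-unique = mk λ v → subst (_≤ 1) (sym (values-cap v)) (≤one c v)
      has : ∀ u → ∃ λ p → (u , p) ∈ t
      has u with 1 ≤? occ (keys t) (toℕ u)
      ... | yes p = entry t u (mk p)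
      -- A label missing in the table would bring the number of distinct labels below `n` to
      -- `n + 1`.
      ... | no o = ⊥-elim (<-irrefl refl
          (<-≤-trans (≤-reflexive (cong suc (trans (sym whole) (cong suc (sym (nums-length kids))))))
              (length≤-below (toℕ u ∷ toℕ root ∷ nums kids) more below)))
        where
        k≡ : keys t ≡ toℕ root ∷ nums kids
        k≡ = cong (toℕ root ∷_) (table-keys E)
        more : Unique (toℕ u ∷ toℕ root ∷ nums kids)
        more = mk λ v → go v (toℕ u ≟ v)
          where
          go : ∀ v → Dec (toℕ u ≡ v) → occ (toℕ u ∷ toℕ root ∷ nums kids) v ≤ 1
          go v (yes refl) = ≤-reflexive (cong₂ _+_ (δ-refl (toℕ u)) (trans (cong (λ k → occ k (toℕ u)) (sym k≡))
              (n≤0⇒n≡0 (≤-pred (≰⇒> o)))))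
          go v (no ne) = subst (λ z → z + occ (toℕ root ∷ nums kids) v ≤ 1) (sym (δ-≢ ne)) (once unique v)
        below : ∀ v → In (toℕ u ∷ toℕ root ∷ nums kids) v → v < n
        below v i with In-case {toℕ u} {toℕ root ∷ nums kids} i
        ... | inj₁ refl = toℕ<n u
        ... | inj₂ j with In-case {toℕ root} {nums kids} j
        ... | inj₁ refl = toℕ<n root
        ... | inj₂ k = nums-below kids v k
      pos : Fin n → ℕ
      pos u = proj₁ (has u)
      pos< : ∀ u → pos u < m
      pos< u = ≰⇒> λ m≤ → <-irrefl refl (≤-trans (hit (value-In (proj₂ (has u))))
          (≤-reflexive (trans (values-cap (pos u)) (out c (pos u) m≤))))
      pos-inj : ∀ u v → pos u ≡ pos v → u ≡ v
      pos-inj u v e = injective values-unique (proj₂ (has u)) (subst (λ p → (v , p) ∈ t) (sym e) (proj₂ (has v)))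
      pos-arc : ∀ u v → D u v ≡ true → R (pos u) (pos v) ≡ true
      pos-arc u v d with arcs-kept oriented E valid d (covers (proj₁ (arc-adj true d)))
      ... | p , q , pi , qi , pq = subst₂ (λ p q → R p q ≡ true)
        (functional keys-unique pi (proj₂ (has u))) (functional keys-unique qi (proj₂ (has v))) pq

-- Continuing the tournament to all natural numbers, and conclusion

module Extension {m : ℕ} (T : Tournament m) where
  open Tournament T

  -- The numbers from `m` on form a transitive tail dominated by everything before it, where the
  -- half conditions hold trivially.
  A : ℕ → ℕ → Bool
  A i j with i <? m | j <? m
  ... | yes p | yes q = arc (fromℕ< p) (fromℕ< q)
  ... | _     | _     = i <ᵇ j

  <ᵇ-true : ∀ {i j} → i < j → (i <ᵇ j) ≡ true
  <ᵇ-true p = T⇒ (<⇒<ᵇ p)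

  <ᵇ-false : ∀ {i j} → j ≤ i → (i <ᵇ j) ≡ false
  <ᵇ-false {i} {j} p with i <ᵇ j in eq
  ... | false = refl
  ... | true = ⊥-elim (<-irrefl refl (<-≤-trans (<ᵇ⇒< i j (⇒T eq)) p))

  <ᵇ-tot : ∀ {i j} → i ≢ j → (i <ᵇ j) ≡ not (j <ᵇ i)
  <ᵇ-tot {i} {j} n with ≤-total i j
  ... | inj₁ p = trans (<ᵇ-true (≤∧≢⇒< p n)) (cong not (sym (<ᵇ-false p)))
  ... | inj₂ p = trans (<ᵇ-false p) (cong not (sym (<ᵇ-true (≤∧≢⇒< p (n ∘ sym)))))

  A-irr : ∀ i → A i i ≡ false
  A-irr i with i <? m
  ... | yes p = loopless (fromℕ< p)
  ... | no _ = <ᵇ-false {i} ≤-refl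

  A-tot : ∀ {i j} → i ≢ j → A i j ≡ not (A j i)
  A-tot {i} {j} n with i <? m | j <? m
  ... | yes p | yes q = complete _ _ λ e → n (fromℕ<-injective _ _ p q e)
  ... | yes p | no _ = <ᵇ-tot n
  ... | no _ | yes q = <ᵇ-tot n
  ... | no _ | no _ = <ᵇ-tot n

  A-below : ∀ {i j} → i < m → m ≤ j → A i j ≡ true
  A-below {i} {j} p q with i <? m | j <? m
  ... | _ | yes r = ⊥-elim (<-irrefl refl (<-≤-trans r q))
  ... | yes _ | no _ = <ᵇ-true (<-≤-trans p q)
  ... | no _ | no _ = <ᵇ-true (<-≤-trans p q)

  A-above : ∀ {i j} → m ≤ i → i < j → A i j ≡ true
  A-above {i} {j} p q with i <? m | j <? m
  ... | yes r | _ = ⊥-elim (<-irrefl refl (<-≤-trans r p))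
  ... | no _ | yes _ = <ᵇ-true q
  ... | no _ | no _ = <ᵇ-true q

  A-arc : ∀ {i j} (p : i < m) (q : j < m) → A i j ≡ true → arc (fromℕ< p) (fromℕ< q) ≡ true
  A-arc {i} {j} p q e with i <? m | j <? m
  ... | yes p′ | yes q′ = subst₂ (λ u v → arc u v ≡ true) (fromℕ<-cong i i refl p′ p) (fromℕ<-cong j j refl q′ q) e
  ... | no n | _ = ⊥-elim (n p)
  ... | yes _ | no n = ⊥-elim (n q)

  open Median A

  vertices : List ℕ
  vertices = vacant (λ _ → 0) m

  ordering : ∃ λ l → length l ≡ m × Unique l × (∀ v → In l v → v < m) × ¬ BadR l × ¬ BadL l
  ordering = finish (improve (length vertices * length vertices) vertices (m≤m+n _ _))
    where
    uq : Unique vertices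
    uq = mk λ v → case vacant-occ (λ _ → 0) m v of λ { (inj₁ e) → ≤-trans (≤-reflexive e) z≤n ; (inj₂ (e , _)) → ≤-reflexive e }
    below : ∀ v → In vertices v → v < m
    below v (mk i) = case vacant-occ (λ _ → 0) m v of λ { (inj₁ e) → ⊥-elim (<-irrefl refl (subst (1 ≤_) e i)) ; (inj₂ (_ , _ , p)) → p }
    len : ∀ m → length (vacant (λ _ → 0) m) ≡ m
    len zero = refl
    len (suc m) = cong suc (len m)
    finish : (∃ λ l → length l ≡ length vertices × (∀ v → occ l v ≡ occ vertices v) × ¬ BadR l × ¬ BadL l) → _
    finish (l , e , eq , r , s) = l , trans e (len m) , Unique-⊑ (λ v → ≤-reflexive (eq v)) uq , (λ v i → below v
        (In-⊑ (λ v → ≤-reflexive (eq v)) i)) , r , s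

embed : ∀ {n m} → 2 ≤ n → (𝒪 : OrientedTree n) →
  n + 144 * (leafCount (OrientedTree.arc 𝒪) * leafCount (OrientedTree.arc 𝒪)) + 124 ≤ m + 280 * leafCount
      (OrientedTree.arc 𝒪) →
  (T : Tournament m) → OrientedTree.arc 𝒪 ⊆ᵀ T
embed {n} {m} n≥2 𝒪 big T = place ordering
  where
  open OrientedTree 𝒪 renaming (arc to D)
  open Extension T
  open Median A
  place : (∃ λ l → length l ≡ m × Unique l × (∀ v → In l v → v < m) × ¬ BadR l × ¬ BadL l) → D ⊆ᵀ T
  place (l , len , uq , small , r , s) = found (Strategy.placement 𝒯 𝒪 (rooted n≥2 𝒪) big)
    where
    σ′ : ℕ → ℕ
    σ′ = σ A-irr A-tot m A-below A-above l len uq small r s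
    𝒯 : Tour
    𝒯 = tour A-irr A-tot m A-below A-above l len uq small r s
    found : (∃ λ (pos : Fin n → ℕ) → (∀ u → pos u < m) × (∀ u v → pos u ≡ pos v → u ≡ v) × (∀ u v → D u v ≡ true →
        Tour.R 𝒯 (pos u) (pos v) ≡ true)) → D ⊆ᵀ T
    found (pos , pos< , pos-inj , pos-arc) = (λ u → fromℕ< (σ< u)) ,
        (λ {u} {v} e → pos-inj u v (σ-inj A-irr A-tot m A-below A-above l len uq small r s (fromℕ<-injective _ _
            (σ< u) (σ< v) e))) ,
        λ u v d → A-arc (σ< u) (σ< v) (pos-arc u v d)
      where
      σ< : ∀ u → σ′ (pos u) < m
      σ< u = σ-in A-irr A-tot m A-below A-above l len uq small r s (pos< u)

mainTheorem6 : (n : ℕ) → 2 ≤ n → (T : OrientedTree n) →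
    Unavoidable ((n + 144 * (leafCount (OrientedTree.arc T) * leafCount (OrientedTree.arc T)) + 124)
                   ∸ (280 * leafCount (OrientedTree.arc T)))
                (OrientedTree.arc T)
mainTheorem6 n n≥2 T = embed n≥2 T (m≤n+o∸ (280 * leafCount (OrientedTree.arc T)))
  where
  -- With truncated subtraction this inequality holds whether or not `b ≤ a`.
  m≤n+o∸ : ∀ {a} b → a ≤ (a ∸ b) + b
  m≤n+o∸ {a} b = ≤-trans (m≤n+m∸n a b) (≤-reflexive (+-comm b (a ∸ b)))
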